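{- For all positive integers $a,b,s,x$ with $x\leq a$ and all integers $k_1,k_2,\dotsc,k_s$ with $0< k_1<k_2<\dots<k_s\le a/2$, we have $$ \operatorname{M}_{\odot}(H_{a,2b}(k_1,k_2,\dotsc,k_s)) = \operatorname{M}_{\odot,|}(H_{a,2b}(k_1,k_2,\dotsc,k_s))^2, $$ and $$ \operatorname{M}_{\odot}(H_{2a-1,2b}(k_1,k_2,\dotsc,k_s;2x-1)) = \operatorname{M}_{\odot,|}(H_{2a-1,2b}(k_1,k_2,\dotsc,k_s;2x-1))^2, $$ where $\odot$ denotes symmetry with respect to the center of the region (equivalently, invariance under rotation by $180^\circ$ around its center).
   Context: Work on the triangular lattice drawn so that one family of lattice lines is vertical. For a lattice region $R$, $\operatorname{M}(R)$ denotes the number of lozenge tilings of $R$, and $\operatorname{M}_{s_1,\dotsc,s_k}(R)$ denotes the number of lozenge tilings of $R$ invariant under the symmetries $s_1,\dotsc,s_k$; here $|$ denotes reflection across the vertical symmetry axis and $\odot$ denotes rotation by $180^\circ$ about the center. For positive integers $a,b,s$ and $0<k_1<\dots<k_s\le a/2$, $H_{a,2b}(k_1,\dotsc,k_s)$ is the region obtained from the hexagon with side lengths $a,a,2b,a,a,2b$ (clockwise, starting from the northwestern side) by removing $2s$ triangles of side-length two along its horizontal symmetry axis: $s$ left-pointing such triangles whose vertical sides are at distances $2k_1,\dotsc,2k_s$ from the left side of the hexagon (in units of $\sqrt{3}$ times the lattice spacing), together with their reflections across the vertical symmetry axis of the hexagon. When the first parameter is odd, $2a-1$, this region has a horizontal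 lattice rhombus of odd side-length at its center; for a positive integer $x\le a$, $H_{2a-1,2b}(k_1,\dotsc,k_s;2x-1)$ denotes the region obtained from $H_{2a-1,2b}(k_1,\dotsc,k_s)$ by removing from its center the horizontal lattice rhombus of side $2x-1$.
   Formalization: The distances 2k_i of the vertical sides of the removed triangles from the left side are measured in units of √3/2 (not √3) times the lattice spacing; in the stated units the holes can overlap their reflections and the identity fails (a=3, b=1, k_1=1 gives 3 against 1). -}

module Defs where

open import Data.Integer as ℤ using (ℤ; +_; ∣_∣)
open import Data.List using (List; []; _∷_; _++_; map; filter; length; upTo; concatMap; cartesianProduct)
open import Data.List.Membership.Propositional using (_∈_)
open import Data.List.Relation.Unary.All as All using (All)
open import Data.Nat as ℕ using (ℕ; suc; _+_; _*_)
open import Data.Product using (_×_; _,_)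
open import Data.Product.Properties using (≡-dec)
open import Data.Sum using (_⊎_)
open import Data.Vec using (Vec)
open import Data.Vec.Relation.Unary.Any as VecAny using ()
open import Relation.Binary.Definitions using (DecidableEquality)
open import Relation.Binary.PropositionalEquality using (_≡_; refl; cong)
open import Relation.Nullary using (no)
open import Relation.Nullary.Decidable using (_×-dec_; _⊎-dec_; ¬?; map′)
open import Relation.Unary using (Pred; Decidable)

import Data.List.Membership.DecPropositional as DecMembership

-- The lattice point (p , q) is p e₁ + q e₂, where e₁ and e₂ are the unit
-- lattice steps pointing up-right and down-right (30° above and below the
-- horizontal).
Point : Set
Point = ℤ × ℤ

_≟ᴾ_ : DecidableEquality Point
_≟ᴾ_ = ≡-dec ℤ._≟_ ℤ._≟_

-- Horizontal coordinate in units of √3/2 lattice spacings (the distance between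
-- consecutive vertical lattice lines), and vertical coordinate in units of
-- half a lattice spacing.
xc yc : Point → ℤ
xc (p , q) = p ℤ.+ q
yc (p , q) = p ℤ.- q

-- Unit triangles, given by their tip, i.e. the vertex opposite the vertical side.
data Triangle : Set where
  ◁ ▷ : (tip : Point) → Triangle

_≟ᵀ_ : DecidableEquality Triangle
◁ P ≟ᵀ ◁ Q = map′ (cong ◁) (λ { refl → refl }) (P ≟ᴾ Q)
▷ P ≟ᵀ ▷ Q = map′ (cong ▷) (λ { refl → refl }) (P ≟ᴾ Q)
◁ _ ≟ᵀ ▷ _ = no λ ()
▷ _ ≟ᵀ ◁ _ = no λ ()

vertices : Triangle → List Point
vertices (◁ (p , q)) = (p , q) ∷ (ℤ.suc p , q) ∷ (p , ℤ.suc q) ∷ []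
vertices (▷ (p , q)) = (p , q) ∷ (ℤ.pred p , q) ∷ (p , ℤ.pred q) ∷ []

-- Regions are finite sets of unit triangles, listed without repetition.
Region : Set
Region = List Triangle

-- Two unit triangles sharing a side have opposite orientations, so a lozenge is
-- determined by the tips (P , Q) of its halves ◁ P and ▷ Q.
Lozenge : Set
Lozenge = Point × Point

_≟ᴸ_ : DecidableEquality Lozenge
_≟ᴸ_ = ≡-dec _≟ᴾ_ _≟ᴾ_

halves : Lozenge → List Triangle
halves (P , Q) = ◁ P ∷ ▷ Q ∷ []

open DecMembership _≟ᵀ_ using () renaming (_∈?_ to _∈ᵀ?_)
open DecMembership _≟ᴸ_ using () renaming (_∈?_ to _∈ᴸ?_)

-- A lozenge contains exactly one left-pointing half, so listing, for each ◁ P, the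
-- lozenges across its upper slanted, lower slanted and vertical side (and none
-- for ▷ Q) lists every lozenge once.
lozengesAt : Triangle → List Lozenge
lozengesAt (▷ _)       = []
lozengesAt (◁ (p , q)) =
  map ((p , q) ,_) ((ℤ.suc p , q) ∷ (p , ℤ.suc q) ∷ (ℤ.suc p , ℤ.suc q) ∷ [])

lozengesIn : Region → List Lozenge
lozengesIn R = filter (λ ℓ → All.all? (_∈ᵀ? R) (halves ℓ)) (concatMap lozengesAt R)

coverage : Triangle → List Lozenge → ℕ
coverage t T = length (filter (λ ℓ → t ∈ᵀ? halves ℓ) T)

Tiles : Region → Pred (List Lozenge) _
Tiles R T = All (λ t → coverage t T ≡ 1) R

tiles? : ∀ R → Decidable (Tiles R)
tiles? R T = All.all? (λ t → coverage t T ℕ.≟ 1) R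

-- A symmetry is given by its action on lattice points.  Only reflections across
-- vertical lines and rotations by 180° are used; these exchange left- and
-- right-pointing triangles and send tips to tips, whence their action on lozenges.
Symmetry : Set
Symmetry = Point → Point

act : Symmetry → Lozenge → Lozenge
act σ (P , Q) = σ Q , σ P

Invariant : Symmetry → Pred (List Lozenge) _
Invariant σ T = All (λ ℓ → act σ ℓ ∈ T) T

invariant? : ∀ σ → Decidable (Invariant σ)
invariant? σ T = All.all? (λ ℓ → act σ ℓ ∈ᴸ? T) T

-- Reflection across the vertical line xc = a, sending (xc , yc) to
-- (2a − xc , yc), and rotation by 180° about the point with xc = a, yc = 0,
-- sending (xc , yc) to (2a − xc , − yc).
reflection rotation : ℕ → Symmetry
reflection a (p , q) = + a ℤ.- q , + a ℤ.- p
rotation   a (p , q) = + a ℤ.- p , + a ℤ.- q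

sublists : {A : Set} → List A → List (List A)
sublists []       = [] ∷ []
sublists (x ∷ xs) = sublists xs ++ map (x ∷_) (sublists xs)

-- The number of lozenge tilings of R invariant under all the given symmetries.
M : List Symmetry → Region → ℕ
M σs R = length (filter (λ T → tiles? R T ×-dec All.all? (λ σ → invariant? σ T) σs)
                        (sublists (lozengesIn R)))

-- Convex lattice polygons, as sets of lattice points.  A unit triangle lies in
-- such a polygon exactly when its vertices do.
_⊑_ : Triangle → Pred Point _ → Set
t ⊑ P = All P (vertices t)

-- The hexagon with sides a, a, 2b, a, a, 2b, placed with its left side on xc = 0
-- and its horizontal symmetry axis on yc = 0.
Hexagon : ℕ → ℕ → Pred Point _
Hexagon a b P = (+ 0 ℤ.≤ xc P × xc P ℤ.≤ + (2 * a))
  × (+ ∣ yc P ∣ ℤ.≤ + (2 * b) ℤ.+ xc P)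
  × (+ ∣ yc P ∣ ℤ.≤ + (2 * b) ℤ.+ (+ (2 * a) ℤ.- xc P))

hexagon? : ∀ a b → Decidable (Hexagon a b)
hexagon? a b P = ((+ 0 ℤ.≤? xc P) ×-dec (xc P ℤ.≤? + (2 * a)))
  ×-dec (+ ∣ yc P ∣ ℤ.≤? + (2 * b) ℤ.+ xc P)
  ×-dec (+ ∣ yc P ∣ ℤ.≤? + (2 * b) ℤ.+ (+ (2 * a) ℤ.- xc P))

-- Left- and right-pointing triangles of side r, symmetric about yc = 0, with vertical
-- side on xc = d.
LeftTriangle RightTriangle : ℕ → ℤ → Pred Point _
LeftTriangle  r d P = xc P ℤ.≤ d × + ∣ yc P ∣ ℤ.≤ + r ℤ.- (d ℤ.- xc P)
RightTriangle r d P = d ℤ.≤ xc P × + ∣ yc P ∣ ℤ.≤ + r ℤ.- (xc P ℤ.- d)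

leftTriangle? : ∀ r d → Decidable (LeftTriangle r d)
leftTriangle? r d P = (xc P ℤ.≤? d) ×-dec (+ ∣ yc P ∣ ℤ.≤? + r ℤ.- (d ℤ.- xc P))

rightTriangle? : ∀ r d → Decidable (RightTriangle r d)
rightTriangle? r d P = (d ℤ.≤? xc P) ×-dec (+ ∣ yc P ∣ ℤ.≤? + r ℤ.- (xc P ℤ.- d))

-- The rhombus of side r centred at xc = a, yc = 0, with horizontal long diagonal.
Rhombus : ℕ → ℕ → Pred Point _
Rhombus a r P = ∣ xc P ℤ.- + a ∣ + ∣ yc P ∣ ℕ.≤ r

rhombus? : ∀ a r → Decidable (Rhombus a r)
rhombus? a r P = ∣ xc P ℤ.- + a ∣ + ∣ yc P ∣ ℕ.≤? r

-- Every lattice point (p , q) of Hexagon a b satisfies −b ≤ p, q ≤ a + b.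
hexagonRegion : ℕ → ℕ → Region
hexagonRegion a b = filter (λ t → All.all? (hexagon? a b) (vertices t))
                           (map ◁ box ++ map ▷ box)
  where
  range : List ℤ
  range = map (λ i → + i ℤ.- + b) (upTo (suc (a + 2 * b)))

  box : List Point
  box = cartesianProduct range range

-- The two triangular holes belonging to the parameter k: the left-pointing one, with
-- vertical side on the 2k-th vertical lattice line to the right of the left
-- side of the hexagon, and its mirror image.
InHole : ℕ → Triangle → ℕ → Set
InHole a t k = t ⊑ LeftTriangle 2 (+ (2 * k)) ⊎ t ⊑ RightTriangle 2 (+ (2 * a) ℤ.- + (2 * k))

inHole? : ∀ a t → Decidable (InHole a t)
inHole? a t k = All.all? (leftTriangle? 2 (+ (2 * k))) (vertices t)
  ⊎-dec All.all? (rightTriangle? 2 (+ (2 * a) ℤ.- + (2 * k))) (vertices t)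

-- H a b ks is H_{a,2b}(k₁,…,kₛ).
H : ∀ {s} → ℕ → ℕ → Vec ℕ s → Region
H a b ks = filter (λ t → ¬? (VecAny.any? (inHole? a t) ks)) (hexagonRegion a b)

-- H◇ a b ks r is H_{a,2b}(k₁,…,kₛ; r).  It is meant for a and r odd, when the
-- rhombus has its vertices at lattice points.
H◇ : ∀ {s} → ℕ → ℕ → Vec ℕ s → ℕ → Region
H◇ a b ks r = filter (λ t → ¬? (All.all? (rhombus? a r) (vertices t))) (H a b ks)

{-# OPTIONS --safe #-}

-- Cut a tiling that is invariant under the rotation along the vertical axis.  Its left
-- half is a family of nonintersecting lattice paths (through the lozenges with vertical
-- sides) that start on the left side and on the vertical sides of the holes and end in a
-- set that is symmetric about the horizontal axis.  If the tiling is also invariant under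
-- the reflection, the family is symmetric, never meets the axis, and is given by its upper
-- half, whose end points are arbitrary.
--
-- Both counts are Pfaffians.  Counting steps one at a time, an alternating multilinear
-- functional of the positions of the paths counts nonintersecting families.  Symmetric end
-- sets correspond to the form that pairs a final position with its mirror image.  Pairs of
-- upper families correspond to the sign matrix of a total order on two copies of the final
-- positions above the axis, one traversed downwards and the other upwards, where the
-- reflection principle keeps the paths off the axis.  Replacing the second path of a
-- symmetric pair of starting points by an even combination of paths in the first form, and
-- by the difference of the two paths in the second, one obtains isotropic vectors in both
-- cases, so that only the entries pairing a path with such a vector matter.  These agree:
-- if D(y) and C(y) count the paths from a starting point near the axis with the sign of
-- the reflection and without, then C(y) − C(y+2) = D(y) + D(y+2), so that
-- C(y) = D(y) + 2 Σ_{z>y} D(z).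
module Submission where

-- Squaring makes the two forms equal in size: a symmetric pair of starting points gives two vectors
-- in the first, and its upper point gives one vector for each family in the second. Half of the
-- vectors are isotropic, so a Pfaffian term that matches two paths with each other also matches two
-- isotropic vectors and vanishes.
--
-- The relation between C and D holds for the plain sum over a pair of starting points only next to
-- the axis. For the pair numbered i from 0, let T shift the starting point upwards. D comes from
-- T^i - T^(-1-i), the relation reads (1 - T^(-1)) C = (1 + T^(-1)) D, and dividing gives T^i + 2
-- T^(i-1) + ... + 2 T^(-i) + T^(-1-i): every pair nested inside has to be added twice. These pairs
-- are entries of the same Pfaffian, so adding them does not change it.
--
-- The paths are not told about holes and rhombus. Hence only collisions and the final state have to
-- be tested.

-- Integer inequalities behind the lattice geometry.

module LinearInequalities where

  open import Data.Empty using (⊥; ⊥-elim)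
  open import Data.Integer as ℤ using (ℤ; _+_; _-_; -_; 0ℤ; 1ℤ; ∣_∣)
  import Data.Integer.Properties as ℤP
  open import Data.Integer.Tactic.RingSolver using (solve-∀; solve)
  open import Data.List using ([]; _∷_)
  open import Data.Nat as ℕ using (ℕ)
  import Data.Nat.Properties as ℕP
  open import Data.Product using (_×_; _,_)
  open import Data.Sum using (_⊎_; inj₁; inj₂)
  open import Relation.Binary.PropositionalEquality
  open import Relation.Nullary using (¬_; yes; no)

  infixl 6 _⊕_

  -- Linear inequalities are proved by writing right − left as a sum of known
  -- nonnegative terms and leaving the identity to the ring solver.
  δ : ∀ {i j} → i ℤ.≤ j → 0ℤ ℤ.≤ j - i
  δ = ℤP.i≤j⇒0≤j-i

  δ< : ∀ {i j} → i ℤ.< j → 0ℤ ℤ.≤ j - (1ℤ + i)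
  δ< h = δ (ℤP.i<j⇒suc[i]≤j h)

  _⊕_ : ∀ {i j} → 0ℤ ℤ.≤ i → 0ℤ ℤ.≤ j → 0ℤ ℤ.≤ i + j
  _⊕_ = ℤP.+-mono-≤

  nat : ∀ n → 0ℤ ℤ.≤ ℤ.+ n
  nat n = ℤ.+≤+ ℕ.z≤n

  by : ∀ {i j e} → 0ℤ ℤ.≤ e → j - i ≡ e → i ℤ.≤ j
  by h e = ℤP.0≤i-j⇒j≤i (subst (0ℤ ℤ.≤_) (sym e) h)

  by< : ∀ {i j e} → 0ℤ ℤ.≤ e → j - (1ℤ + i) ≡ e → i ℤ.< j
  by< {i} {j} h e = ℤP.suc[i]≤j⇒i<j (by h e)

  contradictory : ∀ {e n} → 0ℤ ℤ.≤ e → e ≡ ℤ.-[1+ n ] → ⊥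
  contradictory h refl with () ← h

  -- Parity absorbs the slack of 1. Heights are twice the index of an edge up to a shift, so this
  -- turns bounds on heights into bounds on indices.
  halve : ∀ {i j} → i + i ℤ.≤ 1ℤ + (j + j) → i ℤ.≤ j
  halve {i} {j} h with i ℤ.≤? j
  ... | yes p = p
  ... | no ¬p = ⊥-elim (contradictory {n = 0} (δ h ⊕ δ< (ℤP.≰⇒> ¬p) ⊕ δ< (ℤP.≰⇒> ¬p)) (solve (i ∷ j ∷ [])))

  abs⁻ : ∀ {y z} → ℤ.+ ∣ y ∣ ℤ.≤ z → y ℤ.≤ z × - y ℤ.≤ z
  abs⁻ {ℤ.+ n}        h = h , ℤP.≤-trans (ℤP.neg-≤-pos {n} {n}) h
  abs⁻ { ℤ.-[1+ n ]} h = ℤP.≤-trans ℤ.-≤+ h , h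

  abs⁺ : ∀ y {z} → y ℤ.≤ z → - y ℤ.≤ z → ℤ.+ ∣ y ∣ ℤ.≤ z
  abs⁺ (ℤ.+ n)    h g = h
  abs⁺ ℤ.-[1+ n ] h g = g

  -- The ball of the sum norm is an intersection of four half-planes, bounded by the sides of the
  -- rhombus.
  abs²⁻ : ∀ {u v r} → ∣ u ∣ ℕ.+ ∣ v ∣ ℕ.≤ r → (u + v ℤ.≤ ℤ.+ r × u - v ℤ.≤ ℤ.+ r) × (- u + v ℤ.≤ ℤ.+ r × - u - v ℤ.≤ ℤ.+ r)
  abs²⁻ {u} {v} {r} h with abs⁻ {u} ℤP.≤-refl | abs⁻ {v} ℤP.≤-refl
  ... | u₁ , u₂ | v₁ , v₂ = (ℤP.≤-trans (ℤP.+-mono-≤ u₁ v₁) h′ , ℤP.≤-trans (ℤP.+-mono-≤ u₁ v₂) h′) ,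
                            (ℤP.≤-trans (ℤP.+-mono-≤ u₂ v₁) h′ , ℤP.≤-trans (ℤP.+-mono-≤ u₂ v₂) h′)
    where
    h′ : ℤ.+ ∣ u ∣ + ℤ.+ ∣ v ∣ ℤ.≤ ℤ.+ r
    h′ = ℤ.+≤+ h

  abs²⁺ : ∀ {u v r} → u + v ℤ.≤ ℤ.+ r → u - v ℤ.≤ ℤ.+ r → - u + v ℤ.≤ ℤ.+ r → - u - v ℤ.≤ ℤ.+ r → ∣ u ∣ ℕ.+ ∣ v ∣ ℕ.≤ r
  abs²⁺ {ℤ.+ m}      {ℤ.+ n}      h₁ h₂ h₃ h₄ = ℤP.drop‿+≤+ h₁
  abs²⁺ {ℤ.+ m}      {ℤ.-[1+ n ]} h₁ h₂ h₃ h₄ = ℤP.drop‿+≤+ h₂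
  abs²⁺ {ℤ.-[1+ m ]} {ℤ.+ n}      h₁ h₂ h₃ h₄ = ℤP.drop‿+≤+ h₃
  abs²⁺ {ℤ.-[1+ m ]} {ℤ.-[1+ n ]} h₁ h₂ h₃ h₄ = ℤP.drop‿+≤+ h₄

  twice : ∀ n → ℤ.+ (2 ℕ.* n) ≡ ℤ.+ n + ℤ.+ n
  twice n = cong (λ m → ℤ.+ (n ℕ.+ m)) (ℕP.+-identityʳ n)

  module Bounds {B j c : ℤ} where

    -- The edge `c` of column `j` spans the heights from `c + c - 2 - j` to `c + c - j`, in units of
    -- half a lattice spacing. In the left half of the hexagon, with vertical sides of length
    -- `B + B`, this means `c ≤ B + j` and `1 ≤ c + B`. The lemmas with `before` and `after` concern
    -- the tips in the neighbouring columns.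
    top⁻ : c + c - j ℤ.≤ B + B + j → c ℤ.≤ B + j
    top⁻ h = halve (by (δ h ⊕ nat 1) (solve (B ∷ j ∷ c ∷ [])))

    bottom⁻ : - (c + c - ℤ.+ 2 - j) ℤ.≤ B + B + j → 1ℤ ℤ.≤ c + B
    bottom⁻ h = halve (by (δ h ⊕ nat 1) (solve (B ∷ j ∷ c ∷ [])))

    module _ (h : c ℤ.≤ B + j) where

      top-upper : c + c - j ℤ.≤ B + B + j
      top-upper = by (δ h ⊕ δ h) (solve (B ∷ j ∷ c ∷ []))

      top-lower : c + c - ℤ.+ 2 - j ℤ.≤ B + B + j
      top-lower = by (δ h ⊕ δ h ⊕ nat 2) (solve (B ∷ j ∷ c ∷ []))

      top-before : c + c - 1ℤ - j ℤ.≤ B + B + (j - 1ℤ)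
      top-before = by (δ h ⊕ δ h) (solve (B ∷ j ∷ c ∷ []))

      top-after : c + c - 1ℤ - j ℤ.≤ B + B + (j + 1ℤ)
      top-after = by (δ h ⊕ δ h ⊕ nat 2) (solve (B ∷ j ∷ c ∷ []))

    module _ (h : 1ℤ ℤ.≤ c + B) where

      bottom-upper : - (c + c - j) ℤ.≤ B + B + j
      bottom-upper = by (δ h ⊕ δ h ⊕ nat 2) (solve (B ∷ j ∷ c ∷ []))

      bottom-lower : - (c + c - ℤ.+ 2 - j) ℤ.≤ B + B + j
      bottom-lower = by (δ h ⊕ δ h) (solve (B ∷ j ∷ c ∷ []))

      bottom-before : - (c + c - 1ℤ - j) ℤ.≤ B + B + (j - 1ℤ)
      bottom-before = by (δ h ⊕ δ h) (solve (B ∷ j ∷ c ∷ []))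

      bottom-after : - (c + c - 1ℤ - j) ℤ.≤ B + B + (j + 1ℤ)
      bottom-after = by (δ h ⊕ δ h ⊕ nat 2) (solve (B ∷ j ∷ c ∷ []))

  module Widths {A t j : ℤ} where

    here-≤ : j ℤ.≤ A → t + j ℤ.≤ t + (A + A - j)
    here-≤ h = by (δ h ⊕ δ h) (solve (A ∷ t ∷ j ∷ []))

    before-≤ : j ℤ.≤ A → t + (j - 1ℤ) ℤ.≤ t + (A + A - (j - 1ℤ))
    before-≤ h = by (δ h ⊕ δ h ⊕ nat 2) (solve (A ∷ t ∷ j ∷ []))

    after-≤ : 1ℤ + j ℤ.≤ A → t + (j + 1ℤ) ℤ.≤ t + (A + A - (j + 1ℤ))
    after-≤ h = by (δ h ⊕ δ h) (solve (A ∷ t ∷ j ∷ []))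

    double-≤ : 0ℤ ℤ.≤ j → j ℤ.≤ A → j ℤ.≤ A + A
    double-≤ h₀ h = by (δ h ⊕ δ h ⊕ h₀) (solve (A ∷ j ∷ []))

    pred-≥ : 0ℤ ℤ.≤ j - 1ℤ → 1ℤ ℤ.≤ j
    pred-≥ h = by h (solve (j ∷ []))

    ≥-pred : 1ℤ ℤ.≤ j → 0ℤ ℤ.≤ j - 1ℤ
    ≥-pred h = by (δ h) (solve (j ∷ []))

    pred-≤ : j ℤ.≤ A + A → j - 1ℤ ℤ.≤ A + A
    pred-≤ h = by (δ h ⊕ nat 1) (solve (A ∷ j ∷ []))

    suc-≥ : 0ℤ ℤ.≤ j → 0ℤ ℤ.≤ j + 1ℤ
    suc-≥ h = h ⊕ nat 1

    suc-≤ : 0ℤ ℤ.≤ j → 1ℤ + j ℤ.≤ A → j + 1ℤ ℤ.≤ A + A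
    suc-≤ h₀ h = by (δ h ⊕ δ h ⊕ h₀ ⊕ nat 1) (solve (A ∷ j ∷ []))

    weaken : 1ℤ + j ℤ.≤ A → j ℤ.≤ A
    weaken = ℤP.≤-trans (ℤP.i≤suc[i] j)

  module Holes {k j c : ℤ} where

    -- In column `j` a hole with vertical side in column `k + k` reaches up and down to the height
    -- `2 - (k + k - j)`.
    low⁻ : - (c + c - ℤ.+ 2 - j) ℤ.≤ ℤ.+ 2 - (k + k - j) → k ℤ.≤ c
    low⁻ h = halve (by (δ h ⊕ nat 1) (solve (k ∷ j ∷ c ∷ [])))

    high⁻ : c + c - j ℤ.≤ ℤ.+ 2 - (k + k - j) → c + k ℤ.≤ 1ℤ + j
    high⁻ h = halve (by (δ h ⊕ nat 1) (solve (k ∷ j ∷ c ∷ [])))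

    module _ (h : c + k ℤ.≤ 1ℤ + j) where

      high-upper : c + c - j ℤ.≤ ℤ.+ 2 - (k + k - j)
      high-upper = by (δ h ⊕ δ h) (solve (k ∷ j ∷ c ∷ []))

      high-lower : c + c - ℤ.+ 2 - j ℤ.≤ ℤ.+ 2 - (k + k - j)
      high-lower = by (δ h ⊕ δ h ⊕ nat 2) (solve (k ∷ j ∷ c ∷ []))

      high-before : c + c - 1ℤ - j ℤ.≤ ℤ.+ 2 - (k + k - (j - 1ℤ))
      high-before = by (δ h ⊕ δ h) (solve (k ∷ j ∷ c ∷ []))

      high-after : c + c - 1ℤ - j ℤ.≤ ℤ.+ 2 - (k + k - (j + 1ℤ))
      high-after = by (δ h ⊕ δ h ⊕ nat 2) (solve (k ∷ j ∷ c ∷ []))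

    module _ (h : k ℤ.≤ c) where

      low-upper : - (c + c - j) ℤ.≤ ℤ.+ 2 - (k + k - j)
      low-upper = by (δ h ⊕ δ h ⊕ nat 2) (solve (k ∷ j ∷ c ∷ []))

      low-lower : - (c + c - ℤ.+ 2 - j) ℤ.≤ ℤ.+ 2 - (k + k - j)
      low-lower = by (δ h ⊕ δ h) (solve (k ∷ j ∷ c ∷ []))

      low-before : - (c + c - 1ℤ - j) ℤ.≤ ℤ.+ 2 - (k + k - (j - 1ℤ))
      low-before = by (δ h ⊕ δ h) (solve (k ∷ j ∷ c ∷ []))

      low-after : - (c + c - 1ℤ - j) ℤ.≤ ℤ.+ 2 - (k + k - (j + 1ℤ))
      low-after = by (δ h ⊕ δ h ⊕ nat 2) (solve (k ∷ j ∷ c ∷ []))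

    before : j ℤ.≤ k + k → j - 1ℤ ℤ.≤ k + k
    before h = by (δ h ⊕ nat 1) (solve (k ∷ j ∷ []))

    after⁻ : j + 1ℤ ℤ.≤ k + k → 1ℤ + j ℤ.≤ k + k
    after⁻ h = by (δ h) (solve (k ∷ j ∷ []))

    after⁺ : 1ℤ + j ℤ.≤ k + k → j + 1ℤ ℤ.≤ k + k
    after⁺ h = by (δ h) (solve (k ∷ j ∷ []))

  -- The mirror image of a hole has its vertical side at or beyond the middle column and points away
  -- from it, so it contains no triangle of the left half.
  far-◁ : ∀ {A k j} → k + k ℤ.≤ A → j ℤ.≤ A → A + A - (k + k) ℤ.≤ j - 1ℤ → ⊥
  far-◁ {A} {k} {j} h g l = contradictory {n = 0} (δ h ⊕ δ g ⊕ δ l) (solve (A ∷ k ∷ j ∷ []))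

  far-▷ : ∀ {A k j} → k + k ℤ.≤ A → 1ℤ + j ℤ.≤ A → A + A - (k + k) ℤ.≤ j → ⊥
  far-▷ {A} {k} {j} h g l = contradictory {n = 0} (δ h ⊕ δ g ⊕ δ l) (solve (A ∷ k ∷ j ∷ []))

  module Rhombi {A R j c : ℤ} where

    -- The reflection across the horizontal axis exchanges the two left sides of the rhombus, hence
    -- the two inequalities.
    mirror₁ : ℤ.+ 2 + A ℤ.≤ R + (c + c) → (1ℤ + j - c) + (1ℤ + j - c) + A ℤ.≤ R + (j + j)
    mirror₁ h = by (δ h) (solve (A ∷ R ∷ j ∷ c ∷ []))

    mirror₂ : c + c + A ℤ.≤ R + (j + j) → ℤ.+ 2 + A ℤ.≤ R + ((1ℤ + j - c) + (1ℤ + j - c))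
    mirror₂ h = by (δ h) (solve (A ∷ R ∷ j ∷ c ∷ []))

    -- Left of the middle column the rhombus widens exactly as fast as a path can move, so a path
    -- inside it cannot leave.
    stay₁ : c + c + A ℤ.≤ R + (j + j) → c + c + A ℤ.≤ R + ((1ℤ + j) + (1ℤ + j))
    stay₁ h = by (δ h ⊕ nat 2) (solve (A ∷ R ∷ j ∷ c ∷ []))

    rise₁ : c + c + A ℤ.≤ R + (j + j) → (1ℤ + c) + (1ℤ + c) + A ℤ.≤ R + ((1ℤ + j) + (1ℤ + j))
    rise₁ h = by (δ h) (solve (A ∷ R ∷ j ∷ c ∷ []))

    rise₂ : ℤ.+ 2 + A ℤ.≤ R + (c + c) → ℤ.+ 2 + A ℤ.≤ R + ((1ℤ + c) + (1ℤ + c))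
    rise₂ h = by (δ h ⊕ nat 2) (solve (A ∷ R ∷ c ∷ []))

    first : R ℤ.≤ A → c + c + A ℤ.≤ R + (0ℤ + 0ℤ) → ℤ.+ 2 + A ℤ.≤ R + (c + c) → ⊥
    first h h₁ h₂ = contradictory {n = 1} (δ h ⊕ δ h ⊕ δ h₁ ⊕ δ h₂) (solve (A ∷ R ∷ c ∷ []))

    outside⁻ : ¬ (c + c + A ℤ.≤ R + (A + A)) → 1ℤ + A + R ℤ.≤ c + c
    outside⁻ h = by (δ< (ℤP.≰⇒> h)) (solve (A ∷ R ∷ c ∷ []))

    outside⁺ : 1ℤ + A + R ℤ.≤ c + c → ¬ (c + c + A ℤ.≤ R + (A + A))
    outside⁺ h h′ = contradictory {n = 0} (δ h ⊕ δ h′) (solve (A ∷ R ∷ c ∷ []))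

    beyond : 0ℤ ℤ.≤ R → ℤ.+ 2 + A ℤ.≤ c + c → ℤ.+ 2 + A ℤ.≤ R + (c + c)
    beyond h₀ h = by (h₀ ⊕ δ h) (solve (A ∷ R ∷ c ∷ []))

    reflect-< : c + c ℤ.< 1ℤ + A → 1ℤ + A ℤ.< (1ℤ + A - c) + (1ℤ + A - c)
    reflect-< h = by< (δ< h) (solve (A ∷ c ∷ []))

    fixed : c + c ≡ 1ℤ + A → c ≡ 1ℤ + A - c
    fixed e = trans (cancel c) (cong (_- c) e)
      where
      cancel : ∀ c → c ≡ c + c - c
      cancel = solve-∀

  module Steps {B j c : ℤ} where

    mirror-top : 1ℤ ℤ.≤ c + B → 1ℤ + j - c ℤ.≤ B + j
    mirror-top h = by (δ h) (solve (B ∷ j ∷ c ∷ []))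

    mirror-bottom : c ℤ.≤ B + j → 1ℤ ℤ.≤ 1ℤ + j - c + B
    mirror-bottom h = by (δ h) (solve (B ∷ j ∷ c ∷ []))

    stay-top : c ℤ.≤ B + j → c ℤ.≤ B + (1ℤ + j)
    stay-top h = by (δ h ⊕ nat 1) (solve (B ∷ j ∷ c ∷ []))

    rise-top : c ℤ.≤ B + j → 1ℤ + c ℤ.≤ B + (1ℤ + j)
    rise-top h = by (δ h) (solve (B ∷ j ∷ c ∷ []))

    rise-bottom : 1ℤ ℤ.≤ c + B → 1ℤ ℤ.≤ 1ℤ + c + B
    rise-bottom h = by (δ h ⊕ nat 1) (solve (B ∷ c ∷ []))

    gap-top : 1ℤ ℤ.≤ c → 0ℤ ℤ.≤ B → c ℤ.≤ B + (c + c)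
    gap-top h h₀ = by (δ h ⊕ nat 1 ⊕ h₀) (solve (B ∷ c ∷ []))

    gap-top′ : 1ℤ ℤ.≤ c → 0ℤ ℤ.≤ B → 1ℤ + c ℤ.≤ B + (c + c)
    gap-top′ h h₀ = by (δ h ⊕ h₀) (solve (B ∷ c ∷ []))

    gap-bottom : 1ℤ ℤ.≤ c → 0ℤ ℤ.≤ B → 1ℤ ℤ.≤ c + B
    gap-bottom h h₀ = by (δ h ⊕ h₀) (solve (B ∷ c ∷ []))

  module _ {k j c : ℤ} where

    -- A triangle of side two contains three vertical unit edges: two on its vertical side, and one
    -- in its interior, a column earlier. Further to the left the two bounds on `c` contradict each
    -- other.
    hole-edges : j ℤ.≤ k + k → k ℤ.≤ c → c + k ℤ.≤ 1ℤ + j → (j ≡ k + k × (c ≡ 1ℤ + k ⊎ c ≡ k)) ⊎ (1ℤ + j ≡ k + k × c ≡ k)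
    hole-edges h₁ h₂ h₃ with 1ℤ + j ℤ.≤? k + k
    ... | yes h = inj₂ (ℤP.≤-antisym h (by (δ h₂ ⊕ δ h₃) (solve (k ∷ j ∷ c ∷ []))) , ℤP.≤-antisym (by (δ h ⊕ δ h₃) (solve (k ∷ j ∷ c ∷ []))) h₂)
    ... | no ¬h with c ℤ.≤? k
    ...   | yes h = inj₁ (j≡ , inj₂ (ℤP.≤-antisym h h₂))
      where
      j≡ : j ≡ k + k
      j≡ = ℤP.≤-antisym h₁ (by (δ< (ℤP.≰⇒> ¬h)) (solve (k ∷ j ∷ [])))
    ...   | no ¬h′ = inj₁ (j≡ , inj₁ (ℤP.≤-antisym (by (δ h₃ ⊕ δ h₁) (solve (k ∷ j ∷ c ∷ []))) (by (δ< (ℤP.≰⇒> ¬h′)) (solve (k ∷ c ∷ [])))))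
      where
      j≡ : j ≡ k + k
      j≡ = ℤP.≤-antisym h₁ (by (δ< (ℤP.≰⇒> ¬h)) (solve (k ∷ j ∷ [])))

  module Mirrors {s t x : ℤ} where

    turn-≥ : x ℤ.≤ s → 0ℤ ℤ.≤ s - x
    turn-≥ = δ

    turn-≤ : 0ℤ ℤ.≤ x → s - x ℤ.≤ s
    turn-≤ h = by h (solve (s ∷ x ∷ []))

    turn-back : t + x ≡ t + (s - (s - x))
    turn-back = solve (s ∷ t ∷ x ∷ [])

  module MirrorHoles {s d x : ℤ} where

    left-right : x ℤ.≤ d → s - d ℤ.≤ s - x
    left-right h = by (δ h) (solve (s ∷ d ∷ x ∷ []))

    left-right′ : ℤ.+ 2 - (d - x) ≡ ℤ.+ 2 - ((s - x) - (s - d))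
    left-right′ = solve (s ∷ d ∷ x ∷ [])

    right-left : s - d ℤ.≤ x → s - x ℤ.≤ d
    right-left h = by (δ h) (solve (s ∷ d ∷ x ∷ []))

    right-left′ : ℤ.+ 2 - (x - (s - d)) ≡ ℤ.+ 2 - (d - (s - x))
    right-left′ = solve (s ∷ d ∷ x ∷ [])

  module Box {A B p q : ℤ} where

    low : - (p - q) ℤ.≤ B + B + (p + q) → 0ℤ ℤ.≤ p + B
    low h = halve (by (δ h ⊕ nat 1) (solve (B ∷ p ∷ q ∷ [])))

    low′ : p - q ℤ.≤ B + B + (p + q) → 0ℤ ℤ.≤ q + B
    low′ h = halve (by (δ h ⊕ nat 1) (solve (B ∷ p ∷ q ∷ [])))

    high : p - q ℤ.≤ B + B + (A + A - (p + q)) → p + B ℤ.≤ A + (B + B)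
    high h = halve (by (δ h ⊕ nat 1) (solve (A ∷ B ∷ p ∷ q ∷ [])))

    high′ : - (p - q) ℤ.≤ B + B + (A + A - (p + q)) → q + B ℤ.≤ A + (B + B)
    high′ h = halve (by (δ h ⊕ nat 1) (solve (A ∷ B ∷ p ∷ q ∷ [])))

-- Alternating functionals, contractions and Pfaffians over the integers.

module Pfaffians where

  open import Data.Bool using (Bool; true; false; not; if_then_else_)
  open import Data.Integer as ℤ using (ℤ; _+_; _*_; _-_; -_; 0ℤ; 1ℤ; -1ℤ)
  import Data.Integer.Properties as ℤP
  open import Data.Integer.Tactic.RingSolver using (solve-∀)
  open import Data.List using (List; []; _∷_; _++_; map; length)
  import Data.List.Properties as LP
  open import Data.List.Relation.Unary.All as All using (All; []; _∷_)
  import Data.List.Relation.Unary.All.Properties as AllP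
  open import Data.List.Relation.Unary.AllPairs using (AllPairs; []; _∷_)
  open import Data.List.Membership.Propositional using (_∈_)
  open import Data.List.Membership.Propositional.Properties using (∈-∃++)
  open import Data.Product using (_×_; _,_; proj₂)
  open import Data.Nat as ℕ using (ℕ; zero; suc)
  import Data.Nat.Properties as ℕP
  open import Relation.Binary.PropositionalEquality

  sumOver : {A : Set} → (A → ℤ) → List A → ℤ
  sumOver f []       = 0ℤ
  sumOver f (x ∷ xs) = f x + sumOver f xs

  sumOver-++ : ∀ {A : Set} (f : A → ℤ) xs ys → sumOver f (xs ++ ys) ≡ sumOver f xs + sumOver f ys
  sumOver-++ f []       ys = sym (ℤP.+-identityˡ _)
  sumOver-++ f (x ∷ xs) ys = trans (cong (f x +_) (sumOver-++ f xs ys)) (sym (ℤP.+-assoc (f x) _ _))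

  sumOver-map : ∀ {A B : Set} (f : B → ℤ) (g : A → B) xs → sumOver f (map g xs) ≡ sumOver (λ x → f (g x)) xs
  sumOver-map f g []       = refl
  sumOver-map f g (x ∷ xs) = cong (f (g x) +_) (sumOver-map f g xs)

  sumOver-cong : ∀ {A : Set} {f g : A → ℤ} → (∀ x → f x ≡ g x) → ∀ xs → sumOver f xs ≡ sumOver g xs
  sumOver-cong e []       = refl
  sumOver-cong e (x ∷ xs) = cong₂ _+_ (e x) (sumOver-cong e xs)

  private
    double-zero : ∀ {i} → i ≡ - i → i ≡ 0ℤ
    double-zero {ℤ.+ zero}  _ = refl
    double-zero {ℤ.+ suc n} ()
    double-zero {ℤ.-[1+ n ]} ()

  -- Formal combinations: the objects combined need no addition of their own, because only values of
  -- functions on them are ever summed.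
  Combination : Set → Set
  Combination X = List (ℤ × X)

  lin : {X : Set} → Combination X → (X → ℤ) → ℤ
  lin L f = sumOver (λ { (k , x) → k * f x }) L

  lin-zero : ∀ {X : Set} (L : Combination X) → lin L (λ _ → 0ℤ) ≡ 0ℤ
  lin-zero []            = refl
  lin-zero ((k , _) ∷ L) = cong₂ _+_ (ℤP.*-zeroʳ k) (lin-zero L)

  lin-cong : ∀ {X : Set} (L : Combination X) {f g : X → ℤ} → (∀ x → f x ≡ g x) → lin L f ≡ lin L g
  lin-cong L e = sumOver-cong (λ { (k , x) → cong (k *_) (e x) }) L

  lin-affine : ∀ {X : Set} (L : Combination X) a (f g : X → ℤ) → lin L (λ x → a * f x - g x) ≡ a * lin L f - lin L g
  lin-affine []            a f g = shuffle a
    where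
    shuffle : ∀ a → 0ℤ ≡ a * 0ℤ - 0ℤ
    shuffle = solve-∀
  lin-affine ((k , x) ∷ L) a f g = trans (cong (k * (a * f x - g x) +_) (lin-affine L a f g)) (shuffle k a (f x) (g x) _ _)
    where
    shuffle : ∀ k a u v p q → k * (a * u - v) + (a * p - q) ≡ a * (k * u + p) - (k * v + q)
    shuffle = solve-∀

  signs : ℕ → ℤ
  signs zero    = 1ℤ
  signs (suc n) = - signs n

  signs-even : ∀ n → signs (n ℕ.+ n) ≡ 1ℤ
  signs-even zero    = refl
  signs-even (suc n) rewrite ℕP.+-suc n n = trans (ℤP.neg-involutive (signs (n ℕ.+ n))) (signs-even n)

  module Alternating {X : Set} where

    record Alternates (φ : List X → ℤ) : Set where
      constructor alternating
      field swap : ∀ as x y bs → φ (as ++ x ∷ y ∷ bs) ≡ - φ (as ++ y ∷ x ∷ bs)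

    open Alternates

    alternates-∷ : ∀ {φ} x → Alternates φ → Alternates (λ xs → φ (x ∷ xs))
    alternates-∷ x alt = alternating λ as → swap alt (x ∷ as)

    module _ {φ : List X → ℤ} (alt : Alternates φ) where

      repeat-zero : ∀ as x bs → φ (as ++ x ∷ x ∷ bs) ≡ 0ℤ
      repeat-zero as x bs = double-zero (swap alt as x x bs)

    move-front : ∀ {φ} → Alternates φ → ∀ xs y zs → φ (xs ++ y ∷ zs) ≡ signs (length xs) * φ (y ∷ xs ++ zs)
    move-front alt []       y zs = sym (ℤP.*-identityˡ _)
    move-front {φ} alt (x ∷ xs) y zs = begin
      φ (x ∷ xs ++ y ∷ zs)                         ≡⟨ move-front (alternates-∷ x alt) xs y zs ⟩
      signs (length xs) * φ (x ∷ y ∷ xs ++ zs)     ≡⟨ cong (signs (length xs) *_) (swap alt [] x y _) ⟩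
      signs (length xs) * - φ (y ∷ x ∷ xs ++ zs)   ≡⟨ swap-sign (signs (length xs)) _ ⟩
      - signs (length xs) * φ (y ∷ x ∷ xs ++ zs)   ∎
      where
      open ≡-Reasoning
      swap-sign : ∀ s t → s * - t ≡ - s * t
      swap-sign = solve-∀

    prefixed : ∀ {φ} → Alternates φ → ∀ as → Alternates (λ xs → φ (as ++ xs))
    prefixed {φ} alt as = alternating λ bs x y cs → begin
      φ (as ++ bs ++ x ∷ y ∷ cs)     ≡⟨ cong φ (sym (LP.++-assoc as bs _)) ⟩
      φ ((as ++ bs) ++ x ∷ y ∷ cs)   ≡⟨ swap alt (as ++ bs) x y cs ⟩
      - φ ((as ++ bs) ++ y ∷ x ∷ cs) ≡⟨ cong (λ l → - φ l) (LP.++-assoc as bs _) ⟩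
      - φ (as ++ bs ++ y ∷ x ∷ cs)   ∎
      where open ≡-Reasoning

    -- Two transpositions for each entry passed, hence no sign. The two starts of a hole can
    -- therefore be put anywhere in the list.
    move-pair : ∀ {φ} → Alternates φ → ∀ xs y z zs → φ (xs ++ y ∷ z ∷ zs) ≡ φ (y ∷ z ∷ xs ++ zs)
    move-pair alt [] y z zs = refl
    move-pair {φ} alt (x ∷ xs) y z zs = begin
      φ (x ∷ xs ++ y ∷ z ∷ zs)     ≡⟨ move-pair (alternates-∷ x alt) xs y z zs ⟩
      φ (x ∷ y ∷ z ∷ xs ++ zs)     ≡⟨ swap alt [] x y _ ⟩
      - φ (y ∷ x ∷ z ∷ xs ++ zs)   ≡⟨ cong -_ (swap alt (y ∷ []) x z _) ⟩
      - - φ (y ∷ z ∷ x ∷ xs ++ zs) ≡⟨ ℤP.neg-involutive _ ⟩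
      φ (y ∷ z ∷ x ∷ xs ++ zs)     ∎
      where open ≡-Reasoning

    repeat-zero′ : ∀ {φ} → Alternates φ → ∀ as x bs cs → φ (as ++ x ∷ bs ++ x ∷ cs) ≡ 0ℤ
    repeat-zero′ {φ} alt as x bs cs = begin
      φ (as ++ x ∷ bs ++ x ∷ cs)                        ≡⟨ move-front (alternates-∷ x (prefixed alt as) ) bs x cs ⟩
      signs (length bs) * φ (as ++ x ∷ x ∷ bs ++ cs)   ≡⟨ cong (signs (length bs) *_) (repeat-zero alt as x _) ⟩
      signs (length bs) * 0ℤ                            ≡⟨ ℤP.*-zeroʳ (signs (length bs)) ⟩
      0ℤ                                                ∎
      where open ≡-Reasoning

    -- The interior product with the covector `α`: an alternating sum over the deletion of one
    -- entry.
    contract : (X → ℤ) → (List X → ℤ) → List X → ℤ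
    contract α φ []       = 0ℤ
    contract α φ (x ∷ xs) = α x * φ xs - contract α (λ ys → φ (x ∷ ys)) xs

    -- The hypothesis speaks only of deletions from this particular list, so that its length or its
    -- excess can be used in each term.
    contract-ext : ∀ {α β φ ψ} xs → (∀ as x bs → xs ≡ as ++ x ∷ bs → α x * φ (as ++ bs) ≡ β x * ψ (as ++ bs)) →
                   contract α φ xs ≡ contract β ψ xs
    contract-ext []       e = refl
    contract-ext (x ∷ xs) e = cong₂ _-_ (e [] x xs refl)
      (contract-ext xs λ as y bs eq → e (x ∷ as) y bs (cong (x ∷_) eq))

    contract-zero : ∀ {α : X → ℤ} xs → contract α (λ _ → 0ℤ) xs ≡ 0ℤ
    contract-zero []           = refl
    contract-zero {α} (x ∷ xs) = cong₂ _-_ (ℤP.*-zeroʳ (α x)) (contract-zero xs)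

    contract-congʳ : ∀ {α φ ψ} → (∀ xs → φ xs ≡ ψ xs) → ∀ xs → contract α φ xs ≡ contract α ψ xs
    contract-congʳ {α} e xs = contract-ext xs λ as x bs _ → cong (α x *_) (e (as ++ bs))

    contract-linʳ : ∀ {α} s φ t ψ xs →
      contract α (λ ys → s * φ ys + t * ψ ys) xs ≡ s * contract α φ xs + t * contract α ψ xs
    contract-linʳ s φ t ψ [] = sym (cong₂ _+_ (ℤP.*-zeroʳ s) (ℤP.*-zeroʳ t))
    contract-linʳ {α} s φ t ψ (x ∷ xs) =
      trans (cong (λ c → α x * (s * φ xs + t * ψ xs) - c) (contract-linʳ {α} s (λ ys → φ (x ∷ ys)) t (λ ys → ψ (x ∷ ys)) xs))
            (shuffle (α x) s (φ xs) t (ψ xs) _ _)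
      where
      shuffle : ∀ a s u t v c d → a * (s * u + t * v) - (s * c + t * d) ≡ s * (a * u - c) + t * (a * v - d)
      shuffle = solve-∀

    contract-negʳ : ∀ {α} φ xs → contract α (λ ys → - φ ys) xs ≡ - contract α φ xs
    contract-negʳ φ []       = refl
    contract-negʳ {α} φ (x ∷ xs) =
      trans (cong (λ c → α x * - φ xs - c) (contract-negʳ (λ ys → φ (x ∷ ys)) xs)) (shuffle (α x) (φ xs) _)
      where
      shuffle : ∀ a u c → a * - u - - c ≡ - (a * u - c)
      shuffle = solve-∀

    contract-linˡ : ∀ {α φ} (L : Combination (X → ℤ)) → (∀ x → α x ≡ lin L (λ β → β x)) → ∀ xs →
      contract α φ xs ≡ lin L (λ β → contract β φ xs)
    contract-linˡ L e [] = sym (lin-zero L)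
    contract-linˡ {α} {φ} L e (x ∷ xs) = begin
      α x * φ xs - contract α φₓ xs
        ≡⟨ cong₂ (λ a c → a * φ xs - c) (e x) (contract-linˡ L e xs) ⟩
      lin L (λ β → β x) * φ xs - lin L (λ β → contract β φₓ xs)
        ≡⟨ cong (_- lin L (λ β → contract β φₓ xs)) (ℤP.*-comm _ (φ xs)) ⟩
      φ xs * lin L (λ β → β x) - lin L (λ β → contract β φₓ xs)
        ≡⟨ sym (lin-affine L (φ xs) (λ β → β x) (λ β → contract β φₓ xs)) ⟩
      lin L (λ β → φ xs * β x - contract β φₓ xs)
        ≡⟨ lin-cong L (λ β → cong (_- contract β φₓ xs) (ℤP.*-comm (φ xs) (β x))) ⟩
      lin L (λ β → β x * φ xs - contract β φₓ xs) ∎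
      where
      open ≡-Reasoning
      φₓ : List X → ℤ
      φₓ ys = φ (x ∷ ys)

    contract-lin : ∀ {Y : Set} {α} (L : Combination Y) (φ : Y → List X → ℤ) xs →
      contract α (λ ys → lin L (λ u → φ u ys)) xs ≡ lin L (λ u → contract α (φ u) xs)
    contract-lin L φ [] = sym (lin-zero L)
    contract-lin {α = α} L φ (x ∷ xs) =
      trans (cong (λ c → α x * lin L (λ u → φ u xs) - c) (contract-lin L (λ u ys → φ u (x ∷ ys)) xs))
            (sym (lin-affine L (α x) (λ u → φ u xs) (λ u → contract α (λ ys → φ u (x ∷ ys)) xs)))

    contract-alternates : ∀ {α φ} → Alternates φ → Alternates (contract α φ)
    contract-alternates {α} {φ} alt = alternating (go alt)
      where
      go : ∀ {φ} → Alternates φ → ∀ as x y bs → contract α φ (as ++ x ∷ y ∷ bs) ≡ - contract α φ (as ++ y ∷ x ∷ bs)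
      go {φ} alt [] x y bs = begin
        α x * φ (y ∷ bs) - (α y * φ (x ∷ bs) - contract α (λ ys → φ (x ∷ y ∷ ys)) bs)
          ≡⟨ cong (λ c → α x * φ (y ∷ bs) - (α y * φ (x ∷ bs) - c))
               (trans (contract-congʳ (λ ys → swap alt [] x y ys) bs) (contract-negʳ (λ ys → φ (y ∷ x ∷ ys)) bs)) ⟩
        α x * φ (y ∷ bs) - (α y * φ (x ∷ bs) - - contract α (λ ys → φ (y ∷ x ∷ ys)) bs)
          ≡⟨ shuffle (α x * φ (y ∷ bs)) (α y * φ (x ∷ bs)) _ ⟩
        - (α y * φ (x ∷ bs) - (α x * φ (y ∷ bs) - contract α (λ ys → φ (y ∷ x ∷ ys)) bs)) ∎
        where
        open ≡-Reasoning
        shuffle : ∀ u v c → u - (v - - c) ≡ - (v - (u - c))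
        shuffle = solve-∀
      go {φ} alt (a ∷ as) x y bs =
        trans (cong₂ (λ u c → α a * u - c) (swap alt as x y bs) (go (alternates-∷ a alt) as x y bs))
              (shuffle (α a) _ _)
        where
        shuffle : ∀ a u c → a * - u - - c ≡ - (a * u - c)
        shuffle = solve-∀

    -- Two deletions leave the same list in either order, but with opposite signs. This makes the
    -- Pfaffian alternate in its first two entries, where the recursion of `pf` gives no induction
    -- hypothesis.
    contract-anticommute : ∀ α β φ xs → contract α (contract β φ) xs ≡ - contract β (contract α φ) xs
    contract-anticommute α β φ []       = refl
    contract-anticommute α β φ (x ∷ xs) = begin
      α x * contract β φ xs - contract α (λ ys → contract β φ (x ∷ ys)) xs
        ≡⟨ cong (λ c → α x * contract β φ xs - c) (expand α β) ⟩
      α x * contract β φ xs - (β x * contract α φ xs + -1ℤ * contract α (contract β φₓ) xs)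
        ≡⟨ cong (λ c → α x * contract β φ xs - (β x * contract α φ xs + -1ℤ * c)) (contract-anticommute α β φₓ xs) ⟩
      α x * contract β φ xs - (β x * contract α φ xs + -1ℤ * - contract β (contract α φₓ) xs)
        ≡⟨ shuffle (α x * contract β φ xs) (β x * contract α φ xs) _ ⟩
      - (β x * contract α φ xs - (α x * contract β φ xs + -1ℤ * contract β (contract α φₓ) xs))
        ≡⟨ cong (λ c → - (β x * contract α φ xs - c)) (sym (expand β α)) ⟩
      - (β x * contract α φ xs - contract β (λ ys → contract α φ (x ∷ ys)) xs) ∎
      where
      open ≡-Reasoning
      φₓ : List X → ℤ
      φₓ ys = φ (x ∷ ys)
      shuffle : ∀ u v c → u - (v + -1ℤ * - c) ≡ - (v - (u + -1ℤ * c))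
      shuffle = solve-∀
      minus : ∀ u c → u - c ≡ u + -1ℤ * c
      minus = solve-∀
      expand : ∀ α β → contract α (λ ys → contract β φ (x ∷ ys)) xs
             ≡ β x * contract α φ xs + -1ℤ * contract α (contract β φₓ) xs
      expand α β = trans (contract-congʳ (λ ys → minus (β x * φ ys) (contract β φₓ ys)) xs)
                         (contract-linʳ (β x) φ -1ℤ (contract β φₓ) xs)

  open Alternating public

  module Pfaffian {X : Set} (A : X → X → ℤ) where

    -- Expansion along the first row. The number is half the length, which makes the recursion
    -- structural; a list of any other length gets the value zero.
    pf : ℕ → List X → ℤ
    pf zero    []       = 1ℤ
    pf zero    (_ ∷ _)  = 0ℤ
    pf (suc n) []       = 0ℤ
    pf (suc n) (x ∷ xs) = contract (A x) (pf n) xs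

    -- The expansion is an alternating sum of an odd number of terms, each equal to 1 by induction.
    pf-ones : ∀ n xs → AllPairs (λ x y → A x y ≡ 1ℤ) xs → length xs ≡ n ℕ.+ n → pf n xs ≡ 1ℤ
    pf-ones zero    []       _        _  = refl
    pf-ones (suc n) (x ∷ xs) (h ∷ hs) eq = trans
      (contract-ext xs λ as y bs e → cong₂ _*_ (one as y bs e)
        (pf-ones n (as ++ bs) (remove as (subst (AllPairs _) e hs))
          (ℕP.suc-injective (trans (sym (LP.length-++-sucʳ as y bs)) (trans (cong length (sym e)) eq′)))))
      (go xs n eq′)
      where
      eq′ : length xs ≡ suc (n ℕ.+ n)
      eq′ = trans (ℕP.suc-injective eq) (ℕP.+-suc n n)
      one : ∀ as y bs → xs ≡ as ++ y ∷ bs → A x y ≡ 1ℤ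
      one as y bs e = All.head (AllP.++⁻ʳ as (subst (All _) e h))
      remove : ∀ as {y bs} → AllPairs (λ x y → A x y ≡ 1ℤ) (as ++ y ∷ bs) → AllPairs (λ x y → A x y ≡ 1ℤ) (as ++ bs)
      remove []       (_ ∷ ps) = ps
      remove (a ∷ as) (p ∷ ps) = AllP.++⁺ (AllP.++⁻ˡ as p) (All.tail (AllP.++⁻ʳ as p)) ∷ remove as ps
      go : ∀ xs n → length xs ≡ suc (n ℕ.+ n) → contract (λ _ → 1ℤ) (λ _ → 1ℤ) xs ≡ 1ℤ
      go (x ∷ [])         zero    e = refl
      go (x ∷ y ∷ zs)     (suc n) e
        rewrite go zs n (trans (ℕP.suc-injective (ℕP.suc-injective e)) (ℕP.+-suc n n)) = refl

    module _ (skew : ∀ x y → A x y ≡ - A y x) where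

      pf-alternates : ∀ n → Alternates (pf n)
      pf-swap : ∀ n as x y bs → pf n (as ++ x ∷ y ∷ bs) ≡ - pf n (as ++ y ∷ x ∷ bs)
      pf-alternates n = alternating (pf-swap n)
      pf-swap zero    []       x y bs = refl
      pf-swap zero    (_ ∷ as) x y bs = refl
      pf-swap (suc n) (a ∷ as) x y bs = Alternates.swap (contract-alternates (pf-alternates n)) as x y bs
      -- Here the remaining functional `pf 0` is not a contraction, so anticommutation does not
      -- apply and two entries are treated by hand.
      pf-swap (suc zero) [] x y [] = cong (λ c → c * 1ℤ - 0ℤ) (skew x y) ▹ shuffle (A y x)
        where
        _▹_ = trans
        shuffle : ∀ a → - a * 1ℤ - 0ℤ ≡ - (a * 1ℤ - 0ℤ)
        shuffle = solve-∀
      pf-swap (suc zero) [] x y (b ∷ bs) = trans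
        (cong₂ (λ u c → u * 0ℤ - c) (skew x y) (vanish (A x) y b bs))
        (trans (shuffle (A y x)) (cong (λ c → - (A y x * 0ℤ - c)) (sym (vanish (A y) x b bs))))
        where
        vanish : ∀ α y b bs → contract α (λ ys → pf 0 (y ∷ ys)) (b ∷ bs) ≡ 0ℤ
        vanish α y b bs = contract-zero {α = α} (b ∷ bs)
        shuffle : ∀ a → - a * 0ℤ - 0ℤ ≡ - (a * 0ℤ - 0ℤ)
        shuffle = solve-∀
      pf-swap (suc (suc n)) [] x y bs = begin
        A x y * pf (suc n) bs - contract (A x) (contract (A y) (pf n)) bs
          ≡⟨ cong₂ (λ u c → u * pf (suc n) bs - c) (skew x y) (contract-anticommute (A x) (A y) (pf n) bs) ⟩
        - A y x * pf (suc n) bs - - contract (A y) (contract (A x) (pf n)) bs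
          ≡⟨ shuffle (A y x) _ _ ⟩
        - (A y x * pf (suc n) bs - contract (A y) (contract (A x) (pf n)) bs) ∎
        where
        open ≡-Reasoning
        shuffle : ∀ a u c → - a * u - - c ≡ - (a * u - c)
        shuffle = solve-∀

      module _ {z : X} (L : Combination X) (rel : ∀ w → A z w ≡ lin L (λ x → A x w)) where

        private
          relʳ : ∀ w → A w z ≡ lin L (A w)
          relʳ w = begin
            A w z                                  ≡⟨ skew w z ⟩
            - A z w                                ≡⟨ cong -_ (rel w) ⟩
            - lin L (λ x → A x w)                  ≡⟨ minus _ ⟩
            -1ℤ * lin L (λ x → A x w) - 0ℤ         ≡⟨ cong (λ c → -1ℤ * lin L (λ x → A x w) - c) (sym (lin-zero L)) ⟩
            -1ℤ * lin L (λ x → A x w) - lin L (λ _ → 0ℤ) ≡⟨ sym (lin-affine L -1ℤ (λ x → A x w) (λ _ → 0ℤ)) ⟩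
            lin L (λ x → -1ℤ * A x w - 0ℤ)         ≡⟨ lin-cong L (λ x → trans (sym (minus (A x w))) (sym (skew w x))) ⟩
            lin L (A w)                            ∎
            where
            open ≡-Reasoning
            minus : ∀ u → - u ≡ -1ℤ * u - 0ℤ
            minus = solve-∀

          contract-at : ∀ {α φ} → α z ≡ lin L α →
            (∀ as bs → φ (as ++ z ∷ bs) ≡ lin L (λ x → φ (as ++ x ∷ bs))) →
            ∀ as bs → contract α φ (as ++ z ∷ bs) ≡ lin L (λ x → contract α φ (as ++ x ∷ bs))
          contract-at {α} {φ} hα hφ [] bs = begin
            α z * φ bs - contract α (λ ys → φ (z ∷ ys)) bs
              ≡⟨ cong₂ (λ a c → a * φ bs - c) hα (trans (contract-congʳ (hφ []) bs) (contract-lin L (λ x ys → φ (x ∷ ys)) bs)) ⟩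
            lin L α * φ bs - lin L (λ x → contract α (λ ys → φ (x ∷ ys)) bs)
              ≡⟨ cong (_- lin L (λ x → contract α (λ ys → φ (x ∷ ys)) bs)) (ℤP.*-comm (lin L α) (φ bs)) ⟩
            φ bs * lin L α - lin L (λ x → contract α (λ ys → φ (x ∷ ys)) bs)
              ≡⟨ sym (lin-affine L (φ bs) α (λ x → contract α (λ ys → φ (x ∷ ys)) bs)) ⟩
            lin L (λ x → φ bs * α x - contract α (λ ys → φ (x ∷ ys)) bs)
              ≡⟨ lin-cong L (λ x → cong (_- contract α (λ ys → φ (x ∷ ys)) bs) (ℤP.*-comm (φ bs) (α x))) ⟩
            lin L (λ x → α x * φ bs - contract α (λ ys → φ (x ∷ ys)) bs) ∎
            where open ≡-Reasoning
          contract-at {α} {φ} hα hφ (a ∷ as) bs =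
            trans (cong₂ (λ u c → α a * u - c) (hφ as bs)
                    (contract-at {φ = λ ys → φ (a ∷ ys)} hα (λ as → hφ (a ∷ as)) as bs))
                  (sym (lin-affine L (α a) (λ x → φ (as ++ x ∷ bs)) (λ x → contract α (λ ys → φ (a ∷ ys)) (as ++ x ∷ bs))))

        -- `X` carries no linear structure: the relation is asked of rows of `A` only. That is all
        -- the expansion sees of `z`, as a row when `z` comes first and, by skewness, as a column
        -- otherwise.
        pf-linear : ∀ n as bs → pf n (as ++ z ∷ bs) ≡ lin L (λ x → pf n (as ++ x ∷ bs))
        pf-linear zero    []       bs = sym (lin-zero L)
        pf-linear zero    (_ ∷ as) bs = sym (lin-zero L)
        pf-linear (suc n) []       bs = trans
          (contract-linˡ (map (λ { (k , x) → k , A x }) L) (λ w → trans (rel w) (sym (sumOver-map _ _ L))) bs)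
          (sumOver-map _ _ L)
        pf-linear (suc n) (a ∷ as) bs = contract-at (relʳ a) (pf-linear n) as bs

      pf-linear₂ : ∀ {x y z} → (∀ w → A z w ≡ A x w + A y w) → ∀ n as bs →
                   pf n (as ++ z ∷ bs) ≡ pf n (as ++ x ∷ bs) + pf n (as ++ y ∷ bs)
      pf-linear₂ {x} {y} rel n as bs = trans
        (pf-linear ((1ℤ , x) ∷ (1ℤ , y) ∷ []) (λ w → trans (rel w) (shuffle (A x w) (A y w))) n as bs) (sym (shuffle (pf n (as ++ x ∷ bs)) (pf n (as ++ y ∷ bs))))
        where
        shuffle : ∀ u v → u + v ≡ 1ℤ * u + (1ℤ * v + 0ℤ)
        shuffle = solve-∀

      pf-zero : ∀ n as z bs → (∀ w → A z w ≡ 0ℤ) → pf n (as ++ z ∷ bs) ≡ 0ℤ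
      pf-zero n as z bs h = pf-linear [] h n as bs

      -- Each vector added to `z` already stands in `as`, so its term is a Pfaffian with a repeated
      -- entry.
      pf-span : ∀ n as z z′ bs (L : Combination X) → All (λ p → proj₂ p ∈ as) L →
                (∀ w → A z′ w ≡ A z w + lin L (λ x → A x w)) → pf n (as ++ z′ ∷ bs) ≡ pf n (as ++ z ∷ bs)
      pf-span n as z z′ bs L ∈as rel = begin
        pf n (as ++ z′ ∷ bs)
          ≡⟨ pf-linear ((1ℤ , z) ∷ L) (λ w → trans (rel w) (cong (_+ lin L (λ x → A x w)) (sym (ℤP.*-identityˡ (A z w))))) n as bs ⟩
        1ℤ * pf n (as ++ z ∷ bs) + lin L (λ x → pf n (as ++ x ∷ bs))
          ≡⟨ cong₂ _+_ (ℤP.*-identityˡ (pf n (as ++ z ∷ bs))) (vanish ∈as) ⟩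
        pf n (as ++ z ∷ bs) + 0ℤ ≡⟨ ℤP.+-identityʳ _ ⟩
        pf n (as ++ z ∷ bs) ∎
        where
        open ≡-Reasoning
        repeated : ∀ {x} → x ∈ as → pf n (as ++ x ∷ bs) ≡ 0ℤ
        repeated {x} x∈ with ∈-∃++ x∈
        ... | us , vs , refl = trans (cong (pf n) (LP.++-assoc us (x ∷ vs) (x ∷ bs)))
                                     (repeat-zero′ (pf-alternates n) us x vs bs)
        vanish : ∀ {L} → All (λ p → proj₂ p ∈ as) L → lin L (λ x → pf n (as ++ x ∷ bs)) ≡ 0ℤ
        vanish []                    = refl
        vanish (_∷_ {k , x} x∈ ∈as) = cong₂ _+_ (trans (cong (k *_) (repeated x∈)) (ℤP.*-zeroʳ k)) (vanish ∈as)

    contract-last : ∀ {α : X → ℤ} {φ : List X → ℤ} xs z → All (λ x → α x ≡ 0ℤ) xs →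
      contract α φ (xs ++ z ∷ []) ≡ signs (length xs) * (α z * φ xs)
    contract-last {α} {φ} [] z [] = shuffle (α z) (φ [])
      where
      shuffle : ∀ a u → a * u - 0ℤ ≡ 1ℤ * (a * u)
      shuffle = solve-∀
    contract-last {α} {φ} (x ∷ xs) z (h ∷ hs) = trans
      (cong₂ (λ u c → u * φ (xs ++ z ∷ []) - c) h (contract-last {α} {λ ys → φ (x ∷ ys)} xs z hs))
      (shuffle (signs (length xs)) (α z) (φ (x ∷ xs)))
      where
      shuffle : ∀ s a u → 0ℤ - s * (a * u) ≡ - s * (a * u)
      shuffle = solve-∀

    contract-vanish : ∀ {α : X → ℤ} {φ : List X → ℤ} xs → All (λ x → α x ≡ 0ℤ) xs → contract α φ xs ≡ 0ℤ
    contract-vanish []       []       = refl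
    contract-vanish {α} {φ} (x ∷ xs) (h ∷ hs) = cong₂ (λ u c → u * φ xs - c) h (contract-vanish xs hs)

  -- Allows labels that carry more information than the vectors they stand for, such as a tag for
  -- isotropy.
  pf-map : ∀ {X Y : Set} (A : Y → Y → ℤ) (f : X → Y) n xs →
    Pfaffian.pf (λ x y → A (f x) (f y)) n xs ≡ Pfaffian.pf A n (map f xs)
  pf-map A f zero    []       = refl
  pf-map A f zero    (_ ∷ _)  = refl
  pf-map A f (suc n) []       = refl
  pf-map A f (suc n) (x ∷ xs) = trans (contract-congʳ (pf-map A f n) xs) (contract-map (Pfaffian.pf A n) xs)
    where
    contract-map : ∀ φ xs → contract (λ y → A (f x) (f y)) (λ ys → φ (map f ys)) xs ≡ contract (A (f x)) φ (map f xs)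
    contract-map φ []       = refl
    contract-map φ (y ∷ ys) = cong (λ c → A (f x) (f y) * φ (map f ys) - c) (contract-map (λ zs → φ (f y ∷ zs)) ys)

  module Isotropic {X : Set} (A A′ : X → X → ℤ) (isotropic : X → Bool)
    (zeroA : ∀ x y → isotropic x ≡ true → isotropic y ≡ true → A x y ≡ 0ℤ)
    (zeroA′ : ∀ x y → isotropic x ≡ true → isotropic y ≡ true → A′ x y ≡ 0ℤ)
    (agree : ∀ x y → isotropic x ≡ not (isotropic y) → A x y ≡ A′ x y) where

    open Pfaffian

    weight : X → ℤ
    weight x = if isotropic x then 1ℤ else -1ℤ

    excess : List X → ℤ
    excess = sumOver weight

    excess-remove : ∀ as x bs → excess (as ++ x ∷ bs) ≡ weight x + excess (as ++ bs)
    excess-remove as x bs = begin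
      excess (as ++ x ∷ bs)              ≡⟨ sumOver-++ weight as (x ∷ bs) ⟩
      excess as + (weight x + excess bs) ≡⟨ shuffle (excess as) (weight x) (excess bs) ⟩
      weight x + (excess as + excess bs) ≡⟨ cong (weight x +_) (sym (sumOver-++ weight as bs)) ⟩
      weight x + excess (as ++ bs)       ∎
      where
      open ≡-Reasoning
      shuffle : ∀ a w b → a + (w + b) ≡ w + (a + b)
      shuffle = solve-∀

    private
      module Positive (B : X → X → ℤ) (zeroB : ∀ x y → isotropic x ≡ true → isotropic y ≡ true → B x y ≡ 0ℤ) where

        -- With more isotropic entries than others, every perfect matching joins two isotropic ones.
        pf-excess : ∀ n xs → 1ℤ ℤ.≤ excess xs → pf B n xs ≡ 0ℤ
        pf-excess zero    []       (ℤ.+≤+ ())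
        pf-excess zero    (_ ∷ _)  _ = refl
        pf-excess (suc n) []       _ = refl
        pf-excess (suc n) (x ∷ xs) h = trans (contract-ext xs term) (contract-zero {α = B x} xs)
          where
          term : ∀ as y bs → xs ≡ as ++ y ∷ bs → B x y * pf B n (as ++ bs) ≡ B x y * 0ℤ
          term as y bs refl with isotropic x in ex | isotropic y in ey | excess-remove as y bs
          ... | true  | true  | _ = cong (_* pf B n (as ++ bs)) (zeroB x y ex ey) ▹ sym (ℤP.*-zeroʳ (B x y))
            where _▹_ = trans
          ... | true  | false | e = cong (B x y *_) (pf-excess n (as ++ bs) (subst (1ℤ ℤ.≤_) (cancel e) h))
            where
            cancel : ∀ {u v} → u ≡ -1ℤ + v → 1ℤ + u ≡ v
            cancel {v = v} refl = shuffle v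
              where
              shuffle : ∀ v → 1ℤ + (-1ℤ + v) ≡ v
              shuffle = solve-∀
          ... | false | true  | e = cong (B x y *_) (pf-excess n (as ++ bs) (subst (1ℤ ℤ.≤_) (cancel e) h))
            where
            cancel : ∀ {u v} → u ≡ 1ℤ + v → -1ℤ + u ≡ v
            cancel {v = v} refl = shuffle v
              where
              shuffle : ∀ v → -1ℤ + (1ℤ + v) ≡ v
              shuffle = solve-∀
          ... | false | false | e = cong (B x y *_) (pf-excess n (as ++ bs)
                  (ℤP.≤-trans h (ℤP.≤-trans (ℤP.≤-reflexive (cancel {v = excess (as ++ bs)} e)) (ℤP.≤-trans (ℤP.+-monoʳ-≤ (excess (as ++ bs)) (ℤ.-≤+ {1} {0})) (ℤP.≤-reflexive (ℤP.+-identityʳ _))))))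
            where
            cancel : ∀ {u v} → u ≡ -1ℤ + v → -1ℤ + u ≡ v + ℤ.-[1+ 1 ]
            cancel {v = v} refl = shuffle v
              where
              shuffle : ∀ v → -1ℤ + (-1ℤ + v) ≡ v + ℤ.-[1+ 1 ]
              shuffle = solve-∀

    -- In a balanced list a matching that joins two non-isotropic entries also joins two isotropic
    -- ones. The surviving terms use mixed pairs only, and there the forms agree.
    pf-agree : ∀ n xs → excess xs ≡ 0ℤ → pf A n xs ≡ pf A′ n xs
    pf-agree zero    []       _ = refl
    pf-agree zero    (_ ∷ _)  _ = refl
    pf-agree (suc n) []       _ = refl
    pf-agree (suc n) (x ∷ xs) h = contract-ext xs term
      where
      term : ∀ as y bs → xs ≡ as ++ y ∷ bs → A x y * pf A n (as ++ bs) ≡ A′ x y * pf A′ n (as ++ bs)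
      term as y bs refl with isotropic x in ex | isotropic y in ey | excess-remove as y bs
      ... | true  | true  | _ = trans (cong (_* pf A n (as ++ bs)) (zeroA x y ex ey))
                                      (sym (cong (_* pf A′ n (as ++ bs)) (zeroA′ x y ex ey)))
      ... | true  | false | e = cong₂ _*_ (agree x y (trans ex (cong not (sym ey)))) (pf-agree n (as ++ bs) (trans (cancel e) h))
        where
        cancel : ∀ {u v} → u ≡ -1ℤ + v → v ≡ 1ℤ + u
        cancel {v = v} refl = shuffle v
          where
          shuffle : ∀ v → v ≡ 1ℤ + (-1ℤ + v)
          shuffle = solve-∀
      ... | false | true  | e = cong₂ _*_ (agree x y (trans ex (cong not (sym ey)))) (pf-agree n (as ++ bs) (trans (cancel e) h))
        where
        cancel : ∀ {u v} → u ≡ 1ℤ + v → v ≡ -1ℤ + u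
        cancel {v = v} refl = shuffle v
          where
          shuffle : ∀ v → v ≡ -1ℤ + (1ℤ + v)
          shuffle = solve-∀
      -- Removing two non-isotropic entries from a balanced list leaves excess 2, so the minor
      -- vanishes for both forms.
      ... | false | false | e = trans (vanish A (Positive.pf-excess A zeroA)) (sym (vanish A′ (Positive.pf-excess A′ zeroA′)))
        where
        cancel : ∀ {u v} → u ≡ -1ℤ + v → -1ℤ + u ≡ 0ℤ → v ≡ ℤ.+ 2
        cancel {v = v} refl e = trans (shuffle v) (cong (_+ ℤ.+ 2) e)
          where
          shuffle : ∀ v → v ≡ -1ℤ + (-1ℤ + v) + ℤ.+ 2
          shuffle = solve-∀
        vanish : ∀ B → (∀ n xs → 1ℤ ℤ.≤ excess xs → pf B n xs ≡ 0ℤ) → B x y * pf B n (as ++ bs) ≡ 0ℤ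
        vanish B z = trans (cong (B x y *_) (z n (as ++ bs) (subst (1ℤ ℤ.≤_) (sym (cancel e h)) (ℤ.+≤+ (ℕ.s≤s ℕ.z≤n))))) (ℤP.*-zeroʳ (B x y))

-- Nonintersecting paths counted column by column with a Pfaffian.

module PathSystems where

  open import Data.Bool using (if_then_else_)
  open import Data.Empty using (⊥-elim)
  open import Data.Integer as ℤ using (ℤ; _+_; _*_; _-_; -_; 0ℤ; 1ℤ)
  import Data.Integer.Properties as ℤP
  open import Data.Integer.Tactic.RingSolver using (solve-∀)
  open import Data.List using (List; []; _∷_; _++_; map; length; filter; concatMap; _ʳ++_; reverse)
  import Data.List.Properties as LP
  open import Data.List.Membership.Propositional using (_∈_; find; lose)
  open import Data.List.Membership.Propositional.Properties
  open import Data.List.Relation.Binary.Pointwise as Pw using (Pointwise; []; _∷_)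
  open import Data.List.Relation.Unary.All as All using (All; []; _∷_)
  import Data.List.Relation.Unary.All.Properties as AllP
  open import Data.List.Relation.Unary.Any using (here; there)
  open import Data.List.Relation.Unary.Linked as Linked using (Linked; []; [-]; _∷_)
  open import Data.Maybe using (Maybe; just; nothing; maybe)
  open import Data.Nat as ℕ using (ℕ; zero; suc)
  import Data.Nat.Properties as ℕP
  open import Data.Product using (_×_; _,_; ∃)
  open import Data.Sum using (_⊎_; inj₁; inj₂)
  open import Function using (_∘_)
  open import Relation.Binary.PropositionalEquality
  open import Relation.Nullary using (¬_; Dec; yes; no; does)
  open import Relation.Nullary.Decidable using (_×-dec_)
  open import Relation.Unary using (Decidable)
  open Pfaffians

  sumOver-cong-∈ : ∀ {A : Set} {f g : A → ℤ} xs → (∀ {x} → x ∈ xs → f x ≡ g x) → sumOver f xs ≡ sumOver g xs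
  sumOver-cong-∈ []       e = refl
  sumOver-cong-∈ (x ∷ xs) e = cong₂ _+_ (e (here refl)) (sumOver-cong-∈ xs (e ∘ there))

  sumOver-*ʳ : ∀ {A : Set} (f : A → ℤ) c xs → sumOver f xs * c ≡ sumOver (λ x → f x * c) xs
  sumOver-*ʳ f c []       = ℤP.*-zeroˡ c
  sumOver-*ʳ f c (x ∷ xs) = trans (ℤP.*-distribʳ-+ c (f x) _) (cong (f x * c +_) (sumOver-*ʳ f c xs))

  sumOver-*ˡ : ∀ {A : Set} (f : A → ℤ) c xs → c * sumOver f xs ≡ sumOver (λ x → c * f x) xs
  sumOver-*ˡ f c []       = ℤP.*-zeroʳ c
  sumOver-*ˡ f c (x ∷ xs) = trans (ℤP.*-distribˡ-+ c (f x) _) (cong (c * f x +_) (sumOver-*ˡ f c xs))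

  Descending Weakly : List ℤ → Set
  Descending = Linked ℤ._>_
  Weakly     = Linked ℤ._≥_

  descending? : Decidable Descending
  descending? = Linked.linked? (λ x y → y ℤP.<? x)

  -- Since the midpoint of the edge `c` of column `j` has height `c + c - 1 - j`, keeping the index
  -- is a step down by half a spacing and raising it is a step up.
  data Step : ℤ → ℤ → Set where
    stay : ∀ {x} → Step x x
    rise : ∀ {x} → Step x (ℤ.suc x)

  allSteps : List ℤ → List (List ℤ)
  allSteps []       = [] ∷ []
  allSteps (x ∷ xs) = map (x ∷_) (allSteps xs) ++ map (ℤ.suc x ∷_) (allSteps xs)

  ∈-allSteps⁻ : ∀ xs {ys} → ys ∈ allSteps xs → Pointwise Step xs ys
  ∈-allSteps⁻ []       (here refl) = []
  ∈-allSteps⁻ (x ∷ xs) m with ∈-++⁻ (map (x ∷_) (allSteps xs)) m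
  ... | inj₁ m′ with ∈-map⁻ (x ∷_) m′
  ...   | ys , ys∈ , refl = stay ∷ ∈-allSteps⁻ xs ys∈
  ∈-allSteps⁻ (x ∷ xs) m | inj₂ m′ with ∈-map⁻ (ℤ.suc x ∷_) m′
  ...   | ys , ys∈ , refl = rise ∷ ∈-allSteps⁻ xs ys∈

  ∈-allSteps⁺ : ∀ {xs ys} → Pointwise Step xs ys → ys ∈ allSteps xs
  ∈-allSteps⁺ []         = here refl
  ∈-allSteps⁺ (stay ∷ p) = ∈-++⁺ˡ (∈-map⁺ _ (∈-allSteps⁺ p))
  ∈-allSteps⁺ {x ∷ xs} (rise ∷ p) = ∈-++⁺ʳ (map (x ∷_) (allSteps xs)) (∈-map⁺ _ (∈-allSteps⁺ p))

  step-≥ : ∀ {x x′ y y′} → x ℤ.> y → Step x x′ → Step y y′ → x′ ℤ.≥ y′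
  step-≥ h stay stay = ℤP.<⇒≤ h
  step-≥ h stay rise = ℤP.i<j⇒suc[i]≤j h
  step-≥ h rise stay = ℤP.≤-trans (ℤP.<⇒≤ h) (ℤP.i≤suc[i] _)
  step-≥ h rise rise = ℤP.suc-mono (ℤP.<⇒≤ h)

  -- Neighbouring positions differ by at least 1 and a step changes the difference by at most 1:
  -- paths can meet, but not cross.
  steps-weakly : ∀ {xs ys} → Descending xs → Pointwise Step xs ys → Weakly ys
  steps-weakly []      []          = []
  steps-weakly [-]     (_ ∷ [])    = [-]
  steps-weakly (h ∷ d) (s ∷ t ∷ p) = step-≥ h s t ∷ steps-weakly d (t ∷ p)

  repeat : ∀ {xs} → Weakly xs → ¬ Descending xs → ∃ λ as → ∃ λ x → ∃ λ bs → xs ≡ as ++ x ∷ x ∷ bs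
  repeat []  ¬d = ⊥-elim (¬d [])
  repeat [-] ¬d = ⊥-elim (¬d [-])
  repeat {x ∷ y ∷ xs} (h ∷ w) ¬d with x ℤP.≟ y
  ... | yes refl = [] , x , xs , refl
  ... | no x≢y with repeat w (λ d → ¬d (ℤP.≤∧≢⇒< h (x≢y ∘ sym) ∷ d))
  ...   | as , z , bs , eq = x ∷ as , z , bs , cong (x ∷_) eq

  insertPair : ℤ → List ℤ → List ℤ
  insertPair k []       = ℤ.suc k ∷ k ∷ []
  insertPair k (x ∷ xs) with x ℤ.≤? k
  ... | yes _ = ℤ.suc k ∷ k ∷ x ∷ xs
  ... | no  _ = x ∷ insertPair k xs

  insertPair-split : ∀ k xs → ∃ λ as → ∃ λ bs → xs ≡ as ++ bs × insertPair k xs ≡ as ++ ℤ.suc k ∷ k ∷ bs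
  insertPair-split k []       = [] , [] , refl , refl
  insertPair-split k (x ∷ xs) with x ℤ.≤? k
  ... | yes _ = [] , x ∷ xs , refl , refl
  ... | no  _ with insertPair-split k xs
  ...   | as , bs , e , e′ = x ∷ as , bs , cong (x ∷_) e , cong (x ∷_) e′

  -- A position that is not at most `k` is at least `k + 1`, so a new position may coincide with an
  -- old one but is never out of order.
  insertPair-weakly : ∀ k {xs} → Weakly xs → Weakly (insertPair k xs)
  insertPair-weakly k {[]} w = ℤP.i≤suc[i] k ∷ [-]
  insertPair-weakly k {x ∷ xs} w with x ℤ.≤? k
  ... | yes h = ℤP.i≤suc[i] k ∷ (h ∷ w)
  insertPair-weakly k {x ∷ []} w | no h = ℤP.i<j⇒suc[i]≤j (ℤP.≰⇒> h) ∷ (ℤP.i≤suc[i] k ∷ [-])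
  insertPair-weakly k {x ∷ y ∷ xs} (h′ ∷ w) | no h with insertPair-weakly k {y ∷ xs} w
  ... | w′ with y ℤ.≤? k
  ...   | yes _ = ℤP.i<j⇒suc[i]≤j (ℤP.≰⇒> h) ∷ w′
  ...   | no  _ = h′ ∷ w′

  insertMaybe : Maybe ℤ → List ℤ → List ℤ
  insertMaybe nothing  xs = xs
  insertMaybe (just k) xs = insertPair k xs

  insertMaybe-weakly : ∀ g {xs} → Weakly xs → Weakly (insertMaybe g xs)
  insertMaybe-weakly nothing  w = w
  insertMaybe-weakly (just k) w = insertPair-weakly k w

  module System (insert : ℕ → List ℤ → List ℤ)
    (Valid : ℕ → List ℤ → Set) (valid? : ∀ j → Decidable (Valid j))
    (Final : List ℤ → Set) (final? : Decidable Final) where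

    -- `n` columns remain after column `j`. A history records every state as reached by the steps,
    -- before the insertion, since the column alone determines what is inserted.
    chains : ℕ → ℕ → List ℤ → List (List (List ℤ))
    chains zero    j xs = if does (final? xs) then [] ∷ [] else []
    chains (suc n) j xs =
      concatMap (λ ys → map (ys ∷_) (chains n (suc j) (insert (suc j) ys)))
                (filter (λ ys → valid? (suc j) (insert (suc j) ys)) (allSteps xs))

    data Chain : ℕ → ℕ → List ℤ → List (List ℤ) → Set where
      done : ∀ {j xs} → Final xs → Chain 0 j xs []
      link : ∀ {n j xs ys h} → Pointwise Step xs ys × Valid (suc j) (insert (suc j) ys) →
             Chain n (suc j) (insert (suc j) ys) h → Chain (suc n) j xs (ys ∷ h)

    ∈-chains⁻ : ∀ n j xs {h} → h ∈ chains n j xs → Chain n j xs h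
    ∈-chains⁻ zero j xs m with final? xs | m
    ... | yes f | here refl = done f
    ... | no  _ | ()
    ∈-chains⁻ (suc n) j xs m with ∈-concatMap⁻ (λ ys → map (ys ∷_) (chains n (suc j) (insert (suc j) ys))) {xs = filter (λ ys → valid? (suc j) (insert (suc j) ys)) (allSteps xs)} m
    ... | m′ with find m′
    ... | ys , ys∈ , h∈ with ∈-map⁻ (ys ∷_) h∈ | ∈-filter⁻ (λ ys → valid? (suc j) (insert (suc j) ys)) {xs = allSteps xs} ys∈
    ...   | h′ , h′∈ , refl | ys∈′ , v = link (∈-allSteps⁻ xs ys∈′ , v) (∈-chains⁻ n (suc j) _ h′∈)

    ∈-chains⁺ : ∀ {n j xs h} → Chain n j xs h → h ∈ chains n j xs
    ∈-chains⁺ {xs = xs} (done f) with final? xs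
    ... | yes _ = here refl
    ... | no ¬f = ⊥-elim (¬f f)
    ∈-chains⁺ {suc n} {j} {xs} {ys ∷ h} (link (p , v) c) =
      ∈-concatMap⁺ (λ ys → map (ys ∷_) (chains n (suc j) (insert (suc j) ys)))
        {xs = filter (λ ys → valid? (suc j) (insert (suc j) ys)) (allSteps xs)}
        (lose (∈-filter⁺ (λ ys → valid? (suc j) (insert (suc j) ys)) (∈-allSteps⁺ p) v) (∈-map⁺ (ys ∷_) (∈-chains⁺ c)))

    count : ℕ → ℕ → List ℤ → ℤ
    count n j xs = ℤ.+ length (chains n j xs)

    count-suc : ∀ n j xs → count (suc n) j xs ≡
      sumOver (λ ys → if does (valid? (suc j) (insert (suc j) ys)) then count n (suc j) (insert (suc j) ys) else 0ℤ) (allSteps xs)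
    count-suc n j xs = go (allSteps xs)
      where
      f : List ℤ → List (List (List ℤ))
      f ys = map (ys ∷_) (chains n (suc j) (insert (suc j) ys))
      v? : Decidable (λ ys → Valid (suc j) (insert (suc j) ys))
      v? ys = valid? (suc j) (insert (suc j) ys)
      go : ∀ yss → ℤ.+ length (concatMap f (filter v? yss)) ≡
        sumOver (λ ys → if does (v? ys) then count n (suc j) (insert (suc j) ys) else 0ℤ) yss
      go []         = refl
      go (ys ∷ yss) with v? ys
      ... | no  _ = trans (go yss) (sym (ℤP.+-identityˡ _))
      ... | yes _ = begin
        ℤ.+ length (f ys ++ concatMap f (filter v? yss))
          ≡⟨ cong ℤ.+_ (LP.length-++ (f ys)) ⟩
        ℤ.+ (length (f ys) ℕ.+ length (concatMap f (filter v? yss)))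
          ≡⟨ ℤP.pos-+ (length (f ys)) _ ⟩
        ℤ.+ length (f ys) + ℤ.+ length (concatMap f (filter v? yss))
          ≡⟨ cong₂ _+_ (cong ℤ.+_ (LP.length-map {A = List (List ℤ)} (ys ∷_) (chains n (suc j) (insert (suc j) ys)))) (go yss) ⟩
        _ ∎
        where open ≡-Reasoning

  -- Every step of the walkers is a sum over independent choices, and an alternating
  -- functional kills the choices in which two walkers collide.
  module Gessel-Viennot {X : Set} (A : X → X → ℤ) (skew : ∀ x y → A x y ≡ - A y x) where

    open Pfaffian A

    module _ (lab : ℕ → ℤ → X) (rel : ∀ n x w → A (lab (suc n) x) w ≡ A (lab n x) w + A (lab n (ℤ.suc x)) w) where

      -- `rel` is the recursion of Pascal's triangle: a label with one more step left is the sum of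
      -- the labels at the two next positions. Multilinearity gives one term for each independent
      -- choice of steps, collisions included.
      expand : ∀ m n as xs bs → pf m (as ++ map (lab (suc n)) xs ++ bs) ≡
        sumOver (λ ys → pf m (as ++ map (lab n) ys ++ bs)) (allSteps xs)
      expand m n as []       bs = sym (ℤP.+-identityʳ _)
      expand m n as (x ∷ xs) bs = begin
        pf m (as ++ lab (suc n) x ∷ map (lab (suc n)) xs ++ bs)
          ≡⟨ pf-linear₂ skew (rel n x) m as _ ⟩
        pf m (as ++ lab n x ∷ map (lab (suc n)) xs ++ bs) + pf m (as ++ lab n (ℤ.suc x) ∷ map (lab (suc n)) xs ++ bs)
          ≡⟨ cong₂ _+_ (branch x) (branch (ℤ.suc x)) ⟩
        sumOver (λ ys → pf m (as ++ map (lab n) ys ++ bs)) (map (x ∷_) (allSteps xs)) +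
        sumOver (λ ys → pf m (as ++ map (lab n) ys ++ bs)) (map (ℤ.suc x ∷_) (allSteps xs))
          ≡⟨ sym (sumOver-++ _ (map (x ∷_) (allSteps xs)) _) ⟩
        sumOver (λ ys → pf m (as ++ map (lab n) ys ++ bs)) (allSteps (x ∷ xs)) ∎
        where
        open ≡-Reasoning
        branch : ∀ y → pf m (as ++ lab n y ∷ map (lab (suc n)) xs ++ bs) ≡
          sumOver (λ ys → pf m (as ++ map (lab n) ys ++ bs)) (map (y ∷_) (allSteps xs))
        branch y = begin
          pf m (as ++ lab n y ∷ map (lab (suc n)) xs ++ bs)
            ≡⟨ cong (pf m) (sym (LP.++-assoc as (lab n y ∷ []) _)) ⟩
          pf m ((as ++ lab n y ∷ []) ++ map (lab (suc n)) xs ++ bs)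
            ≡⟨ expand m n (as ++ lab n y ∷ []) xs bs ⟩
          sumOver (λ ys → pf m ((as ++ lab n y ∷ []) ++ map (lab n) ys ++ bs)) (allSteps xs)
            ≡⟨ sumOver-cong (λ ys → cong (pf m) (LP.++-assoc as (lab n y ∷ []) _)) (allSteps xs) ⟩
          sumOver (λ ys → pf m (as ++ lab n y ∷ map (lab n) ys ++ bs)) (allSteps xs)
            ≡⟨ sym (sumOver-map _ (y ∷_) (allSteps xs)) ⟩
          _ ∎

      -- The second of two families is listed in reverse, because the sign matrix traverses its copy
      -- of the final positions upwards.
      expandʳ : ∀ m n as xs bs → pf m (as ++ (map (lab (suc n)) xs ʳ++ bs)) ≡
        sumOver (λ ys → pf m (as ++ (map (lab n) ys ʳ++ bs))) (allSteps xs)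
      expandʳ m n as []       bs = sym (ℤP.+-identityʳ _)
      expandʳ m n as (x ∷ xs) bs = begin
        pf m (as ++ (map (lab (suc n)) xs ʳ++ lab (suc n) x ∷ bs))
          ≡⟨ cong (λ l → pf m (as ++ l)) (LP.ʳ++-defn (map (lab (suc n)) xs)) ⟩
        pf m (as ++ r ++ lab (suc n) x ∷ bs)
          ≡⟨ cong (pf m) (sym (LP.++-assoc as r _)) ⟩
        pf m ((as ++ r) ++ lab (suc n) x ∷ bs)
          ≡⟨ pf-linear₂ skew (rel n x) m (as ++ r) bs ⟩
        pf m ((as ++ r) ++ lab n x ∷ bs) + pf m ((as ++ r) ++ lab n (ℤ.suc x) ∷ bs)
          ≡⟨ cong₂ _+_ (branch x) (branch (ℤ.suc x)) ⟩
        sumOver (λ ys → pf m (as ++ (map (lab n) ys ʳ++ bs))) (map (x ∷_) (allSteps xs)) +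
        sumOver (λ ys → pf m (as ++ (map (lab n) ys ʳ++ bs))) (map (ℤ.suc x ∷_) (allSteps xs))
          ≡⟨ sym (sumOver-++ _ (map (x ∷_) (allSteps xs)) _) ⟩
        sumOver (λ ys → pf m (as ++ (map (lab n) ys ʳ++ bs))) (allSteps (x ∷ xs)) ∎
        where
        open ≡-Reasoning
        r : List X
        r = reverse (map (lab (suc n)) xs)
        branch : ∀ y → pf m ((as ++ r) ++ lab n y ∷ bs) ≡
          sumOver (λ ys → pf m (as ++ (map (lab n) ys ʳ++ bs))) (map (y ∷_) (allSteps xs))
        branch y = begin
          pf m ((as ++ r) ++ lab n y ∷ bs) ≡⟨ cong (pf m) (LP.++-assoc as r _) ⟩
          pf m (as ++ r ++ lab n y ∷ bs)   ≡⟨ cong (λ l → pf m (as ++ l)) (sym (LP.ʳ++-defn (map (lab (suc n)) xs))) ⟩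
          pf m (as ++ (map (lab (suc n)) xs ʳ++ lab n y ∷ bs)) ≡⟨ expandʳ m n as xs (lab n y ∷ bs) ⟩
          _ ≡⟨ sym (sumOver-map _ (y ∷_) (allSteps xs)) ⟩
          _ ∎

    pf-insert : ∀ (f : ℤ → X) m k xs bs → pf m (map f xs ++ f (ℤ.suc k) ∷ f k ∷ bs) ≡ pf m (map f (insertPair k xs) ++ bs)
    pf-insert f m k xs bs with insertPair-split k xs
    ... | as , cs , refl , e rewrite e | LP.map-++ f as cs | LP.map-++ f as (ℤ.suc k ∷ k ∷ cs)
          | LP.++-assoc (map f as) (map f cs) (f (ℤ.suc k) ∷ f k ∷ bs)
          | LP.++-assoc (map f as) (f (ℤ.suc k) ∷ f k ∷ map f cs) bs
      = move-pair (prefixed (pf-alternates skew m) (map f as)) (map f cs) (f (ℤ.suc k)) (f k) bs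

    pf-repeat : ∀ (f : ℤ → X) m {xs} bs → Weakly xs → ¬ Descending xs → pf m (map f xs ++ bs) ≡ 0ℤ
    pf-repeat f m bs w ¬d with repeat w ¬d
    ... | as , x , cs , refl rewrite LP.map-++ f as (x ∷ x ∷ cs) | LP.++-assoc (map f as) (f x ∷ f x ∷ map f cs) bs
      = repeat-zero (pf-alternates skew m) (map f as) (f x) (map f cs ++ bs)

    pf-repeatʳ : ∀ (f : ℤ → X) m as {xs} bs → Weakly xs → ¬ Descending xs → pf m (as ++ (map f xs ʳ++ bs)) ≡ 0ℤ
    pf-repeatʳ f m as bs w ¬d with repeat w ¬d
    ... | us , x , vs , refl rewrite LP.map-++ f us (x ∷ x ∷ vs) | LP.++-ʳ++ (map f us) {f x ∷ f x ∷ map f vs} {bs}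
          | LP.ʳ++-defn (map f vs) {f x ∷ f x ∷ (map f us ʳ++ bs)} | sym (LP.++-assoc as (reverse (map f vs)) (f x ∷ f x ∷ (map f us ʳ++ bs)))
      = repeat-zero (pf-alternates skew m) (as ++ reverse (map f vs)) (f x) (map f us ʳ++ bs)

    pf-zeroʳ : ∀ m as xs z bs → (∀ w → A z w ≡ 0ℤ) → z ∈ xs → pf m (as ++ (xs ʳ++ bs)) ≡ 0ℤ
    pf-zeroʳ m as xs z bs h z∈ with ∈-∃++ z∈
    ... | us , vs , refl rewrite LP.++-ʳ++ us {z ∷ vs} {bs} | LP.ʳ++-defn vs {z ∷ (us ʳ++ bs)}
          | sym (LP.++-assoc as (reverse vs) (z ∷ (us ʳ++ bs)))
      = pf-zero skew m (as ++ reverse vs) z (us ʳ++ bs) h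

    pf-zeroˡ : ∀ m xs z bs → (∀ w → A z w ≡ 0ℤ) → z ∈ xs → pf m (xs ++ bs) ≡ 0ℤ
    pf-zeroˡ m xs z bs h z∈ with ∈-∃++ z∈
    ... | us , vs , refl rewrite LP.++-assoc us (z ∷ vs) bs = pf-zero skew m us z (vs ++ bs) h

  guard-* : ∀ {P Q : Set} {u v w} (d : Dec P) (e : Dec Q) → (P → Q → u * v ≡ w) → (¬ P → w ≡ 0ℤ) → (¬ Q → w ≡ 0ℤ) →
    (if does d then u else 0ℤ) * (if does e then v else 0ℤ) ≡ w
  guard-* (yes p) (yes q) h _ _ = h p q
  guard-* {u = u} (yes p) (no ¬q) _ _ h = trans (ℤP.*-zeroʳ u) (sym (h ¬q))
  guard-* (no ¬p) _ _ h _ = sym (h ¬p)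

  indicator : {P : Set} → Dec P → ℤ
  indicator d = if does d then 1ℤ else 0ℤ

  module _ (gap : ℕ → Maybe ℤ) where

    gaps : ℕ → ℕ → ℕ
    gaps zero    j = 0
    gaps (suc n) j = maybe (λ _ → 1) 0 (gap (suc j)) ℕ.+ gaps n (suc j)

    module _ {X : Set} (lab : ℕ → ℤ → X) where

      -- Paths that start in later columns wait at the end of the list from the outset, labelled
      -- with the number of steps they will have left. The list thus keeps its length throughout the
      -- recursion.
      later : ℕ → ℕ → List X
      later zero    j = []
      later (suc n) j = maybe (λ k → lab n (ℤ.suc k) ∷ lab n k ∷ []) [] (gap (suc j)) ++ later n (suc j)

      length-later : ∀ n j → length (later n j) ≡ gaps n j ℕ.+ gaps n j
      length-later zero    j = refl
      length-later (suc n) j with gap (suc j)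
      ... | nothing = length-later n (suc j)
      ... | just k  = cong suc (trans (cong suc (length-later n (suc j))) (sym (ℕP.+-suc (gaps n (suc j)) _)))

    -- Of the two starts of a hole only `suc k` lies above the axis, and it occurs once for each of
    -- the two families. The two vectors are adjacent so that they can move as a pair.
    laterPairs : {X : Set} (up low : ℕ → ℤ → X) → ℕ → ℕ → List X
    laterPairs up low zero    j = []
    laterPairs up low (suc n) j =
      maybe (λ k → up n (ℤ.suc k) ∷ low n (ℤ.suc k) ∷ []) [] (gap (suc j)) ++ laterPairs up low n (suc j)

  module _ (gap : ℕ → Maybe ℤ) (Final : List ℤ → Set) (final? : Decidable Final) where

    private
      module S = System (λ j → insertMaybe (gap j)) (λ _ → Descending) (λ _ → descending?) Final final?

    module _ {X : Set} (A : X → X → ℤ) (skew : ∀ x y → A x y ≡ - A y x)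
      (lab : ℕ → ℤ → X) (rel : ∀ n x w → A (lab (suc n) x) w ≡ A (lab n x) w + A (lab n (ℤ.suc x)) w) where

      open Pfaffian A
      open Gessel-Viennot A skew

      private
        length-insert : ∀ n j ys {u} → length ys ≡ u →
          length (insertMaybe (gap (suc j)) ys) ℕ.+ length (later gap lab n (suc j)) ≡ u ℕ.+ length (later gap lab (suc n) j)
        length-insert n j ys refl with gap (suc j)
        ... | nothing = refl
        ... | just k with insertPair-split k ys
        ...   | as , bs , refl , e rewrite e | LP.length-++ as {bs} | LP.length-++ as {ℤ.suc k ∷ k ∷ bs}
                  | ℕP.+-suc (length as) (suc (length bs)) | ℕP.+-suc (length as) (length bs)
                  | ℕP.+-suc (length as ℕ.+ length bs) (suc (length (later gap lab n (suc j))))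
                  | ℕP.+-suc (length as ℕ.+ length bs) (length (later gap lab n (suc j))) = refl

        pf-later : ∀ m n j ys → pf m (map (lab n) ys ++ later gap lab (suc n) j) ≡
                   pf m (map (lab n) (insertMaybe (gap (suc j)) ys) ++ later gap lab n (suc j))
        pf-later m n j ys with gap (suc j)
        ... | nothing = refl
        ... | just k  = pf-insert (lab n) m k ys (later gap lab n (suc j))

      -- After expanding one step of all paths, a state with a collision has two equal neighbours
      -- and its term vanishes, while the other states continue by induction. The middle column
      -- enters only through the value of the form on point masses.
      count≡pf : ∀ m → (∀ xs → Descending xs → length xs ≡ m ℕ.+ m → pf m (map (lab 0) xs) ≡ indicator (final? xs)) →
        ∀ n j xs → Descending xs → length xs ℕ.+ length (later gap lab n j) ≡ m ℕ.+ m →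
        S.count n j xs ≡ pf m (map (lab n) xs ++ later gap lab n j)
      count≡pf m base zero    j xs d l rewrite LP.++-identityʳ (map (lab 0) xs) | ℕP.+-identityʳ (length xs)
        with final? xs | base xs d l
      ... | yes _ | e = sym e
      ... | no  _ | e = sym e
      count≡pf m base (suc n) j xs d l = begin
        S.count (suc n) j xs
          ≡⟨ S.count-suc n j xs ⟩
        sumOver (λ ys → if does (descending? (ins ys)) then S.count n (suc j) (ins ys) else 0ℤ) (allSteps xs)
          ≡⟨ sumOver-cong-∈ (allSteps xs) (λ {ys} m∈ → term ys (∈-allSteps⁻ xs m∈)) ⟩
        sumOver (λ ys → pf m (map (lab n) ys ++ later gap lab (suc n) j)) (allSteps xs)
          ≡⟨ sym (expand lab rel m n [] xs (later gap lab (suc n) j)) ⟩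
        pf m (map (lab (suc n)) xs ++ later gap lab (suc n) j) ∎
        where
        open ≡-Reasoning
        ins : List ℤ → List ℤ
        ins = insertMaybe (gap (suc j))
        term : ∀ ys → Pointwise Step xs ys → (if does (descending? (ins ys)) then S.count n (suc j) (ins ys) else 0ℤ)
               ≡ pf m (map (lab n) ys ++ later gap lab (suc n) j)
        term ys p with descending? (ins ys)
        ... | yes d′ = trans (count≡pf m base n (suc j) (ins ys) d′ (trans (length-insert n j ys (sym (Pw.Pointwise-length p))) l))
                             (sym (pf-later m n j ys))
        ... | no ¬d′ = sym (trans (pf-later m n j ys)
                         (pf-repeat (lab n) m (later gap lab n (suc j)) (insertMaybe-weakly (gap (suc j)) (steps-weakly d p)) ¬d′))

  Upper : ℕ → ℤ → Set
  Upper j c = ℤ.+ suc j ℤ.< c + c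

  upper? : ∀ j → Decidable (Upper j)
  upper? j c = ℤ.+ suc j ℤP.<? c + c

  UpperState : ℕ → List ℤ → Set
  UpperState j us = Descending us × All (Upper j) us

  upperState? : ∀ j → Decidable (UpperState j)
  upperState? j us = descending? us ×-dec All.all? (upper? j) us

  -- `suc k` is the lowest position above the axis in column `k + k`, so the new path becomes the
  -- last of a descending list.
  appendMaybe : Maybe ℤ → List ℤ → List ℤ
  appendMaybe nothing  us = us
  appendMaybe (just k) us = us ++ ℤ.suc k ∷ []

  -- A step changes twice the distance from the axis, measured in lattice spacings, by 1, so a path
  -- reaches the axis before it can pass below.
  step-upper : ∀ {j x y} → Upper j x → Step x y → ℤ.+ suc (suc j) ℤ.≤ y + y
  step-upper u stay = ℤP.i<j⇒suc[i]≤j u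
  step-upper {x = x} u rise = ℤP.≤-trans (ℤP.i<j⇒suc[i]≤j u) (ℤP.+-mono-≤ (ℤP.i≤suc[i] x) (ℤP.i≤suc[i] x))

  halve-< : ∀ {k c} → ℤ.suc (k + k) ℤ.≤ c + c → ℤ.suc k ℤ.≤ c
  halve-< {k} {c} h with ℤ.suc k ℤ.≤? c
  ... | yes p = p
  ... | no ¬p = ⊥-elim (ℤP.<-irrefl refl (ℤP.suc[i]≤j⇒i<j (ℤP.≤-trans h (ℤP.+-mono-≤ c≤k c≤k))))
    where
    c≤k : c ℤ.≤ k
    c≤k = subst (c ℤ.≤_) (ℤP.pred-suc k) (ℤP.i<j⇒i≤pred[j] (ℤP.≰⇒> ¬p))

  snoc-weakly : ∀ {us x} → Weakly us → All (x ℤ.≤_) us → Weakly (us ++ x ∷ [])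
  snoc-weakly []      []          = [-]
  snoc-weakly [-]     (h ∷ [])    = h ∷ [-]
  snoc-weakly (g ∷ w) (_ ∷ h ∷ a) = g ∷ snoc-weakly w (h ∷ a)

  module _ (gap : ℕ → Maybe ℤ) (gap-even : ∀ {j k} → gap j ≡ just k → ℤ.+ j ≡ k + k)
    (Final : List ℤ → Set) (final? : Decidable Final) where

    private
      module U = System (λ j → appendMaybe (gap j)) UpperState upperState? Final final?

    appendMaybe-upper : ∀ j {us ys} → UpperState j us → Pointwise Step us ys →
      Weakly (appendMaybe (gap (suc j)) ys) × All (λ c → ℤ.+ suc (suc j) ℤ.≤ c + c) (appendMaybe (gap (suc j)) ys)
    appendMaybe-upper j {us} {ys} (d , u) p = go (gap (suc j)) refl
      where
      steps : ∀ {us ys} → All (Upper j) us → Pointwise Step us ys → All (λ c → ℤ.+ suc (suc j) ℤ.≤ c + c) ys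
      steps []      []      = []
      steps (u ∷ a) (s ∷ p) = step-upper u s ∷ steps a p
      go : ∀ g → gap (suc j) ≡ g → Weakly (appendMaybe g ys) × All (λ c → ℤ.+ suc (suc j) ℤ.≤ c + c) (appendMaybe g ys)
      go nothing  e = steps-weakly d p , steps u p
      go (just k) e = snoc-weakly (steps-weakly d p) (All.map (λ {c} h → halve-< {k} (subst (λ v → ℤ.suc v ℤ.≤ c + c) (gap-even e) h)) (steps u p)) ,
                      AllP.++⁺ (steps u p) (subst (ℤ._≤ ℤ.suc k + ℤ.suc k) (cong ℤ.suc (sym (gap-even e)))
                         (subst (ℤ.suc (k + k) ℤ.≤_) (shuffle k) (ℤP.i≤suc[i] (ℤ.suc (k + k)))) ∷ [])
        where
        shuffle : ∀ k → 1ℤ + (1ℤ + (k + k)) ≡ (1ℤ + k) + (1ℤ + k)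
        shuffle = solve-∀

    module _ {X : Set} (A : X → X → ℤ) (skew : ∀ x y → A x y ≡ - A y x) (up low : ℕ → ℤ → X)
      (up-rel : ∀ n x w → A (up (suc n) x) w ≡ A (up n x) w + A (up n (ℤ.suc x)) w)
      (low-rel : ∀ n x w → A (low (suc n) x) w ≡ A (low n x) w + A (low n (ℤ.suc x)) w)
      (a : ℕ)
      (up-zero : ∀ n j c → j ℕ.+ n ≡ a → c + c ≡ ℤ.+ suc j → ∀ w → A (up n c) w ≡ 0ℤ)
      (low-zero : ∀ n j c → j ℕ.+ n ≡ a → c + c ≡ ℤ.+ suc j → ∀ w → A (low n c) w ≡ 0ℤ) where

      open Pfaffian A
      open Gessel-Viennot A skew

      private
        length-append : ∀ n j {us ys m} → Pointwise Step us ys → length us ℕ.+ gaps gap (suc n) j ≡ m →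
          length (appendMaybe (gap (suc j)) ys) ℕ.+ gaps gap n (suc j) ≡ m
        length-append n j {us} {ys} p refl with gap (suc j)
        ... | nothing = cong (ℕ._+ gaps gap n (suc j)) (sym (Pw.Pointwise-length p))
        ... | just k rewrite LP.length-++ ys {ℤ.suc k ∷ []} | ℕP.+-assoc (length ys) 1 (gaps gap n (suc j)) =
          cong (ℕ._+ suc (gaps gap n (suc j))) (sym (Pw.Pointwise-length p))

        pf-later : ∀ m n j ys zs → pf m (map (up n) ys ++ (map (low n) zs ʳ++ laterPairs gap up low (suc n) j)) ≡
          pf m (map (up n) (appendMaybe (gap (suc j)) ys) ++ (map (low n) (appendMaybe (gap (suc j)) zs) ʳ++ laterPairs gap up low n (suc j)))
        pf-later m n j ys zs with gap (suc j)
        ... | nothing = refl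
        ... | just k rewrite LP.map-++ (up n) ys (ℤ.suc k ∷ []) | LP.map-++ (low n) zs (ℤ.suc k ∷ [])
                | LP.++-ʳ++ (map (low n) zs) {low n (ℤ.suc k) ∷ []} {laterPairs gap up low n (suc j)}
                | LP.++-assoc (map (up n) ys) (up n (ℤ.suc k) ∷ []) (low n (ℤ.suc k) ∷ (map (low n) zs ʳ++ laterPairs gap up low n (suc j)))
                | LP.ʳ++-defn (map (low n) zs) {up n (ℤ.suc k) ∷ low n (ℤ.suc k) ∷ laterPairs gap up low n (suc j)}
                | LP.ʳ++-defn (map (low n) zs) {laterPairs gap up low n (suc j)}
          = move-pair (prefixed (pf-alternates skew m) (map (up n) ys)) (reverse (map (low n) zs)) (up n (ℤ.suc k)) (low n (ℤ.suc k)) (laterPairs gap up low n (suc j))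

        -- The two ways to fail are the two that the Pfaffian removes: a collision repeats an entry,
        -- and a position on the axis has a zero row.
        invalid : ∀ j {us} → Weakly us → All (λ c → ℤ.+ suc j ℤ.≤ c + c) us → ¬ UpperState j us →
                  ¬ Descending us ⊎ ∃ λ c → c ∈ us × c + c ≡ ℤ.+ suc j
        invalid j {us} w a ¬v with descending? us
        ... | no ¬d = inj₁ ¬d
        ... | yes d = inj₂ (go a λ u → ¬v (d , u))
          where
          go : ∀ {us} → All (λ c → ℤ.+ suc j ℤ.≤ c + c) us → ¬ All (Upper j) us → ∃ λ c → c ∈ us × c + c ≡ ℤ.+ suc j
          go []            ¬a = ⊥-elim (¬a [])
          go {c ∷ us} (h ∷ a) ¬a with upper? j c
          ... | no ¬u = c , here refl , ℤP.≤-antisym (ℤP.≮⇒≥ ¬u) h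
          ... | yes u with go a (λ b → ¬a (u ∷ b))
          ...   | c′ , m , e = c′ , there m , e

      -- The two families are independent, so they use different vectors for the same position and
      -- only collisions within one family cancel. Staying above the axis is enforced by `up-zero`
      -- and `low-zero`.
      count²≡pf : ∀ m → (∀ us vs → UpperState a us → UpperState a vs → length us ≡ m → length vs ≡ m →
          pf m (map (up 0) us ++ (map (low 0) vs ʳ++ [])) ≡ indicator (final? us) * indicator (final? vs)) →
        ∀ n j us vs → j ℕ.+ n ≡ a → UpperState j us → UpperState j vs →
        length us ℕ.+ gaps gap n j ≡ m → length vs ℕ.+ gaps gap n j ≡ m →
        U.count n j us * U.count n j vs ≡ pf m (map (up n) us ++ (map (low n) vs ʳ++ laterPairs gap up low n j))
      count²≡pf m base zero j us vs t du dv lu lv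
        rewrite trans (sym (ℕP.+-identityʳ j)) t | ℕP.+-identityʳ (length us) | ℕP.+-identityʳ (length vs)
        with final? us | final? vs | base us vs du dv lu lv
      ... | yes _ | yes _ | e = sym e
      ... | yes _ | no  _ | e = sym e
      ... | no  _ | yes _ | e = sym e
      ... | no  _ | no  _ | e = sym e
      count²≡pf m base (suc n) j us vs t du dv lu lv = begin
        U.count (suc n) j us * U.count (suc n) j vs
          ≡⟨ cong₂ _*_ (U.count-suc n j us) (U.count-suc n j vs) ⟩
        sumOver cnt (allSteps us) * sumOver cnt (allSteps vs)
          ≡⟨ sumOver-*ʳ cnt _ (allSteps us) ⟩
        sumOver (λ ys → cnt ys * sumOver cnt (allSteps vs)) (allSteps us)
          ≡⟨ sumOver-cong (λ ys → sumOver-*ˡ cnt (cnt ys) (allSteps vs)) (allSteps us) ⟩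
        sumOver (λ ys → sumOver (λ zs → cnt ys * cnt zs) (allSteps vs)) (allSteps us)
          ≡⟨ sumOver-cong-∈ (allSteps us) (λ {ys} m₁ → sumOver-cong-∈ (allSteps vs) λ {zs} m₂ →
               term ys zs (∈-allSteps⁻ us m₁) (∈-allSteps⁻ vs m₂)) ⟩
        sumOver (λ ys → sumOver (λ zs → pf m (map (up n) ys ++ (map (low n) zs ʳ++ laterPairs gap up low (suc n) j))) (allSteps vs)) (allSteps us)
          ≡⟨ sumOver-cong (λ ys → sym (expandʳ low low-rel m n (map (up n) ys) vs (laterPairs gap up low (suc n) j))) (allSteps us) ⟩
        sumOver (λ ys → pf m (map (up n) ys ++ (map (low (suc n)) vs ʳ++ laterPairs gap up low (suc n) j))) (allSteps us)
          ≡⟨ sym (expand up up-rel m n [] us (map (low (suc n)) vs ʳ++ laterPairs gap up low (suc n) j)) ⟩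
        pf m (map (up (suc n)) us ++ (map (low (suc n)) vs ʳ++ laterPairs gap up low (suc n) j)) ∎
        where
        open ≡-Reasoning
        t′ : suc j ℕ.+ n ≡ a
        t′ = trans (sym (ℕP.+-suc j n)) t
        ins : List ℤ → List ℤ
        ins = appendMaybe (gap (suc j))
        cnt : List ℤ → ℤ
        cnt ys = if does (upperState? (suc j) (ins ys)) then U.count n (suc j) (ins ys) else 0ℤ
        zero₁ : ∀ ys zs → Pointwise Step us ys → ¬ UpperState (suc j) (ins ys) →
          pf m (map (up n) (ins ys) ++ (map (low n) (ins zs) ʳ++ laterPairs gap up low n (suc j))) ≡ 0ℤ
        zero₁ ys zs p ¬v with appendMaybe-upper j du p
        ... | w , u with invalid (suc j) w u ¬v
        ...   | inj₁ ¬d = pf-repeat (up n) m _ w ¬d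
        ...   | inj₂ (c , c∈ , e) = pf-zeroˡ m _ (up n c) _ (up-zero n (suc j) c t′ e) (∈-map⁺ (up n) c∈)
        zero₂ : ∀ ys zs → Pointwise Step vs zs → ¬ UpperState (suc j) (ins zs) →
          pf m (map (up n) (ins ys) ++ (map (low n) (ins zs) ʳ++ laterPairs gap up low n (suc j))) ≡ 0ℤ
        zero₂ ys zs p ¬v with appendMaybe-upper j dv p
        ... | w , u with invalid (suc j) w u ¬v
        ...   | inj₁ ¬d = pf-repeatʳ (low n) m (map (up n) (ins ys)) _ w ¬d
        ...   | inj₂ (c , c∈ , e) = pf-zeroʳ m (map (up n) (ins ys)) _ (low n c) _ (low-zero n (suc j) c t′ e) (∈-map⁺ (low n) c∈)
        term : ∀ ys zs → Pointwise Step us ys → Pointwise Step vs zs →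
          cnt ys * cnt zs ≡ pf m (map (up n) ys ++ (map (low n) zs ʳ++ laterPairs gap up low (suc n) j))
        term ys zs p q = trans
          (guard-* (upperState? (suc j) (ins ys)) (upperState? (suc j) (ins zs))
            (λ v v′ → count²≡pf m base n (suc j) (ins ys) (ins zs) t′ v v′ (length-append n j p lu) (length-append n j q lv))
            (zero₁ ys zs p) (zero₂ ys zs q))
          (sym (pf-later m n j ys zs))

-- The two skew forms on the middle column and their isotropic vectors.

module MiddleForms where

  open import Data.Bool using (Bool; true; false; not; if_then_else_)
  open import Data.Empty using (⊥-elim)
  open import Data.Integer as ℤ using (ℤ; _+_; _*_; _-_; -_; 0ℤ; 1ℤ; -1ℤ)
  import Data.Integer.Properties as ℤP
  open import Data.Integer.Tactic.RingSolver using (solve-∀)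
  open import Data.List using (List; []; _∷_; _++_; map; length; reverse; _ʳ++_)
  import Data.List
  import Data.List.Properties as LP
  import Data.List.Membership.Propositional
  open import Data.List.Membership.Propositional.Properties
  open import Data.List.Relation.Unary.All as All using (All; []; _∷_)
  import Data.List.Relation.Unary.All.Properties as AllP
  open import Data.List.Relation.Unary.AllPairs using (AllPairs; []; _∷_)
  open import Data.List.Relation.Unary.Any using (here)
  import Data.List.Relation.Unary.Any.Properties as AnyP
  open import Data.List.Relation.Unary.Linked as Linked using (Linked; []; [-]; _∷_)
  import Data.List.Relation.Unary.Linked.Properties as LinkedP
  open import Data.Nat as ℕ using (ℕ; zero; suc)
  import Data.Nat.Properties as ℕP
  open import Data.Product using (_×_; _,_; ∃; proj₁; proj₂)
  import Data.Sum
  open import Data.Sum using (_⊎_; inj₁; inj₂)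
  open import Function using (_∘_)
  open import Relation.Binary.Definitions using (tri<; tri≈; tri>)
  open import Relation.Binary.PropositionalEquality
  open import Relation.Nullary using (¬_; Dec; yes; no; does)
  open import Relation.Nullary.Decidable using (_×-dec_; _⊎-dec_; dec-false)
  open import Relation.Unary using (Decidable)
  open Pfaffians
  open PathSystems

  sumBelow : ℕ → (ℕ → ℤ) → ℤ
  sumBelow zero    f = 0ℤ
  sumBelow (suc n) f = f 0 + sumBelow n (f ∘ suc)

  sumBelow-cong : ∀ n {f g} → (∀ i → i ℕ.< n → f i ≡ g i) → sumBelow n f ≡ sumBelow n g
  sumBelow-cong zero    e = refl
  sumBelow-cong (suc n) e = cong₂ _+_ (e 0 (ℕ.s≤s ℕ.z≤n)) (sumBelow-cong n (λ i h → e (suc i) (ℕ.s≤s h)))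

  sumBelow-cong′ : ∀ n {f g} → (∀ i → f i ≡ g i) → sumBelow n f ≡ sumBelow n g
  sumBelow-cong′ n e = sumBelow-cong n (λ i _ → e i)

  sumBelow-zero : ∀ n {f} → (∀ i → f i ≡ 0ℤ) → sumBelow n f ≡ 0ℤ
  sumBelow-zero zero    e = refl
  sumBelow-zero (suc n) e = cong₂ _+_ (e 0) (sumBelow-zero n (e ∘ suc))

  sumBelow-+ : ∀ n f g → sumBelow n (λ i → f i + g i) ≡ sumBelow n f + sumBelow n g
  sumBelow-+ zero    f g = refl
  sumBelow-+ (suc n) f g = trans (cong (f 0 + g 0 +_) (sumBelow-+ n (f ∘ suc) (g ∘ suc))) (shuffle (f 0) (g 0) _ _)
    where
    shuffle : ∀ a b c d → a + b + (c + d) ≡ a + c + (b + d)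
    shuffle = solve-∀

  sumBelow-* : ∀ n c f → sumBelow n (λ i → c * f i) ≡ c * sumBelow n f
  sumBelow-* zero    c f = sym (ℤP.*-zeroʳ c)
  sumBelow-* (suc n) c f = trans (cong (c * f 0 +_) (sumBelow-* n c (f ∘ suc))) (sym (ℤP.*-distribˡ-+ c (f 0) _))

  sumBelow-neg : ∀ n f → sumBelow n (λ i → - f i) ≡ - sumBelow n f
  sumBelow-neg zero    f = refl
  sumBelow-neg (suc n) f = trans (cong (- f 0 +_) (sumBelow-neg n (f ∘ suc))) (sym (ℤP.neg-distrib-+ (f 0) _))

  sumBelow-swap : ∀ n m (f : ℕ → ℕ → ℤ) → sumBelow n (λ i → sumBelow m (f i)) ≡ sumBelow m (λ k → sumBelow n (λ i → f i k))
  sumBelow-swap zero    m f = sym (sumBelow-zero m (λ _ → refl))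
  sumBelow-swap (suc n) m f = trans (cong (sumBelow m (f 0) +_) (sumBelow-swap n m (f ∘ suc)))
                                    (sym (sumBelow-+ m (f 0) (λ k → sumBelow n (λ i → f (suc i) k))))

  sumBelow-single : ∀ n (f g : ℕ → ℤ) k → k ℕ.< n → f k ≡ 1ℤ → (∀ i → i ≢ k → f i ≡ 0ℤ) → sumBelow n (λ i → f i * g i) ≡ g k
  sumBelow-single (suc n) f g zero h one z = trans
    (cong₂ _+_ (cong (_* g 0) one) (sumBelow-zero n (λ i → cong (_* g (suc i)) (z (suc i) λ ()))))
    (trans (ℤP.+-identityʳ _) (ℤP.*-identityˡ (g 0)))
  sumBelow-single (suc n) f g (suc k) (ℕ.s≤s h) one z = trans
    (cong₂ _+_ (cong (_* g 0) (z 0 λ ())) (sumBelow-single n (f ∘ suc) (g ∘ suc) k h one (λ i ne → z (suc i) (ne ∘ ℕP.suc-injective))))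
    (ℤP.+-identityˡ _)

  -- Binomial coefficients, extended by zero to all integers `d` so that the recursion has no
  -- boundary cases.
  paths : ℕ → ℤ → ℤ
  paths zero    d = if does (d ℤ.≟ 0ℤ) then 1ℤ else 0ℤ
  paths (suc n) d = paths n d + paths n (d - 1ℤ)

  paths₀-≡ : ∀ {d} → d ≡ 0ℤ → paths 0 d ≡ 1ℤ
  paths₀-≡ refl = refl

  paths₀-≢ : ∀ {d} → d ≢ 0ℤ → paths 0 d ≡ 0ℤ
  paths₀-≢ {d} h rewrite dec-false (d ℤ.≟ 0ℤ) h = refl

  paths-symmetric : ∀ n d → paths n (ℤ.+ n - d) ≡ paths n d
  paths-symmetric zero d with d ℤ.≟ 0ℤ
  ... | yes refl = refl
  ... | no d≢0 = paths₀-≢ λ e → d≢0 (trans (shuffle d) (cong -_ e))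
    where
    shuffle : ∀ d → d ≡ - (0ℤ - d)
    shuffle = solve-∀
  paths-symmetric (suc n) d = begin
    paths n (ℤ.+ suc n - d) + paths n (ℤ.+ suc n - d - 1ℤ)
      ≡⟨ cong₂ (λ u v → paths n u + paths n v) (shuffle₁ (ℤ.+ n) d) (shuffle₂ (ℤ.+ n) d) ⟩
    paths n (ℤ.+ n - (d - 1ℤ)) + paths n (ℤ.+ n - d)
      ≡⟨ cong₂ _+_ (paths-symmetric n (d - 1ℤ)) (paths-symmetric n d) ⟩
    paths n (d - 1ℤ) + paths n d
      ≡⟨ ℤP.+-comm (paths n (d - 1ℤ)) _ ⟩
    paths n d + paths n (d - 1ℤ) ∎
    where
    open ≡-Reasoning
    shuffle₁ : ∀ n d → 1ℤ + n - d ≡ n - (d - 1ℤ)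
    shuffle₁ = solve-∀
    shuffle₂ : ∀ n d → 1ℤ + n - d - 1ℤ ≡ n - d
    shuffle₂ = solve-∀

  paths-beyond : ∀ n d → ℤ.+ n ℤ.< d → paths n d ≡ 0ℤ
  paths-beyond zero    d h = paths₀-≢ λ e → ℤP.<-irrefl (sym e) h
  paths-beyond (suc n) d h = cong₂ _+_ (paths-beyond n d (ℤP.≤-<-trans (ℤP.i≤suc[i] (ℤ.+ n)) h))
    (paths-beyond n (d - 1ℤ) (subst₂ ℤ._<_ (shuffle (ℤ.+ n)) refl (ℤP.+-monoˡ-< -1ℤ h)))
    where
    shuffle : ∀ n → 1ℤ + n - 1ℤ ≡ n
    shuffle = solve-∀

  -- The sign of `i - k`, defined so that it is unchanged when both indices lose their successor, as
  -- happens when the first summand of a sum is split off.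
  order : ℕ → ℕ → ℤ
  order zero    zero    = 0ℤ
  order zero    (suc _) = -1ℤ
  order (suc _) zero    = 1ℤ
  order (suc i) (suc k) = order i k

  order-skew : ∀ i k → order i k ≡ - order k i
  order-skew zero    zero    = refl
  order-skew zero    (suc _) = refl
  order-skew (suc _) zero    = refl
  order-skew (suc i) (suc k) = order-skew i k

  order-> : ∀ {i k} → k ℕ.< i → order i k ≡ 1ℤ
  order-> {suc i} {zero}  _         = refl
  order-> {suc i} {suc k} (ℕ.s≤s h) = order-> h

  private
    tail-total : ∀ n (D C : ℕ → ℤ) → (∀ i → C i - C (suc i) ≡ D i + D (suc i)) → C (suc n) ≡ 0ℤ → D (suc n) ≡ 0ℤ →
      C 0 ≡ D 0 + ℤ.+ 2 * sumBelow n (D ∘ suc)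
    tail-total zero    D C r c d = begin
      C 0             ≡⟨ shuffle (C 0) (C 1) ⟩
      C 0 - C 1 + C 1 ≡⟨ cong₂ _+_ (trans (r 0) (cong (D 0 +_) d)) c ⟩
      D 0 + 0ℤ + 0ℤ   ≡⟨ ℤP.+-identityʳ (D 0 + 0ℤ) ⟩
      D 0 + 0ℤ        ∎
      where
      open ≡-Reasoning
      shuffle : ∀ a b → a ≡ a - b + b
      shuffle = solve-∀
    tail-total (suc n) D C r c d = begin
      C 0                        ≡⟨ shuffle₁ (C 0) (C 1) ⟩
      C 0 - C 1 + C 1            ≡⟨ cong₂ _+_ (r 0) (tail-total n (D ∘ suc) (C ∘ suc) (r ∘ suc) c d) ⟩
      D 0 + D 1 + (D 1 + ℤ.+ 2 * sumBelow n (D ∘ suc ∘ suc)) ≡⟨ shuffle₂ (D 0) (D 1) _ ⟩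
      D 0 + ℤ.+ 2 * (D 1 + sumBelow n (D ∘ suc ∘ suc)) ∎
      where
      open ≡-Reasoning
      shuffle₁ : ∀ a b → a ≡ a - b + b
      shuffle₁ = solve-∀
      shuffle₂ : ∀ a b s → a + b + (b + ℤ.+ 2 * s) ≡ a + ℤ.+ 2 * (b + s)
      shuffle₂ = solve-∀

  -- The factor `1 - order i k` is 0, 1 or 2 according to whether `k` is below, equal to or above
  -- `i`. The sum is thus `D i` plus twice the tail, and summing the differences of `C` from `i` to
  -- `n` gives the same.
  telescope : ∀ n (D C : ℕ → ℤ) → (∀ i → C i - C (suc i) ≡ D i + D (suc i)) → C n ≡ 0ℤ → D n ≡ 0ℤ →
    ∀ i → i ℕ.< n → sumBelow n (λ k → D k * (1ℤ - order i k)) ≡ C i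
  telescope (suc n) D C r c d zero _ = trans
    (cong₂ _+_ (ℤP.*-identityʳ (D 0)) (trans (sumBelow-cong′ n (λ k → ℤP.*-comm (D (suc k)) (ℤ.+ 2))) (sumBelow-* n (ℤ.+ 2) (D ∘ suc))))
    (sym (tail-total n D C r c d))
  telescope (suc n) D C r c d (suc i) (ℕ.s≤s h) = trans
    (cong (_+ sumBelow n (λ k → D (suc k) * (1ℤ - order i k))) (ℤP.*-zeroʳ (D 0)))
    (trans (ℤP.+-identityˡ _) (telescope n (D ∘ suc) (C ∘ suc) (r ∘ suc) c d i h))

  module Middle (a : ℕ) (P₀ : ℤ) (N : ℕ) (mid : ℤ.+ suc a ℤ.< P₀ + P₀) where

    pos neg : ℕ → ℤ
    pos i = P₀ + ℤ.+ i
    neg i = ℤ.+ suc a - pos i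

    mirror : ℤ → ℤ
    mirror c = ℤ.+ suc a - c

    mirror-involutive : ∀ c → mirror (mirror c) ≡ c
    mirror-involutive c = shuffle (ℤ.+ suc a) c
      where
      shuffle : ∀ s c → s - (s - c) ≡ c
      shuffle = solve-∀

    InRange : ℤ → Set
    InRange c = P₀ ℤ.≤ c × c ℤ.< P₀ + ℤ.+ N

    inRange? : Decidable InRange
    inRange? c = (P₀ ℤ.≤? c) ×-dec (c ℤP.<? P₀ + ℤ.+ N)

    index : ∀ {c} → InRange c → ∃ λ i → i ℕ.< N × c ≡ pos i
    index {c} (h , h′) with c - P₀ in e | ℤP.i≤j⇒0≤j-i h
    ... | ℤ.+ i | _ = i , ℤP.drop‿+<+ (subst₂ ℤ._<_ e (shuffle P₀ (ℤ.+ N)) (ℤP.+-monoˡ-< (- P₀) h′)) , trans (shuffle′ P₀ c) (cong (P₀ +_) e)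
      where
      shuffle : ∀ p n → p + n - p ≡ n
      shuffle = solve-∀
      shuffle′ : ∀ p c → c ≡ p + (c - p)
      shuffle′ = solve-∀

    pos-injective : ∀ {i k} → pos i ≡ pos k → i ≡ k
    pos-injective {i} {k} e = ℤP.+-injective (trans (shuffle P₀ (ℤ.+ i)) (trans (cong (_- P₀) e) (sym (shuffle P₀ (ℤ.+ k)))))
      where
      shuffle : ∀ p i → i ≡ p + i - p
      shuffle = solve-∀

    P₀≤pos : ∀ i → P₀ ℤ.≤ pos i
    P₀≤pos i = subst (ℤ._≤ pos i) (ℤP.+-identityʳ P₀) (ℤP.+-monoʳ-≤ P₀ {0ℤ} {ℤ.+ i} (ℤ.+≤+ ℕ.z≤n))

    separated : ∀ {c d} → P₀ ℤ.≤ c → P₀ ℤ.≤ d → mirror c ≢ d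
    separated {c} {d} h h′ e = ℤP.<-irrefl (sym (trans (cong (c +_) (sym e)) (shuffle (ℤ.+ suc a) c)))
      (ℤP.<-≤-trans mid (ℤP.+-mono-≤ h h′))
      where
      shuffle : ∀ s c → c + (s - c) ≡ s
      shuffle = solve-∀

    pairing : (ℤ → ℤ) → (ℤ → ℤ) → ℤ
    pairing v w = sumBelow N (λ i → v (pos i) * w (neg i) - v (neg i) * w (pos i))

    pairing-skew : ∀ v w → pairing v w ≡ - pairing w v
    pairing-skew v w = trans (sumBelow-cong′ N (λ i → shuffle (v (pos i)) (w (neg i)) (v (neg i)) (w (pos i)))) (sumBelow-neg N _)
      where
      shuffle : ∀ p q r s → p * q - r * s ≡ - (s * r - q * p)
      shuffle = solve-∀

    pairing-+ : ∀ {u v z} → (∀ p → z p ≡ u p + v p) → ∀ w → pairing z w ≡ pairing u w + pairing v w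
    pairing-+ {u} {v} {z} e w = trans (sumBelow-cong′ N (λ i → trans
        (cong₂ (λ p q → p * w (neg i) - q * w (pos i)) (e (pos i)) (e (neg i)))
        (shuffle (u (pos i)) (v (pos i)) (w (neg i)) (u (neg i)) (v (neg i)) (w (pos i)))))
      (sumBelow-+ N _ _)
      where
      shuffle : ∀ p q x r s y → (p + q) * x - (r + s) * y ≡ p * x - r * y + (q * x - s * y)
      shuffle = solve-∀

    -- The vector attached to a path at position `p` with `n` steps left: the number of ways to
    -- reach each end `P`. With no steps left it is a point mass.
    lab : ℕ → ℤ → ℤ → ℤ
    lab n p P = paths n (P - p)

    lab-suc : ∀ n p P → lab (suc n) p P ≡ lab n p P + lab n (ℤ.suc p) P
    lab-suc n p P = cong (λ u → paths n (P - p) + paths n u) (shuffle P p)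
      where
      shuffle : ∀ P p → P - p - 1ℤ ≡ P - (1ℤ + p)
      shuffle = solve-∀

    lab-rel : ∀ n p w → pairing (lab (suc n) p) w ≡ pairing (lab n p) w + pairing (lab n (ℤ.suc p)) w
    lab-rel n p w = pairing-+ {lab n p} {lab n (ℤ.suc p)} {lab (suc n) p} (lab-suc n p) w

    private
      minus-zero : ∀ {u v} → u - v ≡ 0ℤ → u ≡ v
      minus-zero {u} {v} = ℤP.i-j≡0⇒i≡j u v

      lab₀-≢ : ∀ {c p} → p ≢ c → lab 0 c p ≡ 0ℤ
      lab₀-≢ h = paths₀-≢ (h ∘ minus-zero)

      lab₀-≡ : ∀ c → lab 0 c c ≡ 1ℤ
      lab₀-≡ c = paths₀-≡ (ℤP.i≡j⇒i-j≡0 {c} refl)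

      product-zero : ∀ {u v} → u ≡ 0ℤ ⊎ v ≡ 0ℤ → u * v ≡ 0ℤ
      product-zero (inj₁ refl) = refl
      product-zero {u} (inj₂ refl) = ℤP.*-zeroʳ u

    pairing-unpaired : ∀ {c d} → d ≢ mirror c → pairing (lab 0 c) (lab 0 d) ≡ 0ℤ
    pairing-unpaired {c} {d} h = sumBelow-zero N λ i → cong₂ _-_ (product-zero (first i)) (product-zero (second i))
      where
      first : ∀ i → lab 0 c (pos i) ≡ 0ℤ ⊎ lab 0 d (neg i) ≡ 0ℤ
      first i with pos i ℤ.≟ c
      ... | no ne    = inj₁ (lab₀-≢ ne)
      ... | yes refl = inj₂ (lab₀-≢ (h ∘ sym))
      second : ∀ i → lab 0 c (neg i) ≡ 0ℤ ⊎ lab 0 d (pos i) ≡ 0ℤ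
      second i with neg i ℤ.≟ c
      ... | no ne    = inj₁ (lab₀-≢ ne)
      ... | yes refl = inj₂ (lab₀-≢ λ e → h (trans (sym e) (sym (mirror-involutive (pos i)))))

    pairing-outside : ∀ {c} w → ¬ InRange c → ¬ InRange (mirror c) → pairing (lab 0 c) w ≡ 0ℤ
    pairing-outside {c} w h h′ = trans (sumBelow-cong N λ i i<N → cong₂ _-_
        (product-zero {v = w (neg i)} (inj₁ (lab₀-≢ λ e → h (subst InRange e (inside i i<N)))))
        (product-zero {v = w (pos i)} (inj₁ (lab₀-≢ {c} {neg i} λ e → h′ (subst InRange (trans (sym (mirror-involutive (pos i))) (cong mirror e)) (inside i i<N))))))
      (sumBelow-zero N (λ _ → refl))
      where
      inside : ∀ i → i ℕ.< N → InRange (pos i)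
      inside i i<N = P₀≤pos i , ℤP.+-monoʳ-< P₀ (ℤ.+<+ i<N)

    pairing-paired : ∀ {c} → InRange c → pairing (lab 0 c) (lab 0 (mirror c)) ≡ 1ℤ
    pairing-paired {c} r with index r
    ... | k , k<N , refl = trans (sumBelow-cong′ N simplify)
        (trans (sumBelow-single N (λ i → lab 0 (pos k) (pos i)) (λ i → lab 0 (neg k) (neg i)) k k<N (lab₀-≡ (pos k))
                  (λ i ne → lab₀-≢ (ne ∘ pos-injective)))
               (lab₀-≡ (neg k)))
      where
      simplify : ∀ i → lab 0 (pos k) (pos i) * lab 0 (neg k) (neg i) - lab 0 (pos k) (neg i) * lab 0 (neg k) (pos i)
                 ≡ lab 0 (pos k) (pos i) * lab 0 (neg k) (neg i)
      simplify i = trans (cong (λ u → lab 0 (pos k) (pos i) * lab 0 (neg k) (neg i) - u)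
                           (product-zero {lab 0 (pos k) (neg i)} (inj₁ (lab₀-≢ (separated (P₀≤pos i) (P₀≤pos k))))))
                         (ℤP.+-identityʳ _)

    Symmetric : List ℤ → Set
    Symmetric xs = xs ≡ reverse (map mirror xs)

    Final : List ℤ → Set
    Final xs = Symmetric xs × All (λ c → InRange c ⊎ InRange (mirror c)) xs

    final? : Decidable Final
    final? xs = LP.≡-dec ℤ._≟_ xs (reverse (map mirror xs)) ×-dec All.all? (λ c → inRange? c ⊎-dec inRange? (mirror c)) xs

    reverse-mirror : ∀ x zs z → reverse (map mirror (x ∷ zs ++ z ∷ [])) ≡ mirror z ∷ reverse (map mirror zs) ++ mirror x ∷ []
    reverse-mirror x zs z = begin
      reverse (mirror x ∷ map mirror (zs ++ z ∷ []))         ≡⟨ LP.unfold-reverse (mirror x) (map mirror (zs ++ z ∷ [])) ⟩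
      reverse (map mirror (zs ++ z ∷ [])) ++ mirror x ∷ []    ≡⟨ cong (λ l → reverse l ++ mirror x ∷ []) (LP.map-++ mirror zs (z ∷ [])) ⟩
      reverse (map mirror zs ++ mirror z ∷ []) ++ mirror x ∷ [] ≡⟨ cong (_++ mirror x ∷ []) (LP.reverse-++ (map mirror zs) (mirror z ∷ [])) ⟩
      mirror z ∷ reverse (map mirror zs) ++ mirror x ∷ []     ∎
      where open ≡-Reasoning

    symmetric-peel : ∀ x zs z → Symmetric (x ∷ zs ++ z ∷ []) → z ≡ mirror x × Symmetric zs
    symmetric-peel x zs z e with LP.∷-injective (trans e (reverse-mirror x zs z))
    ... | _ , e′ with LP.∷ʳ-injective zs (reverse (map mirror zs)) e′
    ...   | s , e″ = e″ , s

    symmetric-wrap : ∀ x zs → Symmetric zs → Symmetric (x ∷ zs ++ mirror x ∷ [])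
    symmetric-wrap x zs e = trans (cong₂ (λ u l → u ∷ l ++ mirror x ∷ []) (sym (mirror-involutive x)) e)
                                  (sym (reverse-mirror x zs (mirror x)))

    private
      indicator-yes : ∀ {P : Set} (d : Dec P) → P → indicator d ≡ 1ℤ
      indicator-yes (yes _) p = refl
      indicator-yes (no ¬p) p = ⊥-elim (¬p p)

      indicator-no : ∀ {P : Set} (d : Dec P) → ¬ P → indicator d ≡ 0ℤ
      indicator-no (yes p) ¬p = ⊥-elim (¬p p)
      indicator-no (no _)  ¬p = refl

      mirror-< : ∀ {c d} → c ℤ.< d → mirror d ℤ.< mirror c
      mirror-< h = ℤP.+-monoʳ-< (ℤ.+ suc a) (ℤP.neg-mono-< h)

      head-> : ∀ {x xs} → Descending (x ∷ xs) → All (ℤ._< x) xs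
      head-> [-]     = []
      head-> (h ∷ d) = h ∷ All.map (λ g → ℤP.<-trans g h) (head-> d)

      last-< : ∀ xs {z} → Descending (xs ++ z ∷ []) → All (z ℤ.<_) xs
      last-< []       d = []
      last-< (x ∷ xs) d = All.lookup (head-> d) (∈-++⁺ʳ xs (here refl)) ∷ last-< xs (Linked.tail d)

      init-descending : ∀ xs {z} → Descending (xs ++ z ∷ []) → Descending xs
      init-descending []           d       = []
      init-descending (x ∷ [])     d       = [-]
      init-descending (x ∷ y ∷ xs) (h ∷ d) = h ∷ init-descending (y ∷ xs) d

    open Pfaffian pairing

    -- Compare the smallest position with the mirror image of the largest. If it is higher, the
    -- largest position has no partner in the list; if it is lower, the smallest one has none; in
    -- both cases a row vanishes. If they agree, both are peeled off, with no sign because an even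
    -- number of entries lies between them.
    pf-final : ∀ m xs → Descending xs → length xs ≡ m ℕ.+ m → pf m (map (lab 0) xs) ≡ indicator (final? xs)
    pf-final-ends : ∀ m x zs z → Descending (x ∷ zs ++ z ∷ []) → length zs ≡ m ℕ.+ m →
      pf (suc m) (map (lab 0) (x ∷ zs ++ z ∷ [])) ≡ indicator (final? (x ∷ zs ++ z ∷ []))

    pf-final zero    []       d l = refl
    pf-final (suc m) (x ∷ ys) d l with Data.List.initLast ys
    ... | [] = ⊥-elim (ℕP.1+n≢0 (sym (trans (ℕP.suc-injective l) (ℕP.+-suc m m))))
    ... | zs Data.List.∷ʳ′ z = pf-final-ends m x zs z d
      (ℕP.suc-injective (trans (sym (trans (LP.length-++ zs) (ℕP.+-comm (length zs) 1))) (trans (ℕP.suc-injective l) (ℕP.+-suc m m))))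

    pf-final-ends m x zs z d l with ℤP.<-cmp z (mirror x)
    ... | tri> _ ne gt = trans
      (contract-vanish (map (lab 0) (zs ++ z ∷ []))
        (AllP.map⁺ (All.map (λ {y} h → pairing-unpaired {x} {y} (λ e → ℤP.<-irrefl (sym e) (ℤP.<-≤-trans gt h)))
          (AllP.++⁺ (All.map ℤP.<⇒≤ (last-< zs (Linked.tail d))) (ℤP.≤-refl ∷ [])))))
      (sym (indicator-no (final? (x ∷ zs ++ z ∷ [])) λ f → ne (proj₁ (symmetric-peel x zs z (proj₁ f)))))
    ... | tri< lt ne _ = begin
      pf (suc m) (map (lab 0) (x ∷ zs ++ z ∷ []))
        ≡⟨ cong (pf (suc m)) (LP.map-++ (lab 0) (x ∷ zs) (z ∷ [])) ⟩
      pf (suc m) (map (lab 0) (x ∷ zs) ++ lab 0 z ∷ [])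
        ≡⟨ move-front (pf-alternates pairing-skew (suc m)) (map (lab 0) (x ∷ zs)) (lab 0 z) [] ⟩
      sgn * contract (pairing (lab 0 z)) (pf m) (map (lab 0) (x ∷ zs) ++ [])
        ≡⟨ cong (sgn *_) (contract-vanish {pairing (lab 0 z)} {pf m} (map (lab 0) (x ∷ zs) ++ []) (AllP.++⁺ (AllP.map⁺ (All.map
             (λ {y} h → pairing-unpaired {z} {y} (λ e → ℤP.<-irrefl refl (ℤP.≤-<-trans h
               (subst (x ℤ.<_) (sym e) (subst (ℤ._< mirror z) (mirror-involutive x) (mirror-< lt))))))
             (ℤP.≤-refl ∷ All.map ℤP.<⇒≤ (AllP.++⁻ˡ zs (head-> d))))) [])) ⟩
      sgn * 0ℤ ≡⟨ ℤP.*-zeroʳ sgn ⟩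
      0ℤ ≡⟨ sym (indicator-no (final? (x ∷ zs ++ z ∷ [])) λ f → ne (proj₁ (symmetric-peel x zs z (proj₁ f)))) ⟩
      indicator (final? (x ∷ zs ++ z ∷ [])) ∎
      where
      open ≡-Reasoning
      sgn : ℤ
      sgn = signs (length (map (lab 0) (x ∷ zs)))
    ... | tri≈ _ refl _ = begin
      contract (pairing (lab 0 x)) (pf m) (map (lab 0) (zs ++ mirror x ∷ []))
        ≡⟨ cong (contract (pairing (lab 0 x)) (pf m)) (LP.map-++ (lab 0) zs (mirror x ∷ [])) ⟩
      contract (pairing (lab 0 x)) (pf m) (map (lab 0) zs ++ lab 0 (mirror x) ∷ [])
        ≡⟨ contract-last (map (lab 0) zs) (lab 0 (mirror x)) (AllP.map⁺ (All.map
             (λ {y} h → pairing-unpaired {x} {y} (λ e → ℤP.<-irrefl (sym e) h)) (last-< zs (Linked.tail d)))) ⟩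
      signs (length (map (lab 0) zs)) * (pairing (lab 0 x) (lab 0 (mirror x)) * pf m (map (lab 0) zs))
        ≡⟨ cong₂ (λ s u → s * (pairing (lab 0 x) (lab 0 (mirror x)) * u))
             (trans (cong signs (trans (LP.length-map (lab 0) zs) l)) (signs-even m))
             (pf-final m zs (init-descending zs (Linked.tail d)) l) ⟩
      1ℤ * (pairing (lab 0 x) (lab 0 (mirror x)) * indicator (final? zs))
        ≡⟨ ℤP.*-identityˡ _ ⟩
      pairing (lab 0 x) (lab 0 (mirror x)) * indicator (final? zs)
        ≡⟨ ends (inRange? x) (final? zs) ⟩
      indicator (final? (x ∷ zs ++ mirror x ∷ [])) ∎
      where
      open ≡-Reasoning
      mirror-x<x : mirror x ℤ.< x
      mirror-x<x = All.lookup (head-> d) (∈-++⁺ʳ zs (here refl))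
      mirror-out : ¬ InRange (mirror x)
      mirror-out (h , _) = separated {mirror x} {x} h (ℤP.≤-trans h (ℤP.<⇒≤ mirror-x<x)) (mirror-involutive x)
      ends : (r : Dec (InRange x)) (f : Dec (Final zs)) →
        pairing (lab 0 x) (lab 0 (mirror x)) * indicator f ≡ indicator (final? (x ∷ zs ++ mirror x ∷ []))
      ends (no ¬r) f = trans (cong (_* indicator f) (pairing-outside (lab 0 (mirror x)) ¬r mirror-out))
        (sym (indicator-no (final? (x ∷ zs ++ mirror x ∷ [])) λ g → Data.Sum.[ ¬r , mirror-out ] (All.head (proj₂ g))))
      ends (yes r) (yes (s , f)) = trans (cong (_* 1ℤ) (pairing-paired r))
        (sym (indicator-yes (final? (x ∷ zs ++ mirror x ∷ []))
          (symmetric-wrap x zs s , inj₁ r ∷ AllP.++⁺ f (inj₂ (subst InRange (sym (mirror-involutive x)) r) ∷ []))))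
      ends (yes r) (no ¬f) = trans (ℤP.*-zeroʳ (pairing (lab 0 x) (lab 0 (mirror x))))
        (sym (indicator-no (final? (x ∷ zs ++ mirror x ∷ [])) λ g →
          ¬f (proj₂ (symmetric-peel x zs (mirror x) (proj₁ g)) , AllP.++⁻ˡ zs (All.tail (proj₂ g)))))

    Pair : Set
    Pair = (ℕ → ℤ) × (ℕ → ℤ)

    private
      entry : (α β α′ β′ s : ℤ) → ℤ
      entry α β α′ β′ s = α * α′ * s + α * β′ - β * α′ - β * β′ * s

    -- The sign matrix of the total order on two copies of the final positions in
    -- which the first copy is traversed downwards and the second one upwards.
    sign : Pair → Pair → ℤ
    sign (α , β) (α′ , β′) = sumBelow N λ i → sumBelow N λ k → entry (α i) (β i) (α′ k) (β′ k) (order i k)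

    sign-skew : ∀ v w → sign v w ≡ - sign w v
    sign-skew (α , β) (α′ , β′) = begin
      sumBelow N (λ i → sumBelow N λ k → entry (α i) (β i) (α′ k) (β′ k) (order i k))
        ≡⟨ sumBelow-cong′ N (λ i → sumBelow-cong′ N λ k → trans
             (cong (entry (α i) (β i) (α′ k) (β′ k)) (order-skew i k))
             (shuffle (α i) (β i) (α′ k) (β′ k) (order k i))) ⟩
      sumBelow N (λ i → sumBelow N λ k → - entry (α′ k) (β′ k) (α i) (β i) (order k i))
        ≡⟨ sumBelow-swap N N (λ i k → - entry (α′ k) (β′ k) (α i) (β i) (order k i)) ⟩
      sumBelow N (λ k → sumBelow N λ i → - entry (α′ k) (β′ k) (α i) (β i) (order k i))
        ≡⟨ sumBelow-cong′ N (λ k → sumBelow-neg N _) ⟩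
      sumBelow N (λ k → - sumBelow N λ i → entry (α′ k) (β′ k) (α i) (β i) (order k i))
        ≡⟨ sumBelow-neg N _ ⟩
      - sumBelow N (λ k → sumBelow N λ i → entry (α′ k) (β′ k) (α i) (β i) (order k i)) ∎
      where
      open ≡-Reasoning
      shuffle : ∀ α β α′ β′ s → α * α′ * - s + α * β′ - β * α′ - β * β′ * - s ≡ - (α′ * α * s + α′ * β - β′ * α - β′ * β * s)
      shuffle = solve-∀

    sign-+ : ∀ {u v z : Pair} → (∀ i → proj₁ z i ≡ proj₁ u i + proj₁ v i) → (∀ i → proj₂ z i ≡ proj₂ u i + proj₂ v i) →
      ∀ w → sign z w ≡ sign u w + sign v w
    sign-+ {α , β} {α₂ , β₂} {γ , δ} e e′ (α′ , β′) = begin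
      sumBelow N (λ i → sumBelow N λ k → entry (γ i) (δ i) (α′ k) (β′ k) (order i k))
        ≡⟨ sumBelow-cong′ N (λ i → sumBelow-cong′ N λ k → trans
             (cong₂ (λ p q → entry p q (α′ k) (β′ k) (order i k)) (e i) (e′ i))
             (shuffle (α i) (β i) (α₂ i) (β₂ i) (α′ k) (β′ k) (order i k))) ⟩
      sumBelow N (λ i → sumBelow N λ k → entry (α i) (β i) (α′ k) (β′ k) (order i k) + entry (α₂ i) (β₂ i) (α′ k) (β′ k) (order i k))
        ≡⟨ sumBelow-cong′ N (λ i → sumBelow-+ N _ _) ⟩
      sumBelow N (λ i → sumBelow N (λ k → entry (α i) (β i) (α′ k) (β′ k) (order i k)) + sumBelow N λ k → entry (α₂ i) (β₂ i) (α′ k) (β′ k) (order i k))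
        ≡⟨ sumBelow-+ N _ _ ⟩
      _ ∎
      where
      open ≡-Reasoning
      shuffle : ∀ α β α₂ β₂ α′ β′ s → (α + α₂) * α′ * s + (α + α₂) * β′ - (β + β₂) * α′ - (β + β₂) * β′ * s
        ≡ α * α′ * s + α * β′ - β * α′ - β * β′ * s + (α₂ * α′ * s + α₂ * β′ - β₂ * α′ - β₂ * β′ * s)
      shuffle = solve-∀

    sign-zero : ∀ {z : Pair} → (∀ i → i ℕ.< N → proj₁ z i ≡ 0ℤ) → (∀ i → i ℕ.< N → proj₂ z i ≡ 0ℤ) → ∀ w → sign z w ≡ 0ℤ
    sign-zero {γ , δ} e e′ (α′ , β′) = trans
      (sumBelow-cong N λ i h → sumBelow-cong′ N λ k → trans (cong₂ (λ p q → entry p q (α′ k) (β′ k) (order i k)) (e i h) (e′ i h)) refl)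
      (sumBelow-zero N λ i → sumBelow-zero N λ k → refl)

    -- With `n` steps left a path is in column `a - n`, where the reflection sends `p` to
    -- `1 + (a - n) - p`.
    mirrorAt : ℕ → ℤ → ℤ
    mirrorAt n p = ℤ.+ suc a - ℤ.+ n - p

    -- Reflection principle: paths to the i-th final position that avoid the axis.
    reflected : ℕ → ℤ → ℕ → ℤ
    reflected n p i = lab n p (pos i) - lab n (mirrorAt n p) (pos i)

    up low : ℕ → ℤ → Pair
    up  n p = reflected n p , λ _ → 0ℤ
    low n p = (λ _ → 0ℤ) , reflected n p

    -- Paths can be reflected across the axis; arithmetically this is the symmetry of the binomial
    -- coefficients.
    lab-mirror : ∀ n p P → lab n p (mirror P) ≡ lab n (mirrorAt n p) P
    lab-mirror n p P = trans (sym (paths-symmetric n (mirror P - p))) (cong (paths n) (shuffle (ℤ.+ suc a) P (ℤ.+ n) p))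
      where
      shuffle : ∀ s P n p → n - (s - P - p) ≡ P - (s - n - p)
      shuffle = solve-∀

    reflected-suc : ∀ n p i → reflected (suc n) p i ≡ reflected n p i + reflected n (ℤ.suc p) i
    reflected-suc n p i = begin
      lab (suc n) p (pos i) - lab (suc n) (mirrorAt (suc n) p) (pos i)
        ≡⟨ cong₂ _-_ (lab-suc n p (pos i)) (lab-suc n (mirrorAt (suc n) p) (pos i)) ⟩
      lab n p (pos i) + lab n (ℤ.suc p) (pos i) - (lab n (mirrorAt (suc n) p) (pos i) + lab n (ℤ.suc (mirrorAt (suc n) p)) (pos i))
        ≡⟨ cong₂ (λ u v → lab n p (pos i) + lab n (ℤ.suc p) (pos i) - (lab n u (pos i) + lab n v (pos i)))
             (shuffle₁ (ℤ.+ suc a) (ℤ.+ n) p) (shuffle₂ (ℤ.+ suc a) (ℤ.+ n) p) ⟩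
      lab n p (pos i) + lab n (ℤ.suc p) (pos i) - (lab n (mirrorAt n (ℤ.suc p)) (pos i) + lab n (mirrorAt n p) (pos i))
        ≡⟨ shuffle₃ (lab n p (pos i)) (lab n (ℤ.suc p) (pos i)) _ _ ⟩
      reflected n p i + reflected n (ℤ.suc p) i ∎
      where
      open ≡-Reasoning
      shuffle₁ : ∀ s n p → s - (1ℤ + n) - p ≡ s - n - (1ℤ + p)
      shuffle₁ = solve-∀
      shuffle₂ : ∀ s n p → 1ℤ + (s - (1ℤ + n) - p) ≡ s - n - p
      shuffle₂ = solve-∀
      shuffle₃ : ∀ p q r s → p + q - (r + s) ≡ p - s + (q - r)
      shuffle₃ = solve-∀

    up-rel : ∀ n p w → sign (up (suc n) p) w ≡ sign (up n p) w + sign (up n (ℤ.suc p)) w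
    up-rel n p = sign-+ {up n p} {up n (ℤ.suc p)} {up (suc n) p} (reflected-suc n p) (λ _ → refl)

    low-rel : ∀ n p w → sign (low (suc n) p) w ≡ sign (low n p) w + sign (low n (ℤ.suc p)) w
    low-rel n p = sign-+ {low n p} {low n (ℤ.suc p)} {low (suc n) p} (λ _ → refl) (reflected-suc n p)

    -- A starting point on the axis is its own mirror image, so the two terms of the reflection
    -- principle cancel.
    reflected-axis : ∀ n j c → j ℕ.+ n ≡ a → c + c ≡ ℤ.+ suc j → ∀ i → reflected n c i ≡ 0ℤ
    reflected-axis n j c t e i = trans (cong (λ u → lab n c (pos i) - lab n u (pos i)) mirror≡c) (ℤP.i≡j⇒i-j≡0 {lab n c (pos i)} refl)
      where
      shuffle : ∀ j n c → 1ℤ + (j + n) - n - c ≡ 1ℤ + j - c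
      shuffle = solve-∀
      shuffle′ : ∀ c → c + c - c ≡ c
      shuffle′ = solve-∀
      mirror≡c : mirrorAt n c ≡ c
      mirror≡c = trans (cong (λ u → ℤ.+ suc u - ℤ.+ n - c) (sym t)) (trans (shuffle (ℤ.+ j) (ℤ.+ n) c) (trans (cong (_- c) (sym e)) (shuffle′ c)))

    up-zero : ∀ n j c → j ℕ.+ n ≡ a → c + c ≡ ℤ.+ suc j → ∀ w → sign (up n c) w ≡ 0ℤ
    up-zero n j c t e = sign-zero {up n c} (λ i _ → reflected-axis n j c t e i) (λ _ _ → refl)

    low-zero : ∀ n j c → j ℕ.+ n ≡ a → c + c ≡ ℤ.+ suc j → ∀ w → sign (low n c) w ≡ 0ℤ
    low-zero n j c t e = sign-zero {low n c} (λ _ _ → refl) (λ i _ → reflected-axis n j c t e i)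

    private
      lower-out : ∀ {c} → Upper a c → ∀ i → lab 0 (mirrorAt 0 c) (pos i) ≡ 0ℤ
      lower-out {c} u i = lab₀-≢ {mirrorAt 0 c} {pos i} λ e → ℤP.<-irrefl refl (begin-strict
        ℤ.+ suc a                  <⟨ mid ⟩
        P₀ + P₀                    ≤⟨ ℤP.+-mono-≤ (P₀≤pos i) (P₀≤pos i) ⟩
        pos i + pos i              ≡⟨ cong₂ _+_ e e ⟩
        mirrorAt 0 c + mirrorAt 0 c ≡⟨ shuffle (ℤ.+ suc a) c ⟩
        ℤ.+ suc a + (ℤ.+ suc a - (c + c)) <⟨ ℤP.+-monoʳ-< (ℤ.+ suc a) (ℤP.+-monoʳ-< (ℤ.+ suc a) (ℤP.neg-mono-< u)) ⟩
        ℤ.+ suc a + (ℤ.+ suc a - ℤ.+ suc a) ≡⟨ shuffle′ (ℤ.+ suc a) ⟩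
        ℤ.+ suc a                  ∎)
        where
        open ℤP.≤-Reasoning
        shuffle : ∀ s c → s - 0ℤ - c + (s - 0ℤ - c) ≡ s + (s - (c + c))
        shuffle = solve-∀
        shuffle′ : ∀ s → s + (s - s) ≡ s
        shuffle′ = solve-∀

    reflected₀ : ∀ {c} → Upper a c → ∀ i → reflected 0 c i ≡ lab 0 c (pos i)
    reflected₀ {c} u i = trans (cong (λ v → lab 0 c (pos i) - v) (lower-out {c} u i)) (ℤP.+-identityʳ _)

    reflected₀-out : ∀ {c} → Upper a c → ¬ InRange c → ∀ i → i ℕ.< N → reflected 0 c i ≡ 0ℤ
    reflected₀-out {c} u h i i<N = trans (reflected₀ u i)
      (lab₀-≢ λ e → h (subst InRange e (P₀≤pos i , ℤP.+-monoʳ-< P₀ (ℤ.+<+ i<N))))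

    private
      Single : (ℕ → ℤ) → ℕ → Set
      Single f k = f k ≡ 1ℤ × (∀ i → i ≢ k → f i ≡ 0ℤ)

      reflected₀-single : ∀ {c k} → Upper a c → c ≡ pos k → Single (reflected 0 c) k
      reflected₀-single {k = k} u refl = trans (reflected₀ u k) (lab₀-≡ (pos k)) ,
        λ i ne → trans (reflected₀ u i) (lab₀-≢ (ne ∘ pos-injective))

      double-single : ∀ {f g i k} (h : ℕ → ℕ → ℤ) → i ℕ.< N → k ℕ.< N → Single f i → Single g k →
        sumBelow N (λ p → sumBelow N λ q → f p * (g q * h p q)) ≡ h i k
      double-single {f} {g} {i} {k} h i<N k<N (f₁ , f₀) (g₁ , g₀) = begin
        sumBelow N (λ p → sumBelow N λ q → f p * (g q * h p q)) ≡⟨ sumBelow-cong′ N (λ p → sumBelow-* N (f p) _) ⟩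
        sumBelow N (λ p → f p * sumBelow N λ q → g q * h p q)   ≡⟨ sumBelow-single N f _ i i<N f₁ f₀ ⟩
        sumBelow N (λ q → g q * h i q)                          ≡⟨ sumBelow-single N g (h i) k k<N g₁ g₀ ⟩
        h i k ∎
        where open ≡-Reasoning

      descending-index : ∀ {i k} → pos k ℤ.< pos i → k ℕ.< i
      descending-index {i} {k} h = ℤP.drop‿+<+ (subst₂ ℤ._<_ (shuffle P₀ (ℤ.+ k)) (shuffle P₀ (ℤ.+ i)) (ℤP.+-monoˡ-< (- P₀) h))
        where
        shuffle : ∀ p i → p + i - p ≡ i
        shuffle = solve-∀

    sign-up-up : ∀ {c d} → Upper a c → Upper a d → InRange c → InRange d → c ℤ.> d → sign (up 0 c) (up 0 d) ≡ 1ℤ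
    sign-up-up {c} {d} uc ud rc rd h with index rc | index rd
    ... | i , i<N , ec | k , k<N , ed = trans
      (sumBelow-cong′ N λ p → sumBelow-cong′ N λ q → shuffle (reflected 0 c p) (reflected 0 d q) (order p q))
      (trans (double-single order i<N k<N (reflected₀-single uc ec) (reflected₀-single ud ed))
             (order-> (descending-index (subst₂ ℤ._<_ ed ec h))))
      where
      shuffle : ∀ x y s → x * y * s + x * 0ℤ - 0ℤ * y - 0ℤ * 0ℤ * s ≡ x * (y * s)
      shuffle = solve-∀

    sign-up-low : ∀ {c d} → Upper a c → Upper a d → InRange c → InRange d → sign (up 0 c) (low 0 d) ≡ 1ℤ
    sign-up-low {c} {d} uc ud rc rd with index rc | index rd
    ... | i , i<N , ec | k , k<N , ed = trans
      (sumBelow-cong′ N λ p → sumBelow-cong′ N λ q → shuffle (reflected 0 c p) (reflected 0 d q) (order p q))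
      (double-single (λ _ _ → 1ℤ) i<N k<N (reflected₀-single uc ec) (reflected₀-single ud ed))
      where
      shuffle : ∀ x y s → x * 0ℤ * s + x * y - 0ℤ * 0ℤ - 0ℤ * y * s ≡ x * (y * 1ℤ)
      shuffle = solve-∀

    sign-low-low : ∀ {c d} → Upper a c → Upper a d → InRange c → InRange d → c ℤ.< d → sign (low 0 c) (low 0 d) ≡ 1ℤ
    sign-low-low {c} {d} uc ud rc rd h with index rc | index rd
    ... | i , i<N , ec | k , k<N , ed = trans
      (sumBelow-cong′ N λ p → sumBelow-cong′ N λ q → shuffle (reflected 0 c p) (reflected 0 d q) (order p q))
      (trans (double-single (λ p q → - order p q) i<N k<N (reflected₀-single uc ec) (reflected₀-single ud ed))
             (trans (sym (order-skew k i)) (order-> (descending-index (subst₂ ℤ._<_ ec ed h)))))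
      where
      shuffle : ∀ x y s → 0ℤ * 0ℤ * s + 0ℤ * y - x * 0ℤ - x * y * s ≡ x * (y * - s)
      shuffle = solve-∀

    private
      descending-pairs : ∀ {xs} → Descending xs → AllPairs ℤ._>_ xs
      descending-pairs = LinkedP.Linked⇒AllPairs (λ h g → ℤP.<-trans g h)

      all-reverse : ∀ {X : Set} {P : X → Set} {xs} → All P xs → All P (reverse xs)
      all-reverse ps = All.tabulate λ m → All.lookup ps (AnyP.reverse⁻ m)

      reverse-pairs : ∀ {X : Set} {R : X → X → Set} xs → AllPairs R xs → AllPairs (λ x y → R y x) (reverse xs)
      reverse-pairs []       []       = []
      reverse-pairs {R = R} (x ∷ xs) (h ∷ hs) rewrite LP.unfold-reverse x xs =
        snoc (reverse xs) (reverse-pairs xs hs) (all-reverse h)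
        where
        snoc : ∀ ys → AllPairs (λ x y → R y x) ys → All (R x) ys → AllPairs (λ x y → R y x) (ys ++ x ∷ [])
        snoc []       []       []       = [] ∷ []
        snoc (y ∷ ys) (p ∷ ps) (r ∷ rs) = AllP.++⁺ p (r ∷ []) ∷ snoc ys ps rs

      ++-pairs : ∀ {X : Set} {R : X → X → Set} {xs ys} → AllPairs R xs → AllPairs R ys → All (λ x → All (R x) ys) xs → AllPairs R (xs ++ ys)
      ++-pairs []       qs []       = qs
      ++-pairs (p ∷ ps) qs (r ∷ rs) = AllP.++⁺ p r ∷ ++-pairs ps qs rs

      map-pairs : ∀ {X : Set} {R : X → X → Set} (f : ℤ → X) {P : ℤ → Set} {S : ℤ → ℤ → Set} →
        (∀ {x y} → P x → P y → S x y → R (f x) (f y)) → ∀ {xs} → All P xs → AllPairs S xs → AllPairs R (map f xs)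
      map-pairs f g []       []       = []
      map-pairs {R = R} f {P} {S} g (p ∷ ps) (s ∷ ss) = AllP.map⁺ (row p ps s) ∷ map-pairs f g ps ss
        where
        row : ∀ {x ys} → P x → All P ys → All (S x) ys → All (λ y → R (f x) (f y)) ys
        row p []       []       = []
        row p (q ∷ qs) (s ∷ ss) = g p q s ∷ row p qs ss

    FinalUpper : List ℤ → Set
    FinalUpper = All InRange

    finalUpper? : Decidable FinalUpper
    finalUpper? = All.all? inRange?

    open Pfaffian sign using () renaming (pf to pfₛ; pf-ones to pfₛ-ones; pf-zero to pfₛ-zero)

    -- The list follows the total order of the sign matrix, so all entries above the diagonal are 1.
    -- An end outside the range has the zero vector.
    pf-up-low : ∀ m us vs → UpperState a us → UpperState a vs → length us ≡ m → length vs ≡ m →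
      pfₛ m (map (up 0) us ++ (map (low 0) vs ʳ++ [])) ≡ indicator (finalUpper? us) * indicator (finalUpper? vs)
    pf-up-low m us vs (du , uu) (dv , uv) lu lv with finalUpper? us | finalUpper? vs
    ... | yes fu | yes fv = pfₛ-ones m _ pairs len
      where
      both-u : All (λ c → Upper a c × InRange c) us
      both-u = All.zip (uu , fu)
      both-v : All (λ c → Upper a c × InRange c) vs
      both-v = All.zip (uv , fv)
      pairs : AllPairs (λ x y → sign x y ≡ 1ℤ) (map (up 0) us ++ reverse (map (low 0) vs))
      pairs = ++-pairs
        (map-pairs (up 0) (λ { (u , r) (u′ , r′) h → sign-up-up u u′ r r′ h }) both-u (descending-pairs du))
        (reverse-pairs (map (low 0) vs) (map-pairs (low 0) (λ { (u , r) (u′ , r′) h → sign-low-low u′ u r′ r h }) both-v (descending-pairs dv)))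
        (AllP.map⁺ (All.map (λ { (u , r) → all-reverse (AllP.map⁺ (All.map (λ { (u′ , r′) → sign-up-low u u′ r r′ }) both-v)) }) both-u))
      len : length (map (up 0) us ++ reverse (map (low 0) vs)) ≡ m ℕ.+ m
      len = trans (LP.length-++ (map (up 0) us)) (cong₂ ℕ._+_ (trans (LP.length-map (up 0) us) lu)
              (trans (LP.length-reverse (map (low 0) vs)) (trans (LP.length-map (low 0) vs) lv)))
    ... | no ¬f | f with AllP.¬All⇒Any¬ inRange? us ¬f
    ...   | any with Data.List.Membership.Propositional.find any
    ...     | c , c∈ , ¬r = Gessel-Viennot.pf-zeroˡ sign sign-skew m (map (up 0) us) (up 0 c) _
                (sign-zero {up 0 c} (reflected₀-out (All.lookup uu c∈) ¬r) (λ _ _ → refl)) (∈-map⁺ (up 0) c∈)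
    pf-up-low m us vs (du , uu) (dv , uv) lu lv | yes _ | no ¬f with AllP.¬All⇒Any¬ inRange? vs ¬f
    ...   | any with Data.List.Membership.Propositional.find any
    ...     | c , c∈ , ¬r = Gessel-Viennot.pf-zeroʳ sign sign-skew m (map (up 0) us) (map (low 0) vs) (low 0 c) []
                (sign-zero {low 0 c} (λ _ _ → refl) (reflected₀-out (All.lookup uv c∈) ¬r)) (∈-map⁺ (low 0) c∈)

    -- The weight in `nest` is 1 on the pair `i` and 2 on all pairs nearer to the axis: one more
    -- step adds the previous outermost pair a second time and the new one once.
    pairAt nest : ℕ → ℤ → ℕ → ℤ → ℤ
    pairAt n p₀ i P = lab n (p₀ + ℤ.+ i) P + lab n (p₀ - 1ℤ - ℤ.+ i) P
    nest n p₀ zero    P = pairAt n p₀ 0 P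
    nest n p₀ (suc i) P = nest n p₀ i P + (pairAt n p₀ i P + pairAt n p₀ (suc i) P)

    private
      spread : ℕ → ℤ → ℕ → ℤ → ℤ
      spread n p₀ i P = lab n (p₀ + ℤ.+ i) P - lab n (p₀ - 1ℤ - ℤ.+ i) P

      -- Moving the end up by one amounts to moving the start down by one. Hence the upper path of
      -- the pair `suc i` at `P + 1` counts the same as that of the pair `i` at `P`, and likewise
      -- for the lower paths with `P` and `P + 1` exchanged; the rest cancels.
      nest-difference : ∀ n p₀ i P → nest n p₀ i P - nest n p₀ i (P + 1ℤ) ≡ spread n p₀ i P + spread n p₀ i (P + 1ℤ)
      nest-difference n p₀ zero P = trans
        (cong (λ r → lab n (p₀ + ℤ.+ 0) P + r - nest n p₀ 0 (P + 1ℤ)) r≡)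
        (trans (shuffle (lab n (p₀ + ℤ.+ 0) P) _ _)
               (cong (λ r → lab n (p₀ + ℤ.+ 0) P - r + spread n p₀ 0 (P + 1ℤ)) (sym r≡)))
        where
        shuffle : ∀ q r s → q + r - (r + s) ≡ q - r + (r - s)
        shuffle = solve-∀
        arg : ∀ P p → P - (p - 1ℤ - 0ℤ) ≡ P + 1ℤ - (p + 0ℤ)
        arg = solve-∀
        r≡ : lab n (p₀ - 1ℤ - ℤ.+ 0) P ≡ lab n (p₀ + ℤ.+ 0) (P + 1ℤ)
        r≡ = cong (paths n) (arg P p₀)
      nest-difference n p₀ (suc i) P = trans (shuffle₁ (nest n p₀ i P) (nest n p₀ i (P + 1ℤ)) _ _)
        (trans (cong (_+ (pairAt n p₀ i P + pairAt n p₀ (suc i) P - (pairAt n p₀ i (P + 1ℤ) + pairAt n p₀ (suc i) (P + 1ℤ))))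
                     (nest-difference n p₀ i P))
               (final (lab n (p₀ + ℤ.+ i) P) (lab n (p₀ + ℤ.+ i) (P + 1ℤ)) (lab n (p₀ - 1ℤ - ℤ.+ i) P) (lab n (p₀ - 1ℤ - ℤ.+ i) (P + 1ℤ))
                      (lab n (p₀ + ℤ.+ suc i) P) (lab n (p₀ - 1ℤ - ℤ.+ suc i) (P + 1ℤ)) a≡ b≡))
        where
        shuffle₁ : ∀ c c′ q q′ → c + q - (c′ + q′) ≡ c - c′ + (q - q′)
        shuffle₁ = solve-∀
        shuffle₂ : ∀ A A′ B B′ x y → A - B + (A′ - B′) + (A + B + (x + B′) - (A′ + B′ + (A + y))) ≡ x - B′ + (A - y)
        shuffle₂ = solve-∀
        final : ∀ A A′ B B′ x y {x′ y′} → x′ ≡ A → y′ ≡ B′ →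
          A - B + (A′ - B′) + (A + B + (x + y′) - (A′ + B′ + (x′ + y))) ≡ x - y′ + (x′ - y)
        final A A′ B B′ x y refl refl = shuffle₂ A A′ B B′ x y
        arg₁ : ∀ P p i → P + 1ℤ - (p + (1ℤ + i)) ≡ P - (p + i)
        arg₁ = solve-∀
        a≡ : lab n (p₀ + ℤ.+ suc i) (P + 1ℤ) ≡ lab n (p₀ + ℤ.+ i) P
        a≡ = cong (paths n) (arg₁ P p₀ (ℤ.+ i))
        arg₂ : ∀ P p i → P - (p - 1ℤ - (1ℤ + i)) ≡ P + 1ℤ - (p - 1ℤ - i)
        arg₂ = solve-∀
        b≡ : lab n (p₀ - 1ℤ - ℤ.+ suc i) P ≡ lab n (p₀ - 1ℤ - ℤ.+ i) (P + 1ℤ)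
        b≡ = cong (paths n) (arg₂ P p₀ (ℤ.+ i))

      outer-beyond : ∀ n p₀ i P → p₀ + ℤ.+ i + ℤ.+ n ℤ.< P → lab n (p₀ + ℤ.+ i) P ≡ 0ℤ
      outer-beyond n p₀ i P h = paths-beyond n _ (subst (ℤ._< P - (p₀ + ℤ.+ i)) (shuffle p₀ (ℤ.+ i) (ℤ.+ n)) (ℤP.+-monoˡ-< (- (p₀ + ℤ.+ i)) h))
        where
        shuffle : ∀ p i n → p + i + n - (p + i) ≡ n
        shuffle = solve-∀

      inner-beyond : ∀ n p₀ i P → p₀ + ℤ.+ i + ℤ.+ n ℤ.< P → lab n (p₀ - 1ℤ - ℤ.+ i) P ≡ 0ℤ
      inner-beyond n p₀ i P h = paths-beyond n _ (ℤP.≤-<-trans (ℤP.i≤i+j (ℤ.+ n) (ℤ.+ (suc i ℕ.+ i)))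
        (subst (ℤ._< P - (p₀ - 1ℤ - ℤ.+ i)) (shuffle p₀ (ℤ.+ i) (ℤ.+ n)) (ℤP.+-monoˡ-< (- (p₀ - 1ℤ - ℤ.+ i)) h)))
        where
        shuffle : ∀ p i n → p + i + n - (p - 1ℤ - i) ≡ n + (1ℤ + i + i)
        shuffle = solve-∀

      nest-beyond : ∀ n p₀ i P → p₀ + ℤ.+ i + ℤ.+ n ℤ.< P → nest n p₀ i P ≡ 0ℤ
      nest-beyond n p₀ zero    P h = cong₂ _+_ (outer-beyond n p₀ 0 P h) (inner-beyond n p₀ 0 P h)
      nest-beyond n p₀ (suc i) P h = cong₂ _+_ (nest-beyond n p₀ i P h′)
        (cong₂ _+_ (cong₂ _+_ (outer-beyond n p₀ i P h′) (inner-beyond n p₀ i P h′))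
                   (cong₂ _+_ (outer-beyond n p₀ (suc i) P h) (inner-beyond n p₀ (suc i) P h)))
        where
        h′ : p₀ + ℤ.+ i + ℤ.+ n ℤ.< P
        h′ = ℤP.≤-<-trans (ℤP.+-monoˡ-≤ (ℤ.+ n) (ℤP.+-monoʳ-≤ p₀ (ℤ.+≤+ (ℕP.n≤1+n i)))) h

      module _ (n : ℕ) (p₀ : ℤ) (axis : p₀ + p₀ ≡ ℤ.+ suc a - ℤ.+ n + 1ℤ) where

        mirror-outer : ∀ i → mirrorAt n (p₀ + ℤ.+ i) ≡ p₀ - 1ℤ - ℤ.+ i
        mirror-outer i = trans (shuffle₁ (ℤ.+ suc a - ℤ.+ n) p₀ (ℤ.+ i)) (trans (cong (λ u → u - 1ℤ - p₀ - ℤ.+ i) (sym axis)) (shuffle₂ p₀ (ℤ.+ i)))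
          where
          shuffle₁ : ∀ s p i → s - (p + i) ≡ s + 1ℤ - 1ℤ - p - i
          shuffle₁ = solve-∀
          shuffle₂ : ∀ p i → p + p - 1ℤ - p - i ≡ p - 1ℤ - i
          shuffle₂ = solve-∀

        mirror-inner : ∀ i → mirrorAt n (p₀ - 1ℤ - ℤ.+ i) ≡ p₀ + ℤ.+ i
        mirror-inner i = trans (cong (mirrorAt n) (sym (mirror-outer i))) (shuffle (ℤ.+ suc a - ℤ.+ n) (p₀ + ℤ.+ i))
          where
          shuffle : ∀ s c → s - (s - c) ≡ c
          shuffle = solve-∀

        pairAt-even : ∀ i P → pairAt n p₀ i (mirror P) ≡ pairAt n p₀ i P
        pairAt-even i P = trans
          (cong₂ _+_ (trans (lab-mirror n _ P) (cong (λ c → lab n c P) (mirror-outer i)))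
                     (trans (lab-mirror n _ P) (cong (λ c → lab n c P) (mirror-inner i))))
          (ℤP.+-comm (lab n (p₀ - 1ℤ - ℤ.+ i) P) _)

        nest-even : ∀ i P → nest n p₀ i (mirror P) ≡ nest n p₀ i P
        nest-even zero    P = pairAt-even 0 P
        nest-even (suc i) P = cong₂ _+_ (nest-even i P) (cong₂ _+_ (pairAt-even i P) (pairAt-even (suc i) P))

        spread-reflected : ∀ i k → reflected n (p₀ + ℤ.+ i) k ≡ spread n p₀ i (pos k)
        spread-reflected i k = cong (λ c → lab n (p₀ + ℤ.+ i) (pos k) - lab n c (pos k)) (mirror-outer i)

    -- A symmetric pair of starting points. `axis` says that `p₀` and `p₀ - 1` are mirror images in
    -- the column with `rest` steps left, and `depth` numbers the pairs outwards from there. By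
    -- `near` all reachable ends lie below the top of the range, so that the telescoping sums end in
    -- zero.
    record Start : Set where
      constructor start
      field
        rest  : ℕ
        p₀    : ℤ
        depth : ℕ
        axis  : p₀ + p₀ ≡ ℤ.+ suc a - ℤ.+ rest + 1ℤ
        near  : p₀ + ℤ.+ depth + ℤ.+ rest ℤ.< P₀ + ℤ.+ N

      path : ℤ → ℤ
      path = lab rest (p₀ + ℤ.+ depth)

      even : ℤ → ℤ
      even = nest rest p₀ depth

      path₂ : Pair
      path₂ = up rest (p₀ + ℤ.+ depth)

      odd₂ : Pair
      odd₂ = (λ k → - reflected rest (p₀ + ℤ.+ depth) k) , reflected rest (p₀ + ℤ.+ depth)

    open Start

    even-mirror : ∀ t P → even t (mirror P) ≡ even t P
    even-mirror t = nest-even (rest t) (p₀ t) (axis t) (depth t)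

    -- On two functions that are invariant under the reflection the two halves of the form cancel.
    even-isotropic : ∀ s t → pairing (even s) (even t) ≡ 0ℤ
    even-isotropic s t = sumBelow-zero N λ i → trans
      (cong₂ (λ u v → even s (pos i) * u - v * even t (pos i)) (even-mirror t (pos i)) (even-mirror s (pos i)))
      (shuffle (even s (pos i)) (even t (pos i)))
      where
      shuffle : ∀ u v → u * v - u * v ≡ 0ℤ
      shuffle = solve-∀

    odd-isotropic : ∀ s t → sign (odd₂ s) (odd₂ t) ≡ 0ℤ
    odd-isotropic s t = sumBelow-zero N λ i → sumBelow-zero N λ k →
      shuffle (reflected (rest s) (p₀ s + ℤ.+ depth s) i) (reflected (rest t) (p₀ t + ℤ.+ depth t) k) (order i k)
      where
      shuffle : ∀ x y s → - x * - y * s + - x * y - x * - y - x * y * s ≡ 0ℤ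
      shuffle = solve-∀

    -- Both sides equal the sum of `D i` times `even t (pos i)`. On the left, evenness leaves the
    -- path counted with the sign of the reflection. On the right, the odd vector turns the matrix
    -- entries into `1 - order i k`, and telescoping turns `D′` into the even combination.
    pairing≡sign : ∀ s t → pairing (path s) (even t) ≡ sign (path₂ s) (odd₂ t)
    pairing≡sign s t = trans (sumBelow-cong′ N left) (sym (sumBelow-cong N right))
      where
      D D′ : ℕ → ℤ
      D  = reflected (rest s) (p₀ s + ℤ.+ depth s)
      D′ = reflected (rest t) (p₀ t + ℤ.+ depth t)
      left : ∀ i → path s (pos i) * even t (neg i) - path s (neg i) * even t (pos i) ≡ D i * even t (pos i)
      left i = trans (cong₂ (λ u v → path s (pos i) * u - v * even t (pos i)) (even-mirror t (pos i))
                       (lab-mirror (rest s) (p₀ s + ℤ.+ depth s) (pos i)))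
                     (shuffle (path s (pos i)) _ (even t (pos i)))
        where
        shuffle : ∀ u v c → u * c - v * c ≡ (u - v) * c
        shuffle = solve-∀
      right : ∀ i → i ℕ.< N → sumBelow N (λ k → entry (D i) 0ℤ (- D′ k) (D′ k) (order i k)) ≡ D i * even t (pos i)
      right i i<N = trans (sumBelow-cong′ N (λ k → shuffle (D i) (D′ k) (order i k)))
        (trans (sumBelow-* N (D i) _) (cong (D i *_) (telescope N D′ (λ k → even t (pos k)) difference
          (nest-beyond (rest t) (p₀ t) (depth t) (pos N) (near t)) beyond i i<N)))
        where
        shuffle : ∀ x y s → x * - y * s + x * y - 0ℤ * - y - 0ℤ * y * s ≡ x * (y * (1ℤ - s))
        shuffle = solve-∀
        next : ∀ p k → p + (1ℤ + k) ≡ p + k + 1ℤ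
        next = solve-∀
        difference : ∀ k → even t (pos k) - even t (pos (suc k)) ≡ D′ k + D′ (suc k)
        difference k = trans
          (subst (λ q → even t (pos k) - even t q ≡ spread (rest t) (p₀ t) (depth t) (pos k) + spread (rest t) (p₀ t) (depth t) q)
            (sym (next P₀ (ℤ.+ k))) (nest-difference (rest t) (p₀ t) (depth t) (pos k)))
          (sym (cong₂ _+_ (spread-reflected (rest t) (p₀ t) (axis t) (depth t) k) (spread-reflected (rest t) (p₀ t) (axis t) (depth t) (suc k))))
        beyond : D′ N ≡ 0ℤ
        beyond = trans (spread-reflected (rest t) (p₀ t) (axis t) (depth t) N)
          (cong₂ _-_ (outer-beyond (rest t) (p₀ t) (depth t) (pos N) (near t)) (inner-beyond (rest t) (p₀ t) (depth t) (pos N) (near t)))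

    -- Being isotropic is a role assigned by the replacement and cannot be read off from a function,
    -- so the lists carry it as a tag.
    Tagged : Set
    Tagged = Bool × Start

    vector : Tagged → ℤ → ℤ
    vector (false , s) = path s
    vector (true  , s) = even s

    vector₂ : Tagged → Pair
    vector₂ (false , s) = path₂ s
    vector₂ (true  , s) = odd₂ s

    interleave : List Start → List Tagged
    interleave []       = []
    interleave (s ∷ ss) = (false , s) ∷ (true , s) ∷ interleave ss

    interleave-++ : ∀ ss ts → interleave (ss ++ ts) ≡ interleave ss ++ interleave ts
    interleave-++ []       ts = refl
    interleave-++ (s ∷ ss) ts = cong (λ l → (false , s) ∷ (true , s) ∷ l) (interleave-++ ss ts)

    private
      agreement : ∀ x y → proj₁ x ≡ not (proj₁ y) → pairing (vector x) (vector y) ≡ sign (vector₂ x) (vector₂ y)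
      agreement (false , s) (true  , t) _ = pairing≡sign s t
      agreement (true  , s) (false , t) _ =
        trans (pairing-skew (even s) (path t)) (trans (cong -_ (pairing≡sign t s)) (sym (sign-skew (odd₂ s) (path₂ t))))

      isotropic₁ : ∀ x y → proj₁ x ≡ true → proj₁ y ≡ true → pairing (vector x) (vector y) ≡ 0ℤ
      isotropic₁ (true , s) (true , t) _ _ = even-isotropic s t

      isotropic₂ : ∀ x y → proj₁ x ≡ true → proj₁ y ≡ true → sign (vector₂ x) (vector₂ y) ≡ 0ℤ
      isotropic₂ (true , s) (true , t) _ _ = odd-isotropic s t

      module Iso = Isotropic (λ x y → pairing (vector x) (vector y)) (λ x y → sign (vector₂ x) (vector₂ y)) proj₁ isotropic₁ isotropic₂ agreement

    pf-interleave : ∀ m ss → pf m (map vector (interleave ss)) ≡ pfₛ m (map vector₂ (interleave ss))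
    pf-interleave m ss = trans (sym (pf-map pairing vector m (interleave ss)))
      (trans (Iso.pf-agree m (interleave ss) (balanced ss)) (pf-map sign vector₂ m (interleave ss)))
      where
      balanced : ∀ ss → Iso.excess (interleave ss) ≡ 0ℤ
      balanced []       = refl
      balanced (s ∷ ss) = cong (λ e → -1ℤ + (1ℤ + e)) (balanced ss)

-- The number of path systems with symmetric ends is a square.

module CountSquare where

  open import Data.Empty using (⊥-elim)
  open import Data.Integer as ℤ using (ℤ; _+_; _*_; _-_; -_; 0ℤ; 1ℤ; -1ℤ)
  import Data.Integer.Properties as ℤP
  open import Data.Integer.Tactic.RingSolver using (solve-∀)
  open import Data.Nat.Tactic.RingSolver renaming (solve-∀ to ℕ-solve-∀)
  open import Data.List using (List; []; _∷_; _++_; map; length; reverse; _ʳ++_)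
  import Data.List.Properties as LP
  open import Data.List.Membership.Propositional using (_∈_)
  open import Data.List.Membership.Propositional.Properties
  open import Data.List.Relation.Unary.All as All using (All; []; _∷_)
  import Data.List.Relation.Unary.All.Properties as AllP
  open import Data.List.Relation.Unary.Any using (here; there)
  open import Data.List.Relation.Unary.Linked using ([]; [-]; _∷_)
  open import Data.Maybe using (Maybe; just; nothing; maybe)
  open import Data.Nat as ℕ using (ℕ; zero; suc)
  import Data.Nat.Properties as ℕP
  open import Data.Product using (_×_; _,_; proj₁; proj₂)
  open import Relation.Binary.PropositionalEquality
  open import Relation.Nullary using (yes; no)
  open Pfaffians
  open PathSystems
  open MiddleForms

  -- The unit edges of the left side, from `b` down to `1 - b`. They are built outwards from the
  -- axis, so that one more step adds one symmetric pair.
  initial initialUpper : ℕ → List ℤ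
  initial zero    = []
  initial (suc i) = ℤ.+ suc i ∷ initial i ++ (0ℤ - ℤ.+ i) ∷ []
  initialUpper zero    = []
  initialUpper (suc i) = ℤ.+ suc i ∷ initialUpper i

  length-initial : ∀ b → length (initial b) ≡ b ℕ.+ b
  length-initial zero    = refl
  length-initial (suc b) = cong suc (trans (LP.length-++ (initial b)) (trans (ℕP.+-comm (length (initial b)) 1)
    (trans (cong suc (length-initial b)) (sym (ℕP.+-suc b b)))))

  length-initialUpper : ∀ b → length (initialUpper b) ≡ b
  length-initialUpper zero    = refl
  length-initialUpper (suc b) = cong suc (length-initialUpper b)

  initialUpper-upper : ∀ b → UpperState 0 (initialUpper b)
  initialUpper-upper b = descending b , uppers b
    where
    descending : ∀ b → Descending (initialUpper b)
    descending zero          = []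
    descending (suc zero)    = [-]
    descending (suc (suc b)) = ℤ.+<+ (ℕP.n<1+n (suc b)) ∷ descending (suc b)
    uppers : ∀ b → All (Upper 0) (initialUpper b)
    uppers zero    = []
    uppers (suc b) = ℤ.+<+ (subst (1 ℕ.<_) (sym (ℕP.+-suc (suc b) b)) (ℕ.s≤s (ℕ.s≤s ℕ.z≤n))) ∷ uppers b

  module _ where

    private
      cons : ∀ {x xs} → All (ℤ._< x) xs → Descending xs → Descending (x ∷ xs)
      cons []      []      = [-]
      cons (h ∷ _) [-]     = h ∷ [-]
      cons (h ∷ _) (g ∷ d) = h ∷ (g ∷ d)

      snoc : ∀ {z} xs → All (z ℤ.<_) xs → Descending xs → Descending (xs ++ z ∷ [])
      snoc []           _           _       = [-]
      snoc (x ∷ [])     (h ∷ _)     _       = h ∷ [-]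
      snoc (x ∷ y ∷ xs) (_ ∷ h ∷ a) (g ∷ d) = g ∷ snoc (y ∷ xs) (h ∷ a) d

      below : ∀ i → 0ℤ - ℤ.+ suc i ℤ.< 0ℤ - ℤ.+ i
      below i = ℤP.+-monoʳ-< 0ℤ (ℤP.neg-mono-< (ℤ.+<+ (ℕP.n<1+n i)))

      nonpositive : ∀ i → 0ℤ - ℤ.+ i ℤ.≤ 0ℤ
      nonpositive zero    = ℤP.≤-refl
      nonpositive (suc i) = ℤ.-≤+

      bounds : ∀ i → All (λ c → c ℤ.< ℤ.+ suc i × 0ℤ - ℤ.+ i ℤ.< c) (initial i)
      bounds zero    = []
      bounds (suc i) = (ℤ.+<+ (ℕP.n<1+n (suc i)) , ℤP.≤-<-trans (nonpositive (suc i)) (ℤ.+<+ (ℕ.s≤s ℕ.z≤n)))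
        ∷ AllP.++⁺ (All.map (λ { (h , g) → ℤP.<-trans h (ℤ.+<+ (ℕP.n<1+n (suc i))) , ℤP.<-trans (below i) g }) (bounds i))
                   ((ℤP.≤-<-trans (nonpositive i) (ℤ.+<+ (ℕ.s≤s ℕ.z≤n)) , below i) ∷ [])

    initial-descending : ∀ b → Descending (initial b)
    initial-descending zero    = []
    initial-descending (suc i) = cons
      (AllP.++⁺ (All.map proj₁ (bounds i)) (ℤP.≤-<-trans (nonpositive i) (ℤ.+<+ (ℕ.s≤s ℕ.z≤n)) ∷ []))
      (snoc (initial i) (All.map proj₂ (bounds i)) (initial-descending i))

  module Core (a b : ℕ) (P₀ : ℤ) (N : ℕ) (mid : ℤ.+ suc a ℤ.< P₀ + P₀) (big : ℤ.+ (a ℕ.+ b) ℤ.< P₀ + ℤ.+ N)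
    (gap : ℕ → Maybe ℤ) (gap-even : ∀ {j k} → gap j ≡ just k → ℤ.+ j ≡ k + k) where

    open Middle a P₀ N mid
    open Pfaffian pairing
    open Pfaffian sign using () renaming (pf to pfₛ; pf-alternates to pfₛ-alternates; pf-span to pfₛ-span)

    private
      module S = System (λ j → insertMaybe (gap j)) (λ _ → Descending) (λ _ → descending?) Final final?
      module U = System (λ j → appendMaybe (gap j)) UpperState upperState? FinalUpper finalUpper?

      later₁ : ℕ → ℕ → List (ℤ → ℤ)
      later₁ = later gap lab

      later₂ : ℕ → ℕ → List Pair
      later₂ = laterPairs gap up low

      firstStart : ∀ i → i ℕ.< b → Start
      firstStart i i<b = start a 1ℤ i (axis (ℤ.+ a)) (ℤP.≤-<-trans (ℤ.+≤+ le) big)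
        where
        axis : ∀ a → 1ℤ + 1ℤ ≡ 1ℤ + a - a + 1ℤ
        axis = solve-∀
        le : 1 ℕ.+ i ℕ.+ a ℕ.≤ a ℕ.+ b
        le = subst (ℕ._≤ a ℕ.+ b) (ℕP.+-comm a (suc i)) (ℕP.+-monoʳ-≤ a i<b)

      firstStarts : ∀ i → i ℕ.≤ b → List Start
      firstStarts zero    _  = []
      firstStarts (suc i) le = firstStarts i (ℕP.<⇒≤ le) ++ firstStart i le ∷ []

      gapStart : ∀ n j k → suc j ℕ.+ n ≡ a → gap (suc j) ≡ just k → Start
      gapStart n j k t e = start n (ℤ.suc k) 0 axis near
        where
        twice : ℤ.+ suc j ≡ k + k
        twice = gap-even e
        axis : ℤ.suc k + ℤ.suc k ≡ ℤ.+ suc a - ℤ.+ n + 1ℤ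
        axis = trans (shuffle₁ k) (trans (cong (λ u → 1ℤ + u + 1ℤ) (sym twice)) (trans (shuffle₂ (ℤ.+ suc j) (ℤ.+ n)) (cong (λ u → ℤ.+ suc u - ℤ.+ n + 1ℤ) t)))
          where
          shuffle₁ : ∀ k → 1ℤ + k + (1ℤ + k) ≡ 1ℤ + (k + k) + 1ℤ
          shuffle₁ = solve-∀
          shuffle₂ : ∀ j n → 1ℤ + j + 1ℤ ≡ 1ℤ + (j + n) - n + 1ℤ
          shuffle₂ = solve-∀
        -- A path from `suc k` with `n` steps left ends at most at `suc k + n`. With `1 ≤ k` this is
        -- at most `k + k + n`, which is `a`.
        positive : 1ℤ ℤ.≤ k
        positive with 1ℤ ℤ.≤? k
        ... | yes p = p
        ... | no ¬p = ⊥-elim (ℤP.<-irrefl refl (ℤP.<-≤-trans (ℤ.+<+ (ℕ.s≤s ℕ.z≤n)) (ℤP.≤-trans (ℤP.≤-reflexive twice) (ℤP.+-mono-≤ k≤0 k≤0))))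
          where
          k≤0 : k ℤ.≤ 0ℤ
          k≤0 = ℤP.i<j⇒i≤pred[j] (ℤP.≰⇒> ¬p)
        near : ℤ.suc k + ℤ.+ 0 + ℤ.+ n ℤ.< P₀ + ℤ.+ N
        near = ℤP.≤-<-trans (begin
          1ℤ + k + 0ℤ + ℤ.+ n  ≤⟨ ℤP.+-monoˡ-≤ (ℤ.+ n) (ℤP.+-monoˡ-≤ 0ℤ (ℤP.+-monoˡ-≤ k positive)) ⟩
          k + k + 0ℤ + ℤ.+ n   ≡⟨ cong (_+ ℤ.+ n) (ℤP.+-identityʳ (k + k)) ⟩
          k + k + ℤ.+ n        ≡⟨ cong (_+ ℤ.+ n) (sym twice) ⟩
          ℤ.+ (suc j ℕ.+ n)    ≡⟨ cong ℤ.+_ t ⟩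
          ℤ.+ a                ≤⟨ ℤ.+≤+ (ℕP.m≤m+n a b) ⟩
          ℤ.+ (a ℕ.+ b)        ∎) big
          where open ℤP.≤-Reasoning

      gapStarts : ∀ n j → j ℕ.+ n ≡ a → List Start
      -- The value of the gap is an argument together with its equation: splitting on it then still
      -- leaves the equation from which the start obtains its axis.
      atGap : ∀ n j → suc j ℕ.+ n ≡ a → ∀ g → gap (suc j) ≡ g → List Start
      gapStarts zero    j t = []
      gapStarts (suc n) j t = atGap n j (trans (sym (ℕP.+-suc j n)) t) (gap (suc j)) refl
      atGap n j t nothing  e = gapStarts n (suc j) t
      atGap n j t (just k) e = gapStart n j k t e ∷ gapStarts n (suc j) t

      module _ (m : ℕ) where

        move-across : ∀ {X : Set} {φ : List X → ℤ} → Alternates φ → ∀ x ys zs k → length ys ≡ k ℕ.+ k → φ (x ∷ ys ++ zs) ≡ φ (ys ++ x ∷ zs)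
        move-across {φ = φ} alt x ys zs k l = sym (trans (move-front alt ys x zs)
          (trans (cong (_* φ (x ∷ ys ++ zs)) (trans (cong signs l) (signs-even k))) (ℤP.*-identityˡ _)))

        doubles : ℕ → ℤ → ℕ → Combination (ℤ → ℤ)
        doubles n p zero    = []
        doubles n p (suc i) = (ℤ.+ 2 , lab n (p + ℤ.+ i)) ∷ (ℤ.+ 2 , lab n (p - 1ℤ - ℤ.+ i)) ∷ doubles n p i

        -- The lower path of the outermost pair is singled out because it is the entry to be
        -- replaced; the remaining summands occur elsewhere in the list.
        nest-span : ∀ n p i w → pairing (nest n p i) w ≡
          pairing (lab n (p - 1ℤ - ℤ.+ i)) w + lin ((1ℤ , lab n (p + ℤ.+ i)) ∷ doubles n p i) (λ v → pairing v w)
        nest-span n p i w = trans (go i) (shuffle (pairing (lab n (p + ℤ.+ i)) w) (pairing (lab n (p - 1ℤ - ℤ.+ i)) w) _)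
          where
          shuffle : ∀ u v s → u + v + s ≡ v + (1ℤ * u + s)
          shuffle = solve-∀
          twoLabs : ∀ i → pairing (pairAt n p i) w ≡ pairing (lab n (p + ℤ.+ i)) w + pairing (lab n (p - 1ℤ - ℤ.+ i)) w
          twoLabs i = pairing-+ {lab n (p + ℤ.+ i)} {lab n (p - 1ℤ - ℤ.+ i)} {pairAt n p i} (λ _ → refl) w
          go : ∀ i → pairing (nest n p i) w ≡ pairing (lab n (p + ℤ.+ i)) w + pairing (lab n (p - 1ℤ - ℤ.+ i)) w + lin (doubles n p i) (λ v → pairing v w)
          go zero    = trans (twoLabs 0) (sym (ℤP.+-identityʳ _))
          go (suc i) = begin
            pairing (nest n p (suc i)) w
              ≡⟨ pairing-+ {nest n p i} {λ P → pairAt n p i P + pairAt n p (suc i) P} {nest n p (suc i)} (λ _ → refl) w ⟩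
            pairing (nest n p i) w + pairing (λ P → pairAt n p i P + pairAt n p (suc i) P) w
              ≡⟨ cong₂ _+_ (go i) (trans (pairing-+ {pairAt n p i} {pairAt n p (suc i)} {λ P → pairAt n p i P + pairAt n p (suc i) P} (λ _ → refl) w) (cong₂ _+_ (twoLabs i) (twoLabs (suc i)))) ⟩
            x + y + s + (x + y + (u + v))
              ≡⟨ regroup x y s u v ⟩
            u + v + (ℤ.+ 2 * x + (ℤ.+ 2 * y + s)) ∎
            where
            open ≡-Reasoning
            x y s u v : ℤ
            x = pairing (lab n (p + ℤ.+ i)) w
            y = pairing (lab n (p - 1ℤ - ℤ.+ i)) w
            s = lin (doubles n p i) (λ v → pairing v w)
            u = pairing (lab n (p + ℤ.+ suc i)) w
            v = pairing (lab n (p - 1ℤ - ℤ.+ suc i)) w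
            regroup : ∀ x y s u v → x + y + s + (x + y + (u + v)) ≡ u + v + (ℤ.+ 2 * x + (ℤ.+ 2 * y + s))
            regroup = solve-∀

        -- The outermost pair comes first: its replacement uses the inner paths, which must still be
        -- present as plain paths at that moment.
        first₁ : ∀ i (le : i ℕ.≤ b) rest → pf m (map (lab a) (initial i) ++ rest) ≡ pf m (map vector (interleave (firstStarts i le)) ++ rest)
        first₁ zero    le rest = refl
        first₁ (suc i) le rest = begin
          pf m (x ∷ map (lab a) (initial i ++ (0ℤ - ℤ.+ i) ∷ []) ++ rest)
            ≡⟨ cong (λ l → pf m (x ∷ l)) (trans (cong (_++ rest) (LP.map-++ (lab a) (initial i) _)) (LP.++-assoc L (y ∷ []) rest)) ⟩
          pf m (x ∷ L ++ y ∷ rest)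
            ≡⟨ move-across (pf-alternates pairing-skew m) x L (y ∷ rest) i (trans (LP.length-map (lab a) (initial i)) (length-initial i)) ⟩
          pf m (L ++ x ∷ y ∷ rest)
            ≡⟨ cong (pf m) (sym (LP.++-assoc L (x ∷ []) (y ∷ rest))) ⟩
          pf m ((L ++ x ∷ []) ++ y ∷ rest)
            ≡⟨ sym (pf-span pairing-skew m (L ++ x ∷ []) y c rest ((1ℤ , x) ∷ doubles a 1ℤ i) (∈-++⁺ʳ L (here refl) ∷ All.map ∈-++⁺ˡ (available i)) (nest-span a 1ℤ i)) ⟩
          pf m ((L ++ x ∷ []) ++ c ∷ rest)
            ≡⟨ cong (pf m) (LP.++-assoc L (x ∷ []) (c ∷ rest)) ⟩
          pf m (L ++ x ∷ c ∷ rest)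
            ≡⟨ first₁ i (ℕP.<⇒≤ le) (x ∷ c ∷ rest) ⟩
          pf m (map vector (interleave (firstStarts i (ℕP.<⇒≤ le))) ++ x ∷ c ∷ rest)
            ≡⟨ cong (pf m) (sym (LP.++-assoc (map vector (interleave (firstStarts i (ℕP.<⇒≤ le)))) (x ∷ c ∷ []) rest)) ⟩
          pf m ((map vector (interleave (firstStarts i (ℕP.<⇒≤ le))) ++ x ∷ c ∷ []) ++ rest)
            ≡⟨ cong (λ l → pf m (l ++ rest)) (sym (trans (cong (map vector) (interleave-++ (firstStarts i (ℕP.<⇒≤ le)) (firstStart i le ∷ [])))
                 (LP.map-++ vector (interleave (firstStarts i (ℕP.<⇒≤ le))) _))) ⟩
          pf m (map vector (interleave (firstStarts (suc i) le)) ++ rest) ∎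
          where
          open ≡-Reasoning
          x y c : ℤ → ℤ
          x = lab a (ℤ.+ suc i)
          y = lab a (0ℤ - ℤ.+ i)
          c = nest a 1ℤ i
          L : List (ℤ → ℤ)
          L = map (lab a) (initial i)
          available : ∀ i → All (λ q → proj₂ q ∈ map (lab a) (initial i)) (doubles a 1ℤ i)
          available zero    = []
          available (suc i) = here refl ∷ there (lift (∈-++⁺ʳ (initial i) (here refl))) ∷ All.map widen (available i)
            where
            lift : ∀ {z zs} → z ∈ zs → lab a z ∈ map (lab a) zs
            lift = ∈-map⁺ (lab a)
            widen : ∀ {v} → v ∈ map (lab a) (initial i) → v ∈ map (lab a) (initial (suc i))
            widen {v} v∈ = there (subst (v ∈_) (sym (LP.map-++ (lab a) (initial i) _)) (∈-++⁺ˡ v∈))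

        gaps₁ : ∀ n j t as → pf m (as ++ later₁ n j) ≡ pf m (as ++ map vector (interleave (gapStarts n j t)))
        gaps₁ zero    j t as = refl
        gaps₁ (suc n) j t as = go (trans (sym (ℕP.+-suc j n)) t) (gap (suc j)) refl
          where
          go : ∀ t g (e : gap (suc j) ≡ g) →
            pf m (as ++ maybe (λ k → lab n (ℤ.suc k) ∷ lab n k ∷ []) [] g ++ later₁ n (suc j)) ≡ pf m (as ++ map vector (interleave (atGap n j t g e)))
          go t nothing  e = gaps₁ n (suc j) t as
          go t (just k) e = begin
            pf m (as ++ lab n (ℤ.suc k) ∷ lab n k ∷ rest)
              ≡⟨ cong₂ (λ u v → pf m (as ++ lab n u ∷ lab n v ∷ rest)) (sym (ℤP.+-identityʳ (ℤ.suc k))) (shuffle k) ⟩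
            pf m (as ++ x ∷ y ∷ rest)
              ≡⟨ cong (pf m) (sym (LP.++-assoc as (x ∷ []) (y ∷ rest))) ⟩
            pf m ((as ++ x ∷ []) ++ y ∷ rest)
              ≡⟨ sym (pf-span pairing-skew m (as ++ x ∷ []) y c rest ((1ℤ , x) ∷ []) (∈-++⁺ʳ as (here refl) ∷ []) (nest-span n (ℤ.suc k) 0)) ⟩
            pf m ((as ++ x ∷ []) ++ c ∷ rest)
              ≡⟨ cong (pf m) (trans (LP.++-assoc as (x ∷ []) (c ∷ rest)) (sym (LP.++-assoc as (x ∷ c ∷ []) rest))) ⟩
            pf m ((as ++ x ∷ c ∷ []) ++ rest)
              ≡⟨ gaps₁ n (suc j) t (as ++ x ∷ c ∷ []) ⟩
            pf m ((as ++ x ∷ c ∷ []) ++ map vector (interleave (gapStarts n (suc j) t)))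
              ≡⟨ cong (pf m) (LP.++-assoc as (x ∷ c ∷ []) _) ⟩
            pf m (as ++ x ∷ c ∷ map vector (interleave (gapStarts n (suc j) t))) ∎
            where
            open ≡-Reasoning
            x y c : ℤ → ℤ
            x = lab n (ℤ.suc k + ℤ.+ 0)
            y = lab n (ℤ.suc k - 1ℤ - ℤ.+ 0)
            c = nest n (ℤ.suc k) 0
            rest : List (ℤ → ℤ)
            rest = later₁ n (suc j)
            shuffle : ∀ k → k ≡ 1ℤ + k - 1ℤ - 0ℤ
            shuffle = solve-∀

        -- The odd vector differs from the lower copy by the upper copy, which is the preceding
        -- entry.
        odd-span : ∀ s as bs → let open Start in
          pfₛ m (as ++ path₂ s ∷ low (rest s) (p₀ s + ℤ.+ depth s) ∷ bs) ≡ pfₛ m (as ++ path₂ s ∷ odd₂ s ∷ bs)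
        odd-span s as bs = begin
          pfₛ m (as ++ path₂ s ∷ l ∷ bs)          ≡⟨ cong (pfₛ m) (sym (LP.++-assoc as (path₂ s ∷ []) (l ∷ bs))) ⟩
          pfₛ m ((as ++ path₂ s ∷ []) ++ l ∷ bs)  ≡⟨ sym (pfₛ-span sign-skew m (as ++ path₂ s ∷ []) l (odd₂ s) bs ((-1ℤ , path₂ s) ∷ []) (∈-++⁺ʳ as (here refl) ∷ []) rel) ⟩
          pfₛ m ((as ++ path₂ s ∷ []) ++ odd₂ s ∷ bs) ≡⟨ cong (pfₛ m) (LP.++-assoc as (path₂ s ∷ []) (odd₂ s ∷ bs)) ⟩
          pfₛ m (as ++ path₂ s ∷ odd₂ s ∷ bs)     ∎
          where
          open ≡-Reasoning
          open Start
          l : Pair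
          l = low (rest s) (p₀ s + ℤ.+ depth s)
          rel : ∀ w → sign (odd₂ s) w ≡ sign l w + (-1ℤ * sign (path₂ s) w + 0ℤ)
          rel w = trans (minus (sign (odd₂ s) w) (sign (path₂ s) w)) (cong (_+ (-1ℤ * sign (path₂ s) w + 0ℤ))
            (sym (sign-+ {odd₂ s} {path₂ s} {l} (λ i → cancel (reflected (rest s) (p₀ s + ℤ.+ depth s) i)) (λ i → sym (ℤP.+-identityʳ _)) w)))
            where
            minus : ∀ u v → u ≡ u + v + (-1ℤ * v + 0ℤ)
            minus = solve-∀
            cancel : ∀ u → 0ℤ ≡ - u + u
            cancel = solve-∀

        first₂ : ∀ i (le : i ℕ.≤ b) rest → pfₛ m (map (up a) (initialUpper i) ++ (map (low a) (initialUpper i) ʳ++ rest))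
          ≡ pfₛ m (map vector₂ (interleave (firstStarts i le)) ++ rest)
        first₂ zero    le rest = refl
        first₂ (suc i) le rest = begin
          pfₛ m (x ∷ L ++ (R ʳ++ y ∷ rest))
            ≡⟨ cong (λ l → pfₛ m (x ∷ l)) (trans (cong (L ++_) (LP.ʳ++-defn R)) (sym (LP.++-assoc L (reverse R) (y ∷ rest)))) ⟩
          pfₛ m (x ∷ (L ++ reverse R) ++ y ∷ rest)
            ≡⟨ move-across (pfₛ-alternates sign-skew m) x (L ++ reverse R) (y ∷ rest) i len ⟩
          pfₛ m ((L ++ reverse R) ++ x ∷ y ∷ rest)
            ≡⟨ odd-span (firstStart i le) (L ++ reverse R) rest ⟩
          pfₛ m ((L ++ reverse R) ++ x ∷ c ∷ rest)
            ≡⟨ cong (pfₛ m) (trans (LP.++-assoc L (reverse R) _) (cong (L ++_) (sym (LP.ʳ++-defn R)))) ⟩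
          pfₛ m (L ++ (R ʳ++ x ∷ c ∷ rest))
            ≡⟨ first₂ i (ℕP.<⇒≤ le) (x ∷ c ∷ rest) ⟩
          pfₛ m (map vector₂ (interleave (firstStarts i (ℕP.<⇒≤ le))) ++ x ∷ c ∷ rest)
            ≡⟨ cong (pfₛ m) (sym (LP.++-assoc (map vector₂ (interleave (firstStarts i (ℕP.<⇒≤ le)))) (x ∷ c ∷ []) rest)) ⟩
          pfₛ m ((map vector₂ (interleave (firstStarts i (ℕP.<⇒≤ le))) ++ x ∷ c ∷ []) ++ rest)
            ≡⟨ cong (λ l → pfₛ m (l ++ rest)) (sym (trans (cong (map vector₂) (interleave-++ (firstStarts i (ℕP.<⇒≤ le)) (firstStart i le ∷ [])))
                 (LP.map-++ vector₂ (interleave (firstStarts i (ℕP.<⇒≤ le))) _))) ⟩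
          pfₛ m (map vector₂ (interleave (firstStarts (suc i) le)) ++ rest) ∎
          where
          open ≡-Reasoning
          x y c : Pair
          x = up a (ℤ.+ suc i)
          y = low a (ℤ.+ suc i)
          c = Start.odd₂ (firstStart i le)
          L R : List Pair
          L = map (up a) (initialUpper i)
          R = map (low a) (initialUpper i)
          len : length (L ++ reverse R) ≡ i ℕ.+ i
          len = trans (LP.length-++ L) (cong₂ ℕ._+_ (trans (LP.length-map (up a) (initialUpper i)) (length-initialUpper i))
            (trans (LP.length-reverse R) (trans (LP.length-map (low a) (initialUpper i)) (length-initialUpper i))))

        gaps₂ : ∀ n j t as → pfₛ m (as ++ later₂ n j) ≡ pfₛ m (as ++ map vector₂ (interleave (gapStarts n j t)))
        gaps₂ zero    j t as = refl
        gaps₂ (suc n) j t as = go (trans (sym (ℕP.+-suc j n)) t) (gap (suc j)) refl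
          where
          go : ∀ t g (e : gap (suc j) ≡ g) →
            pfₛ m (as ++ maybe (λ k → up n (ℤ.suc k) ∷ low n (ℤ.suc k) ∷ []) [] g ++ later₂ n (suc j)) ≡ pfₛ m (as ++ map vector₂ (interleave (atGap n j t g e)))
          go t nothing  e = gaps₂ n (suc j) t as
          go t (just k) e = begin
            pfₛ m (as ++ up n (ℤ.suc k) ∷ low n (ℤ.suc k) ∷ rest)
              ≡⟨ cong (λ u → pfₛ m (as ++ up n u ∷ low n u ∷ rest)) (sym (ℤP.+-identityʳ (ℤ.suc k))) ⟩
            pfₛ m (as ++ x ∷ low n (ℤ.suc k + ℤ.+ 0) ∷ rest)
              ≡⟨ odd-span (gapStart n j k t e) as rest ⟩
            pfₛ m (as ++ x ∷ c ∷ rest)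
              ≡⟨ cong (pfₛ m) (sym (LP.++-assoc as (x ∷ c ∷ []) rest)) ⟩
            pfₛ m ((as ++ x ∷ c ∷ []) ++ rest)
              ≡⟨ gaps₂ n (suc j) t (as ++ x ∷ c ∷ []) ⟩
            pfₛ m ((as ++ x ∷ c ∷ []) ++ map vector₂ (interleave (gapStarts n (suc j) t)))
              ≡⟨ cong (pfₛ m) (LP.++-assoc as (x ∷ c ∷ []) _) ⟩
            pfₛ m (as ++ x ∷ c ∷ map vector₂ (interleave (gapStarts n (suc j) t))) ∎
            where
            open ≡-Reasoning
            x c : Pair
            x = up n (ℤ.suc k + ℤ.+ 0)
            c = Start.odd₂ (gapStart n j k t e)
            rest : List Pair
            rest = later₂ n (suc j)

    count-square : S.count a 0 (initial b) ≡ U.count a 0 (initialUpper b) * U.count a 0 (initialUpper b)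
    count-square = begin
      S.count a 0 (initial b)
        ≡⟨ count≡pf gap Final final? pairing pairing-skew lab lab-rel m (pf-final m) a 0 (initial b) (initial-descending b) total ⟩
      pf m (map (lab a) (initial b) ++ later₁ a 0)
        ≡⟨ first₁ m b ℕP.≤-refl (later₁ a 0) ⟩
      pf m (map vector (interleave F) ++ later₁ a 0)
        ≡⟨ gaps₁ m a 0 refl (map vector (interleave F)) ⟩
      pf m (map vector (interleave F) ++ map vector (interleave G))
        ≡⟨ cong (pf m) (sym (trans (cong (map vector) (interleave-++ F G)) (LP.map-++ vector (interleave F) (interleave G)))) ⟩
      pf m (map vector (interleave (F ++ G)))
        ≡⟨ pf-interleave m (F ++ G) ⟩
      pfₛ m (map vector₂ (interleave (F ++ G)))
        ≡⟨ cong (pfₛ m) (trans (cong (map vector₂) (interleave-++ F G)) (LP.map-++ vector₂ (interleave F) (interleave G))) ⟩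
      pfₛ m (map vector₂ (interleave F) ++ map vector₂ (interleave G))
        ≡⟨ sym (gaps₂ m a 0 refl (map vector₂ (interleave F))) ⟩
      pfₛ m (map vector₂ (interleave F) ++ later₂ a 0)
        ≡⟨ sym (first₂ m b ℕP.≤-refl (later₂ a 0)) ⟩
      pfₛ m (map (up a) (initialUpper b) ++ (map (low a) (initialUpper b) ʳ++ later₂ a 0))
        ≡⟨ sym (count²≡pf gap gap-even FinalUpper finalUpper? sign sign-skew up low up-rel low-rel a up-zero low-zero m
             (pf-up-low m) a 0 (initialUpper b) (initialUpper b) refl (initialUpper-upper b) (initialUpper-upper b) half half) ⟩
      U.count a 0 (initialUpper b) * U.count a 0 (initialUpper b) ∎
      where
      open ≡-Reasoning
      m : ℕ
      -- One path of each symmetric pair: the size of an upper family, and half of the number of all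
      -- paths.
      m = b ℕ.+ gaps gap a 0
      F G : List Start
      F = firstStarts b ℕP.≤-refl
      G = gapStarts a 0 refl
      half : length (initialUpper b) ℕ.+ gaps gap a 0 ≡ m
      half = cong (ℕ._+ gaps gap a 0) (length-initialUpper b)
      total : length (initial b) ℕ.+ length (later₁ a 0) ≡ m ℕ.+ m
      total = trans (cong₂ ℕ._+_ (length-initial b) (length-later gap lab a 0)) (interchange b b (gaps gap a 0) (gaps gap a 0))
        where
        interchange : ∀ p q r s → p ℕ.+ q ℕ.+ (r ℕ.+ s) ≡ p ℕ.+ r ℕ.+ (q ℕ.+ s)
        interchange = ℕ-solve-∀

-- Symmetric path systems and their upper halves.

module Doubling where

  open import Data.Empty using (⊥-elim)
  open import Data.Integer as ℤ using (ℤ; _+_; _-_; -_; 0ℤ; 1ℤ)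
  import Data.Integer.Properties as ℤP
  open import Data.Integer.Tactic.RingSolver using (solve-∀)
  open import Data.List using (List; []; _∷_; _++_; map; length; reverse)
  import Data.List.Properties as LP
  open import Data.List.Membership.Propositional.Properties
  open import Data.List.Relation.Binary.Pointwise as Pw using (Pointwise; []; _∷_)
  open import Data.List.Relation.Unary.All as All using (All; []; _∷_)
  import Data.List.Relation.Unary.All.Properties as AllP
  open import Data.List.Relation.Unary.AllPairs using (AllPairs; []; _∷_)
  import Data.List.Relation.Unary.Any.Properties as AnyP
  open import Data.List.Relation.Unary.Linked using ([]; _∷_)
  import Data.List.Relation.Unary.Linked.Properties as LinkedP
  open import Data.Maybe using (Maybe; just; nothing)
  open import Data.Nat as ℕ using (ℕ; zero; suc)
  import Data.Nat.Properties as ℕP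
  open import Data.Product using (_×_; _,_; ∃; proj₁; proj₂)
  open import Data.Sum using (_⊎_; inj₁; inj₂)
  open import Relation.Binary.PropositionalEquality
  open import Relation.Nullary using (yes; no)
  open Pfaffians
  open PathSystems
  open MiddleForms
  open CountSquare

  mir : ℕ → ℤ → ℤ
  mir j c = ℤ.+ suc j - c

  mir-involutive : ∀ j c → mir j (mir j c) ≡ c
  mir-involutive j c = shuffle (ℤ.+ suc j) c
    where
    shuffle : ∀ s c → s - (s - c) ≡ c
    shuffle = solve-∀

  double : ℕ → List ℤ → List ℤ
  double j us = us ++ reverse (map (mir j) us)

  doubleChain : ℕ → List (List ℤ) → List (List ℤ)
  doubleChain j []       = []
  doubleChain j (us ∷ h) = double (suc j) us ∷ doubleChain (suc j) h

  SymmetricAt : ℕ → List ℤ → Set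
  SymmetricAt j xs = xs ≡ reverse (map (mir j) xs)

  data SymmetricChain : ℕ → List (List ℤ) → Set where
    []  : ∀ {j} → SymmetricChain j []
    _∷_ : ∀ {j xs h} → SymmetricAt (suc j) xs → SymmetricChain (suc j) h → SymmetricChain j (xs ∷ h)

  reverse-map-double : ∀ j xs ys → reverse (map (mir j) (xs ++ ys)) ≡ reverse (map (mir j) ys) ++ reverse (map (mir j) xs)
  reverse-map-double j xs ys = trans (cong reverse (LP.map-++ (mir j) xs ys)) (LP.reverse-++ (map (mir j) xs) (map (mir j) ys))

  mir-reverse : ∀ j us → reverse (map (mir j) (reverse (map (mir j) us))) ≡ us
  mir-reverse j us = begin
    reverse (map (mir j) (reverse (map (mir j) us))) ≡⟨ cong reverse (LP.reverse-map (mir j) (map (mir j) us)) ⟩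
    reverse (reverse (map (mir j) (map (mir j) us))) ≡⟨ LP.reverse-involutive _ ⟩
    map (mir j) (map (mir j) us)                     ≡⟨ sym (LP.map-∘ us) ⟩
    map (λ c → mir j (mir j c)) us                   ≡⟨ LP.map-cong (mir-involutive j) us ⟩
    map (λ c → c) us                                 ≡⟨ LP.map-id us ⟩
    us                                               ∎
    where open ≡-Reasoning

  double-symmetric : ∀ j us → SymmetricAt j (double j us)
  double-symmetric j us = sym (trans (reverse-map-double j us _) (cong (_++ reverse (map (mir j) us)) (mir-reverse j us)))

  length-mir : ∀ j us → length (reverse (map (mir j) us)) ≡ length us
  length-mir j us = trans (LP.length-reverse (map (mir j) us)) (LP.length-map (mir j) us)

  ++-split : ∀ {A : Set} (xs ys : List A) {us vs} → length xs ≡ length ys → xs ++ us ≡ ys ++ vs → xs ≡ ys × us ≡ vs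
  ++-split []       []       l e = refl , e
  ++-split (x ∷ xs) (y ∷ ys) l e with LP.∷-injective e
  ... | refl , e′ with ++-split xs ys (ℕP.suc-injective l) e′
  ...   | refl , e″ = refl , e″

  symmetric⇒double : ∀ j us ws → length us ≡ length ws → SymmetricAt j (us ++ ws) → us ++ ws ≡ double j us
  symmetric⇒double j us ws l e with ++-split us (reverse (map (mir j) ws)) (trans l (sym (length-mir j ws))) (trans e (reverse-map-double j us ws))
  ... | _ , ws≡ = cong (us ++_) ws≡

  double-injective : ∀ j us vs → double j us ≡ double j vs → us ≡ vs
  double-injective j us vs e = proj₁ (++-split us vs l e)
    where
    halve : ∀ m n → m ℕ.+ m ≡ n ℕ.+ n → m ≡ n
    halve zero    zero    _ = refl
    halve (suc m) (suc n) e = cong suc (halve m n (ℕP.suc-injective (trans (sym (ℕP.+-suc m m)) (trans (ℕP.suc-injective e) (ℕP.+-suc n n)))))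
    len : ∀ us → length (double j us) ≡ length us ℕ.+ length us
    len us = trans (LP.length-++ us) (cong (length us ℕ.+_) (length-mir j us))
    l : length us ≡ length vs
    l = halve (length us) (length vs) (trans (sym (len us)) (trans (cong length e) (len vs)))

  doubleChain-injective : ∀ j h h′ → doubleChain j h ≡ doubleChain j h′ → h ≡ h′
  doubleChain-injective j []       []         e = refl
  doubleChain-injective j (us ∷ h) (vs ∷ h′) e with LP.∷-injective e
  ... | e₁ , e₂ = cong₂ _∷_ (double-injective (suc j) us vs e₁) (doubleChain-injective (suc j) h h′ e₂)

  doubleChain-symmetric : ∀ j h → SymmetricChain j (doubleChain j h)
  doubleChain-symmetric j []       = []
  doubleChain-symmetric j (us ∷ h) = double-symmetric (suc j) us ∷ doubleChain-symmetric (suc j) h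

  double-initial : ∀ b → double 0 (initialUpper b) ≡ initial b
  double-initial zero    = refl
  double-initial (suc b) = cong (ℤ.+ suc b ∷_) (begin
    us ++ reverse (mir 0 (ℤ.+ suc b) ∷ map (mir 0) us) ≡⟨ cong (us ++_) (LP.unfold-reverse (mir 0 (ℤ.+ suc b)) (map (mir 0) us)) ⟩
    us ++ reverse (map (mir 0) us) ++ mir 0 (ℤ.+ suc b) ∷ [] ≡⟨ sym (LP.++-assoc us _ _) ⟩
    double 0 us ++ mir 0 (ℤ.+ suc b) ∷ [] ≡⟨ cong₂ (λ l c → l ++ c ∷ []) (double-initial b) (shuffle (ℤ.+ b)) ⟩
    initial b ++ (0ℤ - ℤ.+ b) ∷ [] ∎)
    where
    open ≡-Reasoning
    us : List ℤ
    us = initialUpper b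
    shuffle : ∀ b → 1ℤ - (1ℤ + b) ≡ 0ℤ - b
    shuffle = solve-∀

  -- The reflections of consecutive columns differ by one, so they exchange steps up and steps down.
  Step-mir : ∀ j {x y} → Step x y → Step (mir j x) (mir (suc j) y)
  Step-mir j {x} stay = subst (Step (mir j x)) (shuffle (ℤ.+ suc j) x) rise
    where
    shuffle : ∀ s x → 1ℤ + (s - x) ≡ 1ℤ + s - x
    shuffle = solve-∀
  Step-mir j {x} rise = subst (Step (mir j x)) (shuffle (ℤ.+ suc j) x) stay
    where
    shuffle : ∀ s x → s - x ≡ 1ℤ + s - (1ℤ + x)
    shuffle = solve-∀

  double-steps : ∀ j {us ys} → Pointwise Step us ys → Pointwise Step (double j us) (double (suc j) ys)
  double-steps j p = Pw.++⁺ p (Pw.reverse⁺ (Pw.map⁺ (mir j) (mir (suc j)) (Pw.map (Step-mir j) p)))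

  module _ {k : ℤ} where

    insertPair-between : ∀ us ws → All (ℤ.suc k ℤ.≤_) us → All (ℤ._≤ k) ws → insertPair k (us ++ ws) ≡ us ++ ℤ.suc k ∷ k ∷ ws
    insertPair-between []       []       _ _ = refl
    insertPair-between []       (w ∷ ws) _ (h ∷ _) with w ℤ.≤? k
    ... | yes _ = refl
    ... | no ¬h = ⊥-elim (¬h h)
    insertPair-between (u ∷ us) ws (h ∷ a) l with u ℤ.≤? k
    ... | yes g = ⊥-elim (ℤP.<-irrefl refl (ℤP.suc[i]≤j⇒i<j (ℤP.≤-trans h g)))
    ... | no _  = cong (u ∷_) (insertPair-between us ws a l)

  -- The two starts of a hole are mirror images next to the axis, so they fit exactly between the
  -- upper half and its reflection.
  insert-double : ∀ j g {ys} → (∀ {k} → g ≡ just k → ℤ.+ j ≡ k + k) → All (λ c → ℤ.+ suc j ℤ.≤ c + c) ys →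
    insertMaybe g (double j ys) ≡ double j (appendMaybe g ys)
  insert-double j nothing  e u = refl
  insert-double j (just k) {ys} e u = begin
    insertPair k (double j ys)                      ≡⟨ insertPair-between ys _ above below ⟩
    ys ++ ℤ.suc k ∷ k ∷ reverse (map (mir j) ys)    ≡⟨ cong (λ c → ys ++ ℤ.suc k ∷ c ∷ reverse (map (mir j) ys)) k≡ ⟩
    ys ++ ℤ.suc k ∷ mir j (ℤ.suc k) ∷ reverse (map (mir j) ys) ≡⟨ sym (LP.++-assoc ys (ℤ.suc k ∷ []) _) ⟩
    (ys ++ ℤ.suc k ∷ []) ++ mir j (ℤ.suc k) ∷ reverse (map (mir j) ys) ≡⟨ cong ((ys ++ ℤ.suc k ∷ []) ++_) (sym (reverse-map-double j ys (ℤ.suc k ∷ []))) ⟩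
    double j (ys ++ ℤ.suc k ∷ [])                   ∎
    where
    open ≡-Reasoning
    k≡ : k ≡ mir j (ℤ.suc k)
    k≡ = sym (trans (cong (λ u → 1ℤ + u - (1ℤ + k)) (e refl)) (shuffle k))
      where
      shuffle : ∀ k → 1ℤ + (k + k) - (1ℤ + k) ≡ k
      shuffle = solve-∀
    above : All (ℤ.suc k ℤ.≤_) ys
    above = All.map (λ {c} h → halve-< {k} (subst (λ v → ℤ.suc v ℤ.≤ c + c) (e refl) h)) u
    below : All (ℤ._≤ k) (reverse (map (mir j) ys))
    below = All.tabulate λ m → All.lookup (AllP.map⁺ (All.map (λ {c} h → subst (mir j c ℤ.≤_) (sym k≡) (ℤP.+-monoʳ-≤ (ℤ.+ suc j) (ℤP.neg-mono-≤ h))) above)) (AnyP.reverse⁻ m)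

  module _ where

    private
      pairs : ∀ {xs} → Descending xs → AllPairs ℤ._>_ xs
      pairs = LinkedP.Linked⇒AllPairs (λ h g → ℤP.<-trans g h)

      snoc : ∀ {x} ys → AllPairs ℤ._>_ ys → All (ℤ._> x) ys → AllPairs ℤ._>_ (ys ++ x ∷ [])
      snoc []       []       []       = [] ∷ []
      snoc (y ∷ ys) (p ∷ ps) (r ∷ rs) = AllP.++⁺ p (r ∷ []) ∷ snoc ys ps rs

      append : ∀ {xs ys} → AllPairs ℤ._>_ xs → AllPairs ℤ._>_ ys → All (λ x → All (ℤ._< x) ys) xs → AllPairs ℤ._>_ (xs ++ ys)
      append []       qs []       = qs
      append (p ∷ ps) qs (r ∷ rs) = AllP.++⁺ p r ∷ append ps qs rs

      all-reverse : ∀ {P : ℤ → Set} {xs} → All P xs → All P (reverse xs)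
      all-reverse ps = All.tabulate λ m → All.lookup ps (AnyP.reverse⁻ m)

      mirrored : ∀ j us → AllPairs ℤ._>_ us → AllPairs ℤ._>_ (reverse (map (mir j) us))
      mirrored j []       []       = []
      mirrored j (u ∷ us) (h ∷ hs) rewrite LP.unfold-reverse (mir j u) (map (mir j) us) =
        snoc _ (mirrored j us hs) (all-reverse (AllP.map⁺ (All.map (λ g → ℤP.+-monoʳ-< (ℤ.+ suc j) (ℤP.neg-mono-< g)) h)))

      below : ∀ j {x y} → Upper j x → Upper j y → mir j y ℤ.< x
      below j {x} {y} ux uy with x ℤ.≤? mir j y
      ... | no ¬h = ℤP.≰⇒> ¬h
      ... | yes h = ⊥-elim (ℤP.<-irrefl refl (begin-strict
        x + x               ≤⟨ ℤP.+-mono-≤ h h ⟩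
        s - y + (s - y)     ≡⟨ shuffle s y ⟩
        s + (s - (y + y))   <⟨ ℤP.+-monoʳ-< s (ℤP.+-monoʳ-< s (ℤP.neg-mono-< uy)) ⟩
        s + (s - s)         ≡⟨ shuffle′ s ⟩
        s                   <⟨ ux ⟩
        x + x               ∎))
        where
        open ℤP.≤-Reasoning
        s : ℤ
        s = ℤ.+ suc j
        shuffle : ∀ s y → s - y + (s - y) ≡ s + (s - (y + y))
        shuffle = solve-∀
        shuffle′ : ∀ s → s + (s - s) ≡ s
        shuffle′ = solve-∀

    mirrored-descending : ∀ j {xs} → Descending xs → Descending (reverse (map (mir j) xs))
    mirrored-descending j {xs} d = LinkedP.AllPairs⇒Linked (mirrored j xs (pairs d))

    double-descending : ∀ j {us} → UpperState j us → Descending (double j us)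
    double-descending j {us} (d , u) = LinkedP.AllPairs⇒Linked
      (append (pairs d) (mirrored j us (pairs d)) (All.map (λ ux → all-reverse (AllP.map⁺ (All.map (λ {y} uy → below j {y = y} ux uy) u))) u))

    -- Every position of the first half exceeds its own mirror image, which occurs in the second
    -- half; that is what lying above the axis means.
    double-upper : ∀ j us → Descending (double j us) → UpperState j us
    double-upper j us d = LinkedP.AllPairs⇒Linked (proj₁ (split us (pairs d))) , All.tabulate λ {x} x∈ →
      subst (ℤ._< x + x) (shuffle (ℤ.+ suc j) x) (ℤP.+-monoˡ-< x (All.lookup (All.lookup (proj₂ (split us (pairs d))) x∈)
        (AnyP.reverse⁺ (∈-map⁺ (mir j) x∈))))
      where
      shuffle : ∀ s x → s - x + x ≡ s
      shuffle = solve-∀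
      split : ∀ xs {ys} → AllPairs ℤ._>_ (xs ++ ys) → AllPairs ℤ._>_ xs × All (λ x → All (ℤ._< x) ys) xs
      split []       p        = [] , []
      split (x ∷ xs) (p ∷ ps) with split xs ps
      ... | q , r = AllP.++⁻ˡ xs p ∷ q , AllP.++⁻ʳ xs p ∷ r

  module Doubled (a : ℕ) (P₀ : ℤ) (N : ℕ) (mid : ℤ.+ suc a ℤ.< P₀ + P₀)
    (gap : ℕ → Maybe ℤ) (gap-even : ∀ {j k} → gap j ≡ just k → ℤ.+ j ≡ k + k) where

    open Middle a P₀ N mid

    private
      module S = System (λ j → insertMaybe (gap j)) (λ _ → Descending) (λ _ → descending?) Final final?
      module U = System (λ j → appendMaybe (gap j)) UpperState upperState? FinalUpper finalUpper?

      insert≡ : ∀ j {us ys} → UpperState j us → Pointwise Step us ys →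
        insertMaybe (gap (suc j)) (double (suc j) ys) ≡ double (suc j) (appendMaybe (gap (suc j)) ys)
      insert≡ j {us} {ys} v p = insert-double (suc j) (gap (suc j)) gap-even (weak v p)
        where
        weak : ∀ {us ys} → UpperState j us → Pointwise Step us ys → All (λ c → ℤ.+ suc (suc j) ℤ.≤ c + c) ys
        weak (_ , u) p = go u p
          where
          go : ∀ {us ys} → All (Upper j) us → Pointwise Step us ys → All (λ c → ℤ.+ suc (suc j) ℤ.≤ c + c) ys
          go []      []      = []
          go (u ∷ a) (s ∷ p) = step-upper u s ∷ go a p

      split-steps : ∀ us {ws zs} → Pointwise Step (us ++ ws) zs →
        ∃ λ ys → ∃ λ vs → zs ≡ ys ++ vs × Pointwise Step us ys × Pointwise Step ws vs
      split-steps []       p       = [] , _ , refl , [] , p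
      split-steps (u ∷ us) (s ∷ p) with split-steps us p
      ... | ys , vs , refl , p₁ , p₂ = _ ∷ ys , vs , refl , s ∷ p₁ , p₂

    double-chain : ∀ {n j us h} → j ℕ.+ n ≡ a → UpperState j us → U.Chain n j us h → S.Chain n j (double j us) (doubleChain j h)
    double-chain {zero} {j} {us} t v (U.done f) with trans (sym (ℕP.+-identityʳ j)) t
    ... | refl = S.done (double-symmetric a us ,
      AllP.++⁺ (All.map inj₁ f) (All.tabulate λ m → All.lookup {P = λ c → InRange c ⊎ InRange (mirror c)} (AllP.map⁺ (All.map (λ {c} r → inj₂ (subst InRange (sym (mir-involutive a c)) r)) f)) (AnyP.reverse⁻ m)))
    double-chain {suc n} {j} t v (U.link (p , v′) c) = S.link
      (double-steps j p , subst Descending (sym (insert≡ j v p)) (double-descending (suc j) v′))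
      (subst (λ xs → S.Chain n (suc j) xs _) (sym (insert≡ j v p)) (double-chain (trans (sym (ℕP.+-suc j n)) t) v′ c))

    -- Each state is cut in the middle of the list. Symmetry recovers the second half from the
    -- first, and strict descent of the whole state puts the first half above the axis.
    halve-chain : ∀ {n j us h} → j ℕ.+ n ≡ a → UpperState j us → S.Chain n j (double j us) h → SymmetricChain j h →
      ∃ λ h′ → h ≡ doubleChain j h′ × U.Chain n j us h′
    halve-chain {zero} {j} {us} t v (S.done (s , f)) [] with trans (sym (ℕP.+-identityʳ j)) t
    ... | refl = [] , refl , U.done (All.tabulate λ {c} c∈ → inside (All.lookup (proj₂ v) c∈) (All.lookup (AllP.++⁻ˡ us f) c∈))
      where
      inside : ∀ {c} → Upper a c → InRange c ⊎ InRange (mirror c) → InRange c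
      inside u (inj₁ r) = r
      inside {c} u (inj₂ (h , _)) = ⊥-elim (separated {mirror c} {c} h (ℤP.≤-trans h (ℤP.<⇒≤ lower)) (mirror-involutive c))
        where
        shuffle : ∀ c → c + c - c ≡ c
        shuffle = solve-∀
        lower : mirror c ℤ.< c
        lower = subst (mirror c ℤ.<_) (shuffle c) (ℤP.+-monoˡ-< (- c) u)
    halve-chain {suc n} {j} {us} t v (S.link (p , d) c) (s ∷ sc) with split-steps us p
    ... | ys , vs , refl , p₁ , p₂ with symmetric⇒double (suc j) ys vs
            (trans (sym (Pw.Pointwise-length p₁)) (trans (sym (length-mir j us)) (Pw.Pointwise-length p₂))) s
    ...   | e rewrite e with halve-chain {us = appendMaybe (gap (suc j)) ys} (trans (sym (ℕP.+-suc j n)) t)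
              (double-upper (suc j) _ (subst Descending (insert≡ j v p₁) d)) (subst (λ xs → S.Chain n (suc j) xs _) (insert≡ j v p₁) c) sc
    ...     | h′ , refl , c′ = ys ∷ h′ , refl , U.link (p₁ , double-upper (suc j) _ (subst Descending (insert≡ j v p₁) d)) c′

-- Counting by bijections between lists without repetitions.

module Counting where

  open import Data.Empty using (⊥-elim)
  open import Data.Integer as ℤ using (ℤ)
  import Data.Integer.Properties as ℤP
  open import Data.List using (List; []; _∷_; _++_; map; length; filter; concatMap)
  import Data.List.Properties as LP
  open import Data.List.Membership.Propositional using (_∈_; find)
  open import Data.List.Membership.Propositional.Properties
  open import Data.List.Relation.Unary.All as All using (All; []; _∷_)
  open import Data.List.Relation.Unary.AllPairs using ([]; _∷_)
  open import Data.List.Relation.Unary.Any using (here; there)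
  open import Data.List.Relation.Unary.Unique.Propositional using (Unique)
  import Data.List.Relation.Unary.Unique.Propositional.Properties as UniqueP
  open import Data.Nat as ℕ using (ℕ; zero; suc)
  import Data.Nat.Properties as ℕP
  open import Data.Product using (_×_; _,_; ∃; proj₁; proj₂)
  open import Data.Sum using (_⊎_; inj₁; inj₂)
  open import Function using (_∘_)
  open import Relation.Binary.PropositionalEquality
  open import Relation.Nullary using (¬_; yes; no)
  open import Relation.Unary using (Decidable)
  open import Defs
  open PathSystems

  module _ {A B : Set} where

    injection-≤ : ∀ (f : A → B) xs ys → Unique xs → (∀ {x} → x ∈ xs → f x ∈ ys) →
      (∀ {x y} → x ∈ xs → y ∈ xs → f x ≡ f y → x ≡ y) → length xs ℕ.≤ length ys
    injection-≤ f []       ys u into inj = ℕ.z≤n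
    injection-≤ f (x ∷ xs) ys (x∉ ∷ u) into inj with ∈-∃++ (into (here refl))
    ... | as , bs , refl rewrite LP.length-++-sucʳ as (f x) bs = ℕ.s≤s (injection-≤ f xs (as ++ bs) u
      (λ {y} y∈ → remove y y∈ (∈-++⁻ as (into (there y∈)))) (λ p q → inj (there p) (there q)))
      where
      remove : ∀ y → y ∈ xs → f y ∈ as ⊎ f y ∈ f x ∷ bs → f y ∈ as ++ bs
      remove y y∈ (inj₁ m)         = ∈-++⁺ˡ m
      remove y y∈ (inj₂ (there m)) = ∈-++⁺ʳ as m
      remove y y∈ (inj₂ (here e))  = ⊥-elim (All.lookup x∉ y∈ (inj (here refl) (there y∈) (sym e)))

  bijection-length : ∀ {A B : Set} (f : A → B) xs ys → Unique xs → Unique ys → (∀ {x} → x ∈ xs → f x ∈ ys) →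
    (∀ {x y} → x ∈ xs → y ∈ xs → f x ≡ f y → x ≡ y) → (∀ {y} → y ∈ ys → ∃ λ x → x ∈ xs × f x ≡ y) → length xs ≡ length ys
  bijection-length f xs ys ux uy into inj onto = ℕP.≤-antisym (injection-≤ f xs ys ux into inj)
    (subst (length ys ℕ.≤_) (LP.length-map f xs) (injection-≤ (λ y → y) ys (map f xs) uy image (λ _ _ e → e)))
    where
    image : ∀ {y} → y ∈ ys → y ∈ map f xs
    image y∈ with onto y∈
    ... | x , x∈ , refl = ∈-map⁺ f x∈

  module _ {A : Set} where

    sublists-⊆ : ∀ (L : List A) {T x} → T ∈ sublists L → x ∈ T → x ∈ L
    sublists-⊆ []      (here refl) x∈ = x∈
    sublists-⊆ (y ∷ L) T∈ x∈ with ∈-++⁻ (sublists L) T∈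
    ... | inj₁ m = there (sublists-⊆ L m x∈)
    ... | inj₂ m with ∈-map⁻ (y ∷_) m | x∈
    ...   | T′ , m′ , refl | here e   = here e
    ...   | T′ , m′ , refl | there x∈′ = there (sublists-⊆ L m′ x∈′)

    sublist-unique : ∀ {L : List A} {T} → Unique L → T ∈ sublists L → Unique T
    sublist-unique {[]}    u (here refl) = []
    sublist-unique {y ∷ L} (y∉ ∷ u) T∈ with ∈-++⁻ (sublists L) T∈
    ... | inj₁ m = sublist-unique u m
    ... | inj₂ m with ∈-map⁻ (y ∷_) m
    ...   | T′ , m′ , refl = All.tabulate (λ x∈ → All.lookup y∉ (sublists-⊆ L m′ x∈)) ∷ sublist-unique u m′

    filter∈sublists : ∀ {P : A → Set} (P? : Decidable P) L → filter P? L ∈ sublists L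
    filter∈sublists P? []      = here refl
    filter∈sublists P? (x ∷ L) with P? x
    ... | yes _ = ∈-++⁺ʳ (sublists L) (∈-map⁺ (x ∷_) (filter∈sublists P? L))
    ... | no  _ = ∈-++⁺ˡ (filter∈sublists P? L)

    sublists-unique : ∀ {L : List A} → Unique L → Unique (sublists L)
    sublists-unique {[]}    u = [] ∷ []
    sublists-unique {y ∷ L} (y∉ ∷ u) = UniqueP.++⁺ (sublists-unique u) (UniqueP.map⁺ (proj₂ ∘ LP.∷-injective) (sublists-unique u)) disjoint
      where
      disjoint : ∀ {T} → ¬ (T ∈ sublists L × T ∈ map (y ∷_) (sublists L))
      disjoint (m , m′) with ∈-map⁻ (y ∷_) m′
      ... | T′ , _ , refl = All.lookup y∉ (sublists-⊆ L m (here refl)) refl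

    -- Sublists inherit the order of `L`, so they behave as sets. Tilings, which are counted as
    -- sublists, may thus be compared by membership.
    sublists-ext : ∀ {L : List A} {T T′} → Unique L → T ∈ sublists L → T′ ∈ sublists L →
      (∀ {x} → x ∈ T → x ∈ T′) → (∀ {x} → x ∈ T′ → x ∈ T) → T ≡ T′
    sublists-ext {[]} u (here refl) (here refl) f g = refl
    sublists-ext {y ∷ L} (y∉ ∷ u) T∈ T′∈ f g with ∈-++⁻ (sublists L) T∈ | ∈-++⁻ (sublists L) T′∈
    ... | inj₁ m | inj₁ m′ = sublists-ext u m m′ f g
    ... | inj₁ m | inj₂ m′ with ∈-map⁻ (y ∷_) m′
    ...   | S′ , s′ , refl = ⊥-elim (All.lookup y∉ (sublists-⊆ L m (g (here refl))) refl)
    sublists-ext {y ∷ L} (y∉ ∷ u) T∈ T′∈ f g | inj₂ m | inj₁ m′ with ∈-map⁻ (y ∷_) m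
    ...   | S , s , refl = ⊥-elim (All.lookup y∉ (sublists-⊆ L m′ (f (here refl))) refl)
    sublists-ext {y ∷ L} (y∉ ∷ u) T∈ T′∈ f g | inj₂ m | inj₂ m′ with ∈-map⁻ (y ∷_) m | ∈-map⁻ (y ∷_) m′
    ...   | S , s , refl | S′ , s′ , refl = cong (y ∷_) (sublists-ext u s s′ (λ x∈ → strip s x∈ (f (there x∈))) (λ x∈ → strip s′ x∈ (g (there x∈))))
      where
      strip : ∀ {S S′ x} → S ∈ sublists L → x ∈ S → x ∈ y ∷ S′ → x ∈ S′
      strip s x∈ (there m) = m
      strip s x∈ (here refl) = ⊥-elim (All.lookup y∉ (sublists-⊆ L s x∈) refl)

    module _ {P : A → Set} (P? : Decidable P) where

      -- Coverage is defined as a length; with the converse `one⁺` this replaces coverage 1 by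
      -- existence and uniqueness.
      one⁻ : ∀ T → length (filter P? T) ≡ 1 → ∃ λ x → (x ∈ T × P x) × (∀ {y} → y ∈ T → P y → y ≡ x)
      one⁻ T e with filter P? T in eq
      ... | x ∷ [] = x , ∈-filter⁻ P? (subst (x ∈_) (sym eq) (here refl)) , λ y∈ py → only (subst (_ ∈_) eq (∈-filter⁺ P? y∈ py))
        where
        only : ∀ {y} → y ∈ x ∷ [] → y ≡ x
        only (here e) = e

      one⁺ : ∀ {T x} → Unique T → x ∈ T → P x → (∀ {y} → y ∈ T → P y → y ≡ x) → length (filter P? T) ≡ 1
      one⁺ {T} {x} u x∈ px only with filter P? T in eq
      ... | [] with () ← subst (x ∈_) eq (∈-filter⁺ P? x∈ px)
      ... | y ∷ [] = refl
      ... | y ∷ z ∷ zs with subst Unique eq (UniqueP.filter⁺ P? u)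
      ...   | (y≢z ∷ _) ∷ _ = ⊥-elim (y≢z (trans (is (here refl)) (sym (is (there (here refl))))))
        where
        is : ∀ {w} → w ∈ y ∷ z ∷ zs → w ≡ x
        is m with ∈-filter⁻ P? (subst (_ ∈_) (sym eq) m)
        ... | w∈ , pw = only w∈ pw

  allSteps-unique : ∀ xs → Unique (allSteps xs)
  allSteps-unique []       = [] ∷ []
  allSteps-unique (x ∷ xs) = UniqueP.++⁺ (UniqueP.map⁺ (proj₂ ∘ LP.∷-injective) (allSteps-unique xs))
                                         (UniqueP.map⁺ (proj₂ ∘ LP.∷-injective) (allSteps-unique xs)) disjoint
    where
    disjoint : ∀ {ys} → ¬ (ys ∈ map (x ∷_) (allSteps xs) × ys ∈ map (ℤ.suc x ∷_) (allSteps xs))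
    disjoint (m , m′) with ∈-map⁻ (x ∷_) m | ∈-map⁻ (ℤ.suc x ∷_) m′
    ... | zs , _ , refl | ws , _ , e = ℤP.<-irrefl (proj₁ (LP.∷-injective e)) (ℤP.suc[i]≤j⇒i<j ℤP.≤-refl)

  module _ (insert : ℕ → List ℤ → List ℤ)
    (Valid : ℕ → List ℤ → Set) (valid? : ∀ j → Decidable (Valid j))
    (Final : List ℤ → Set) (final? : Decidable Final) where

    open System insert Valid valid? Final final?

    private
      prefixed-unique : ∀ (f : List ℤ → List (List (List ℤ))) → (∀ ys → Unique (f ys)) → ∀ {yss} → Unique yss →
        Unique (concatMap (λ ys → map (ys ∷_) (f ys)) yss)
      prefixed-unique f u [] = []
      prefixed-unique f u {ys ∷ yss} (ys∉ ∷ uy) = UniqueP.++⁺ (UniqueP.map⁺ (proj₂ ∘ LP.∷-injective) (u ys)) (prefixed-unique f u uy) disjoint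
        where
        disjoint : ∀ {h} → ¬ (h ∈ map (ys ∷_) (f ys) × h ∈ concatMap (λ ys → map (ys ∷_) (f ys)) yss)
        disjoint (m , m′) with ∈-map⁻ (ys ∷_) m | find (∈-concatMap⁻ (λ ys → map (ys ∷_) (f ys)) {xs = yss} m′)
        ... | h′ , _ , refl | zs , zs∈ , h∈ with ∈-map⁻ (zs ∷_) h∈
        ...   | _ , _ , refl = All.lookup ys∉ zs∈ refl

    chains-unique : ∀ n j xs → Unique (chains n j xs)
    chains-unique zero    j xs with final? xs
    ... | yes _ = [] ∷ []
    ... | no  _ = []
    chains-unique (suc n) j xs = prefixed-unique (λ ys → chains n (suc j) (insert (suc j) ys)) (λ ys → chains-unique n (suc j) _)
      (UniqueP.filter⁺ (λ ys → valid? (suc j) (insert (suc j) ys)) (allSteps-unique xs))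

-- Lozenge tilings as perfect matchings of unit triangles.

module LozengeTilings where

  open import Data.Integer as ℤ using (ℤ; _+_; _-_; -_; 1ℤ)
  import Data.Integer.Properties as ℤP
  open import Data.Integer.Tactic.RingSolver using (solve-∀)
  open import Data.List using (List; []; _∷_; length; concatMap)
  open import Data.List.Membership.Propositional using (_∈_; find; lose)
  open import Data.List.Membership.Propositional.Properties
  open import Data.List.Relation.Unary.All as All using (All; []; _∷_)
  open import Data.List.Relation.Unary.AllPairs using ([]; _∷_)
  open import Data.List.Relation.Unary.Any using (here; there)
  open import Data.List.Relation.Unary.Unique.Propositional using (Unique)
  import Data.List.Relation.Unary.Unique.Propositional.Properties as UniqueP
  open import Data.Nat using (suc)
  open import Data.Product using (_×_; _,_; ∃; ∃₂; proj₁; proj₂)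
  open import Data.Product.Properties using (,-injectiveˡ; ,-injectiveʳ)
  open import Data.Sum using (_⊎_; inj₁; inj₂)
  open import Relation.Binary.PropositionalEquality
  open import Relation.Nullary using (¬_)
  open import Relation.Nullary.Decidable using (_×-dec_)
  open import Defs
  import Data.List.Membership.DecPropositional _≟ᵀ_ as MemT
  open PathSystems using (Step; stay; rise)
  open Counting

  -- The vertical unit edges are indexed by their column j and their height c; lft j c
  -- and rgt j c are the tips of the unit triangles to their left and to their right.
  opaque
    lft rgt : ℤ → ℤ → Point
    lft j c = c - 1ℤ , j - c
    rgt j c = c , j + 1ℤ - c

    lft-injective : ∀ {j c j′ c′} → lft j c ≡ lft j′ c′ → j ≡ j′ × c ≡ c′
    lft-injective {j} {c} {j′} {c′} e = trans (sym (col j c)) (trans (cong (λ { (p , q) → p + q + 1ℤ }) e) (col j′ c′)) ,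
                                        trans (sym (ht c)) (trans (cong (λ { (p , q) → p + 1ℤ }) e) (ht c′))
      where
      col : ∀ j c → c - 1ℤ + (j - c) + 1ℤ ≡ j
      col = solve-∀
      ht : ∀ c → c - 1ℤ + 1ℤ ≡ c
      ht = solve-∀

    rgt-injective : ∀ {j c j′ c′} → rgt j c ≡ rgt j′ c′ → j ≡ j′ × c ≡ c′
    rgt-injective {j} {c} {j′} {c′} e = trans (sym (col j c)) (trans (cong (λ { (p , q) → p + q - 1ℤ }) e) (col j′ c′)) , cong proj₁ e
      where
      col : ∀ j c → c + (j + 1ℤ - c) - 1ℤ ≡ j
      col = solve-∀

    as-lft : ∀ P → ∃₂ λ j c → P ≡ lft j c
    as-lft (p , q) = p + q + 1ℤ , p + 1ℤ , cong₂ _,_ (e₁ p) (e₂ p q)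
      where
      e₁ : ∀ p → p ≡ p + 1ℤ - 1ℤ
      e₁ = solve-∀
      e₂ : ∀ p q → q ≡ p + q + 1ℤ - (p + 1ℤ)
      e₂ = solve-∀

    as-rgt : ∀ Q → ∃₂ λ j c → Q ≡ rgt j c
    as-rgt (p , q) = p + q - 1ℤ , p , cong (p ,_) (e p q)
      where
      e : ∀ p q → q ≡ p + q - 1ℤ + 1ℤ - p
      e = solve-∀

  -- A level lozenge joins the two triangles at one vertical edge and blocks it for paths. A sloped
  -- lozenge has vertical sides in consecutive columns and carries a path from `x` to `y`.
  Level Slope Adjacent : Point → Point → Set
  Level    P Q = ∃₂ λ j c → P ≡ lft j c × Q ≡ rgt j c
  Slope    P Q = ∃₂ λ j x → ∃ λ y → Step x y × P ≡ lft (1ℤ + j) y × Q ≡ rgt j x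
  Adjacent P Q = Level P Q ⊎ Slope P Q

  level-slope : ∀ {P Q Q′} → Level P Q → Slope P Q′ → Q ≢ Q′
  level-slope (j , c , refl , refl) (j′ , x , y , s , e , refl) e′ with lft-injective e | rgt-injective e′
  ... | refl , _ | e″ , _ = ℤP.<-irrefl (sym e″) (ℤP.suc[i]≤j⇒i<j ℤP.≤-refl)

  private
    i≢suc[i] : ∀ {i} → ℤ.suc i ≢ i
    i≢suc[i] e = ℤP.<-irrefl (sym e) (ℤP.suc[i]≤j⇒i<j ℤP.≤-refl)

  module _ (R : Region) where

    opaque
      unfolding lft

      lozenge⁻ : ∀ {P Q} → (P , Q) ∈ lozengesIn R → (◁ P ∈ R × ▷ Q ∈ R) × Adjacent P Q
      lozenge⁻ {P} {Q} m with ∈-filter⁻ (λ ℓ → All.all? (MemT._∈? R) (halves ℓ)) {xs = concatMap lozengesAt R} m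
      ... | m′ , (l ∷ r ∷ []) with find (∈-concatMap⁻ lozengesAt {xs = R} m′)
      ...   | ◁ (p , q) , _ , here refl = (l , r) , inj₂ (p + q , ℤ.suc p , ℤ.suc p , stay , cong₂ _,_ (e₁ p) (e₂ p q) , cong (ℤ.suc p ,_) (e₃ p q))
        where
        e₁ : ∀ p → p ≡ 1ℤ + p - 1ℤ
        e₁ = solve-∀
        e₂ : ∀ p q → q ≡ 1ℤ + (p + q) - (1ℤ + p)
        e₂ = solve-∀
        e₃ : ∀ p q → q ≡ p + q + 1ℤ - (1ℤ + p)
        e₃ = solve-∀
      ...   | ◁ (p , q) , _ , there (here refl) = (l , r) , inj₂ (p + q , p , ℤ.suc p , rise , cong₂ _,_ (e₁ p) (e₂ p q) , cong (p ,_) (e₃ p q))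
        where
        e₁ : ∀ p → p ≡ 1ℤ + p - 1ℤ
        e₁ = solve-∀
        e₂ : ∀ p q → q ≡ 1ℤ + (p + q) - (1ℤ + p)
        e₂ = solve-∀
        e₃ : ∀ p q → 1ℤ + q ≡ p + q + 1ℤ - p
        e₃ = solve-∀
      ...   | ◁ (p , q) , _ , there (there (here refl)) = (l , r) , inj₁ (p + q + 1ℤ , ℤ.suc p , cong₂ _,_ (e₁ p) (e₂ p q) , cong (ℤ.suc p ,_) (e₃ p q))
        where
        e₁ : ∀ p → p ≡ 1ℤ + p - 1ℤ
        e₁ = solve-∀
        e₂ : ∀ p q → q ≡ p + q + 1ℤ - (1ℤ + p)
        e₂ = solve-∀
        e₃ : ∀ p q → 1ℤ + q ≡ p + q + 1ℤ + 1ℤ - (1ℤ + p)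
        e₃ = solve-∀

      lozenge⁺ : ∀ {P Q} → ◁ P ∈ R → ▷ Q ∈ R → Adjacent P Q → (P , Q) ∈ lozengesIn R
      lozenge⁺ {P} {Q} l r adj = ∈-filter⁺ (λ ℓ → All.all? (MemT._∈? R) (halves ℓ))
        (∈-concatMap⁺ lozengesAt {xs = R} (lose l (at adj))) (l ∷ r ∷ [])
        where
        at : ∀ {P Q} → Adjacent P Q → (P , Q) ∈ lozengesAt (◁ P)
        at (inj₁ (j , c , refl , refl)) = there (there (here (cong ((c - 1ℤ , j - c) ,_) (cong₂ _,_ (e₁ c) (e₂ j c)))))
          where
          e₁ : ∀ c → c ≡ 1ℤ + (c - 1ℤ)
          e₁ = solve-∀
          e₂ : ∀ j c → j + 1ℤ - c ≡ 1ℤ + (j - c)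
          e₂ = solve-∀
        at (inj₂ (j , x , _ , stay , refl , refl)) = here (cong ((x - 1ℤ , 1ℤ + j - x) ,_) (cong₂ _,_ (e₁ x) (e₂ j x)))
          where
          e₁ : ∀ c → c ≡ 1ℤ + (c - 1ℤ)
          e₁ = solve-∀
          e₂ : ∀ j c → j + 1ℤ - c ≡ 1ℤ + j - c
          e₂ = solve-∀
        at (inj₂ (j , x , _ , rise , refl , refl)) = there (here (cong ((1ℤ + x - 1ℤ , 1ℤ + j - (1ℤ + x)) ,_) (cong₂ _,_ (e₁ x) (e₂ j x))))
          where
          e₁ : ∀ c → c ≡ 1ℤ + c - 1ℤ
          e₁ = solve-∀
          e₂ : ∀ j c → j + 1ℤ - c ≡ 1ℤ + (1ℤ + j - (1ℤ + c))
          e₂ = solve-∀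

    lozengesIn-unique : Unique R → Unique (lozengesIn R)
    lozengesIn-unique u = UniqueP.filter⁺ (λ ℓ → All.all? (MemT._∈? R) (halves ℓ)) (go u)
      where
      each : ∀ t → Unique (lozengesAt t)
      each (▷ _)       = []
      each (◁ (p , q)) = ((λ e → i≢suc[i] (,-injectiveˡ (,-injectiveʳ e))) ∷ (λ e → i≢suc[i] (sym (,-injectiveʳ (,-injectiveʳ e)))) ∷ [])
        ∷ ((λ e → i≢suc[i] (sym (,-injectiveˡ (,-injectiveʳ e)))) ∷ []) ∷ [] ∷ []
      tip-of : ∀ t {P Q} → (P , Q) ∈ lozengesAt t → t ≡ ◁ P
      tip-of (◁ (p , q)) (here refl)                 = refl
      tip-of (◁ (p , q)) (there (here refl))         = refl
      tip-of (◁ (p , q)) (there (there (here refl))) = refl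
      go : ∀ {ts} → Unique ts → Unique (concatMap lozengesAt ts)
      go [] = []
      go {t ∷ ts} (t∉ ∷ u) = UniqueP.++⁺ (each t) (go u) disjoint
        where
        disjoint : ∀ {ℓ} → ¬ (ℓ ∈ lozengesAt t × ℓ ∈ concatMap lozengesAt ts)
        disjoint (m , m′) with find (∈-concatMap⁻ lozengesAt {xs = ts} m′)
        ... | t′ , t′∈ , m″ = All.lookup t∉ t′∈ (trans (tip-of t m) (sym (tip-of t′ m″)))

    -- The covering condition as a perfect matching of left- and right-pointing triangles, which is
    -- what following a path from column to column uses.
    record Tiling (T : List Lozenge) : Set where
      field
        sublist    : T ∈ sublists (lozengesIn R)
        leftOnce   : ∀ {P Q Q′} → (P , Q) ∈ T → (P , Q′) ∈ T → Q ≡ Q′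
        rightOnce  : ∀ {P P′ Q} → (P , Q) ∈ T → (P′ , Q) ∈ T → P ≡ P′
        leftTotal  : ∀ {P} → ◁ P ∈ R → ∃ λ Q → (P , Q) ∈ T
        rightTotal : ∀ {Q} → ▷ Q ∈ R → ∃ λ P → (P , Q) ∈ T

      inside : ∀ {P Q} → (P , Q) ∈ T → (◁ P ∈ R × ▷ Q ∈ R) × Adjacent P Q
      inside m = lozenge⁻ (sublists-⊆ (lozengesIn R) sublist m)

    tiles⇒tiling : ∀ {T} → T ∈ sublists (lozengesIn R) → Tiles R T → Tiling T
    tiles⇒tiling {T} s tiles = record
      { sublist = s ; leftOnce = leftOnce ; rightOnce = rightOnce ; leftTotal = leftTotal ; rightTotal = rightTotal }
      where
      covers? : ∀ t → _
      covers? t = λ ℓ → t MemT.∈? halves ℓ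
      inside : ∀ {P Q} → (P , Q) ∈ T → (◁ P ∈ R × ▷ Q ∈ R) × Adjacent P Q
      inside m = lozenge⁻ (sublists-⊆ (lozengesIn R) s m)
      leftOnce : ∀ {P Q Q′} → (P , Q) ∈ T → (P , Q′) ∈ T → Q ≡ Q′
      leftOnce m m′ with one⁻ (covers? (◁ _)) T (All.lookup tiles (proj₁ (proj₁ (inside m))))
      ... | _ , _ , only = ,-injectiveʳ (trans (only m (here refl)) (sym (only m′ (here refl))))
      rightOnce : ∀ {P P′ Q} → (P , Q) ∈ T → (P′ , Q) ∈ T → P ≡ P′
      rightOnce m m′ with one⁻ (covers? (▷ _)) T (All.lookup tiles (proj₂ (proj₁ (inside m))))
      ... | _ , _ , only = ,-injectiveˡ (trans (only m (there (here refl))) (sym (only m′ (there (here refl)))))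
      leftTotal : ∀ {P} → ◁ P ∈ R → ∃ λ Q → (P , Q) ∈ T
      leftTotal P∈ with one⁻ (covers? (◁ _)) T (All.lookup tiles P∈)
      ... | (_ , Q) , (m , here refl) , _ = Q , m
      ... | (_ , Q) , (m , there (here ())) , _
      rightTotal : ∀ {Q} → ▷ Q ∈ R → ∃ λ P → (P , Q) ∈ T
      rightTotal Q∈ with one⁻ (covers? (▷ _)) T (All.lookup tiles Q∈)
      ... | (P , _) , (m , there (here refl)) , _ = P , m
      ... | (P , _) , (m , here ()) , _

    tiling⇒tiles : ∀ {T} → Unique R → Tiling T → Tiles R T
    tiling⇒tiles {T} u t = All.tabulate covered
      where
      open Tiling t
      uT : Unique T
      uT = sublist-unique (lozengesIn-unique u) sublist
      covered : ∀ {t} → t ∈ R → coverage t T ≡ 1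
      covered {◁ P} P∈ with leftTotal P∈
      ... | Q , m = one⁺ (λ ℓ → ◁ P MemT.∈? halves ℓ) uT m (here refl) only
        where
        only : ∀ {ℓ} → ℓ ∈ T → ◁ P ∈ halves ℓ → ℓ ≡ (P , Q)
        only m′ (here refl) = cong (P ,_) (leftOnce m′ m)
        only m′ (there (here ()))
      covered {▷ Q} Q∈ with rightTotal Q∈
      ... | P , m = one⁺ (λ ℓ → ▷ Q MemT.∈? halves ℓ) uT m (there (here refl)) only
        where
        only : ∀ {ℓ} → ℓ ∈ T → ▷ Q ∈ halves ℓ → ℓ ≡ (P , Q)
        only m′ (there (here refl)) = cong (_, Q) (rightOnce m′ m)
        only m′ (here ())

    -- Both tilings have exactly one lozenge over each left-pointing triangle.
    tiling-⊆ : ∀ {T T′} → Unique R → Tiling T → Tiling T′ → (∀ {ℓ} → ℓ ∈ T → ℓ ∈ T′) → T ≡ T′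
    tiling-⊆ {T} {T′} u t t′ T⊆ = sublists-ext (lozengesIn-unique u) (sublist t) (sublist t′) T⊆ back
      where
      open Tiling
      back : ∀ {ℓ} → ℓ ∈ T′ → ℓ ∈ T
      back {P , Q} m with leftTotal t (proj₁ (proj₁ (inside t′ m)))
      ... | Q′ , m′ = subst (λ Q → (P , Q) ∈ T) (leftOnce t′ (T⊆ m′) m) m′

    M-tilings : ∀ {A : Set} (σs : List Symmetry) (f : A → List Lozenge) xs → Unique R → Unique xs →
      (∀ {x} → x ∈ xs → Tiling (f x) × All (λ σ → Invariant σ (f x)) σs) →
      (∀ {x y} → x ∈ xs → y ∈ xs → f x ≡ f y → x ≡ y) →
      (∀ {T} → Tiling T → All (λ σ → Invariant σ T) σs → ∃ λ x → x ∈ xs × f x ≡ T) →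
      length xs ≡ M σs R
    M-tilings σs f xs uR ux into inj onto = bijection-length f xs _ ux
      (UniqueP.filter⁺ good? (sublists-unique (lozengesIn-unique uR)))
      (λ x∈ → ∈-filter⁺ good? (Tiling.sublist (proj₁ (into x∈))) (tiling⇒tiles uR (proj₁ (into x∈)) , proj₂ (into x∈)))
      inj
      (λ T∈ → let (s , tiles , inv) = ∈-filter⁻ good? {xs = sublists (lozengesIn R)} T∈ in onto (tiles⇒tiling s tiles) inv)
      where
      good? : ∀ T → _
      good? T = tiles? R T ×-dec All.all? (λ σ → invariant? σ T) σs

-- Path systems as sets of steps.

module PathSteps where

  open import Data.Empty using (⊥-elim)
  open import Data.Integer as ℤ using (ℤ; _+_; _-_; -_; 1ℤ)
  import Data.Integer.Properties as ℤP
  open import Data.Integer.Tactic.RingSolver using (solve-∀)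
  open import Data.List using (List; []; _∷_; _++_; map; length; reverse; zipWith)
  import Data.List.Properties as LP
  open import Data.List.Membership.Propositional using (_∈_)
  open import Data.List.Membership.Propositional.Properties
  open import Data.List.Relation.Binary.Pointwise as Pw using (Pointwise; []; _∷_)
  open import Data.List.Relation.Unary.All as All using (All; []; _∷_)
  import Data.List.Relation.Unary.All.Properties as AllP
  open import Data.List.Relation.Unary.AllPairs using (AllPairs; []; _∷_)
  open import Data.List.Relation.Unary.Any using (here; there)
  import Data.List.Relation.Unary.Any.Properties as AnyP
  open import Data.List.Relation.Unary.Linked using ([]; [-]; _∷_)
  import Data.List.Relation.Unary.Linked.Properties as LinkedP
  open import Data.Maybe using (Maybe; just; nothing)
  open import Data.Nat as ℕ using (ℕ; zero; suc)
  import Data.Nat.Properties as ℕP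
  open import Data.Product using (_×_; _,_; ∃; proj₁; proj₂)
  open import Data.Sum using (_⊎_; inj₁; inj₂)
  open import Relation.Binary.PropositionalEquality
  open import Relation.Nullary using (¬_; yes; no)
  open import Relation.Unary using (Decidable)
  open PathSystems
  open Doubling

  descending⇒pairs : ∀ {xs} → Descending xs → AllPairs ℤ._>_ xs
  descending⇒pairs = LinkedP.Linked⇒AllPairs (λ h g → ℤP.<-trans g h)

  -- c ∈ᵍ g: the gap g is present and c is one of the two positions where its paths start.
  _∈ᵍ_ : ℤ → Maybe ℤ → Set
  c ∈ᵍ g = ∃ λ k → g ≡ just k × (c ≡ ℤ.suc k ⊎ c ≡ k)

  ∈-insertPair⁻ : ∀ k xs {c} → c ∈ insertPair k xs → c ∈ xs ⊎ (c ≡ ℤ.suc k ⊎ c ≡ k)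
  ∈-insertPair⁻ k xs c∈ with insertPair-split k xs
  ... | as , bs , refl , e rewrite e with ∈-++⁻ as c∈
  ...   | inj₁ m = inj₁ (∈-++⁺ˡ m)
  ...   | inj₂ (here e′) = inj₂ (inj₁ e′)
  ...   | inj₂ (there (here e′)) = inj₂ (inj₂ e′)
  ...   | inj₂ (there (there m)) = inj₁ (∈-++⁺ʳ as m)

  ∈-insertPair⁺ : ∀ k xs {c} → c ∈ xs ⊎ (c ≡ ℤ.suc k ⊎ c ≡ k) → c ∈ insertPair k xs
  ∈-insertPair⁺ k xs c∈ with insertPair-split k xs
  ∈-insertPair⁺ k xs (inj₁ c∈) | as , bs , refl , e rewrite e with ∈-++⁻ as c∈
  ... | inj₁ m = ∈-++⁺ˡ m
  ... | inj₂ m = ∈-++⁺ʳ as (there (there m))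
  ∈-insertPair⁺ k xs (inj₂ (inj₁ refl)) | as , bs , refl , e rewrite e = ∈-++⁺ʳ as (here refl)
  ∈-insertPair⁺ k xs (inj₂ (inj₂ refl)) | as , bs , refl , e rewrite e = ∈-++⁺ʳ as (there (here refl))

  ∈-insert⁻ : ∀ g xs {c} → c ∈ insertMaybe g xs → c ∈ xs ⊎ c ∈ᵍ g
  ∈-insert⁻ nothing  xs c∈ = inj₁ c∈
  ∈-insert⁻ (just k) xs c∈ with ∈-insertPair⁻ k xs c∈
  ... | inj₁ m = inj₁ m
  ... | inj₂ e = inj₂ (k , refl , e)

  ∈-insert⁺ˡ : ∀ g xs {c} → c ∈ xs → c ∈ insertMaybe g xs
  ∈-insert⁺ˡ nothing  xs c∈ = c∈
  ∈-insert⁺ˡ (just k) xs c∈ = ∈-insertPair⁺ k xs (inj₁ c∈)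

  ∈-insert⁺ʳ : ∀ g xs {c} → c ∈ᵍ g → c ∈ insertMaybe g xs
  ∈-insert⁺ʳ (just k) xs (_ , refl , e) = ∈-insertPair⁺ k xs (inj₂ e)

  private
    <suc : ∀ {k} → k ℤ.< ℤ.suc k
    <suc = ℤP.suc[i]≤j⇒i<j ℤP.≤-refl

  -- This keeps paths out of the holes: an arrival on the vertical side of a hole would collide with
  -- a path that starts there.
  insert-fresh : ∀ g xs {c} → Descending (insertMaybe g xs) → c ∈ xs → ¬ c ∈ᵍ g
  insert-fresh (just k) xs {c} d c∈ (_ , refl , e) with insertPair-split k xs
  ... | as , bs , refl , e′ rewrite e′ = go as (descending⇒pairs d) (∈-++⁻ as c∈) e
    where
    split : ∀ as {bs} → AllPairs ℤ._>_ (as ++ bs) → All (λ x → All (ℤ._< x) bs) as × AllPairs ℤ._>_ bs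
    split []       p        = [] , p
    split (x ∷ as) (p ∷ ps) with split as ps
    ... | q , r = AllP.++⁻ʳ as p ∷ q , r
    go : ∀ as {bs} → AllPairs ℤ._>_ (as ++ ℤ.suc k ∷ k ∷ bs) → c ∈ as ⊎ c ∈ bs → ¬ (c ≡ ℤ.suc k ⊎ c ≡ k)
    go as p (inj₁ m) e with split as p
    go as p (inj₁ m) (inj₁ refl) | q , _ = ℤP.<-irrefl refl (All.head (All.lookup q m))
    go as p (inj₁ m) (inj₂ refl) | q , _ = ℤP.<-asym (All.head (All.lookup q m)) <suc
    go as p (inj₂ m) e with split as p
    go as p (inj₂ m) (inj₁ refl) | _ , (_ ∷ l) ∷ _ ∷ _ = ℤP.<-irrefl refl (All.lookup l m)
    go as p (inj₂ m) (inj₂ refl) | _ , _ ∷ l ∷ _ = ℤP.<-irrefl refl (All.lookup l m)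

  insert-descending : ∀ g {xs} → Descending xs → (∀ {c} → c ∈ xs → ¬ c ∈ᵍ g) → Descending (insertMaybe g xs)
  insert-descending nothing  d f = d
  insert-descending (just k) d f = go d (λ c∈ e → f c∈ (k , refl , e))
    where
    above : ∀ {x} → ¬ x ℤ.≤ k → x ≢ ℤ.suc k → ℤ.suc k ℤ.< x
    above h ne = ℤP.≤∧≢⇒< (ℤP.i<j⇒suc[i]≤j (ℤP.≰⇒> h)) (λ e → ne (sym e))
    go : ∀ {xs} → Descending xs → (∀ {c} → c ∈ xs → ¬ (c ≡ ℤ.suc k ⊎ c ≡ k)) → Descending (insertPair k xs)
    go {[]} d f = <suc ∷ [-]
    go {x ∷ xs} d f with x ℤ.≤? k
    ... | yes h = <suc ∷ (ℤP.≤∧≢⇒< h (λ e → f (here refl) (inj₂ e)) ∷ d)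
    go {x ∷ []} d f | no h = above h (λ e → f (here refl) (inj₁ e)) ∷ (<suc ∷ [-])
    go {x ∷ y ∷ xs} (g ∷ d) f | no h with go {y ∷ xs} d (λ c∈ → f (there c∈))
    ... | d′ with y ℤ.≤? k
    ...   | yes _ = above h (λ e → f (here refl) (inj₁ e)) ∷ d′
    ...   | no  _ = g ∷ d′

  module _ {xs ys : List ℤ} where

    descending-ext : Descending xs → Descending ys → (∀ {c} → c ∈ xs → c ∈ ys) → (∀ {c} → c ∈ ys → c ∈ xs) → xs ≡ ys
    descending-ext d d′ f g = go (descending⇒pairs d) (descending⇒pairs d′) f g
      where
      go : ∀ {xs ys} → AllPairs ℤ._>_ xs → AllPairs ℤ._>_ ys → (∀ {c} → c ∈ xs → c ∈ ys) → (∀ {c} → c ∈ ys → c ∈ xs) → xs ≡ ys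
      go {[]}     {[]}     p q f g = refl
      go {[]}     {y ∷ ys} p q f g with () ← g (here refl)
      go {x ∷ xs} {[]}     p q f g with () ← f (here refl)
      go {x ∷ xs} {y ∷ ys} (p ∷ ps) (q ∷ qs) f g with x≡y
        where
        x≡y : x ≡ y
        x≡y with f (here refl) | g (here refl)
        ... | here e   | _        = e
        ... | there _  | here e   = sym e
        ... | there m  | there m′ = ⊥-elim (ℤP.<-asym (All.lookup q m) (All.lookup p m′))
      ... | refl = cong (x ∷_) (go ps qs (λ m → strip p m (f (there m))) (λ m → strip q m (g (there m))))
        where
        strip : ∀ {zs ws c} → All (ℤ._< x) zs → c ∈ zs → c ∈ x ∷ ws → c ∈ ws
        strip p m (there m′) = m′
        strip p m (here refl) = ⊥-elim (ℤP.<-irrefl refl (All.lookup p m))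

  Triple : Set
  Triple = ℕ × ℤ × ℤ

  zipAt : ℕ → List ℤ → List ℤ → List Triple
  zipAt j = zipWith λ x y → j , x , y

  module PathPairs (gap : ℕ → Maybe ℤ) (Final : List ℤ → Set) (final? : Decidable Final) where

    open System (λ j → insertMaybe (gap j)) (λ _ → Descending) (λ _ → descending?) Final final?

    -- All steps of the system, each with its column and the heights before and after. Unlike
    -- histories, such sets can be compared with sets of lozenges.
    pairsOf : ℕ → List ℤ → List (List ℤ) → List Triple
    pairsOf j xs []       = []
    pairsOf j xs (ys ∷ h) = zipAt j xs ys ++ pairsOf (suc j) (insertMaybe (gap (suc j)) ys) h

    private
      zip⁻ : ∀ {j xs ys i x y} → Pointwise Step xs ys → (i , x , y) ∈ zipAt j xs ys → i ≡ j × x ∈ xs × y ∈ ys × Step x y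
      zip⁻ (s ∷ p) (here refl) = refl , here refl , here refl , s
      zip⁻ (s ∷ p) (there m) with zip⁻ p m
      ... | e , x∈ , y∈ , s′ = e , there x∈ , there y∈ , s′

      zip-right : ∀ j {xs ys x} → Pointwise Step xs ys → x ∈ xs → ∃ λ y → (j , x , y) ∈ zipAt j xs ys
      zip-right j (s ∷ p) (here refl) = _ , here refl
      zip-right j (s ∷ p) (there m) with zip-right j p m
      ... | y , m′ = y , there m′

      zip-left : ∀ j {xs ys y} → Pointwise Step xs ys → y ∈ ys → ∃ λ x → (j , x , y) ∈ zipAt j xs ys
      zip-left j (s ∷ p) (here refl) = _ , here refl
      zip-left j (s ∷ p) (there m) with zip-left j p m
      ... | x , m′ = x , there m′

      zip-functional : ∀ {j xs ys x y y′} → AllPairs ℤ._>_ xs → Pointwise Step xs ys →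
        (j , x , y) ∈ zipAt j xs ys → (j , x , y′) ∈ zipAt j xs ys → y ≡ y′
      zip-functional d (s ∷ p) (here refl) (here refl) = refl
      zip-functional (l ∷ d) (s ∷ p) (here refl) (there m) = ⊥-elim (ℤP.<-irrefl refl (All.lookup l (proj₁ (proj₂ (zip⁻ p m)))))
      zip-functional (l ∷ d) (s ∷ p) (there m) (here refl) = ⊥-elim (ℤP.<-irrefl refl (All.lookup l (proj₁ (proj₂ (zip⁻ p m)))))
      zip-functional (l ∷ d) (s ∷ p) (there m) (there m′) = zip-functional d p m m′

      zip-injective : ∀ {j xs ys x x′ y} → AllPairs ℤ._>_ ys → Pointwise Step xs ys →
        (j , x , y) ∈ zipAt j xs ys → (j , x′ , y) ∈ zipAt j xs ys → x ≡ x′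
      zip-injective d (s ∷ p) (here refl) (here refl) = refl
      zip-injective (l ∷ d) (s ∷ p) (here refl) (there m) = ⊥-elim (ℤP.<-irrefl refl (All.lookup l (proj₁ (proj₂ (proj₂ (zip⁻ p m))))))
      zip-injective (l ∷ d) (s ∷ p) (there m) (here refl) = ⊥-elim (ℤP.<-irrefl refl (All.lookup l (proj₁ (proj₂ (proj₂ (zip⁻ p m))))))
      zip-injective (l ∷ d) (s ∷ p) (there m) (there m′) = zip-injective d p m m′

      uninsert : ∀ g ys → Descending (insertMaybe g ys) → AllPairs ℤ._>_ ys
      uninsert nothing  ys d = descending⇒pairs d
      uninsert (just k) ys d with insertPair-split k ys
      ... | as , bs , refl , e rewrite e = go as (descending⇒pairs d)
        where
        go : ∀ as {u v bs} → AllPairs ℤ._>_ (as ++ u ∷ v ∷ bs) → AllPairs ℤ._>_ (as ++ bs)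
        go []       (_ ∷ _ ∷ p) = p
        go (x ∷ as) (p ∷ ps) = AllP.++⁺ (AllP.++⁻ˡ as p) (All.tail (All.tail (AllP.++⁻ʳ as p))) ∷ go as ps

    pairs-range : ∀ {n j xs h i x y} → Chain n j xs h → (i , x , y) ∈ pairsOf j xs h → j ℕ.≤ i × i ℕ.< j ℕ.+ n × Step x y
    pairs-range {suc n} {j} {xs} {ys ∷ h} (link (p , d) c) m with ∈-++⁻ (zipAt j xs ys) m
    ... | inj₁ m′ with zip⁻ p m′
    ...   | refl , _ , _ , s = ℕP.≤-refl , ℕP.m<m+n j (ℕ.s≤s ℕ.z≤n) , s
    pairs-range {suc n} {j} {xs} {ys ∷ h} {i} (link (p , d) c) m | inj₂ m′ with pairs-range c m′
    ...   | l , u , s = ℕP.<⇒≤ l , subst (i ℕ.<_) (sym (ℕP.+-suc j n)) u , s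

    private
      later-col : ∀ {n j xs h x y} → Chain n (suc j) xs h → ¬ (j , x , y) ∈ pairsOf (suc j) xs h
      later-col c m = ℕP.<-irrefl refl (proj₁ (pairs-range c m))

    pairs-now : ∀ {n j xs ys h x y} → Chain (suc n) j xs (ys ∷ h) → (j , x , y) ∈ pairsOf j xs (ys ∷ h) → x ∈ xs × y ∈ ys
    pairs-now {j = j} {xs} {ys} (link (p , d) c) m with ∈-++⁻ (zipAt j xs ys) m
    ... | inj₂ m′ = ⊥-elim (later-col c m′)
    ... | inj₁ m′ with zip⁻ p m′
    ...   | _ , x∈ , y∈ , _ = x∈ , y∈

    pairs-functional : ∀ {n j xs h i x y y′} → Descending xs → Chain n j xs h →
      (i , x , y) ∈ pairsOf j xs h → (i , x , y′) ∈ pairsOf j xs h → y ≡ y′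
    pairs-functional {suc n} {j} {xs} {ys ∷ h} d (link (p , d′) c) m m′
      with ∈-++⁻ (zipAt j xs ys) m | ∈-++⁻ (zipAt j xs ys) m′
    ... | inj₂ l | inj₂ l′ = pairs-functional d′ c l l′
    ... | inj₁ l | inj₂ l′ with refl , _ ← zip⁻ p l = ⊥-elim (later-col c l′)
    ... | inj₂ l | inj₁ l′ with refl , _ ← zip⁻ p l′ = ⊥-elim (later-col c l)
    ... | inj₁ l | inj₁ l′ with refl , _ ← zip⁻ p l = zip-functional (descending⇒pairs d) p l l′

    pairs-injective : ∀ {n j xs h i x x′ y} → Chain n j xs h →
      (i , x , y) ∈ pairsOf j xs h → (i , x′ , y) ∈ pairsOf j xs h → x ≡ x′
    pairs-injective {suc n} {j} {xs} {ys ∷ h} (link (p , d′) c) m m′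
      with ∈-++⁻ (zipAt j xs ys) m | ∈-++⁻ (zipAt j xs ys) m′
    ... | inj₂ l | inj₂ l′ = pairs-injective c l l′
    ... | inj₁ l | inj₂ l′ with refl , _ ← zip⁻ p l = ⊥-elim (later-col c l′)
    ... | inj₂ l | inj₁ l′ with refl , _ ← zip⁻ p l′ = ⊥-elim (later-col c l)
    ... | inj₁ l | inj₁ l′ with refl , _ ← zip⁻ p l = zip-injective (uninsert (gap (suc j)) ys d′) p l l′

    pairs-from : ∀ {n j xs h x} → Chain (suc n) j xs h → x ∈ xs → ∃ λ y → (j , x , y) ∈ pairsOf j xs h
    pairs-from {j = j} (link (p , d) c) x∈ with zip-right j p x∈
    ... | y , m = y , ∈-++⁺ˡ m

    pairs-next : ∀ {n j xs h i x y} → Chain n j xs h → (i , x , y) ∈ pairsOf j xs h → suc i ℕ.< j ℕ.+ n → ∃ λ z → (suc i , y , z) ∈ pairsOf j xs h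
    pairs-next {suc n} {j} {xs} {ys ∷ h} (link (p , d) c) m lt with ∈-++⁻ (zipAt j xs ys) m
    pairs-next {suc n} {j} {xs} {ys ∷ h} {i} (link (p , d) c) m lt | inj₂ m′ with pairs-next c m′ (subst (suc i ℕ.<_) (ℕP.+-suc j n) lt)
    ... | z , m″ = z , ∈-++⁺ʳ (zipAt j xs ys) m″
    pairs-next {suc n} {j} {xs} {ys ∷ h} (link (p , d) c) m lt | inj₁ m′ with zip⁻ p m′
    pairs-next {suc zero} {j} {xs} {ys ∷ h} (link (p , d) c) m lt | inj₁ m′ | refl , _ , y∈ , _ =
      ⊥-elim (ℕP.<-irrefl refl (subst (suc j ℕ.<_) (trans (ℕP.+-suc j 0) (cong suc (ℕP.+-identityʳ j))) lt))
    pairs-next {suc (suc n)} {j} {xs} {ys ∷ h} (link (p , d) c) m lt | inj₁ m′ | refl , _ , y∈ , _ with pairs-from c (∈-insert⁺ˡ (gap (suc j)) ys y∈)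
    ... | z , m″ = z , ∈-++⁺ʳ (zipAt j xs ys) m″

    pairs-previous : ∀ {n j xs h i x y} → Chain n j xs h → j ℕ.≤ i → (suc i , x , y) ∈ pairsOf j xs h →
      (∃ λ w → (i , w , x) ∈ pairsOf j xs h) ⊎ x ∈ᵍ gap (suc i)
    pairs-previous {suc n} {j} {xs} {ys ∷ h} (link (p , d) c) le m with ∈-++⁻ (zipAt j xs ys) m
    ... | inj₁ m′ with refl , _ ← zip⁻ p m′ = ⊥-elim (ℕP.<-irrefl refl le)
    ... | inj₂ m′ with ℕP.m≤n⇒m<n∨m≡n le
    ...   | inj₁ lt with pairs-previous c lt m′
    ...     | inj₁ (w , m″) = inj₁ (w , ∈-++⁺ʳ (zipAt j xs ys) m″)
    ...     | inj₂ g = inj₂ g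
    pairs-previous {suc n} {j} {xs} {ys ∷ zs ∷ h} (link (p , d) c@(link _ _)) le m | inj₂ m′ | inj₂ refl
      with ∈-insert⁻ (gap (suc j)) ys (proj₁ (pairs-now c m′))
    ... | inj₂ g = inj₂ g
    ... | inj₁ x∈ with zip-left j p x∈
    ...   | w , m″ = inj₁ (w , ∈-++⁺ˡ m″)

    pairs-gap : ∀ {n j xs h i x} → Chain n j xs h → j ℕ.≤ i → suc i ℕ.< j ℕ.+ n → x ∈ᵍ gap (suc i) → ∃ λ y → (suc i , x , y) ∈ pairsOf j xs h
    pairs-gap {zero} {j} {i = i} (done _) le lt g = ⊥-elim (ℕP.<-irrefl refl (ℕP.<-trans (ℕP.n<1+n i) (ℕP.<-≤-trans lt (subst (ℕ._≤ i) (sym (ℕP.+-identityʳ j)) le))))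
    pairs-gap {suc n} {j} {xs} {ys ∷ h} {i} (link (p , d) c) le lt g with ℕP.m≤n⇒m<n∨m≡n le
    ... | inj₁ l with pairs-gap c l (subst (suc i ℕ.<_) (ℕP.+-suc j n) lt) g
    ...   | y , m = y , ∈-++⁺ʳ (zipAt j xs ys) m
    pairs-gap {suc zero} {j} {xs} {ys ∷ h} (link (p , d) c) le lt g | inj₂ refl =
      ⊥-elim (ℕP.<-irrefl refl (subst (suc j ℕ.<_) (trans (ℕP.+-suc j 0) (cong suc (ℕP.+-identityʳ j))) lt))
    pairs-gap {suc (suc n)} {j} {xs} {ys ∷ h} (link (p , d) c) le lt g | inj₂ refl with pairs-from c (∈-insert⁺ʳ (gap (suc j)) ys g)
    ... | y , m = y , ∈-++⁺ʳ (zipAt j xs ys) m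

    -- Carries the condition on the final state over to the steps that end in the last column; the
    -- state after the last insertion is not part of the history.
    pairs-last : ∀ {n j xs h i x y} → Chain n j xs h → (i , x , y) ∈ pairsOf j xs h → suc i ≡ j ℕ.+ n →
      ∃ λ zs → Final zs × y ∈ zs × (∀ {c} → c ∈ zs → (∃ λ w → (i , w , c) ∈ pairsOf j xs h) ⊎ c ∈ᵍ gap (suc i))
    pairs-last {suc n} {j} {xs} {ys ∷ h} (link (p , d) c) m e with ∈-++⁻ (zipAt j xs ys) m
    pairs-last {suc n} {j} {xs} {ys ∷ h} (link (p , d) c) m e | inj₂ m′ with pairs-last c m′ (trans e (ℕP.+-suc j n))
    ... | zs , f , y∈ , back = zs , f , y∈ , λ c∈ → lift (back c∈)
      where
      lift : ∀ {i c} → (∃ λ w → (i , w , c) ∈ pairsOf (suc j) (insertMaybe (gap (suc j)) ys) h) ⊎ c ∈ᵍ gap (suc i) →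
        (∃ λ w → (i , w , c) ∈ pairsOf j xs (ys ∷ h)) ⊎ c ∈ᵍ gap (suc i)
      lift (inj₁ (w , m)) = inj₁ (w , ∈-++⁺ʳ (zipAt j xs ys) m)
      lift (inj₂ g) = inj₂ g
    pairs-last {suc n} {j} {xs} {ys ∷ h} (link (p , d) c) m e | inj₁ m′ with zip⁻ p m′
    pairs-last {suc (suc n)} {j} (link (p , d) c) m e | inj₁ m′ | refl , _ , y∈ , _ =
      ⊥-elim (ℕP.<-irrefl (trans (ℕP.suc-injective (trans e (ℕP.+-suc j (suc n)))) (ℕP.+-suc j n)) (ℕ.s≤s (ℕP.m≤m+n j n)))
    pairs-last {suc zero} {j} {xs} {ys ∷ h} (link (p , d) (done f)) m e | inj₁ m′ | refl , _ , y∈ , _ =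
      insertMaybe (gap (suc j)) ys , f , ∈-insert⁺ˡ (gap (suc j)) ys y∈ , λ c∈ → back (∈-insert⁻ (gap (suc j)) ys c∈)
      where
      back : ∀ {c} → c ∈ ys ⊎ c ∈ᵍ gap (suc j) → (∃ λ w → (j , w , c) ∈ pairsOf j xs (ys ∷ [])) ⊎ c ∈ᵍ gap (suc j)
      back (inj₂ g) = inj₂ g
      back (inj₁ c∈) with zip-left j p c∈
      ... | w , m = inj₁ (w , ∈-++⁺ˡ m)

    chain-unique : ∀ {n j xs h h′} → Chain n j xs h → Chain n j xs h′ →
      (∀ {i x y y′} → (i , x , y) ∈ pairsOf j xs h → (i , x , y′) ∈ pairsOf j xs h′ → y ≡ y′) → h ≡ h′
    chain-unique (done _) (done _) same = refl
    chain-unique {suc n} {j} {xs} {ys ∷ h} {ys′ ∷ h′} (link (p , d) c) (link (p′ , d′) c′) same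
      with zip-same p p′ (λ m m′ → same (∈-++⁺ˡ m) (∈-++⁺ˡ m′))
      where
      zip-same : ∀ {xs ys ys′} → Pointwise Step xs ys → Pointwise Step xs ys′ →
        (∀ {x y y′} → (j , x , y) ∈ zipAt j xs ys → (j , x , y′) ∈ zipAt j xs ys′ → y ≡ y′) → ys ≡ ys′
      zip-same []      []        e = refl
      zip-same (_ ∷ p) (_ ∷ p′) e = cong₂ _∷_ (e (here refl) (here refl)) (zip-same p p′ (λ m m′ → e (there m) (there m′)))
    ... | refl = cong (ys ∷_) (chain-unique c c′ (λ m m′ → same (∈-++⁺ʳ (zipAt j xs ys) m) (∈-++⁺ʳ (zipAt j xs ys) m′)))

    private
      zip-mirror : ∀ j {xs ys x y} → Pointwise Step xs ys → SymmetricAt j xs → SymmetricAt (suc j) ys →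
        (j , x , y) ∈ zipAt j xs ys → (j , mir j x , mir (suc j) y) ∈ zipAt j xs ys
      zip-mirror j {xs} {ys} {x} {y} p sx sy m = subst₂ (λ as bs → (j , mir j x , mir (suc j) y) ∈ zipAt j as bs) (sym sx) (sym sy)
        (subst ((j , mir j x , mir (suc j) y) ∈_) (sym (rev (map (mir j) xs) (map (mir (suc j)) ys) (trans (LP.length-map (mir j) xs) (trans (Pw.Pointwise-length p) (sym (LP.length-map (mir (suc j)) ys))))))
          (AnyP.reverse⁺ (mapped p m)))
        where
        mapped : ∀ {xs ys} → Pointwise Step xs ys → (j , x , y) ∈ zipAt j xs ys →
          (j , mir j x , mir (suc j) y) ∈ zipAt j (map (mir j) xs) (map (mir (suc j)) ys)
        mapped (_ ∷ p) (here refl) = here refl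
        mapped (_ ∷ p) (there m)   = there (mapped p m)
        snoc : ∀ as bs {u v} → length as ≡ length bs → zipAt j (as ++ u ∷ []) (bs ++ v ∷ []) ≡ zipAt j as bs ++ (j , u , v) ∷ []
        snoc []       []       e = refl
        snoc (a ∷ as) (b ∷ bs) e = cong ((j , a , b) ∷_) (snoc as bs (ℕP.suc-injective e))
        rev : ∀ as bs → length as ≡ length bs → zipAt j (reverse as) (reverse bs) ≡ reverse (zipAt j as bs)
        rev []       []       e = refl
        rev (a ∷ as) (b ∷ bs) e = begin
          zipAt j (reverse (a ∷ as)) (reverse (b ∷ bs)) ≡⟨ cong₂ (zipAt j) (LP.unfold-reverse a as) (LP.unfold-reverse b bs) ⟩
          zipAt j (reverse as ++ a ∷ []) (reverse bs ++ b ∷ []) ≡⟨ snoc (reverse as) (reverse bs) (trans (LP.length-reverse as) (trans (ℕP.suc-injective e) (sym (LP.length-reverse bs)))) ⟩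
          zipAt j (reverse as) (reverse bs) ++ (j , a , b) ∷ [] ≡⟨ cong (_++ (j , a , b) ∷ []) (rev as bs (ℕP.suc-injective e)) ⟩
          reverse (zipAt j as bs) ++ (j , a , b) ∷ [] ≡⟨ sym (LP.unfold-reverse (j , a , b) (zipAt j as bs)) ⟩
          reverse (zipAt j (a ∷ as) (b ∷ bs)) ∎
          where open ≡-Reasoning

    gap-mirror : (∀ {j k} → gap j ≡ just k → ℤ.+ j ≡ k + k) → ∀ j {c} → c ∈ᵍ gap j → mir j c ∈ᵍ gap j
    gap-mirror gap-even j (k , e , inj₁ refl) = k , e , inj₂ (trans (cong (λ u → 1ℤ + u - (1ℤ + k)) (gap-even e)) (shuffle k))
      where
      shuffle : ∀ k → 1ℤ + (k + k) - (1ℤ + k) ≡ k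
      shuffle = solve-∀
    gap-mirror gap-even j (k , e , inj₂ refl) = k , e , inj₁ (trans (cong (λ u → 1ℤ + u - k) (gap-even e)) (shuffle k))
      where
      shuffle : ∀ k → 1ℤ + (k + k) - k ≡ 1ℤ + k
      shuffle = solve-∀

    -- Arrivals and new starts are symmetric separately, and a descending list is determined by its
    -- members, so the order needs no inspection.
    insert-symmetric : (∀ {j k} → gap j ≡ just k → ℤ.+ j ≡ k + k) → ∀ j {ys} → SymmetricAt j ys → Descending (insertMaybe (gap j) ys) → SymmetricAt j (insertMaybe (gap j) ys)
    insert-symmetric gap-even j {ys} s d = descending-ext d (mirrored-descending j d) (λ m → mirror-member (∈-insert⁻ (gap j) ys m)) λ m → unmirror (∈-map⁻ (mir j) (AnyP.reverse⁻ m))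
      where
      ys-mirror : ∀ {c} → c ∈ ys → mir j c ∈ ys
      ys-mirror {c} m = subst (mir j c ∈_) (sym s) (AnyP.reverse⁺ (∈-map⁺ (mir j) m))
      both : ∀ {c} → c ∈ ys ⊎ c ∈ᵍ gap j → mir j c ∈ insertMaybe (gap j) ys
      both (inj₁ m) = ∈-insert⁺ˡ (gap j) ys (ys-mirror m)
      both (inj₂ g) = ∈-insert⁺ʳ (gap j) ys (gap-mirror gap-even j g)
      mirror-member : ∀ {c} → c ∈ ys ⊎ c ∈ᵍ gap j → c ∈ reverse (map (mir j) (insertMaybe (gap j) ys))
      mirror-member {c} m = AnyP.reverse⁺ (subst (_∈ map (mir j) (insertMaybe (gap j) ys)) (mir-involutive j c) (∈-map⁺ (mir j) (both m)))
      unmirror : ∀ {c} → (∃ λ x → x ∈ insertMaybe (gap j) ys × c ≡ mir j x) → c ∈ insertMaybe (gap j) ys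
      unmirror (x , x∈ , refl) = both (∈-insert⁻ (gap j) ys x∈)

    pairs-mirror : (∀ {j k} → gap j ≡ just k → ℤ.+ j ≡ k + k) → ∀ {n j xs h i x y} → Chain n j xs h → SymmetricAt j xs → SymmetricChain j h →
      (i , x , y) ∈ pairsOf j xs h → (i , mir i x , mir (suc i) y) ∈ pairsOf j xs h
    pairs-mirror ge {suc n} {j} {xs} {ys ∷ h} (link (p , d) c) sx (sy ∷ sc) m with ∈-++⁻ (zipAt j xs ys) m
    ... | inj₁ m′ with refl , _ ← zip⁻ p m′ = ∈-++⁺ˡ (zip-mirror j p sx sy m′)
    ... | inj₂ m′ = ∈-++⁺ʳ (zipAt j xs ys) (pairs-mirror ge c (insert-symmetric ge (suc j) sy d) sc m′)

-- Rotation-invariant tilings correspond to path systems in the left half.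

module TilingsAndPaths where

  open import Data.Empty using (⊥; ⊥-elim)
  open import Data.Integer as ℤ using (ℤ; _+_; _-_; -_; 0ℤ; 1ℤ)
  import Data.Integer.Properties as ℤP
  open import Data.Integer.Tactic.RingSolver using (solve-∀)
  open import Data.List using (List; []; _∷_; _++_; map; length; filter; take; drop)
  import Data.List.Properties as LP
  open import Data.List.Membership.Propositional using (_∈_; _∉_)
  open import Data.List.Membership.Propositional.Properties
  open import Data.List.Relation.Binary.Pointwise as Pw using (Pointwise; []; _∷_)
  open import Data.List.Relation.Unary.All as All using (All; []; _∷_)
  open import Data.List.Relation.Unary.Any using (here; there)
  import Data.List.Relation.Unary.Any.Properties as AnyP
  open import Data.List.Relation.Unary.Linked using ([]; [-]; _∷_)
  open import Data.List.Relation.Unary.Unique.Propositional using (Unique)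
  open import Data.Maybe using (Maybe; just; nothing)
  open import Data.Nat as ℕ using (ℕ; zero; suc)
  import Data.Nat.Properties as ℕP
  open import Data.Product using (_×_; _,_; ∃; ∃₂; proj₁; proj₂)
  open import Data.Sum using (_⊎_; inj₁; inj₂)
  open import Relation.Binary.PropositionalEquality
  open import Relation.Nullary using (¬_; yes; no)
  open import Relation.Nullary.Decidable using (_×-dec_; _⊎-dec_; ¬?)
  open import Relation.Unary using (Decidable)
  open import Defs
  open PathSystems
  open MiddleForms
  open CountSquare
  open Doubling
  open Counting
  open LozengeTilings
  open PathSteps
  import Data.List.Membership.DecPropositional _≟ᴸ_ as MemL
  import Data.List.Membership.DecPropositional _≟ᴾ_ as MemP

  opaque
    unfolding lft

    rotation-lft : ∀ a j c → rotation a (lft j c) ≡ rgt (ℤ.+ a + ℤ.+ a - j) (ℤ.+ suc a - c)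
    rotation-lft a j c = cong₂ _,_ (e₁ (ℤ.+ a) c) (e₂ (ℤ.+ a) j c)
      where
      e₁ : ∀ a c → a - (c - 1ℤ) ≡ 1ℤ + a - c
      e₁ = solve-∀
      e₂ : ∀ a j c → a - (j - c) ≡ a + a - j + 1ℤ - (1ℤ + a - c)
      e₂ = solve-∀

    rotation-rgt : ∀ a j c → rotation a (rgt j c) ≡ lft (ℤ.+ a + ℤ.+ a - j) (ℤ.+ suc a - c)
    rotation-rgt a j c = cong₂ _,_ (e₁ (ℤ.+ a) c) (e₂ (ℤ.+ a) j c)
      where
      e₁ : ∀ a c → a - c ≡ 1ℤ + a - c - 1ℤ
      e₁ = solve-∀
      e₂ : ∀ a j c → a - (j + 1ℤ - c) ≡ a + a - j - (1ℤ + a - c)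
      e₂ = solve-∀

    reflection-lft : ∀ a j c → reflection a (lft j c) ≡ rgt (ℤ.+ a + ℤ.+ a - j) (ℤ.+ a - j + c)
    reflection-lft a j c = cong₂ _,_ (e₁ (ℤ.+ a) j c) (e₂ (ℤ.+ a) j c)
      where
      e₁ : ∀ a j c → a - (j - c) ≡ a - j + c
      e₁ = solve-∀
      e₂ : ∀ a j c → a - (c - 1ℤ) ≡ a + a - j + 1ℤ - (a - j + c)
      e₂ = solve-∀

    reflection-rgt : ∀ a j c → reflection a (rgt j c) ≡ lft (ℤ.+ a + ℤ.+ a - j) (ℤ.+ a - j + c)
    reflection-rgt a j c = cong₂ _,_ (e₁ (ℤ.+ a) j c) (e₂ (ℤ.+ a) j c)
      where
      e₁ : ∀ a j c → a - (j + 1ℤ - c) ≡ a - j + c - 1ℤ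
      e₁ = solve-∀
      e₂ : ∀ a j c → a - c ≡ a + a - j - (a - j + c)
      e₂ = solve-∀

  rotation-involutive : ∀ a P → rotation a (rotation a P) ≡ P
  rotation-involutive a (p , q) = cong₂ _,_ (e (ℤ.+ a) p) (e (ℤ.+ a) q)
    where
    e : ∀ a p → a - (a - p) ≡ p
    e = solve-∀

  -- Composing both symmetries gives the reflection across the horizontal axis.
  flip : ℕ → Point → Point
  flip a P = rotation a (reflection a P)

  flip-lft : ∀ a j c → flip a (lft j c) ≡ lft j (1ℤ + j - c)
  flip-lft a j c = trans (cong (rotation a) (reflection-lft a j c)) (trans (rotation-rgt a _ _) (cong₂ lft (e₁ (ℤ.+ a) j) (e₂ (ℤ.+ a) j c)))
    where
    e₁ : ∀ a j → a + a - (a + a - j) ≡ j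
    e₁ = solve-∀
    e₂ : ∀ a j c → 1ℤ + a - (a - j + c) ≡ 1ℤ + j - c
    e₂ = solve-∀

  flip-rgt : ∀ a j c → flip a (rgt j c) ≡ rgt j (1ℤ + j - c)
  flip-rgt a j c = trans (cong (rotation a) (reflection-rgt a j c)) (trans (rotation-lft a _ _) (cong₂ rgt (e₁ (ℤ.+ a) j) (e₂ (ℤ.+ a) j c)))
    where
    e₁ : ∀ a j → a + a - (a + a - j) ≡ j
    e₁ = solve-∀
    e₂ : ∀ a j c → 1ℤ + a - (a - j + c) ≡ 1ℤ + j - c
    e₂ = solve-∀

  flip-rotation : ∀ a P → flip a (rotation a P) ≡ rotation a (flip a P)
  flip-rotation a (p , q) = refl

  flip-involutive : ∀ a P → flip a (flip a P) ≡ P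
  flip-involutive a (p , q) = cong₂ _,_ (e (ℤ.+ a) p) (e (ℤ.+ a) q)
    where
    e : ∀ a p → a - (a - (a - (a - p))) ≡ p
    e = solve-∀

  reflection-flip : ∀ a P → reflection a P ≡ rotation a (flip a P)
  reflection-flip a P = sym (rotation-involutive a (reflection a P))

  -- Takes the tip of the left half of a level lozenge to the tip of its right half, so that level
  -- lozenges can be recognised by an equality test.
  shift : Point → Point
  shift (p , q) = ℤ.suc p , ℤ.suc q

  opaque
    unfolding lft

    shift-lft : ∀ j c → shift (lft j c) ≡ rgt j c
    shift-lft j c = cong₂ _,_ (e₁ c) (e₂ j c)
      where
      e₁ : ∀ c → 1ℤ + (c - 1ℤ) ≡ c
      e₁ = solve-∀
      e₂ : ∀ j c → 1ℤ + (j - c) ≡ j + 1ℤ - c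
      e₂ = solve-∀

  shift-rotation : ∀ a P → rotation a P ≡ shift (rotation a (shift P))
  shift-rotation a (p , q) = cong₂ _,_ (e (ℤ.+ a) p) (e (ℤ.+ a) q)
    where
    e : ∀ a p → a - p ≡ 1ℤ + (a - (1ℤ + p))
    e = solve-∀

  shift-flip : ∀ a P → flip a (shift P) ≡ shift (flip a P)
  shift-flip a (p , q) = cong₂ _,_ (e (ℤ.+ a) q) (e (ℤ.+ a) p)
    where
    e : ∀ a p → a - (a - (1ℤ + p)) ≡ 1ℤ + (a - (a - p))
    e = solve-∀

  adjacent-rotation : ∀ a {P Q} → Adjacent P Q → Adjacent (rotation a Q) (rotation a P)
  adjacent-rotation a (inj₁ (j , c , refl , refl)) = inj₁ (_ , _ , rotation-rgt a j c , rotation-lft a j c)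
  adjacent-rotation a (inj₂ (j , x , y , s , refl , refl)) =
    inj₂ (ℤ.+ a + ℤ.+ a - (1ℤ + j) , _ , _ , turn (ℤ.+ suc a) s ,
          trans (rotation-rgt a j x) (cong (λ i → lft i (ℤ.+ suc a - x)) (e (ℤ.+ a) j)) , rotation-lft a (1ℤ + j) y)
    where
    e : ∀ a j → a + a - j ≡ 1ℤ + (a + a - (1ℤ + j))
    e = solve-∀
    turn : ∀ s {x y} → Step x y → Step (s - y) (s - x)
    turn s stay = stay
    turn s {x} rise = subst (Step (s - (1ℤ + x))) (e′ s x) rise
      where
      e′ : ∀ s x → 1ℤ + (s - (1ℤ + x)) ≡ s - x
      e′ = solve-∀

  adjacent-flip : ∀ a {P Q} → Adjacent P Q → Adjacent (flip a P) (flip a Q)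
  adjacent-flip a (inj₁ (j , c , refl , refl)) = inj₁ (_ , _ , flip-lft a j c , flip-rgt a j c)
  adjacent-flip a (inj₂ (j , x , y , s , refl , refl)) = inj₂ (_ , _ , _ , turn {j} s , flip-lft a (1ℤ + j) y , flip-rgt a j x)
    where
    turn : ∀ {j x y} → Step x y → Step (1ℤ + j - x) (1ℤ + (1ℤ + j) - y)
    turn {j} {x} stay = subst (Step (1ℤ + j - x)) (e j x) rise
      where
      e : ∀ j x → 1ℤ + (1ℤ + j - x) ≡ 1ℤ + (1ℤ + j) - x
      e = solve-∀
    turn {j} {x} rise = subst (Step (1ℤ + j - x)) (e j x) stay
      where
      e : ∀ j x → 1ℤ + j - x ≡ 1ℤ + (1ℤ + j) - (1ℤ + x)
      e = solve-∀

  -- Cell j c: the vertical edge c of column j can lie on a path; Source j c: paths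
  -- start there, on the left side of the hexagon or on the vertical side of a hole.  In the
  -- middle column, the edges above the axis in the region are P₀, …, P₀ + N − 1.
  record HalfRegion (R : Region) (a b : ℕ) (P₀ : ℤ) (N : ℕ) (mid : ℤ.+ suc a ℤ.< P₀ + P₀) (gap : ℕ → Maybe ℤ) : Set₁ where
    open Middle a P₀ N mid
    field
      unique : Unique R
      rot-◁  : ∀ {P} → ◁ P ∈ R → ▷ (rotation a P) ∈ R
      rot-▷  : ∀ {P} → ▷ P ∈ R → ◁ (rotation a P) ∈ R
      ref-◁  : ∀ {P} → ◁ P ∈ R → ▷ (reflection a P) ∈ R
      ref-▷  : ∀ {P} → ▷ P ∈ R → ◁ (reflection a P) ∈ R
      Bound Cell Source : ℕ → ℤ → Set
      source?      : ∀ j → Decidable (Source j)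
      left-column  : ∀ {j c} → ◁ (lft j c) ∈ R → 0ℤ ℤ.< j
      right-column : ∀ {j c} → ▷ (rgt j c) ∈ R → 0ℤ ℤ.≤ j
      ◁⇒cell : ∀ {j c} → j ℕ.≤ a → ◁ (lft (ℤ.+ j) c) ∈ R → Cell j c × ¬ Source j c
      cell⇒◁ : ∀ {j c} → j ℕ.≤ a → Cell j c → ¬ Source j c → ◁ (lft (ℤ.+ j) c) ∈ R
      ▷⇒cell : ∀ {j c} → j ℕ.< a → ▷ (rgt (ℤ.+ j) c) ∈ R → Cell j c
      cell⇒▷ : ∀ {j c} → j ℕ.< a → Cell j c → ▷ (rgt (ℤ.+ j) c) ∈ R
      cell-mirror  : ∀ {j c} → Cell j c → Cell j (mir j c)
      source-zero  : ∀ {c} → Source 0 c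
      initial⇒cell : ∀ {c} → c ∈ initial b → Cell 0 c
      cell⇒initial : ∀ {c} → Cell 0 c → c ∈ initial b
      gap⇒source   : ∀ {j c} → c ∈ᵍ gap (suc j) → Source (suc j) c × Cell (suc j) c
      source⇒gap   : ∀ {j c} → Cell (suc j) c → Source (suc j) c → c ∈ᵍ gap (suc j)
      cell⇒range   : ∀ {c} → Cell a c → c ≢ mirror c → InRange c ⊎ InRange (mirror c)
      range⇒cell   : ∀ {c} → Bound a c → InRange c ⊎ InRange (mirror c) → Cell a c
      cell⇒bound   : ∀ {j c} → Cell j c → Bound j c
      bound-step   : ∀ {j x y} → Bound j x → Step x y → Bound (suc j) y
      cell-back    : ∀ {j x y} → Bound j x → Step x y → Cell (suc j) y → ¬ Source (suc j) y → Cell j x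

  module Correspondence {R : Region} {a b : ℕ} {P₀ : ℤ} {N : ℕ} {mid : ℤ.+ suc a ℤ.< P₀ + P₀} {gap : ℕ → Maybe ℤ}
    (gap-even : ∀ {j k} → gap j ≡ just k → ℤ.+ j ≡ k + k) (half : HalfRegion R a b P₀ N mid gap) where

    open HalfRegion half
    open Middle a P₀ N mid
    open System (λ j → insertMaybe (gap j)) (λ _ → Descending) (λ _ → descending?) Final final?
    open PathPairs gap Final final?

    stepLozenge : Triple → Lozenge
    stepLozenge (i , x , y) = lft (ℤ.+ suc i) y , rgt (ℤ.+ i) x

    private
      suc≢ : ∀ {j : ℤ} → 1ℤ + j ≢ j
      suc≢ e = ℤP.<-irrefl (sym e) (ℤP.suc[i]≤j⇒i<j ℤP.≤-refl)

      suc-inj : ∀ i j → 1ℤ + i ≡ 1ℤ + j → i ≡ j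
      suc-inj i j e = trans (sym (cancel i)) (trans (cong (_- 1ℤ) e) (cancel j))
        where
        cancel : ∀ i → 1ℤ + i - 1ℤ ≡ i
        cancel = solve-∀

      halves-split : ∀ {A : Set} (xs : List A) m → length xs ≡ m ℕ.+ m → ∃₂ λ us ws → xs ≡ us ++ ws × length us ≡ length ws
      halves-split xs m e = take m xs , drop m xs , sym (LP.take++drop≡id m xs) ,
        trans (LP.length-take m xs) (trans (cong (m ℕ.⊓_) e) (trans (ℕP.m≤n⇒m⊓n≡m (ℕP.m≤m+n m m))
          (sym (trans (LP.length-drop m xs) (trans (cong (ℕ._∸ m) e) (ℕP.m+n∸m≡n m m))))))

      on-axis : ∀ {c} → c ≡ mirror c → ℤ.+ suc a ≡ c + c
      on-axis {c} e = trans (shuffle (ℤ.+ suc a) c) (cong (_+ c) (sym e))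
        where
        shuffle : ∀ s c → s ≡ s - c + c
        shuffle = solve-∀

    -- A symmetric state has an even number of positions, so none lies on the axis.
    off-axis : ∀ {xs m} → Descending xs → SymmetricAt a xs → length xs ≡ m ℕ.+ m → ∀ {c} → c ∈ xs → c ≢ mirror c
    off-axis {xs} {m} d s l {c} c∈ e with halves-split xs m l
    ... | us , ws , refl , l′ with symmetric⇒double a us ws l′ s
    ...   | e′ rewrite e′ with double-upper a us d | ∈-++⁻ us c∈
    ...     | _ , u | inj₁ m∈ = ℤP.<-irrefl (on-axis e) (All.lookup u m∈)
    ...     | _ , u | inj₂ m∈ with ∈-map⁻ (mir a) (AnyP.reverse⁻ m∈)
    ...       | x , x∈ , refl = ℤP.<-irrefl (on-axis (trans (sym (mir-involutive a x)) (sym e))) (All.lookup u x∈)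

    module FromTiling {T : List Lozenge} (t : Tiling R T) (rot : Invariant (rotation a) T) where

      open Tiling t

      -- The edges that lie on a path: those that no level lozenge blocks.
      Free : ℕ → ℤ → Set
      Free j c = Cell j c × (lft (ℤ.+ j) c , rgt (ℤ.+ j) c) ∉ T

      -- Symmetry of the level lozenges is enough: they determine the free edges, and these
      -- determine all states.
      Mirrored : Set
      Mirrored = ∀ {j c} → (lft j c , rgt j c) ∈ T → (lft j (1ℤ + j - c) , rgt j (1ℤ + j - c)) ∈ T

      private
        rotated : ∀ {P Q} → (P , Q) ∈ T → (rotation a Q , rotation a P) ∈ T
        rotated m = All.lookup rot m

        -- The rotation turns the middle column upside down. This is the only condition that it
        -- imposes on the left half of the tiling.
        level-middle : ∀ {c} → (lft (ℤ.+ a) c , rgt (ℤ.+ a) c) ∈ T → (lft (ℤ.+ a) (mirror c) , rgt (ℤ.+ a) (mirror c)) ∈ T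
        level-middle {c} m = subst₂ (λ P Q → (P , Q) ∈ T)
          (trans (rotation-rgt a (ℤ.+ a) c) (cong (λ j → lft j (mirror c)) (e (ℤ.+ a))))
          (trans (rotation-lft a (ℤ.+ a) c) (cong (λ j → rgt j (mirror c)) (e (ℤ.+ a)))) (rotated m)
          where
          e : ∀ a → a + a - a ≡ a
          e = solve-∀

        slope-free : ∀ {i : ℤ} {x y} → (lft (1ℤ + i) y , rgt i x) ∈ T → (lft i x , rgt i x) ∉ T
        slope-free m m′ = suc≢ (proj₁ (lft-injective (rightOnce m m′)))

        slope-free′ : ∀ {i : ℤ} {x y} → (lft (1ℤ + i) y , rgt i x) ∈ T → (lft (1ℤ + i) y , rgt (1ℤ + i) y) ∉ T
        slope-free′ m m′ = suc≢ (proj₁ (rgt-injective (leftOnce m′ m)))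

        -- The triangle to the right of a free edge is not matched across that edge, so its lozenge
        -- leads to the next column.
        advance : ∀ {j x} → j ℕ.< a → Free j x → ∃ λ y → Step x y × (lft (ℤ.+ suc j) y , rgt (ℤ.+ j) x) ∈ T
        advance {j} {x} j<a (cell , free) with rightTotal (cell⇒▷ j<a cell)
        ... | P , m with proj₂ (inside m)
        ...   | inj₁ (j′ , c , refl , e) with rgt-injective e
        ...     | refl , refl = ⊥-elim (free m)
        advance {j} {x} j<a (cell , free) | P , m | inj₂ (j′ , x′ , y , s , refl , e) with rgt-injective e
        ...     | refl , refl = y , s , m

        retreat : ∀ {j c} → suc j ℕ.≤ a → Free (suc j) c → ¬ Source (suc j) c → ∃ λ x → Step x c × Free j x × (lft (ℤ.+ suc j) c , rgt (ℤ.+ j) x) ∈ T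
        retreat {j} {c} j<a (cell , free) ¬s with leftTotal (cell⇒◁ j<a cell ¬s)
        ... | Q , m with proj₂ (inside m)
        ...   | inj₁ (j′ , c′ , e , refl) with lft-injective e
        ...     | refl , refl = ⊥-elim (free m)
        retreat {j} {c} j<a (cell , free) ¬s | Q , m | inj₂ (j′ , x , y , s , e , refl) with lft-injective e
        ...     | e′ , refl with suc-inj (ℤ.+ j) j′ e′
        ...       | refl = x , s , (▷⇒cell j<a (proj₂ (proj₁ (inside m))) , slope-free m) , m

        advanceAll : ∀ {j} → j ℕ.< a → ∀ xs → (∀ {c} → c ∈ xs → Free j c) →
          ∃ λ ys → Pointwise (λ x y → Step x y × (lft (ℤ.+ suc j) y , rgt (ℤ.+ j) x) ∈ T) xs ys
        advanceAll lt []       f = [] , []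
        advanceAll lt (x ∷ xs) f with advance lt (f (here refl)) | advanceAll lt xs (λ m → f (there m))
        ... | y , s | ys , p = y ∷ ys , s ∷ p

        pair-right : ∀ {j xs ys x} → Pointwise (λ x y → Step x y × (lft (ℤ.+ suc j) y , rgt (ℤ.+ j) x) ∈ T) xs ys → x ∈ xs →
          ∃ λ y → (j , x , y) ∈ zipAt j xs ys × y ∈ ys × (lft (ℤ.+ suc j) y , rgt (ℤ.+ j) x) ∈ T
        pair-right ((_ , m) ∷ p) (here refl) = _ , here refl , here refl , m
        pair-right (_ ∷ p) (there x∈) with pair-right p x∈
        ... | y , z , y∈ , m = y , there z , there y∈ , m

        pair-left : ∀ {j xs ys y} → Pointwise (λ x y → Step x y × (lft (ℤ.+ suc j) y , rgt (ℤ.+ j) x) ∈ T) xs ys → y ∈ ys →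
          ∃ λ x → (lft (ℤ.+ suc j) y , rgt (ℤ.+ j) x) ∈ T
        pair-left ((_ , m) ∷ p) (here refl) = _ , m
        pair-left (_ ∷ p) (there y∈) = pair-left p y∈

        pair-in : ∀ {j xs ys τ} → Pointwise (λ x y → Step x y × (lft (ℤ.+ suc j) y , rgt (ℤ.+ j) x) ∈ T) xs ys → τ ∈ zipAt j xs ys → stepLozenge τ ∈ T
        pair-in ((_ , m) ∷ p) (here refl) = m
        pair-in (_ ∷ p) (there τ∈) = pair-in p τ∈

        steps-descending : ∀ {j xs ys} → Descending xs → Pointwise (λ x y → Step x y × (lft (ℤ.+ suc j) y , rgt (ℤ.+ j) x) ∈ T) xs ys → Descending ys
        steps-descending []      []       = []
        steps-descending [-]     (_ ∷ []) = [-]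
        steps-descending (h ∷ d) ((s , m) ∷ (s′ , m′) ∷ p) =
          ℤP.≤∧≢⇒< (step-≥ h s s′) (λ { refl → ℤP.<-irrefl (sym (proj₂ (rgt-injective (leftOnce m m′)))) h }) ∷ steps-descending d ((s′ , m′) ∷ p)

        length-insert : ∀ g ys {m} → length ys ≡ m ℕ.+ m → ∃ λ m′ → length (insertMaybe g ys) ≡ m′ ℕ.+ m′
        length-insert nothing  ys {m} e = m , e
        length-insert (just k) ys {m} e with insertPair-split k ys
        ... | as , bs , refl , e′ rewrite e′ = suc m , trans (LP.length-++ as)
          (trans (ℕP.+-suc (length as) (suc (length bs))) (cong suc (trans (ℕP.+-suc (length as) (length bs))
            (trans (cong suc (trans (sym (LP.length-++ as)) e)) (sym (ℕP.+-suc m m))))))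

        mirror-symmetric : ∀ j {ys} → Descending ys → (∀ {c} → c ∈ ys → mir j c ∈ ys) → SymmetricAt j ys
        mirror-symmetric j {ys} d f = descending-ext d (mirrored-descending j d)
          (λ {c} m → AnyP.reverse⁺ (subst (_∈ map (mir j) ys) (mir-involutive j c) (∈-map⁺ (mir j) (f m))))
          (λ m → back (∈-map⁻ (mir j) (AnyP.reverse⁻ m)))
          where
          back : ∀ {c} → (∃ λ x → x ∈ ys × c ≡ mir j x) → c ∈ ys
          back (x , x∈ , refl) = f x∈

        module Advanced {j : ℕ} {xs ys : List ℤ} (j<a : j ℕ.< a) (d : Descending xs) (g : ∀ {c} → Free j c → c ∈ xs)
          (p : Pointwise (λ x y → Step x y × (lft (ℤ.+ suc j) y , rgt (ℤ.+ j) x) ∈ T) xs ys) where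

          dy : Descending ys
          dy = steps-descending d p

          arrive : ∀ {c} → c ∈ ys → Free (suc j) c × ¬ Source (suc j) c
          arrive c∈ with pair-left p c∈
          ... | x , mem with ◁⇒cell j<a (proj₁ (proj₁ (inside mem)))
          ...   | cell , ¬s = (cell , slope-free′ mem) , ¬s

          -- Traced backwards, a free edge that is no source comes from a free edge of the previous
          -- column; that edge is in `xs`, and the path from it must arrive here.
          hit : ∀ {c} → Free (suc j) c → ¬ Source (suc j) c → c ∈ ys
          hit fr ¬s with retreat j<a fr ¬s
          ... | x , _ , fx , mem with pair-right p (g fx)
          ...   | y , _ , y∈ , mem′ with lft-injective (rightOnce mem′ mem)
          ...     | _ , refl = y∈

          d′ : Descending (insertMaybe (gap (suc j)) ys)
          d′ = insert-descending (gap (suc j)) dy (λ c∈ c∈g → proj₂ (arrive c∈) (proj₁ (gap⇒source c∈g)))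

          f′ : ∀ {c} → c ∈ insertMaybe (gap (suc j)) ys → Free (suc j) c
          f′ c∈ with ∈-insert⁻ (gap (suc j)) ys c∈
          ... | inj₁ c∈ys = proj₁ (arrive c∈ys)
          ... | inj₂ c∈g with gap⇒source c∈g
          ...   | s , cell = cell , λ mem → proj₂ (◁⇒cell j<a (proj₁ (proj₁ (inside mem)))) s

          g′ : ∀ {c} → Free (suc j) c → c ∈ insertMaybe (gap (suc j)) ys
          g′ {c} fr with source? (suc j) c
          ... | yes s = ∈-insert⁺ʳ (gap (suc j)) ys (source⇒gap (proj₁ fr) s)
          ... | no ¬s = ∈-insert⁺ˡ (gap (suc j)) ys (hit fr ¬s)

          now : ∀ {x y} → stepLozenge (j , x , y) ∈ T → (j , x , y) ∈ zipAt j xs ys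
          now mem with pair-right p (g (▷⇒cell j<a (proj₂ (proj₁ (inside mem))) , slope-free mem))
          ... | y , τ∈ , _ , mem′ with lft-injective (rightOnce mem′ mem)
          ...   | _ , refl = τ∈

          ◁-mirror : ∀ {c} → Cell (suc j) c → ¬ Source (suc j) c → ¬ Source (suc j) (mir (suc j) c)
          ◁-mirror {c} cell ¬s s = ¬s (subst (Source (suc j)) (mir-involutive (suc j) c)
            (proj₁ (gap⇒source (gap-mirror gap-even (suc j) (source⇒gap (cell-mirror cell) s)))))

          symmetric : Mirrored → SymmetricAt (suc j) ys
          symmetric mi = mirror-symmetric (suc j) dy (λ {c} c∈ → let (cell , free) , ¬s = arrive c∈ in
            hit (cell-mirror cell , λ mem → free (subst (λ c → (lft (ℤ.+ suc j) c , rgt (ℤ.+ suc j) c) ∈ T) (mir-involutive (suc j) c) (mi mem)))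
                (◁-mirror cell ¬s))

      record Built (n j : ℕ) (xs : List ℤ) : Set where
        field
          history  : List (List ℤ)
          chain    : Chain n j xs history
          sound    : ∀ {τ} → τ ∈ pairsOf j xs history → stepLozenge τ ∈ T
          complete : ∀ {i x y} → j ℕ.≤ i → i ℕ.< a → stepLozenge (i , x , y) ∈ T → (i , x , y) ∈ pairsOf j xs history
          mirrored : Mirrored → SymmetricChain j history

      -- The invariant is that the state consists of exactly the free edges of its column. Its even
      -- length is carried along, since starts come in pairs, because it keeps the symmetric final
      -- state off the axis.
      build : ∀ n j xs m → j ℕ.+ n ≡ a → Descending xs → length xs ≡ m ℕ.+ m →
        (∀ {c} → c ∈ xs → Free j c) → (∀ {c} → Free j c → c ∈ xs) → Built n j xs
      build zero j xs m t d l f g with trans (sym (ℕP.+-identityʳ j)) t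
      ... | refl = record
        { history  = []
        ; chain    = done (symmetric , All.tabulate (λ c∈ → cell⇒range (proj₁ (f c∈)) (off-axis {m = m} d symmetric l c∈)))
        ; sound    = λ ()
        ; complete = λ le lt _ → ⊥-elim (ℕP.<-irrefl refl (ℕP.≤-<-trans le lt))
        ; mirrored = λ _ → []
        }
        where
        symmetric : SymmetricAt a xs
        symmetric = mirror-symmetric a d λ {c} c∈ → g (cell-mirror (proj₁ (f c∈)) ,
          λ m → proj₂ (f c∈) (subst (λ c → (lft (ℤ.+ a) c , rgt (ℤ.+ a) c) ∈ T) (mir-involutive a c) (level-middle m)))
      build (suc n) j xs m t d l f g with advanceAll (subst (j ℕ.<_) t (ℕP.m<m+n j (ℕ.s≤s ℕ.z≤n))) xs f
      ... | ys , p with length-insert (gap (suc j)) ys {m} (trans (sym (Pw.Pointwise-length p)) l)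
      ...   | m′ , l′ = record
        { history  = ys ∷ B.history
        ; chain    = link (Pw.map proj₁ p , d′) B.chain
        ; sound    = sound
        ; complete = complete
        ; mirrored = λ mi → symmetric mi ∷ B.mirrored mi
        }
        where
        open Advanced (subst (j ℕ.<_) t (ℕP.m<m+n j (ℕ.s≤s ℕ.z≤n))) d g p
        module B = Built (build n (suc j) (insertMaybe (gap (suc j)) ys) m′ (trans (sym (ℕP.+-suc j n)) t) d′ l′ f′ g′)
        sound : ∀ {τ} → τ ∈ pairsOf j xs (ys ∷ B.history) → stepLozenge τ ∈ T
        sound τ∈ with ∈-++⁻ (zipAt j xs ys) τ∈
        ... | inj₁ τ∈′ = pair-in p τ∈′
        ... | inj₂ τ∈′ = B.sound τ∈′
        complete : ∀ {i x y} → j ℕ.≤ i → i ℕ.< a → stepLozenge (i , x , y) ∈ T → (i , x , y) ∈ pairsOf j xs (ys ∷ B.history)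
        complete le lt mem with ℕP.m≤n⇒m<n∨m≡n le
        ... | inj₁ l    = ∈-++⁺ʳ (zipAt j xs ys) (B.complete l lt mem)
        ... | inj₂ refl = ∈-++⁺ˡ (now mem)

      built : Built a 0 (initial b)
      built = build a 0 (initial b) b refl (initial-descending b) (length-initial b)
        (λ c∈ → initial⇒cell c∈ , λ mem → proj₂ (◁⇒cell ℕ.z≤n (proj₁ (proj₁ (inside mem)))) source-zero)
        (λ fr → cell⇒initial (proj₁ fr))

    steps : List (List ℤ) → List Lozenge
    steps h = map stepLozenge (pairsOf 0 (initial b) h)

    -- Neither half of the lozenge is covered by a step or by the rotated image of one. The four
    -- conditions are permuted by the rotation.
    Clear : List (List ℤ) → Lozenge → Set
    Clear h (P , Q) = (P ∉ map proj₁ (steps h) × rotation a Q ∉ map proj₁ (steps h))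
                    × (Q ∉ map proj₂ (steps h) × rotation a P ∉ map proj₂ (steps h))

    -- Steps fill the left half, their rotated images the right half, and level lozenges whatever
    -- remains.
    Keep : List (List ℤ) → Lozenge → Set
    Keep h ℓ = ℓ ∈ steps h ⊎ act (rotation a) ℓ ∈ steps h ⊎ (proj₂ ℓ ≡ shift (proj₁ ℓ) × Clear h ℓ)

    keep? : ∀ h → Decidable (Keep h)
    keep? h (P , Q) = ((P , Q) MemL.∈? steps h) ⊎-dec (act (rotation a) (P , Q) MemL.∈? steps h) ⊎-dec
      ((Q ≟ᴾ shift P) ×-dec ((¬? (P MemP.∈? map proj₁ (steps h)) ×-dec ¬? (rotation a Q MemP.∈? map proj₁ (steps h)))
        ×-dec (¬? (Q MemP.∈? map proj₂ (steps h)) ×-dec ¬? (rotation a P MemP.∈? map proj₂ (steps h)))))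

    tilingOf : List (List ℤ) → List Lozenge
    tilingOf h = filter (keep? h) (lozengesIn R)

    private
      All-Bound : ∀ {j xs ys} → All (Bound j) xs → Pointwise Step xs ys → All (Bound (suc j)) ys
      All-Bound []       []      = []
      All-Bound (b ∷ bs) (s ∷ p) = bound-step b s ∷ All-Bound bs p

      insert-bound : ∀ {j ys} → All (Bound (suc j)) ys → All (Bound (suc j)) (insertMaybe (gap (suc j)) ys)
      insert-bound {j} {ys} bs = All.tabulate λ c∈ → bound (∈-insert⁻ (gap (suc j)) ys c∈)
        where
        bound : ∀ {c} → c ∈ ys ⊎ c ∈ᵍ gap (suc j) → Bound (suc j) c
        bound (inj₁ m) = All.lookup bs m
        bound (inj₂ g) = cell⇒bound (proj₂ (gap⇒source g))

      arrivals : ∀ {j ys} → Descending (insertMaybe (gap (suc j)) ys) → All (Cell (suc j)) (insertMaybe (gap (suc j)) ys) →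
        ∀ {y} → y ∈ ys → Cell (suc j) y × ¬ Source (suc j) y
      arrivals {j} {ys} d cs y∈ = cell , λ s → insert-fresh (gap (suc j)) ys d y∈ (source⇒gap cell s)
        where
        cell : Cell (suc j) _
        cell = All.lookup cs (∈-insert⁺ˡ (gap (suc j)) ys y∈)

    -- Chains test only collisions and the final state. Avoidance of holes and rhombus follows
    -- backwards from the middle column: if a path continues in an admissible position that is not a
    -- start, its previous position was admissible.
    chain-cells : ∀ {n j xs h} → j ℕ.+ n ≡ a → Chain n j xs h → All (Bound j) xs → All (Cell j) xs
    chain-cells {zero} {j} t (done (_ , f)) bs with trans (sym (ℕP.+-identityʳ j)) t
    ... | refl = All.tabulate λ c∈ → range⇒cell (All.lookup bs c∈) (All.lookup f c∈)
    chain-cells {suc n} {j} t (link (p , d) c) bs = go p bs (arrivals d (chain-cells (trans (sym (ℕP.+-suc j n)) t) c (insert-bound (All-Bound bs p))))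
      where
      go : ∀ {xs ys} → Pointwise Step xs ys → All (Bound j) xs → (∀ {y} → y ∈ ys → Cell (suc j) y × ¬ Source (suc j) y) → All (Cell j) xs
      go []      []       f = []
      go (s ∷ p) (b ∷ bs) f = cell-back b s (proj₁ (f (here refl))) (proj₂ (f (here refl))) ∷ go p bs (λ m → f (there m))

    pairs-cells : ∀ {n j xs h i x y} → j ℕ.+ n ≡ a → Chain n j xs h → All (Bound j) xs → (i , x , y) ∈ pairsOf j xs h →
      Cell i x × Cell (suc i) y × ¬ Source (suc i) y
    pairs-cells {suc n} {j} {xs} {ys ∷ h} t c@(link (p , d) c′) bs m with ∈-++⁻ (zipAt j xs ys) m
    ... | inj₂ m′ = pairs-cells (trans (sym (ℕP.+-suc j n)) t) c′ (insert-bound (All-Bound bs p)) m′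
    ... | inj₁ m′ with zipAt-column xs ys m′
      where
      zipAt-column : ∀ xs ys {i x y} → (i , x , y) ∈ zipAt j xs ys → i ≡ j
      zipAt-column (x ∷ xs) (y ∷ ys) (here refl) = refl
      zipAt-column (x ∷ xs) (y ∷ ys) (there m)   = zipAt-column xs ys m
    ...   | refl with pairs-now c m
    ...     | x∈ , y∈ = All.lookup (chain-cells t c bs) x∈ ,
              arrivals d (chain-cells (trans (sym (ℕP.+-suc j n)) t) c′ (insert-bound (All-Bound bs p))) y∈

    module ToTiling {h : List (List ℤ)} (chain : Chain a 0 (initial b) h) where

      private
        Paired : Triple → Set
        Paired τ = τ ∈ pairsOf 0 (initial b) h

        T : List Lozenge
        T = tilingOf h

        step⁻ : ∀ {P Q} → (P , Q) ∈ steps h → ∃ λ i → ∃₂ λ x y → Paired (i , x , y) × P ≡ lft (ℤ.+ suc i) y × Q ≡ rgt (ℤ.+ i) x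
        step⁻ m with ∈-map⁻ stepLozenge m
        ... | (i , x , y) , τ∈ , refl = i , x , y , τ∈ , refl , refl

        left⁻ : ∀ {P} → P ∈ map proj₁ (steps h) → ∃ λ i → ∃₂ λ x y → Paired (i , x , y) × P ≡ lft (ℤ.+ suc i) y
        left⁻ m with ∈-map⁻ proj₁ m
        ... | (P , Q) , m′ , refl with step⁻ m′
        ...   | i , x , y , τ∈ , e , _ = i , x , y , τ∈ , e

        right⁻ : ∀ {Q} → Q ∈ map proj₂ (steps h) → ∃ λ i → ∃₂ λ x y → Paired (i , x , y) × Q ≡ rgt (ℤ.+ i) x
        right⁻ m with ∈-map⁻ proj₂ m
        ... | (P , Q) , m′ , refl with step⁻ m′
        ...   | i , x , y , τ∈ , _ , e = i , x , y , τ∈ , e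

        left⁺ : ∀ {i x y} → Paired (i , x , y) → lft (ℤ.+ suc i) y ∈ map proj₁ (steps h)
        left⁺ τ∈ = ∈-map⁺ proj₁ (∈-map⁺ stepLozenge τ∈)

        right⁺ : ∀ {i x y} → Paired (i , x , y) → rgt (ℤ.+ i) x ∈ map proj₂ (steps h)
        right⁺ τ∈ = ∈-map⁺ proj₂ (∈-map⁺ stepLozenge τ∈)

        below : ∀ {i x y} → Paired (i , x , y) → i ℕ.< a
        below τ∈ = proj₁ (proj₂ (pairs-range chain τ∈))

        cells : ∀ {i x y} → Paired (i , x , y) → Cell i x × Cell (suc i) y × ¬ Source (suc i) y
        cells = pairs-cells refl chain (All.tabulate λ c∈ → cell⇒bound (initial⇒cell c∈))

        columns : ∀ {i j} → ℤ.+ i ≡ ℤ.+ a + ℤ.+ a - ℤ.+ j → i ℕ.+ j ≡ a ℕ.+ a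
        columns {i} {j} e = ℤP.+-injective (trans (ℤP.pos-+ i j) (trans (cong (_+ ℤ.+ j) e) (trans (shuffle (ℤ.+ a) (ℤ.+ j)) (sym (ℤP.pos-+ a a)))))
          where
          shuffle : ∀ a j → a + a - j + j ≡ a + a
          shuffle = solve-∀

        -- The rotation sends column `j` to column `a + a - j`, at or beyond the middle, whereas the
        -- right-pointing triangles of steps belong to earlier columns.
        far-left : ∀ {j c} → j ℕ.≤ a → rotation a (lft (ℤ.+ j) c) ∉ map proj₂ (steps h)
        far-left {j} {c} le m with right⁻ m
        ... | i , x , y , τ∈ , e with rgt-injective (trans (sym (rotation-lft a (ℤ.+ j) c)) e)
        ...   | e′ , _ = ℕP.<-irrefl (columns (sym e′)) (ℕP.+-mono-<-≤ (below τ∈) le)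

        step-in : ∀ {i x y} → Paired (i , x , y) → stepLozenge (i , x , y) ∈ T
        step-in τ∈ with cells τ∈
        ... | cx , cy , ¬s = ∈-filter⁺ (keep? h) (lozenge⁺ R (cell⇒◁ (below τ∈) cy ¬s) (cell⇒▷ (below τ∈) cx)
          (inj₂ (_ , _ , _ , proj₂ (proj₂ (pairs-range chain τ∈)) , refl , refl))) (inj₁ (∈-map⁺ stepLozenge τ∈))

        -- If the triangle on the right were covered by a step, a path would pass through the edge.
        -- Having started there would make the edge a source, and having arrived there would cover
        -- the triangle on the left.
        level-in : ∀ {j c} → suc j ℕ.≤ a → ◁ (lft (ℤ.+ suc j) c) ∈ R → lft (ℤ.+ suc j) c ∉ map proj₁ (steps h) →
          (lft (ℤ.+ suc j) c , rgt (ℤ.+ suc j) c) ∈ T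
        level-in {j} {c} le ∈R ∉S = ∈-filter⁺ (keep? h) (lozenge⁺ R ∈R right (inj₁ (_ , _ , refl , refl)))
          (inj₂ (inj₂ (sym (shift-lft _ _) , (∉S , cond₂) , cond₃ , far-left le)))
          where
          cell : Cell (suc j) c × ¬ Source (suc j) c
          cell = ◁⇒cell le ∈R
          right : ▷ (rgt (ℤ.+ suc j) c) ∈ R
          right with ℕP.m≤n⇒m<n∨m≡n le
          ... | inj₁ lt   = cell⇒▷ lt (proj₁ cell)
          ... | inj₂ refl = subst (λ Q → ▷ Q ∈ R) (trans (reflection-lft a (ℤ.+ a) c) (cong₂ rgt (e₁ (ℤ.+ a)) (e₂ (ℤ.+ a) c))) (ref-◁ ∈R)
            where
            e₁ : ∀ a → a + a - a ≡ a
            e₁ = solve-∀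
            e₂ : ∀ a c → a - a + c ≡ c
            e₂ = solve-∀
          cond₃ : rgt (ℤ.+ suc j) c ∉ map proj₂ (steps h)
          cond₃ m with right⁻ m
          ... | i , x , y , τ∈ , e with rgt-injective e
          ...   | refl , refl with pairs-previous chain ℕ.z≤n τ∈
          ...     | inj₁ (w , τ∈′) = ∉S (left⁺ τ∈′)
          ...     | inj₂ g = proj₂ cell (proj₁ (gap⇒source g))
          -- The rotated triangle can belong to a step only if the edge is in the middle column. A
          -- path then ends at the mirror image of `c`, hence by the symmetry of the final state
          -- also at `c`.
          cond₂ : rotation a (rgt (ℤ.+ suc j) c) ∉ map proj₁ (steps h)
          cond₂ m with left⁻ m
          ... | i , x , y , τ∈ , e with lft-injective (trans (sym (rotation-rgt a (ℤ.+ suc j) c)) e)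
          ...   | e′ , refl with ℕP.m≤n⇒m<n∨m≡n le
          ...     | inj₁ lt = ℕP.<-irrefl (columns (sym e′)) (ℕP.+-mono-≤-< (below τ∈) lt)
          ...     | inj₂ refl with ℕP.+-cancelʳ-≡ (suc j) (suc i) (suc j) (columns (sym e′))
          ...       | refl with pairs-last chain τ∈ refl
          ...         | zs , (sy , _) , y∈ , back with back (subst (_∈ zs) (mirror-involutive c) (subst (mirror (mirror c) ∈_) (sym sy) (AnyP.reverse⁺ (∈-map⁺ mirror y∈))))
          ...           | inj₁ (w , τ∈′) = ∉S (left⁺ τ∈′)
          ...           | inj₂ g = proj₂ cell (proj₁ (gap⇒source g))

        left-half : ∀ {j c} → suc j ℕ.≤ a → ◁ (lft (ℤ.+ suc j) c) ∈ R → ∃ λ Q → (lft (ℤ.+ suc j) c , Q) ∈ T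
        left-half {j} {c} le ∈R with lft (ℤ.+ suc j) c MemP.∈? map proj₁ (steps h)
        ... | no ∉S = _ , level-in le ∈R ∉S
        ... | yes m with left⁻ m
        ...   | i , x , y , τ∈ , e = _ , subst (λ P → (P , rgt (ℤ.+ i) x) ∈ T) (sym e) (step-in τ∈)

        right-half : ∀ {j c} → j ℕ.< a → ▷ (rgt (ℤ.+ j) c) ∈ R → ∃ λ P → (P , rgt (ℤ.+ j) c) ∈ T
        right-half {j} {c} lt ∈R with rgt (ℤ.+ j) c MemP.∈? map proj₂ (steps h)
        ... | yes m with right⁻ m
        ...   | i , x , y , τ∈ , e = _ , subst (λ Q → (lft (ℤ.+ suc i) y , Q) ∈ T) (sym e) (step-in τ∈)
        right-half {zero} {c} lt ∈R | no ∉S = ⊥-elim (∉S (from-initial chain lt))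
          where
          from-initial : ∀ {n} → Chain n 0 (initial b) h → 0 ℕ.< n → rgt 0ℤ c ∈ map proj₂ (steps h)
          from-initial {suc n} ch _ with pairs-from ch (cell⇒initial (▷⇒cell lt ∈R))
          ... | y , τ∈ = right⁺ τ∈
        right-half {suc j} {c} lt ∈R | no ∉S = _ , level-in (ℕP.<⇒≤ lt) (cell⇒◁ (ℕP.<⇒≤ lt) cell ¬source) ∉S′
          where
          cell : Cell (suc j) c
          cell = ▷⇒cell lt ∈R
          ¬source : ¬ Source (suc j) c
          ¬source s with pairs-gap chain ℕ.z≤n lt (source⇒gap cell s)
          ... | y , τ∈ = ∉S (right⁺ τ∈)
          ∉S′ : lft (ℤ.+ suc j) c ∉ map proj₁ (steps h)
          ∉S′ m with left⁻ m
          ... | i , x , y , τ∈ , e with lft-injective e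
          ...   | refl , refl with pairs-next chain τ∈ lt
          ...     | z , τ∈′ = ∉S (right⁺ τ∈′)

      rotation-invariant : Invariant (rotation a) T
      rotation-invariant = All.tabulate λ { {P , Q} m → let (∈L , k) = ∈-filter⁻ (keep? h) {xs = lozengesIn R} m
                                                            ((l , r) , adj) = lozenge⁻ R ∈L in
          ∈-filter⁺ (keep? h) (lozenge⁺ R (rot-▷ r) (rot-◁ l) (adjacent-rotation a adj)) (turned k) }
        where
        back : ∀ ℓ → act (rotation a) (act (rotation a) ℓ) ≡ ℓ
        back (P , Q) = cong₂ _,_ (rotation-involutive a P) (rotation-involutive a Q)
        turned : ∀ {ℓ} → Keep h ℓ → Keep h (act (rotation a) ℓ)
        turned {ℓ} (inj₁ m) = inj₂ (inj₁ (subst (_∈ steps h) (sym (back ℓ)) m))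
        turned (inj₂ (inj₁ m)) = inj₁ m
        turned {P , Q} (inj₂ (inj₂ (refl , (c₁ , c₂) , (c₃ , c₄)))) = inj₂ (inj₂ (shift-rotation a P ,
          (c₂ , subst (_∉ map proj₁ (steps h)) (sym (rotation-involutive a P)) c₁) ,
          (c₄ , subst (_∉ map proj₂ (steps h)) (sym (rotation-involutive a (shift P))) c₃)))

      private
        turned : ∀ {P Q} → (rotation a P , Q) ∈ T → (rotation a Q , P) ∈ T
        turned {P} {Q} m = subst (λ P → (rotation a Q , P) ∈ T) (rotation-involutive a P) (All.lookup rotation-invariant m)

        turned′ : ∀ {P Q} → (P , rotation a Q) ∈ T → (Q , rotation a P) ∈ T
        turned′ {P} {Q} m = subst (λ Q → (Q , rotation a P) ∈ T) (rotation-involutive a Q) (All.lookup rotation-invariant m)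

        complement-< : ∀ {i j} → i ℕ.+ j ≡ a ℕ.+ a → a ℕ.< j → i ℕ.< a
        complement-< {i} {j} e lt with i ℕ.<? a
        ... | yes p = p
        ... | no ¬p = ⊥-elim (ℕP.<-irrefl (sym e) (ℕP.+-mono-≤-< (ℕP.≮⇒≥ ¬p) lt))

        complement-≤ : ∀ {i j} → i ℕ.+ j ≡ a ℕ.+ a → a ℕ.≤ j → i ℕ.≤ a
        complement-≤ {i} {j} e le with i ℕ.≤? a
        ... | yes p = p
        ... | no ¬p = ⊥-elim (ℕP.<-irrefl (sym e) (ℕP.+-mono-<-≤ (ℕP.≰⇒> ¬p) le))

        right-total-before : ∀ u {c} → ▷ (rgt u c) ∈ R → ∀ {j} → u ≡ ℤ.+ a + ℤ.+ a - ℤ.+ j → a ℕ.< j → ∃ λ P → (P , rgt u c) ∈ T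
        right-total-before (ℤ.+ i) ∈R e lt = right-half (complement-< (columns e) lt) ∈R
        right-total-before ℤ.-[1+ _ ] ∈R e lt with () ← right-column ∈R

        left-total-before : ∀ u {c} → ◁ (lft u c) ∈ R → ∀ {j} → u ≡ ℤ.+ a + ℤ.+ a - ℤ.+ j → a ℕ.≤ j → ∃ λ Q → (lft u c , Q) ∈ T
        left-total-before (ℤ.+ zero)  ∈R e le with ℤ.+<+ () ← left-column ∈R
        left-total-before (ℤ.+ suc i) ∈R e le = left-half (complement-≤ (columns e) le) ∈R
        left-total-before ℤ.-[1+ _ ]  ∈R e le with () ← left-column ∈R

        -- Beyond the middle column, the rotated triangle lies in the left half and its partner is
        -- rotated back.
        left-total-at : ∀ j c → ◁ (lft j c) ∈ R → ∃ λ Q → (lft j c , Q) ∈ T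
        left-total-at (ℤ.+ zero)  c ∈R with ℤ.+<+ () ← left-column ∈R
        left-total-at ℤ.-[1+ _ ]  c ∈R with () ← left-column ∈R
        left-total-at (ℤ.+ suc i) c ∈R with suc i ℕ.≤? a
        ... | yes le = left-half le ∈R
        ... | no ¬le with right-total-before _ (subst (λ Q → ▷ Q ∈ R) (rotation-lft a (ℤ.+ suc i) c) (rot-◁ ∈R)) refl (ℕP.≰⇒> ¬le)
        ...   | P , m = _ , turned′ (subst (λ Q → (P , Q) ∈ T) (sym (rotation-lft a (ℤ.+ suc i) c)) m)

        right-total-at : ∀ j c → ▷ (rgt j c) ∈ R → ∃ λ P → (P , rgt j c) ∈ T
        right-total-at ℤ.-[1+ _ ] c ∈R with () ← right-column ∈R
        right-total-at (ℤ.+ i) c ∈R with i ℕ.<? a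
        ... | yes lt = right-half lt ∈R
        ... | no ¬lt with left-total-before _ (subst (λ P → ◁ P ∈ R) (rotation-rgt a (ℤ.+ i) c) (rot-▷ ∈R)) refl (ℕP.≮⇒≥ ¬lt)
        ...   | Q , m = _ , turned (subst (λ P → (P , Q) ∈ T) (sym (rotation-rgt a (ℤ.+ i) c)) m)

        left-total : ∀ {P} → ◁ P ∈ R → ∃ λ Q → (P , Q) ∈ T
        left-total {P} ∈R with as-lft P
        ... | j , c , refl = left-total-at j c ∈R

        right-total : ∀ {Q} → ▷ Q ∈ R → ∃ λ P → (P , Q) ∈ T
        right-total {Q} ∈R with as-rgt Q
        ... | j , c , refl = right-total-at j c ∈R

        left-once : ∀ {P Q Q′} → (P , Q) ∈ T → (P , Q′) ∈ T → Q ≡ Q′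
        left-once {P} {Q} {Q′} m m′ = once (proj₂ (∈-filter⁻ (keep? h) {xs = lozengesIn R} m)) (proj₂ (∈-filter⁻ (keep? h) {xs = lozengesIn R} m′))
          where
          clash : ∀ {Q Q′} → (P , Q) ∈ steps h → act (rotation a) (P , Q′) ∈ steps h → ⊥
          clash s s′ with step⁻ s
          ... | i , x , y , τ∈ , refl , refl = far-left (below τ∈) (∈-map⁺ proj₂ s′)
          once : Keep h (P , Q) → Keep h (P , Q′) → Q ≡ Q′
          once (inj₁ s) (inj₁ s′) with step⁻ s | step⁻ s′
          ... | i , x , y , τ∈ , refl , refl | i′ , x′ , y′ , τ∈′ , e , refl with lft-injective e
          ...   | refl , refl = cong (rgt (ℤ.+ i)) (pairs-injective chain τ∈ τ∈′)
          once (inj₁ s) (inj₂ (inj₁ s′)) = ⊥-elim (clash {Q} {Q′} s s′)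
          once (inj₂ (inj₁ s)) (inj₁ s′) = ⊥-elim (clash {Q′} {Q} s′ s)
          once (inj₂ (inj₁ s)) (inj₂ (inj₁ s′)) with step⁻ s | step⁻ s′
          ... | i , x , y , τ∈ , e₁ , e₂ | i′ , x′ , y′ , τ∈′ , e₁′ , e₂′ with rgt-injective (trans (sym e₂) e₂′)
          ...   | refl , refl with pairs-functional (initial-descending b) chain τ∈ τ∈′
          ...     | refl = trans (sym (rotation-involutive a Q)) (trans (cong (rotation a) (trans e₁ (sym e₁′))) (rotation-involutive a Q′))
          once (inj₁ s) (inj₂ (inj₂ (_ , (c₁ , _) , _))) = ⊥-elim (c₁ (∈-map⁺ proj₁ s))
          once (inj₂ (inj₂ (_ , (c₁ , _) , _))) (inj₁ s) = ⊥-elim (c₁ (∈-map⁺ proj₁ s))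
          once (inj₂ (inj₁ s)) (inj₂ (inj₂ (_ , _ , (_ , c₄)))) = ⊥-elim (c₄ (∈-map⁺ proj₂ s))
          once (inj₂ (inj₂ (_ , _ , (_ , c₄)))) (inj₂ (inj₁ s)) = ⊥-elim (c₄ (∈-map⁺ proj₂ s))
          once (inj₂ (inj₂ (e , _))) (inj₂ (inj₂ (e′ , _))) = trans e (sym e′)

        right-once : ∀ {P P′ Q} → (P , Q) ∈ T → (P′ , Q) ∈ T → P ≡ P′
        right-once {P} {P′} m m′ = trans (sym (rotation-involutive a P)) (trans
          (cong (rotation a) (left-once (All.lookup rotation-invariant m) (All.lookup rotation-invariant m′))) (rotation-involutive a P′))

      tiling : Tiling R T
      tiling = record { sublist = filter∈sublists (keep? h) (lozengesIn R) ; leftOnce = left-once ; rightOnce = right-once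
                      ; leftTotal = left-total ; rightTotal = right-total }

      step∈ : ∀ {τ} → τ ∈ pairsOf 0 (initial b) h → stepLozenge τ ∈ T
      step∈ = step-in

      -- Given the invariance under rotation, it suffices to treat the reflection across the
      -- horizontal axis, which maps every column to itself.
      reflection-invariant : SymmetricChain 0 h → Invariant (reflection a) T
      reflection-invariant sc = All.tabulate λ { {P , Q} m →
        subst₂ (λ P Q → (P , Q) ∈ T) (sym (reflection-flip a Q)) (sym (reflection-flip a P)) (All.lookup rotation-invariant (flipped m)) }
        where
        initial-symmetric : SymmetricAt 0 (initial b)
        initial-symmetric = subst (SymmetricAt 0) (double-initial b) (double-symmetric 0 (initialUpper b))
        flip-step : ∀ {P Q} → (P , Q) ∈ steps h → (flip a P , flip a Q) ∈ steps h
        flip-step s with step⁻ s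
        ... | i , x , y , τ∈ , refl , refl = subst₂ (λ P Q → (P , Q) ∈ steps h) (sym (flip-lft a (ℤ.+ suc i) y)) (sym (flip-rgt a (ℤ.+ i) x))
          (∈-map⁺ stepLozenge (pairs-mirror gap-even chain initial-symmetric sc τ∈))
        flip-left : ∀ {P} → flip a P ∈ map proj₁ (steps h) → P ∈ map proj₁ (steps h)
        flip-left {P} m with ∈-map⁻ proj₁ m
        ... | (P′ , Q′) , s , e = subst (_∈ map proj₁ (steps h)) (trans (cong (flip a) (sym e)) (flip-involutive a P)) (∈-map⁺ proj₁ (flip-step s))
        flip-right : ∀ {Q} → flip a Q ∈ map proj₂ (steps h) → Q ∈ map proj₂ (steps h)
        flip-right {Q} m with ∈-map⁻ proj₂ m
        ... | (P′ , Q′) , s , e = subst (_∈ map proj₂ (steps h)) (trans (cong (flip a) (sym e)) (flip-involutive a Q)) (∈-map⁺ proj₂ (flip-step s))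
        flip-keep : ∀ {P Q} → Keep h (P , Q) → Keep h (flip a P , flip a Q)
        flip-keep (inj₁ s) = inj₁ (flip-step s)
        flip-keep {P} {Q} (inj₂ (inj₁ s)) = inj₂ (inj₁ (subst₂ (λ P Q → (P , Q) ∈ steps h) (flip-rotation a Q) (flip-rotation a P) (flip-step s)))
        flip-keep {P} (inj₂ (inj₂ (refl , (c₁ , c₂) , (c₃ , c₄)))) = inj₂ (inj₂ (shift-flip a P ,
          ((λ m → c₁ (flip-left m)) , λ m → c₂ (flip-left (subst (_∈ map proj₁ (steps h)) (sym (flip-rotation a (shift P))) m))) ,
          ((λ m → c₃ (flip-right m)) , λ m → c₄ (flip-right (subst (_∈ map proj₂ (steps h)) (sym (flip-rotation a P)) m)))))
        flipped : ∀ {P Q} → (P , Q) ∈ T → (flip a P , flip a Q) ∈ T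
        flipped m = let (∈L , k) = ∈-filter⁻ (keep? h) {xs = lozengesIn R} m
                        ((l , r) , adj) = lozenge⁻ R ∈L in
          ∈-filter⁺ (keep? h) (lozenge⁺ R (rot-▷ (ref-◁ l)) (rot-◁ (ref-▷ r)) (adjacent-flip a adj)) (flip-keep k)

    module _ {T : List Lozenge} (t : Tiling R T) (rot : Invariant (rotation a) T) where

      open Tiling t
      open FromTiling t rot
      open Built built

      private
        rotated : ∀ {P Q} → (P , Q) ∈ T → (rotation a Q , rotation a P) ∈ T
        rotated m = All.lookup rot m

        step-sound : ∀ {ℓ} → ℓ ∈ steps history → ℓ ∈ T × Slope (proj₁ ℓ) (proj₂ ℓ)
        step-sound s with ∈-map⁻ stepLozenge s
        ... | τ , τ∈ , refl = sound τ∈ , _ , _ , _ , proj₂ (proj₂ (pairs-range chain τ∈)) , refl , refl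

        slope-kept : ∀ j {x y} → (lft (1ℤ + j) y , rgt j x) ∈ T → j ℤ.< ℤ.+ a → (lft (1ℤ + j) y , rgt j x) ∈ steps history
        slope-kept (ℤ.+ i) m (ℤ.+<+ lt) = ∈-map⁺ stepLozenge (complete ℕ.z≤n lt m)
        slope-kept ℤ.-[1+ _ ] m _ with () ← right-column (proj₂ (proj₁ (inside m)))

        no-left : ∀ {P Q} → (P , Q) ∈ T → Level P Q → P ∉ map proj₁ (steps history)
        no-left m lv P∈ with ∈-map⁻ proj₁ P∈
        ... | (_ , Q′) , s , refl with step-sound s
        ...   | m′ , sl = level-slope lv sl (leftOnce m m′)

        no-right : ∀ {P Q} → (P , Q) ∈ T → Level P Q → Q ∉ map proj₂ (steps history)
        no-right {P} {Q} m lv Q∈ with ∈-map⁻ proj₂ Q∈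
        ... | (P′ , _) , s , refl with step-sound s
        ...   | m′ , sl = level-slope lv (subst (λ P → Slope P Q) (rightOnce m′ m) sl) refl

        level-rotation : ∀ {P Q} → Level P Q → Level (rotation a Q) (rotation a P)
        level-rotation (j , c , refl , refl) = _ , _ , rotation-rgt a j c , rotation-lft a j c

        -- A sloped lozenge on the left is a recovered step, and one on the right is the rotated
        -- image of such a step. A level lozenge is clear because each of its triangles has only one
        -- partner.
        kept : ∀ {P Q} → (P , Q) ∈ T → Adjacent P Q → Keep history (P , Q)
        kept m (inj₁ lv@(j , c , refl , refl)) = inj₂ (inj₂ (sym (shift-lft j c) ,
          (no-left m lv , no-left (rotated m) (level-rotation lv)) , (no-right m lv , no-right (rotated m) (level-rotation lv))))
        kept m (inj₂ (j , x , y , s , refl , refl)) with j ℤP.<? ℤ.+ a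
        ... | yes lt = inj₁ (slope-kept j m lt)
        ... | no ¬lt = inj₂ (inj₁ (subst (_∈ steps history) (sym turned)
                (slope-kept (ℤ.+ a + ℤ.+ a - (1ℤ + j)) (subst (_∈ T) turned (rotated m)) before)))
          where
          e : ∀ a j → a + a - j ≡ 1ℤ + (a + a - (1ℤ + j))
          e = solve-∀
          turned : act (rotation a) (lft (1ℤ + j) y , rgt j x) ≡
            (lft (1ℤ + (ℤ.+ a + ℤ.+ a - (1ℤ + j))) (ℤ.+ suc a - x) , rgt (ℤ.+ a + ℤ.+ a - (1ℤ + j)) (ℤ.+ suc a - y))
          turned = cong₂ _,_ (trans (rotation-rgt a j x) (cong (λ i → lft i (ℤ.+ suc a - x)) (e (ℤ.+ a) j))) (rotation-lft a (1ℤ + j) y)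
          before : ℤ.+ a + ℤ.+ a - (1ℤ + j) ℤ.< ℤ.+ a
          before = ℤP.suc[i]≤j⇒i<j (subst₂ ℤ._≤_ (e (ℤ.+ a) j) (e′ (ℤ.+ a)) (ℤP.+-monoʳ-≤ (ℤ.+ a + ℤ.+ a) (ℤP.neg-mono-≤ (ℤP.≮⇒≥ ¬lt))))
            where
            e′ : ∀ a → a + a - a ≡ a
            e′ = solve-∀

      history-tiling : tilingOf history ≡ T
      history-tiling = sym (tiling-⊆ R unique t (ToTiling.tiling chain)
        λ { {P , Q} m → ∈-filter⁺ (keep? history) (sublists-⊆ (lozengesIn R) sublist m) (kept m (proj₂ (inside m))) })

    tilingOf-injective : ∀ {h h′} → Chain a 0 (initial b) h → Chain a 0 (initial b) h′ → tilingOf h ≡ tilingOf h′ → h ≡ h′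
    tilingOf-injective {h} {h′} c c′ e = chain-unique c c′ λ m m′ → proj₂ (lft-injective
      (Tiling.rightOnce (ToTiling.tiling c) (ToTiling.step∈ c m) (subst (_ ∈_) (sym e) (ToTiling.step∈ c′ m′))))

    rotation-count : length (chains a 0 (initial b)) ≡ M (rotation a ∷ []) R
    rotation-count = M-tilings R (rotation a ∷ []) tilingOf (chains a 0 (initial b)) unique (chains-unique _ _ _ _ _ a 0 (initial b))
      (λ h∈ → let c = ∈-chains⁻ a 0 (initial b) h∈ in ToTiling.tiling c , ToTiling.rotation-invariant c ∷ [])
      (λ h∈ h′∈ → tilingOf-injective (∈-chains⁻ a 0 (initial b) h∈) (∈-chains⁻ a 0 (initial b) h′∈))
      λ { t (rot ∷ []) → let open FromTiling t rot in Built.history built , ∈-chains⁺ (Built.chain built) , history-tiling t rot }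

    private
      module U = System (λ j → appendMaybe (gap j)) UpperState upperState? FinalUpper finalUpper?
      open Doubled a P₀ N mid gap gap-even

      doubled : ∀ {h} → h ∈ U.chains a 0 (initialUpper b) → Chain a 0 (initial b) (doubleChain 0 h)
      doubled {h} h∈ = subst (λ xs → Chain a 0 xs (doubleChain 0 h)) (double-initial b) (double-chain refl (initialUpper-upper b) (U.∈-chains⁻ a 0 (initialUpper b) h∈))

      reflected-mirrored : ∀ {T} (t : Tiling R T) (rot : Invariant (rotation a) T) → Invariant (reflection a) T → FromTiling.Mirrored t rot
      reflected-mirrored {T} t rot ref {j} {c} m = subst₂ (λ P Q → (P , Q) ∈ T) (flip-lft a j c) (flip-rgt a j c) (All.lookup rot (All.lookup ref m))

    reflection-count : length (U.chains a 0 (initialUpper b)) ≡ M (rotation a ∷ reflection a ∷ []) R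
    reflection-count = M-tilings R (rotation a ∷ reflection a ∷ []) (λ h → tilingOf (doubleChain 0 h)) (U.chains a 0 (initialUpper b)) unique
      (chains-unique _ _ _ _ _ a 0 (initialUpper b))
      (λ {h} h∈ → let c = doubled h∈ in ToTiling.tiling c , ToTiling.rotation-invariant c ∷ ToTiling.reflection-invariant c (doubleChain-symmetric 0 h) ∷ [])
      (λ {h} {h′} h∈ h′∈ e → doubleChain-injective 0 h h′ (tilingOf-injective (doubled h∈) (doubled h′∈) e))
      λ { t (rot ∷ ref ∷ []) → onto t rot ref }
      where
      onto : ∀ {T} → Tiling R T → Invariant (rotation a) T → Invariant (reflection a) T → ∃ λ h → h ∈ U.chains a 0 (initialUpper b) × tilingOf (doubleChain 0 h) ≡ T
      onto t rot ref with halve-chain refl (initialUpper-upper b) (subst (λ xs → Chain a 0 xs (Built.history built)) (sym (double-initial b)) (Built.chain built))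
                            (Built.mirrored built (reflected-mirrored t rot ref))
        where open FromTiling t rot
      ... | h , e , c = h , U.∈-chains⁺ c , trans (cong tilingOf (sym e)) (history-tiling t rot)

-- The polygons in terms of columns and indices of vertical edges.

module Polygons where

  open import Data.Empty using (⊥)
  open import Data.Integer as ℤ using (ℤ; _+_; _-_; -_; 0ℤ; 1ℤ; ∣_∣)
  import Data.Integer.Properties as ℤP
  open import Data.Integer.Tactic.RingSolver using (solve-∀)
  open import Data.List using ([]; _∷_)
  open import Data.List.Relation.Unary.All using (All; []; _∷_)
  open import Data.Nat as ℕ using (ℕ)
  open import Data.Product using (_×_; _,_; proj₁; proj₂)
  open import Relation.Binary.PropositionalEquality
  open import Defs
  open LinearInequalities
  open LozengeTilings

  -- The polygons only depend on the coordinates xc and yc of a point.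
  hexagonAt : ℤ → ℤ → ℤ → ℤ → Set
  hexagonAt s t x y = (0ℤ ℤ.≤ x × x ℤ.≤ s) × (ℤ.+ ∣ y ∣ ℤ.≤ t + x) × (ℤ.+ ∣ y ∣ ℤ.≤ t + (s - x))

  leftAt rightAt : ℤ → ℤ → ℤ → Set
  leftAt  d x y = x ℤ.≤ d × ℤ.+ ∣ y ∣ ℤ.≤ ℤ.+ 2 - (d - x)
  rightAt d x y = d ℤ.≤ x × ℤ.+ ∣ y ∣ ℤ.≤ ℤ.+ 2 - (x - d)

  rhombusAt : ℕ → ℕ → ℤ → ℤ → Set
  rhombusAt a r x y = ∣ x - ℤ.+ a ∣ ℕ.+ ∣ y ∣ ℕ.≤ r

  module _ (f : ℤ → ℤ → Set) (j c : ℤ) where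

    opaque
      unfolding lft

      private
        x₁ : ∀ j c → c - 1ℤ + (j - c) ≡ j - 1ℤ
        x₁ = solve-∀
        x₂ : ∀ j c → 1ℤ + (c - 1ℤ) + (j - c) ≡ j
        x₂ = solve-∀
        x₃ : ∀ j c → c - 1ℤ + (1ℤ + (j - c)) ≡ j
        x₃ = solve-∀
        y₁ : ∀ j c → c - 1ℤ - (j - c) ≡ c + c - 1ℤ - j
        y₁ = solve-∀
        y₂ : ∀ j c → 1ℤ + (c - 1ℤ) - (j - c) ≡ c + c - j
        y₂ = solve-∀
        y₃ : ∀ j c → c - 1ℤ - (1ℤ + (j - c)) ≡ c + c - ℤ.+ 2 - j
        y₃ = solve-∀
        x₁′ : ∀ j c → c + (j + 1ℤ - c) ≡ j + 1ℤ
        x₁′ = solve-∀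
        x₂′ : ∀ j c → ℤ.-1ℤ + c + (j + 1ℤ - c) ≡ j
        x₂′ = solve-∀
        x₃′ : ∀ j c → c + (ℤ.-1ℤ + (j + 1ℤ - c)) ≡ j
        x₃′ = solve-∀
        y₁′ : ∀ j c → c - (j + 1ℤ - c) ≡ c + c - 1ℤ - j
        y₁′ = solve-∀
        y₂′ : ∀ j c → ℤ.-1ℤ + c - (j + 1ℤ - c) ≡ c + c - ℤ.+ 2 - j
        y₂′ = solve-∀
        y₃′ : ∀ j c → c - (ℤ.-1ℤ + (j + 1ℤ - c)) ≡ c + c - j
        y₃′ = solve-∀

      -- The vertices are the tip, one column away, and the two ends of the edge; this substitution
      -- serves all four kinds of polygons.
      at-◁⁻ : All (λ P → f (xc P) (yc P)) (vertices (◁ (lft j c))) → f (j - 1ℤ) (c + c - 1ℤ - j) × f j (c + c - j) × f j (c + c - ℤ.+ 2 - j)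
      at-◁⁻ (p ∷ q ∷ r ∷ []) = subst₂ f (x₁ j c) (y₁ j c) p , subst₂ f (x₂ j c) (y₂ j c) q , subst₂ f (x₃ j c) (y₃ j c) r

      at-◁⁺ : f (j - 1ℤ) (c + c - 1ℤ - j) → f j (c + c - j) → f j (c + c - ℤ.+ 2 - j) → All (λ P → f (xc P) (yc P)) (vertices (◁ (lft j c)))
      at-◁⁺ p q r = subst₂ f (sym (x₁ j c)) (sym (y₁ j c)) p ∷ subst₂ f (sym (x₂ j c)) (sym (y₂ j c)) q ∷ subst₂ f (sym (x₃ j c)) (sym (y₃ j c)) r ∷ []

      at-▷⁻ : All (λ P → f (xc P) (yc P)) (vertices (▷ (rgt j c))) → f (j + 1ℤ) (c + c - 1ℤ - j) × f j (c + c - ℤ.+ 2 - j) × f j (c + c - j)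
      at-▷⁻ (p ∷ q ∷ r ∷ []) = subst₂ f (x₁′ j c) (y₁′ j c) p , subst₂ f (x₂′ j c) (y₂′ j c) q , subst₂ f (x₃′ j c) (y₃′ j c) r

      at-▷⁺ : f (j + 1ℤ) (c + c - 1ℤ - j) → f j (c + c - ℤ.+ 2 - j) → f j (c + c - j) → All (λ P → f (xc P) (yc P)) (vertices (▷ (rgt j c)))
      at-▷⁺ p q r = subst₂ f (sym (x₁′ j c)) (sym (y₁′ j c)) p ∷ subst₂ f (sym (x₂′ j c)) (sym (y₂′ j c)) q ∷ subst₂ f (sym (x₃′ j c)) (sym (y₃′ j c)) r ∷ []

  module _ {A B j c : ℤ} where

    open Bounds {B} {j} {c}
    open Widths {A} {B + B} {j}

    private
      Hex : ℤ → ℤ → Set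
      Hex = hexagonAt (A + A) (B + B)

      -- In the left half the slanted sides on the left bound the height more tightly than those on
      -- the right, so one bound gives both.
      within : ∀ {x} y → 0ℤ ℤ.≤ x → x ℤ.≤ A + A → y ℤ.≤ B + B + x → - y ℤ.≤ B + B + x → B + B + x ℤ.≤ B + B + (A + A - x) → Hex x y
      within {x} y h₀ h₁ h₂ h₃ h₄ = (h₀ , h₁) , abs , ℤP.≤-trans abs h₄
        where
        abs : ℤ.+ ∣ y ∣ ℤ.≤ B + B + x
        abs = abs⁺ y h₂ h₃

      heights⁻ : Hex j (c + c - j) → Hex j (c + c - ℤ.+ 2 - j) → c ℤ.≤ B + j × 1ℤ ℤ.≤ c + B
      heights⁻ (_ , h , _) (_ , g , _) = top⁻ (proj₁ (abs⁻ {c + c - j} h)) , bottom⁻ (proj₂ (abs⁻ {c + c - ℤ.+ 2 - j} g))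

    hexagon-◁⁻ : All (λ P → hexagonAt (A + A) (B + B) (xc P) (yc P)) (vertices (◁ (lft j c))) → 1ℤ ℤ.≤ j × c ℤ.≤ B + j × 1ℤ ℤ.≤ c + B
    hexagon-◁⁻ h with at-◁⁻ Hex j c h
    ... | ((l , _) , _) , q , r = pred-≥ l , heights⁻ q r

    hexagon-◁⁺ : 1ℤ ℤ.≤ j → j ℤ.≤ A → c ℤ.≤ B + j → 1ℤ ℤ.≤ c + B → All (λ P → hexagonAt (A + A) (B + B) (xc P) (yc P)) (vertices (◁ (lft j c)))
    hexagon-◁⁺ h₀ h₁ h₂ h₃ = at-◁⁺ Hex j c
      (within (c + c - 1ℤ - j) (≥-pred h₀) (pred-≤ j≤) (top-before h₂) (bottom-before h₃) (before-≤ h₁))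
      (within (c + c - j) 0≤j j≤ (top-upper h₂) (bottom-upper h₃) (here-≤ h₁))
      (within (c + c - ℤ.+ 2 - j) 0≤j j≤ (top-lower h₂) (bottom-lower h₃) (here-≤ h₁))
      where
      0≤j : 0ℤ ℤ.≤ j
      0≤j = ℤP.≤-trans (ℤ.+≤+ ℕ.z≤n) h₀
      j≤ : j ℤ.≤ A + A
      j≤ = double-≤ 0≤j h₁

    hexagon-▷⁻ : All (λ P → hexagonAt (A + A) (B + B) (xc P) (yc P)) (vertices (▷ (rgt j c))) → 0ℤ ℤ.≤ j × c ℤ.≤ B + j × 1ℤ ℤ.≤ c + B
    hexagon-▷⁻ h with at-▷⁻ Hex j c h
    ... | _ , r , q = proj₁ (proj₁ q) , heights⁻ q r

    hexagon-▷⁺ : 0ℤ ℤ.≤ j → 1ℤ + j ℤ.≤ A → c ℤ.≤ B + j → 1ℤ ℤ.≤ c + B → All (λ P → hexagonAt (A + A) (B + B) (xc P) (yc P)) (vertices (▷ (rgt j c)))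
    hexagon-▷⁺ h₀ h₁ h₂ h₃ = at-▷⁺ Hex j c
      (within (c + c - 1ℤ - j) (suc-≥ h₀) (suc-≤ h₀ h₁) (top-after h₂) (bottom-after h₃) (after-≤ h₁))
      (within (c + c - ℤ.+ 2 - j) h₀ j≤ (top-lower h₂) (bottom-lower h₃) (here-≤ (weaken h₁)))
      (within (c + c - j) h₀ j≤ (top-upper h₂) (bottom-upper h₃) (here-≤ (weaken h₁)))
      where
      j≤ : j ℤ.≤ A + A
      j≤ = double-≤ h₀ (weaken h₁)

  module _ {k j c : ℤ} where

    open Holes {k} {j} {c}

    private
      sides⁻ : leftAt (k + k) j (c + c - j) → leftAt (k + k) j (c + c - ℤ.+ 2 - j) → k ℤ.≤ c × c + k ℤ.≤ 1ℤ + j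
      sides⁻ (_ , q) (_ , r) = low⁻ (proj₂ (abs⁻ {c + c - ℤ.+ 2 - j} r)) , high⁻ (proj₁ (abs⁻ {c + c - j} q))

    left-◁⁻ : All (λ P → leftAt (k + k) (xc P) (yc P)) (vertices (◁ (lft j c))) → j ℤ.≤ k + k × k ℤ.≤ c × c + k ℤ.≤ 1ℤ + j
    left-◁⁻ h with at-◁⁻ (leftAt (k + k)) j c h
    ... | _ , q , r = proj₁ q , sides⁻ q r

    left-◁⁺ : j ℤ.≤ k + k → k ℤ.≤ c → c + k ℤ.≤ 1ℤ + j → All (λ P → leftAt (k + k) (xc P) (yc P)) (vertices (◁ (lft j c)))
    left-◁⁺ h₁ h₂ h₃ = at-◁⁺ (leftAt (k + k)) j c (before h₁ , abs⁺ (c + c - 1ℤ - j) (high-before h₃) (low-before h₂))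
      (h₁ , abs⁺ (c + c - j) (high-upper h₃) (low-upper h₂)) (h₁ , abs⁺ (c + c - ℤ.+ 2 - j) (high-lower h₃) (low-lower h₂))

    left-▷⁻ : All (λ P → leftAt (k + k) (xc P) (yc P)) (vertices (▷ (rgt j c))) → 1ℤ + j ℤ.≤ k + k × k ℤ.≤ c × c + k ℤ.≤ 1ℤ + j
    left-▷⁻ h with at-▷⁻ (leftAt (k + k)) j c h
    ... | p , r , q = after⁻ (proj₁ p) , sides⁻ q r

    left-▷⁺ : 1ℤ + j ℤ.≤ k + k → k ℤ.≤ c → c + k ℤ.≤ 1ℤ + j → All (λ P → leftAt (k + k) (xc P) (yc P)) (vertices (▷ (rgt j c)))
    left-▷⁺ h₁ h₂ h₃ = at-▷⁺ (leftAt (k + k)) j c (after⁺ h₁ , abs⁺ (c + c - 1ℤ - j) (high-after h₃) (low-after h₂))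
      (h₁′ , abs⁺ (c + c - ℤ.+ 2 - j) (high-lower h₃) (low-lower h₂)) (h₁′ , abs⁺ (c + c - j) (high-upper h₃) (low-upper h₂))
      where
      h₁′ : j ℤ.≤ k + k
      h₁′ = ℤP.≤-trans (ℤP.i≤suc[i] j) h₁

  module _ {A k j c : ℤ} (h : k + k ℤ.≤ A) where

    right-◁ : j ℤ.≤ A → All (λ P → rightAt (A + A - (k + k)) (xc P) (yc P)) (vertices (◁ (lft j c))) → ⊥
    right-◁ le p with at-◁⁻ (rightAt (A + A - (k + k))) j c p
    ... | (l , _) , _ = far-◁ {A} {k} {j} h le l

    right-▷ : 1ℤ + j ℤ.≤ A → All (λ P → rightAt (A + A - (k + k)) (xc P) (yc P)) (vertices (▷ (rgt j c))) → ⊥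
    right-▷ le p with at-▷⁻ (rightAt (A + A - (k + k))) j c p
    ... | _ , (l , _) , _ = far-▷ {A} {k} {j} h le l

  module _ {a r : ℕ} {j c : ℤ} where

    private
      A R : ℤ
      A = ℤ.+ a
      R = ℤ.+ r

      -- The two left sides of the rhombus suffice here: for `j ≤ a` the other two bounds follow
      -- from these.
      rhombus⁻ : rhombusAt a r j (c + c - j) → rhombusAt a r j (c + c - ℤ.+ 2 - j) → c + c + A ℤ.≤ R + (j + j) × ℤ.+ 2 + A ℤ.≤ R + (c + c)
      rhombus⁻ q r′ with abs²⁻ {j - A} {c + c - j} q | abs²⁻ {j - A} {c + c - ℤ.+ 2 - j} r′
      ... | _ , h , _ | _ , _ , g = by (δ h) (e₁ A R j c) , by (δ g) (e₂ A R j c)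
        where
        e₁ : ∀ A R j c → R + (j + j) - (c + c + A) ≡ R - (- (j - A) + (c + c - j))
        e₁ = solve-∀
        e₂ : ∀ A R j c → R + (c + c) - (ℤ.+ 2 + A) ≡ R - (- (j - A) - (c + c - ℤ.+ 2 - j))
        e₂ = solve-∀

      module _ (h₁ : c + c + A ℤ.≤ R + (j + j)) (h₂ : ℤ.+ 2 + A ℤ.≤ R + (c + c)) where

        upper : j ℤ.≤ A → rhombusAt a r j (c + c - j)
        upper le = abs²⁺ {j - A} {c + c - j}
          (by (δ h₁ ⊕ δ le ⊕ δ le) (e₁ A R j c)) (by (δ h₂ ⊕ δ le ⊕ δ le ⊕ nat 2) (e₂ A R j c))
          (by (δ h₁) (e₃ A R j c)) (by (δ h₂ ⊕ nat 2) (e₄ A R j c))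
          where
          e₁ : ∀ A R j c → R - (j - A + (c + c - j)) ≡ R + (j + j) - (c + c + A) + (A - j) + (A - j)
          e₁ = solve-∀
          e₂ : ∀ A R j c → R - (j - A - (c + c - j)) ≡ R + (c + c) - (ℤ.+ 2 + A) + (A - j) + (A - j) + ℤ.+ 2
          e₂ = solve-∀
          e₃ : ∀ A R j c → R - (- (j - A) + (c + c - j)) ≡ R + (j + j) - (c + c + A)
          e₃ = solve-∀
          e₄ : ∀ A R j c → R - (- (j - A) - (c + c - j)) ≡ R + (c + c) - (ℤ.+ 2 + A) + ℤ.+ 2
          e₄ = solve-∀

        lower : j ℤ.≤ A → rhombusAt a r j (c + c - ℤ.+ 2 - j)
        lower le = abs²⁺ {j - A} {c + c - ℤ.+ 2 - j}
          (by (δ h₁ ⊕ δ le ⊕ δ le ⊕ nat 2) (e₁ A R j c)) (by (δ h₂ ⊕ δ le ⊕ δ le) (e₂ A R j c))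
          (by (δ h₁ ⊕ nat 2) (e₃ A R j c)) (by (δ h₂) (e₄ A R j c))
          where
          e₁ : ∀ A R j c → R - (j - A + (c + c - ℤ.+ 2 - j)) ≡ R + (j + j) - (c + c + A) + (A - j) + (A - j) + ℤ.+ 2
          e₁ = solve-∀
          e₂ : ∀ A R j c → R - (j - A - (c + c - ℤ.+ 2 - j)) ≡ R + (c + c) - (ℤ.+ 2 + A) + (A - j) + (A - j)
          e₂ = solve-∀
          e₃ : ∀ A R j c → R - (- (j - A) + (c + c - ℤ.+ 2 - j)) ≡ R + (j + j) - (c + c + A) + ℤ.+ 2
          e₃ = solve-∀
          e₄ : ∀ A R j c → R - (- (j - A) - (c + c - ℤ.+ 2 - j)) ≡ R + (c + c) - (ℤ.+ 2 + A)
          e₄ = solve-∀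

        tip-◁ : j ℤ.≤ A → rhombusAt a r (j - 1ℤ) (c + c - 1ℤ - j)
        tip-◁ le = abs²⁺ {j - 1ℤ - A} {c + c - 1ℤ - j}
          (by (δ h₁ ⊕ δ le ⊕ δ le ⊕ nat 2) (e₁ A R j c)) (by (δ h₂ ⊕ δ le ⊕ δ le ⊕ nat 2) (e₂ A R j c))
          (by (δ h₁) (e₃ A R j c)) (by (δ h₂) (e₄ A R j c))
          where
          e₁ : ∀ A R j c → R - (j - 1ℤ - A + (c + c - 1ℤ - j)) ≡ R + (j + j) - (c + c + A) + (A - j) + (A - j) + ℤ.+ 2
          e₁ = solve-∀
          e₂ : ∀ A R j c → R - (j - 1ℤ - A - (c + c - 1ℤ - j)) ≡ R + (c + c) - (ℤ.+ 2 + A) + (A - j) + (A - j) + ℤ.+ 2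
          e₂ = solve-∀
          e₃ : ∀ A R j c → R - (- (j - 1ℤ - A) + (c + c - 1ℤ - j)) ≡ R + (j + j) - (c + c + A)
          e₃ = solve-∀
          e₄ : ∀ A R j c → R - (- (j - 1ℤ - A) - (c + c - 1ℤ - j)) ≡ R + (c + c) - (ℤ.+ 2 + A)
          e₄ = solve-∀

        tip-▷ : 1ℤ + j ℤ.≤ A → rhombusAt a r (j + 1ℤ) (c + c - 1ℤ - j)
        tip-▷ le = abs²⁺ {j + 1ℤ - A} {c + c - 1ℤ - j}
          (by (δ h₁ ⊕ δ le ⊕ δ le ⊕ nat 2) (e₁ A R j c)) (by (δ h₂ ⊕ δ le ⊕ δ le ⊕ nat 2) (e₂ A R j c))
          (by (δ h₁ ⊕ nat 2) (e₃ A R j c)) (by (δ h₂ ⊕ nat 2) (e₄ A R j c))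
          where
          e₁ : ∀ A R j c → R - (j + 1ℤ - A + (c + c - 1ℤ - j)) ≡ R + (j + j) - (c + c + A) + (A - (1ℤ + j)) + (A - (1ℤ + j)) + ℤ.+ 2
          e₁ = solve-∀
          e₂ : ∀ A R j c → R - (j + 1ℤ - A - (c + c - 1ℤ - j)) ≡ R + (c + c) - (ℤ.+ 2 + A) + (A - (1ℤ + j)) + (A - (1ℤ + j)) + ℤ.+ 2
          e₂ = solve-∀
          e₃ : ∀ A R j c → R - (- (j + 1ℤ - A) + (c + c - 1ℤ - j)) ≡ R + (j + j) - (c + c + A) + ℤ.+ 2
          e₃ = solve-∀
          e₄ : ∀ A R j c → R - (- (j + 1ℤ - A) - (c + c - 1ℤ - j)) ≡ R + (c + c) - (ℤ.+ 2 + A) + ℤ.+ 2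
          e₄ = solve-∀

    rhombus-◁⁻ : All (λ P → rhombusAt a r (xc P) (yc P)) (vertices (◁ (lft j c))) → c + c + ℤ.+ a ℤ.≤ ℤ.+ r + (j + j) × ℤ.+ 2 + ℤ.+ a ℤ.≤ ℤ.+ r + (c + c)
    rhombus-◁⁻ h with at-◁⁻ (rhombusAt a r) j c h
    ... | _ , q , r = rhombus⁻ q r

    rhombus-◁⁺ : j ℤ.≤ ℤ.+ a → c + c + ℤ.+ a ℤ.≤ ℤ.+ r + (j + j) → ℤ.+ 2 + ℤ.+ a ℤ.≤ ℤ.+ r + (c + c) → All (λ P → rhombusAt a r (xc P) (yc P)) (vertices (◁ (lft j c)))
    rhombus-◁⁺ le h₁ h₂ = at-◁⁺ (rhombusAt a r) j c (tip-◁ h₁ h₂ le) (upper h₁ h₂ le) (lower h₁ h₂ le)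

    rhombus-▷⁻ : All (λ P → rhombusAt a r (xc P) (yc P)) (vertices (▷ (rgt j c))) → c + c + ℤ.+ a ℤ.≤ ℤ.+ r + (j + j) × ℤ.+ 2 + ℤ.+ a ℤ.≤ ℤ.+ r + (c + c)
    rhombus-▷⁻ h with at-▷⁻ (rhombusAt a r) j c h
    ... | _ , r , q = rhombus⁻ q r

    rhombus-▷⁺ : 1ℤ + j ℤ.≤ ℤ.+ a → c + c + ℤ.+ a ℤ.≤ ℤ.+ r + (j + j) → ℤ.+ 2 + ℤ.+ a ℤ.≤ ℤ.+ r + (c + c) → All (λ P → rhombusAt a r (xc P) (yc P)) (vertices (▷ (rgt j c)))
    rhombus-▷⁺ le h₁ h₂ = at-▷⁺ (rhombusAt a r) j c (tip-▷ h₁ h₂ le) (lower h₁ h₂ (ℤP.≤-trans (ℤP.i≤suc[i] j) le)) (upper h₁ h₂ (ℤP.≤-trans (ℤP.i≤suc[i] j) le))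

-- The regions with holes and rhombus satisfy the requirements of the correspondence.

module Regions where

  open import Data.Empty using (⊥; ⊥-elim)
  open import Data.Integer as ℤ using (ℤ; _+_; _-_; -_; 0ℤ; 1ℤ; ∣_∣)
  import Data.Integer.Properties as ℤP
  open import Data.Integer.Tactic.RingSolver using (solve-∀)
  open import Data.List using (List; []; _∷_; _++_; map; upTo; cartesianProduct; length)
  open import Data.List.Membership.Propositional using (_∈_)
  open import Data.List.Membership.Propositional.Properties
  open import Data.List.Relation.Unary.All as All using (All; []; _∷_)
  open import Data.List.Relation.Unary.Any using (here; there)
  open import Data.List.Relation.Unary.Unique.Propositional using (Unique)
  import Data.List.Relation.Unary.Unique.Propositional.Properties as UniqueP
  open import Data.Maybe using (Maybe; just; nothing)
  open import Data.Nat as ℕ using (ℕ; zero; suc; ⌈_/2⌉)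
  import Data.Nat.Properties as ℕP
  open import Data.Product using (_×_; _,_; ∃; proj₁; proj₂)
  open import Data.Sum using (_⊎_; inj₁; inj₂)
  open import Data.Vec using (Vec)
  import Data.Vec.Relation.Unary.All as VecAll
  import Data.Vec.Relation.Unary.Any as VecAny
  open import Relation.Binary.Definitions using (tri<; tri≈; tri>)
  open import Relation.Binary.PropositionalEquality
  open import Relation.Nullary using (¬_; Dec; yes; no)
  open import Relation.Nullary.Decidable using (_×-dec_; _⊎-dec_; ¬?)
  open import Relation.Unary using (Decidable)
  open import Defs
  open LinearInequalities
  open PathSystems
  open MiddleForms
  open CountSquare
  open Doubling
  open LozengeTilings
  open PathSteps
  open TilingsAndPaths
  open Polygons

  module _ {s : ℕ} (a b : ℕ) (ks : Vec ℕ s) (r : ℕ) where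

    private
      range : List ℤ
      range = map (λ i → ℤ.+ i - ℤ.+ b) (upTo (suc (a ℕ.+ 2 ℕ.* b)))

      box : List Point
      box = cartesianProduct range range

    Inside : Triangle → Set
    Inside t = All (Hexagon a b) (vertices t) × ¬ VecAny.Any (InHole a t) ks × ¬ All (Rhombus a r) (vertices t)

    ∈H◇⁻ : ∀ {t} → t ∈ H◇ a b ks r → Inside t
    ∈H◇⁻ {t} t∈ with ∈-filter⁻ (λ t → ¬? (All.all? (rhombus? a r) (vertices t))) {xs = H a b ks} t∈
    ... | t∈H , ¬rh with ∈-filter⁻ (λ t → ¬? (VecAny.any? (inHole? a t) ks)) {xs = hexagonRegion a b} t∈H
    ...   | t∈hex , ¬hole = proj₂ (∈-filter⁻ (λ t → All.all? (hexagon? a b) (vertices t)) {xs = map ◁ box ++ map ▷ box} t∈hex) , ¬hole , ¬rh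

    private
      hexagon⇒ : ∀ {P} → Hexagon a b P → hexagonAt (ℤ.+ a + ℤ.+ a) (ℤ.+ b + ℤ.+ b) (xc P) (yc P)
      hexagon⇒ {P} h = subst₂ (λ s t → hexagonAt s t (xc P) (yc P)) (twice a) (twice b) h

      hexagon⇐ : ∀ {P} → hexagonAt (ℤ.+ a + ℤ.+ a) (ℤ.+ b + ℤ.+ b) (xc P) (yc P) → Hexagon a b P
      hexagon⇐ {P} h = subst₂ (λ s t → hexagonAt s t (xc P) (yc P)) (sym (twice a)) (sym (twice b)) h

      ∈range : ∀ {p} → 0ℤ ℤ.≤ p + ℤ.+ b → p + ℤ.+ b ℤ.≤ ℤ.+ a + (ℤ.+ b + ℤ.+ b) → p ∈ range
      ∈range {p} h g with p + ℤ.+ b in e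
      ... | ℤ.+ i = subst (_∈ range) (trans (cong (_- ℤ.+ b) (sym e)) (shuffle p (ℤ.+ b)))
        (∈-map⁺ (λ i → ℤ.+ i - ℤ.+ b) (∈-upTo⁺ (ℕ.s≤s (subst (i ℕ.≤_) (cong (λ m → a ℕ.+ (b ℕ.+ m)) (sym (ℕP.+-identityʳ b))) (ℤP.drop‿+≤+ g)))))
        where
        shuffle : ∀ p b → p + b - b ≡ p
        shuffle = solve-∀

      ∈box : ∀ {P} → Hexagon a b P → P ∈ box
      ∈box {p , q} h with hexagon⇒ {p , q} h
      ... | _ , h₁ , h₂ with abs⁻ {p - q} {ℤ.+ b + ℤ.+ b + (p + q)} h₁ | abs⁻ {p - q} {ℤ.+ b + ℤ.+ b + (ℤ.+ a + ℤ.+ a - (p + q))} h₂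
      ...   | u₁ , v₁ | u₂ , v₂ = ∈-cartesianProduct⁺ (∈range {p} (B.low v₁) (B.high u₂)) (∈range {q} (B.low′ u₁) (B.high′ v₂))
        where module B = Box {ℤ.+ a} {ℤ.+ b} {p} {q}

      ∈triangles : ∀ t → All (Hexagon a b) (vertices t) → t ∈ map ◁ box ++ map ▷ box
      ∈triangles (◁ P) (h ∷ _) = ∈-++⁺ˡ (∈-map⁺ ◁ (∈box h))
      ∈triangles (▷ P) (h ∷ _) = ∈-++⁺ʳ (map ◁ box) (∈-map⁺ ▷ (∈box h))

    ∈H◇⁺ : ∀ {t} → Inside t → t ∈ H◇ a b ks r
    ∈H◇⁺ {t} (hex , ¬hole , ¬rh) = ∈-filter⁺ (λ t → ¬? (All.all? (rhombus? a r) (vertices t)))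
      (∈-filter⁺ (λ t → ¬? (VecAny.any? (inHole? a t) ks))
        (∈-filter⁺ (λ t → All.all? (hexagon? a b) (vertices t)) (∈triangles t hex) hex) ¬hole) ¬rh

    H◇-unique : Unique (H◇ a b ks r)
    H◇-unique = UniqueP.filter⁺ (λ t → ¬? (All.all? (rhombus? a r) (vertices t)))
      (UniqueP.filter⁺ (λ t → ¬? (VecAny.any? (inHole? a t) ks))
        (UniqueP.filter⁺ (λ t → All.all? (hexagon? a b) (vertices t))
          (UniqueP.++⁺ (UniqueP.map⁺ (λ { refl → refl }) box-unique) (UniqueP.map⁺ (λ { refl → refl }) box-unique) disjoint)))
      where
      range-unique : Unique range
      range-unique = UniqueP.map⁺ (λ {i} {j} e → ℤP.+-injective (trans (shuffle (ℤ.+ i) (ℤ.+ b)) (trans (cong (_+ ℤ.+ b) e) (sym (shuffle (ℤ.+ j) (ℤ.+ b)))))) (UniqueP.upTo⁺ (suc (a ℕ.+ 2 ℕ.* b)))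
        where
        shuffle : ∀ i b → i ≡ i - b + b
        shuffle = solve-∀
      box-unique : Unique box
      box-unique = UniqueP.cartesianProduct⁺ range-unique range-unique
      disjoint : ∀ {t} → ¬ (t ∈ map ◁ box × t ∈ map ▷ box)
      disjoint (m , m′) with ∈-map⁻ ◁ m | ∈-map⁻ ▷ m′
      ... | _ , _ , refl | _ , _ , ()

    -- Rotation and reflection act alike on what the polygons depend on: they reverse `xc` and
    -- preserve the absolute value of `yc`. Either one exchanges the left and right hole of each
    -- `k`.
    module Symmetric (σ : Symmetry) (involutive : ∀ P → σ (σ P) ≡ P)
      (σ-xc : ∀ P → xc (σ P) ≡ ℤ.+ (2 ℕ.* a) - xc P) (σ-yc : ∀ P → ∣ yc (σ P) ∣ ≡ ∣ yc P ∣)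
      (vertices-◁ : ∀ {F G : Point → Set} P → (∀ X → F X → G (σ X)) → All F (vertices (◁ P)) → All G (vertices (▷ (σ P))))
      (vertices-▷ : ∀ {F G : Point → Set} P → (∀ X → F X → G (σ X)) → All F (vertices (▷ P)) → All G (vertices (◁ (σ P)))) where

      private
        S : ℤ
        S = ℤ.+ (2 ℕ.* a)

        hexagon-σ : ∀ P → Hexagon a b P → Hexagon a b (σ P)
        hexagon-σ P ((h₀ , h₁) , h₂ , h₃) rewrite σ-xc P | σ-yc P =
          (Mirrors.turn-≥ {S} {0ℤ} {xc P} h₁ , Mirrors.turn-≤ {S} {0ℤ} {xc P} h₀) , h₃ ,
          subst (ℤ.+ ∣ yc P ∣ ℤ.≤_) (Mirrors.turn-back {S} {ℤ.+ (2 ℕ.* b)} {xc P}) h₂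

        left-σ : ∀ d P → LeftTriangle 2 d P → RightTriangle 2 (S - d) (σ P)
        left-σ d P (h , g) rewrite σ-xc P | σ-yc P = MirrorHoles.left-right {S} {d} {xc P} h ,
          subst (ℤ.+ ∣ yc P ∣ ℤ.≤_) (MirrorHoles.left-right′ {S} {d} {xc P}) g

        right-σ : ∀ d P → RightTriangle 2 (S - d) P → LeftTriangle 2 d (σ P)
        right-σ d P (h , g) rewrite σ-xc P | σ-yc P = MirrorHoles.right-left {S} {d} {xc P} h ,
          subst (ℤ.+ ∣ yc P ∣ ℤ.≤_) (MirrorHoles.right-left′ {S} {d} {xc P}) g

        rhombus-σ : ∀ P → Rhombus a r P → Rhombus a r (σ P)
        rhombus-σ P h = subst₂ (λ u v → u ℕ.+ v ℕ.≤ r) (sym distance) (sym (σ-yc P)) h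
          where
          shuffle : ∀ a x → a + a - x - a ≡ - (x - a)
          shuffle = solve-∀
          distance : ∣ xc (σ P) - ℤ.+ a ∣ ≡ ∣ xc P - ℤ.+ a ∣
          distance = trans (cong ∣_∣ (trans (cong (_- ℤ.+ a) (trans (σ-xc P) (cong (_- xc P) (twice a)))) (shuffle (ℤ.+ a) (xc P)))) (ℤP.∣-i∣≡∣i∣ (xc P - ℤ.+ a))

        hole-◁ : ∀ P k → InHole a (◁ P) k → InHole a (▷ (σ P)) k
        hole-◁ P k (inj₁ h) = inj₂ (vertices-◁ P (left-σ (ℤ.+ (2 ℕ.* k))) h)
        hole-◁ P k (inj₂ h) = inj₁ (vertices-◁ P (right-σ (ℤ.+ (2 ℕ.* k))) h)

        hole-▷ : ∀ P k → InHole a (▷ P) k → InHole a (◁ (σ P)) k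
        hole-▷ P k (inj₁ h) = inj₂ (vertices-▷ P (left-σ (ℤ.+ (2 ℕ.* k))) h)
        hole-▷ P k (inj₂ h) = inj₁ (vertices-▷ P (right-σ (ℤ.+ (2 ℕ.* k))) h)

      σ-◁ : ∀ {P} → ◁ P ∈ H◇ a b ks r → ▷ (σ P) ∈ H◇ a b ks r
      σ-◁ {P} P∈ with ∈H◇⁻ P∈
      ... | hex , ¬hole , ¬rh = ∈H◇⁺ (vertices-◁ P hexagon-σ hex ,
        (λ h → ¬hole (VecAny.map (λ {k} h → subst (λ P → InHole a (◁ P) k) (involutive P) (hole-▷ (σ P) k h)) h)) ,
        λ h → ¬rh (subst (λ P → All (Rhombus a r) (vertices (◁ P))) (involutive P) (vertices-▷ (σ P) rhombus-σ h)))

      σ-▷ : ∀ {P} → ▷ P ∈ H◇ a b ks r → ◁ (σ P) ∈ H◇ a b ks r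
      σ-▷ {P} P∈ with ∈H◇⁻ P∈
      ... | hex , ¬hole , ¬rh = ∈H◇⁺ (vertices-▷ P hexagon-σ hex ,
        (λ h → ¬hole (VecAny.map (λ {k} h → subst (λ P → InHole a (▷ P) k) (involutive P) (hole-◁ (σ P) k h)) h)) ,
        λ h → ¬rh (subst (λ P → All (Rhombus a r) (vertices (▷ P))) (involutive P) (vertices-◁ (σ P) rhombus-σ h)))

    private
      rotation-xc : ∀ P → xc (rotation a P) ≡ ℤ.+ (2 ℕ.* a) - xc P
      rotation-xc (p , q) = trans (shuffle (ℤ.+ a) p q) (cong (_- (p + q)) (sym (twice a)))
        where
        shuffle : ∀ a p q → a - p + (a - q) ≡ a + a - (p + q)
        shuffle = solve-∀

      rotation-yc : ∀ P → ∣ yc (rotation a P) ∣ ≡ ∣ yc P ∣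
      rotation-yc (p , q) = trans (cong ∣_∣ (shuffle (ℤ.+ a) p q)) (ℤP.∣-i∣≡∣i∣ (p - q))
        where
        shuffle : ∀ a p q → a - p - (a - q) ≡ - (p - q)
        shuffle = solve-∀

      reflection-xc : ∀ P → xc (reflection a P) ≡ ℤ.+ (2 ℕ.* a) - xc P
      reflection-xc (p , q) = trans (shuffle (ℤ.+ a) p q) (cong (_- (p + q)) (sym (twice a)))
        where
        shuffle : ∀ a p q → a - q + (a - p) ≡ a + a - (p + q)
        shuffle = solve-∀

      reflection-yc : ∀ P → ∣ yc (reflection a P) ∣ ≡ ∣ yc P ∣
      reflection-yc (p , q) = cong ∣_∣ (shuffle (ℤ.+ a) p q)
        where
        shuffle : ∀ a p q → a - q - (a - p) ≡ p - q
        shuffle = solve-∀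

      reflection-involutive : ∀ P → reflection a (reflection a P) ≡ P
      reflection-involutive (p , q) = cong₂ _,_ (e (ℤ.+ a) p) (e (ℤ.+ a) q)
        where
        e : ∀ a p → a - (a - p) ≡ p
        e = solve-∀

      -suc : ∀ a p → a - (1ℤ + p) ≡ ℤ.-1ℤ + (a - p)
      -suc = solve-∀

      -pred : ∀ a p → a - (ℤ.-1ℤ + p) ≡ 1ℤ + (a - p)
      -pred = solve-∀

      rotation-◁ : ∀ {F G : Point → Set} P → (∀ X → F X → G (rotation a X)) → All F (vertices (◁ P)) → All G (vertices (▷ (rotation a P)))
      rotation-◁ {G = G} (p , q) f (x ∷ y ∷ z ∷ []) = f _ x ∷ subst (λ u → G (u , ℤ.+ a - q)) (-suc (ℤ.+ a) p) (f _ y) ∷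
        subst (λ u → G (ℤ.+ a - p , u)) (-suc (ℤ.+ a) q) (f _ z) ∷ []

      rotation-▷ : ∀ {F G : Point → Set} P → (∀ X → F X → G (rotation a X)) → All F (vertices (▷ P)) → All G (vertices (◁ (rotation a P)))
      rotation-▷ {G = G} (p , q) f (x ∷ y ∷ z ∷ []) = f _ x ∷ subst (λ u → G (u , ℤ.+ a - q)) (-pred (ℤ.+ a) p) (f _ y) ∷
        subst (λ u → G (ℤ.+ a - p , u)) (-pred (ℤ.+ a) q) (f _ z) ∷ []

      reflection-◁ : ∀ {F G : Point → Set} P → (∀ X → F X → G (reflection a X)) → All F (vertices (◁ P)) → All G (vertices (▷ (reflection a P)))
      reflection-◁ {G = G} (p , q) f (x ∷ y ∷ z ∷ []) = f _ x ∷ subst (λ u → G (u , ℤ.+ a - p)) (-suc (ℤ.+ a) q) (f _ z) ∷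
        subst (λ u → G (ℤ.+ a - q , u)) (-suc (ℤ.+ a) p) (f _ y) ∷ []

      reflection-▷ : ∀ {F G : Point → Set} P → (∀ X → F X → G (reflection a X)) → All F (vertices (▷ P)) → All G (vertices (◁ (reflection a P)))
      reflection-▷ {G = G} (p , q) f (x ∷ y ∷ z ∷ []) = f _ x ∷ subst (λ u → G (u , ℤ.+ a - p)) (-pred (ℤ.+ a) q) (f _ z) ∷
        subst (λ u → G (ℤ.+ a - q , u)) (-pred (ℤ.+ a) p) (f _ y) ∷ []

      module Rotation = Symmetric (rotation a) (rotation-involutive a) rotation-xc rotation-yc rotation-◁ rotation-▷
      module Reflection = Symmetric (reflection a) reflection-involutive reflection-xc reflection-yc reflection-◁ reflection-▷

    -- InnerEdge: the vertical unit edge in the interior of a hole, one column before its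
    -- vertical side.
    Bound InnerEdge InRhombus Cell Source : ℕ → ℤ → Set
    Bound j c     = c ℤ.≤ ℤ.+ b + ℤ.+ j × 1ℤ ℤ.≤ c + ℤ.+ b
    InnerEdge j c = VecAny.Any (λ k → suc j ≡ 2 ℕ.* k × c ≡ ℤ.+ k) ks
    InRhombus j c = c + c + ℤ.+ a ℤ.≤ ℤ.+ r + (ℤ.+ j + ℤ.+ j) × ℤ.+ 2 + ℤ.+ a ℤ.≤ ℤ.+ r + (c + c)
    Cell j c      = Bound j c × ¬ InnerEdge j c × ¬ InRhombus j c
    Source j c    = j ≡ 0 ⊎ VecAny.Any (λ k → j ≡ 2 ℕ.* k × (c ≡ 1ℤ + ℤ.+ k ⊎ c ≡ ℤ.+ k)) ks

    private
      inRhombus? : ∀ j → Decidable (InRhombus j)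
      inRhombus? j c = (c + c + ℤ.+ a ℤ.≤? ℤ.+ r + (ℤ.+ j + ℤ.+ j)) ×-dec (ℤ.+ 2 + ℤ.+ a ℤ.≤? ℤ.+ r + (c + c))

      source? : ∀ j → Decidable (Source j)
      source? j c = (j ℕ.≟ 0) ⊎-dec VecAny.any? (λ k → (j ℕ.≟ 2 ℕ.* k) ×-dec ((c ℤ.≟ 1ℤ + ℤ.+ k) ⊎-dec (c ℤ.≟ ℤ.+ k))) ks

      -- Holes swallowed by the rhombus emit no paths.
      Open : ℕ → ℕ → Set
      Open j k = j ≡ 2 ℕ.* k × ¬ InRhombus j (1ℤ + ℤ.+ k)

      open? : ∀ j → Decidable (Open j)
      open? j k = (j ℕ.≟ 2 ℕ.* k) ×-dec ¬? (inRhombus? j (1ℤ + ℤ.+ k))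

    gapOf : ∀ {j} → Dec (VecAny.Any (Open j) ks) → Maybe ℤ
    gapOf (yes any) = just (ℤ.+ proj₁ (VecAny.satisfied any))
    gapOf (no _)    = nothing

    -- Because `j = 2 * k` determines `k`, any witness found gives the same hole.
    gap : ℕ → Maybe ℤ
    gap j = gapOf (VecAny.any? (open? j) ks)

    private
      doubled : ∀ k {j} → j ≡ 2 ℕ.* k → ℤ.+ j ≡ ℤ.+ k + ℤ.+ k
      doubled k refl = twice k

      undoubled : ∀ k {j} → ℤ.+ j ≡ ℤ.+ k + ℤ.+ k → j ≡ 2 ℕ.* k
      undoubled k e = ℤP.+-injective (trans e (sym (twice k)))

      half-injective : ∀ {k k′} → 2 ℕ.* k ≡ 2 ℕ.* k′ → k ≡ k′
      half-injective {k} {k′} e = ℕP.*-cancelˡ-≡ k k′ 2 e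

      odd≢even : ∀ {k k′} → suc (2 ℕ.* k) ≢ 2 ℕ.* k′
      odd≢even {zero}  {suc k′} e with () ← ℕP.suc-injective (trans e (ℕP.*-suc 2 k′))
      odd≢even {suc k} {suc k′} e = odd≢even {k} {k′} (ℕP.suc-injective (ℕP.suc-injective
        (trans (cong suc (sym (ℕP.*-suc 2 k))) (trans e (ℕP.*-suc 2 k′)))))

      gap⁻ : ∀ {j k} → gap j ≡ just k → ∃ λ k′ → k ≡ ℤ.+ k′ × VecAny.Any (λ x → x ≡ k′) ks × Open j k′
      gap⁻ {j} e with VecAny.any? (open? j) ks | e
      ... | yes any | refl = _ , refl , locate any , proj₂ (VecAny.satisfied any)
        where
        locate : ∀ {n} {xs : Vec ℕ n} {P : ℕ → Set} (any : VecAny.Any P xs) → VecAny.Any (λ x → x ≡ proj₁ (VecAny.satisfied any)) xs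
        locate (VecAny.here p)  = VecAny.here refl
        locate (VecAny.there p) = VecAny.there (locate p)

      gap⁺ : ∀ {j} → VecAny.Any (Open j) ks → ∃ λ k → gap j ≡ just (ℤ.+ k) × Open j k
      gap⁺ {j} any with VecAny.any? (open? j) ks
      ... | yes any′ = _ , refl , proj₂ (VecAny.satisfied any′)
      ... | no ¬any  = ⊥-elim (¬any any)

    gap-even : ∀ {j k} → gap j ≡ just k → ℤ.+ j ≡ k + k
    gap-even e with gap⁻ e
    ... | k , refl , _ , (e′ , _) = doubled k e′

    private
      -- Twice an admissible end is at least `a + 2`, to lie above the axis, and at least
      -- `a + 1 + r`, to lie above the rhombus. `P₀` is half of the larger bound, rounded up.
      target : ℕ
      target = suc (suc a) ℕ.⊔ (suc a ℕ.+ r)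

    P₀ : ℤ
    P₀ = ℤ.+ ⌈ target /2⌉

    -- Chosen generously: no path ends above `a + b`, and the telescoping sums have to run past
    -- every reachable end. The true upper limit is imposed by `Bound`.
    N : ℕ
    N = suc (a ℕ.+ b)

    private
      half-above : ∀ n → n ℕ.≤ ⌈ n /2⌉ ℕ.+ ⌈ n /2⌉
      half-above zero          = ℕ.z≤n
      half-above (suc zero)    = ℕ.s≤s ℕ.z≤n
      half-above (suc (suc n)) = ℕ.s≤s (subst (suc n ℕ.≤_) (sym (ℕP.+-suc ⌈ n /2⌉ ⌈ n /2⌉)) (ℕ.s≤s (half-above n)))

      half-least : ∀ n m → n ℕ.≤ m ℕ.+ m → ⌈ n /2⌉ ℕ.≤ m
      half-least zero          m       h = ℕ.z≤n
      half-least (suc zero)    (suc m) h = ℕ.s≤s ℕ.z≤n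
      half-least (suc (suc n)) (suc m) (ℕ.s≤s h) = ℕ.s≤s (half-least n m (ℕ.s≤s⁻¹ (subst (suc n ℕ.≤_) (ℕP.+-suc m m) h)))

      P₀-least : ∀ {c} → ℤ.+ suc a ℤ.< c + c → ℤ.+ suc a + ℤ.+ r ℤ.≤ c + c → P₀ ℤ.≤ c
      P₀-least {ℤ.+ m} (ℤ.+<+ h) (ℤ.+≤+ g) = ℤ.+≤+ (half-least target m (ℕP.⊔-lub h g))

      P₀-above : ∀ {c} → P₀ ℤ.≤ c → ℤ.+ suc a + ℤ.+ r ℤ.≤ c + c
      P₀-above h = ℤP.≤-trans (ℤ.+≤+ (ℕP.≤-trans (ℕP.m≤n⊔m (suc (suc a)) (suc a ℕ.+ r)) (half-above target))) (ℤP.+-mono-≤ h h)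

    mid : ℤ.+ suc a ℤ.< P₀ + P₀
    mid = ℤ.+<+ (ℕP.≤-trans (ℕP.m≤m⊔n (suc (suc a)) (suc a ℕ.+ r)) (half-above target))

    big : ℤ.+ (a ℕ.+ b) ℤ.< P₀ + ℤ.+ N
    big = ℤ.+<+ (ℕP.m≤n+m N ⌈ target /2⌉)

    open Middle a P₀ N mid

    private
      rhombus-mirror : ∀ {j c} → InRhombus j c → InRhombus j (mir j c)
      rhombus-mirror {j} {c} (h₁ , h₂) = Rhombi.mirror₁ {ℤ.+ a} {ℤ.+ r} {ℤ.+ j} {c} h₂ , Rhombi.mirror₂ {ℤ.+ a} {ℤ.+ r} {ℤ.+ j} {c} h₁

      rhombus-unmirror : ∀ {j c} → InRhombus j (mir j c) → InRhombus j c
      rhombus-unmirror {j} {c} h = subst (InRhombus j) (mir-involutive j c) (rhombus-mirror {j} {mir j c} h)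

      rhombus-step : ∀ {j x y} → Step x y → InRhombus j x → InRhombus (suc j) y
      rhombus-step {j} {x} stay (h₁ , h₂) = Rhombi.stay₁ {ℤ.+ a} {ℤ.+ r} {ℤ.+ j} {x} h₁ , h₂
      rhombus-step {j} {x} rise (h₁ , h₂) = Rhombi.rise₁ {ℤ.+ a} {ℤ.+ r} {ℤ.+ j} {x} h₁ , Rhombi.rise₂ {ℤ.+ a} {ℤ.+ r} {ℤ.+ j} {x} h₂

      -- The positions k and 1 + k in column 2k are mirror images.
      rhombus-pair : ∀ {j k c} → j ≡ 2 ℕ.* k → c ≡ 1ℤ + ℤ.+ k ⊎ c ≡ ℤ.+ k → ¬ InRhombus j (1ℤ + ℤ.+ k) → ¬ InRhombus j c
      rhombus-pair e (inj₁ refl) ¬h h = ¬h h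
      rhombus-pair {j} {k} e (inj₂ refl) ¬h h = ¬h (subst (InRhombus j) (trans (cong (λ u → 1ℤ + u - ℤ.+ k) (doubled k e)) (shuffle (ℤ.+ k))) (rhombus-mirror {j} {ℤ.+ k} h))
        where
        shuffle : ∀ k → 1ℤ + (k + k) - k ≡ 1ℤ + k
        shuffle = solve-∀

      rhombus-pair′ : ∀ {j k c} → j ≡ 2 ℕ.* k → c ≡ 1ℤ + ℤ.+ k ⊎ c ≡ ℤ.+ k → ¬ InRhombus j c → ¬ InRhombus j (1ℤ + ℤ.+ k)
      rhombus-pair′ e (inj₁ refl) ¬h h = ¬h h
      rhombus-pair′ {j} {k} e (inj₂ refl) ¬h h = ¬h (subst (InRhombus j) (trans (cong (λ u → 1ℤ + u - (1ℤ + ℤ.+ k)) (doubled k e)) (shuffle (ℤ.+ k))) (rhombus-mirror {j} {1ℤ + ℤ.+ k} h))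
        where
        shuffle : ∀ k → 1ℤ + (k + k) - (1ℤ + k) ≡ k
        shuffle = solve-∀

      cell-mirror : ∀ {j c} → Cell j c → Cell j (mir j c)
      cell-mirror {j} {c} ((h₁ , h₂) , ¬inner , ¬rh) =
        (Steps.mirror-top {ℤ.+ b} {ℤ.+ j} {c} h₂ , Steps.mirror-bottom {ℤ.+ b} {ℤ.+ j} {c} h₁) ,
        (λ h → ¬inner (VecAny.map (λ { {k} (e , e′) → e , trans (sym (mir-involutive j c)) (trans (cong (mir j) e′) (trans (cong (_- ℤ.+ k) (doubled k e)) (shuffle (ℤ.+ k)))) }) h)) ,
        λ h → ¬rh (rhombus-unmirror {j} {c} h)
        where
        shuffle : ∀ k → k + k - k ≡ k
        shuffle = solve-∀

    module _ (r≤a : r ℕ.≤ a) (positive : VecAll.All (0 ℕ.<_) ks) (small : VecAll.All (λ k → 2 ℕ.* k ℕ.≤ a) ks) where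

      private
        lookupAny : ∀ {P Q : ℕ → Set} {n} {xs : Vec ℕ n} → VecAll.All P xs → VecAny.Any Q xs → ∃ λ k → P k × Q k
        lookupAny (p VecAll.∷ ps) (VecAny.here q)  = _ , p , q
        lookupAny (p VecAll.∷ ps) (VecAny.there q) = lookupAny ps q

        tagged : ∀ {P Q : ℕ → Set} {n} {xs : Vec ℕ n} → VecAll.All P xs → VecAny.Any Q xs → VecAny.Any (λ k → P k × Q k) xs
        tagged (p VecAll.∷ ps) (VecAny.here q)  = VecAny.here (p , q)
        tagged (p VecAll.∷ ps) (VecAny.there q) = VecAny.there (tagged ps q)

        left-◁⇒ : ∀ {j c k} → ◁ (lft (ℤ.+ j) c) ⊑ LeftTriangle 2 (ℤ.+ (2 ℕ.* k)) →
          (j ≡ 2 ℕ.* k × (c ≡ 1ℤ + ℤ.+ k ⊎ c ≡ ℤ.+ k)) ⊎ (suc j ≡ 2 ℕ.* k × c ≡ ℤ.+ k)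
        left-◁⇒ {j} {c} {k} h with left-◁⁻ {ℤ.+ k} {ℤ.+ j} {c} (subst (λ d → ◁ (lft (ℤ.+ j) c) ⊑ LeftTriangle 2 d) (twice k) h)
        ... | h₁ , h₂ , h₃ with hole-edges {ℤ.+ k} {ℤ.+ j} {c} h₁ h₂ h₃
        ...   | inj₁ (e , e′) = inj₁ (undoubled k e , e′)
        ...   | inj₂ (e , e′) = inj₂ (undoubled k e , e′)

        ◁-inHole : ∀ {j c k} → j ℤ.≤ ℤ.+ k + ℤ.+ k → ℤ.+ k ℤ.≤ c → c + ℤ.+ k ℤ.≤ 1ℤ + j → InHole a (◁ (lft j c)) k
        ◁-inHole {j} {c} {k} h₁ h₂ h₃ = inj₁ (subst (λ d → ◁ (lft j c) ⊑ LeftTriangle 2 d) (sym (twice k)) (left-◁⁺ h₁ h₂ h₃))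

        ◁⇒cell : ∀ {j c} → j ℕ.≤ a → ◁ (lft (ℤ.+ j) c) ∈ H◇ a b ks r → Cell j c × ¬ Source j c
        ◁⇒cell {j} {c} le ∈R with ∈H◇⁻ ∈R
        ... | hex , ¬hole , ¬rh with hexagon-◁⁻ {ℤ.+ a} {ℤ.+ b} {ℤ.+ j} {c} (All.map (λ {P} → hexagon⇒ {P}) hex)
        ...   | h₀ , h₁ , h₂ = ((h₁ , h₂) , ¬inner , λ { (g₁ , g₂) → ¬rh (rhombus-◁⁺ (ℤ.+≤+ le) g₁ g₂) }) , ¬source
          where
          ¬inner : ¬ InnerEdge j c
          ¬inner h = ¬hole (VecAny.map (λ { {k} (e , refl) → ◁-inHole {ℤ.+ j} {ℤ.+ k} {k} (ℤP.≤-trans (ℤP.i≤suc[i] (ℤ.+ j)) (ℤP.≤-reflexive (doubled k e))) ℤP.≤-refl (ℤP.≤-reflexive (sym (doubled k e))) }) h)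
          ¬source : ¬ Source j c
          ¬source (inj₁ e) = ℤP.<-irrefl (cong ℤ.+_ (sym e)) (ℤP.suc[i]≤j⇒i<j h₀)
          ¬source (inj₂ h) = ¬hole (VecAny.map (λ { {k} (e , e′) → edge k e e′ }) h)
            where
            edge : ∀ k → j ≡ 2 ℕ.* k → c ≡ 1ℤ + ℤ.+ k ⊎ c ≡ ℤ.+ k → InHole a (◁ (lft (ℤ.+ j) c)) k
            edge k e (inj₁ refl) = ◁-inHole (ℤP.≤-reflexive (doubled k e)) (ℤP.i≤suc[i] (ℤ.+ k)) (ℤP.≤-reflexive (trans (ℤP.+-assoc 1ℤ (ℤ.+ k) (ℤ.+ k)) (cong (1ℤ +_) (sym (doubled k e)))))
            edge k e (inj₂ refl) = ◁-inHole (ℤP.≤-reflexive (doubled k e)) ℤP.≤-refl (ℤP.≤-trans (ℤP.≤-reflexive (sym (doubled k e))) (ℤP.i≤suc[i] (ℤ.+ j)))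

        cell⇒◁ : ∀ {j c} → j ℕ.≤ a → Cell j c → ¬ Source j c → ◁ (lft (ℤ.+ j) c) ∈ H◇ a b ks r
        cell⇒◁ {zero} le cell ¬s = ⊥-elim (¬s (inj₁ refl))
        cell⇒◁ {suc j} {c} le ((h₁ , h₂) , ¬inner , ¬rh) ¬s = ∈H◇⁺
          (All.map (λ {P} → hexagon⇐ {P}) (hexagon-◁⁺ {ℤ.+ a} {ℤ.+ b} (ℤ.+≤+ (ℕ.s≤s ℕ.z≤n)) (ℤ.+≤+ le) h₁ h₂) ,
           (λ h → ¬hole (tagged small h)) , λ h → ¬rh (rhombus-◁⁻ h))
          where
          ¬hole : ¬ VecAny.Any (λ k → 2 ℕ.* k ℕ.≤ a × InHole a (◁ (lft (ℤ.+ suc j) c)) k) ks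
          ¬hole h with VecAny.map {Q = λ k → (suc j ≡ 2 ℕ.* k × (c ≡ 1ℤ + ℤ.+ k ⊎ c ≡ ℤ.+ k)) ⊎ (suc (suc j) ≡ 2 ℕ.* k × c ≡ ℤ.+ k)} (λ { {k} (_ , inj₁ p) → left-◁⇒ p
                               ; {k} (2k≤a , inj₂ p) → ⊥-elim (right-◁ {ℤ.+ a} {ℤ.+ k} {ℤ.+ suc j} {c} (subst (ℤ._≤ ℤ.+ a) (twice k) (ℤ.+≤+ 2k≤a)) (ℤ.+≤+ le)
                                   (subst₂ (λ u v → ◁ (lft (ℤ.+ suc j) c) ⊑ RightTriangle 2 (u - v)) (twice a) (twice k) p)) }) h
          ... | any = split any (λ q → ¬s (inj₂ q)) ¬inner
            where
            split : ∀ {P Q : ℕ → Set} {n} {xs : Vec ℕ n} → VecAny.Any (λ k → P k ⊎ Q k) xs → ¬ VecAny.Any P xs → ¬ VecAny.Any Q xs → ⊥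
            split (VecAny.here (inj₁ p)) f g = f (VecAny.here p)
            split (VecAny.here (inj₂ q)) f g = g (VecAny.here q)
            split (VecAny.there h) f g = split h (λ p → f (VecAny.there p)) (λ q → g (VecAny.there q))

        -- In contrast to `◁⇒cell`, sources are not excluded: the triangle to the right of such an
        -- edge can belong to the region, and there a path begins.
        ▷⇒cell : ∀ {j c} → j ℕ.< a → ▷ (rgt (ℤ.+ j) c) ∈ H◇ a b ks r → Cell j c
        ▷⇒cell {j} {c} lt ∈R with ∈H◇⁻ ∈R
        ... | hex , ¬hole , ¬rh with hexagon-▷⁻ {ℤ.+ a} {ℤ.+ b} {ℤ.+ j} {c} (All.map (λ {P} → hexagon⇒ {P}) hex)
        ...   | _ , h₁ , h₂ = (h₁ , h₂) , ¬inner , λ { (g₁ , g₂) → ¬rh (rhombus-▷⁺ (ℤ.+≤+ lt) g₁ g₂) }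
          where
          ¬inner : ¬ InnerEdge j c
          ¬inner h = ¬hole (VecAny.map (λ { {k} (e , refl) → inj₁ (subst (λ d → ▷ (rgt (ℤ.+ j) (ℤ.+ k)) ⊑ LeftTriangle 2 d) (sym (twice k))
            (left-▷⁺ (ℤP.≤-reflexive (doubled k e)) ℤP.≤-refl (ℤP.≤-reflexive (sym (doubled k e))))) }) h)

        cell⇒▷ : ∀ {j c} → j ℕ.< a → Cell j c → ▷ (rgt (ℤ.+ j) c) ∈ H◇ a b ks r
        cell⇒▷ {j} {c} lt ((h₁ , h₂) , ¬inner , ¬rh) = ∈H◇⁺
          (All.map (λ {P} → hexagon⇐ {P}) (hexagon-▷⁺ {ℤ.+ a} {ℤ.+ b} (ℤ.+≤+ ℕ.z≤n) (ℤ.+≤+ lt) h₁ h₂) ,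
           (λ h → ¬inner (VecAny.map (λ { {k} (2k≤a , p) → inner k 2k≤a p }) (tagged small h))) , λ h → ¬rh (rhombus-▷⁻ h))
          where
          inner : ∀ k → 2 ℕ.* k ℕ.≤ a → InHole a (▷ (rgt (ℤ.+ j) c)) k → suc j ≡ 2 ℕ.* k × c ≡ ℤ.+ k
          inner k 2k≤a (inj₂ p) = ⊥-elim (right-▷ {ℤ.+ a} {ℤ.+ k} {ℤ.+ j} {c} (subst (ℤ._≤ ℤ.+ a) (twice k) (ℤ.+≤+ 2k≤a)) (ℤ.+≤+ lt)
            (subst₂ (λ u v → ▷ (rgt (ℤ.+ j) c) ⊑ RightTriangle 2 (u - v)) (twice a) (twice k) p))
          inner k 2k≤a (inj₁ p) with left-▷⁻ {ℤ.+ k} {ℤ.+ j} {c} (subst (λ d → ▷ (rgt (ℤ.+ j) c) ⊑ LeftTriangle 2 d) (twice k) p)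
          ... | g₁ , g₂ , g₃ with hole-edges {ℤ.+ k} {ℤ.+ j} {c} (ℤP.≤-trans (ℤP.i≤suc[i] (ℤ.+ j)) g₁) g₂ g₃
          ...   | inj₁ (e , _)  = ⊥-elim (ℤP.<-irrefl e (ℤP.suc[i]≤j⇒i<j g₁))
          ...   | inj₂ (e , e′) = undoubled k e , e′

        column-◁ : ∀ {j c} → ◁ (lft j c) ∈ H◇ a b ks r → 0ℤ ℤ.< j
        column-◁ {j} {c} ∈R = ℤP.suc[i]≤j⇒i<j (proj₁ (hexagon-◁⁻ {ℤ.+ a} {ℤ.+ b} {j} {c} (All.map (λ {P} → hexagon⇒ {P}) (proj₁ (∈H◇⁻ ∈R)))))

        column-▷ : ∀ {j c} → ▷ (rgt j c) ∈ H◇ a b ks r → 0ℤ ℤ.≤ j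
        column-▷ {j} {c} ∈R = proj₁ (hexagon-▷⁻ {ℤ.+ a} {ℤ.+ b} {j} {c} (All.map (λ {P} → hexagon⇒ {P}) (proj₁ (∈H◇⁻ ∈R))))

        gap⇒source : ∀ {j c} → c ∈ᵍ gap (suc j) → Source (suc j) c × Cell (suc j) c
        gap⇒source {j} {c} (_ , e , c≡) with gap⁻ e
        ... | k , refl , k∈ , (e′ , ¬rh) = inj₂ (VecAny.map (λ { refl → e′ , c≡ }) k∈) ,
          bound c≡ , (λ h → even-odd h) , rhombus-pair e′ c≡ ¬rh
          where
          k≥1 : 1ℤ ℤ.≤ ℤ.+ k
          k≥1 with lookupAny positive k∈
          ... | _ , p , refl = ℤ.+≤+ p
          bound : c ≡ 1ℤ + ℤ.+ k ⊎ c ≡ ℤ.+ k → Bound (suc j) c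
          bound (inj₁ refl) = subst (λ u → 1ℤ + ℤ.+ k ℤ.≤ ℤ.+ b + u) (sym (doubled k e′)) (Steps.gap-top′ {ℤ.+ b} {0ℤ} {ℤ.+ k} k≥1 (nat b)) ,
            Steps.rise-bottom {ℤ.+ b} {0ℤ} {ℤ.+ k} (Steps.gap-bottom {ℤ.+ b} {0ℤ} {ℤ.+ k} k≥1 (nat b))
          bound (inj₂ refl) = subst (λ u → ℤ.+ k ℤ.≤ ℤ.+ b + u) (sym (doubled k e′)) (Steps.gap-top {ℤ.+ b} {0ℤ} {ℤ.+ k} k≥1 (nat b)) ,
            Steps.gap-bottom {ℤ.+ b} {0ℤ} {ℤ.+ k} k≥1 (nat b)
          even-odd : InnerEdge (suc j) c → ⊥
          even-odd h with VecAny.satisfied h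
          ... | k′ , (e″ , _) = odd≢even {k} {k′} (trans (cong suc (sym e′)) e″)

        -- A cell lies outside the rhombus, hence so does its partner on the vertical side, and the
        -- hole is open.
        source⇒gap : ∀ {j c} → Cell (suc j) c → Source (suc j) c → c ∈ᵍ gap (suc j)
        source⇒gap {j} {c} (_ , _ , ¬rh) (inj₂ h) with VecAny.satisfied h
        ... | k , (e , c≡) with gap⁺ (VecAny.map (λ { (e , c≡) → e , rhombus-pair′ e c≡ ¬rh }) h)
        ...   | k′ , eq , (e′ , _) = ℤ.+ k′ , eq , subst (λ k → c ≡ 1ℤ + ℤ.+ k ⊎ c ≡ ℤ.+ k) (half-injective (trans (sym e) e′)) c≡

        initial⇒bound : ∀ i {c} → c ∈ initial i → c ℤ.≤ ℤ.+ i × 1ℤ ℤ.≤ c + ℤ.+ i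
        initial⇒bound (suc i) (here refl) = ℤP.≤-refl , ℤ.+≤+ (ℕ.s≤s ℕ.z≤n)
        initial⇒bound (suc i) {c} (there m) with ∈-++⁻ (initial i) m
        ... | inj₁ m′ with initial⇒bound i m′
        ...   | h , g = ℤP.≤-trans h (ℤP.i≤suc[i] (ℤ.+ i)) , ℤP.≤-trans g (ℤP.+-monoʳ-≤ c (ℤP.i≤suc[i] (ℤ.+ i)))
        initial⇒bound (suc i) {c} (there m) | inj₂ (here refl) = ℤP.≤-trans (Mirrors.turn-≤ {0ℤ} {0ℤ} {ℤ.+ i} (nat i)) (nat (suc i)) , ℤP.≤-reflexive (shuffle (ℤ.+ i))
          where
          shuffle : ∀ i → 1ℤ ≡ 0ℤ - i + (1ℤ + i)
          shuffle = solve-∀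

        bound⇒initial : ∀ i {c} → c ℤ.≤ ℤ.+ i → 1ℤ ℤ.≤ c + ℤ.+ i → c ∈ initial i
        bound⇒initial zero    {c} h g = ⊥-elim (ℤP.<-irrefl refl (ℤP.<-≤-trans (ℤ.+<+ (ℕ.s≤s ℕ.z≤n)) (ℤP.≤-trans g (subst (ℤ._≤ 0ℤ) (sym (ℤP.+-identityʳ c)) h))))
        bound⇒initial (suc i) {c} h g with c ℤ.≟ ℤ.+ suc i | c ℤ.≟ 0ℤ - ℤ.+ i
        ... | yes refl | _ = here refl
        ... | no _ | yes refl = there (∈-++⁺ʳ (initial i) (here refl))
        ... | no ne | no ne′ = there (∈-++⁺ˡ (bound⇒initial i
            (subst (c ℤ.≤_) (ℤP.pred-suc (ℤ.+ i)) (ℤP.i<j⇒i≤pred[j] (ℤP.≤∧≢⇒< h ne)))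
            (ℤP.i<j⇒suc[i]≤j (ℤP.≤∧≢⇒< nonnegative (λ e → ne′ (trans (shuffle₁ c (ℤ.+ i)) (cong (_- ℤ.+ i) (sym e))))))))
          where
          shuffle₁ : ∀ c i → c ≡ c + i - i
          shuffle₁ = solve-∀
          shuffle₂ : ∀ c i → c + i - 0ℤ ≡ c + (1ℤ + i) - 1ℤ
          shuffle₂ = solve-∀
          nonnegative : 0ℤ ℤ.≤ c + ℤ.+ i
          nonnegative = by (δ g) (shuffle₂ c (ℤ.+ i))

        upper⇒range : ∀ {c} → Cell a c → ℤ.+ suc a ℤ.< c + c → InRange c
        upper⇒range {c} ((h , _) , _ , ¬rh) lt = P₀-least lt
          (Rhombi.outside⁻ {ℤ.+ a} {ℤ.+ r} {0ℤ} {c} (λ g → ¬rh (g , Rhombi.beyond {ℤ.+ a} {ℤ.+ r} {0ℤ} {c} (nat r) (ℤP.i<j⇒suc[i]≤j lt)))) ,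
          ℤP.≤-<-trans (subst (c ℤ.≤_) (cong ℤ.+_ (ℕP.+-comm b a)) h) big

        cell⇒range : ∀ {c} → Cell a c → c ≢ mirror c → InRange c ⊎ InRange (mirror c)
        cell⇒range {c} cell ne with ℤP.<-cmp (c + c) (ℤ.+ suc a)
        ... | tri< lt _ _ = inj₂ (upper⇒range (cell-mirror cell) (Rhombi.reflect-< {ℤ.+ a} {0ℤ} {0ℤ} {c} lt))
        ... | tri≈ _ e _  = ⊥-elim (ne (Rhombi.fixed {ℤ.+ a} {0ℤ} {0ℤ} {c} e))
        ... | tri> _ _ gt = inj₁ (upper⇒range cell gt)

        range⇒cell : ∀ {c} → Bound a c → InRange c ⊎ InRange (mirror c) → Cell a c
        -- An interior edge of a hole in column `a` would put the vertical side of the hole in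
        -- column `suc a`, contrary to `2 * k ≤ a`.
        range⇒cell {c} bd ranged = bd , (λ h → let (k , 2k≤a , e , _) = lookupAny small h in ℕP.<-irrefl refl (ℕP.≤-trans (ℕP.≤-reflexive e) 2k≤a)) , ¬rh ranged
          where
          far : ∀ {c} → InRange c → ¬ InRhombus a c
          far {c} (h , _) (g , _) = Rhombi.outside⁺ {ℤ.+ a} {ℤ.+ r} {0ℤ} {c} (P₀-above h) g
          ¬rh : InRange c ⊎ InRange (mirror c) → ¬ InRhombus a c
          ¬rh (inj₁ i) g = far i g
          ¬rh (inj₂ i) g = far i (rhombus-mirror {a} {c} g)

        bound-step : ∀ {j x y} → Bound j x → Step x y → Bound (suc j) y
        bound-step {j} {x} (h , g) stay = Steps.stay-top {ℤ.+ b} {ℤ.+ j} {x} h , g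
        bound-step {j} {x} (h , g) rise = Steps.rise-top {ℤ.+ b} {ℤ.+ j} {x} h , Steps.rise-bottom {ℤ.+ b} {ℤ.+ j} {x} g

        -- From the interior edge of a hole both steps lead to its vertical side, that is, to a
        -- source, and both steps from within the rhombus stay within it.
        cell-back : ∀ {j x y} → Bound j x → Step x y → Cell (suc j) y → ¬ Source (suc j) y → Cell j x
        cell-back {j} {x} {y} bd s (_ , _ , ¬rh) ¬s = bd , (λ h → ¬s (inj₂ (VecAny.map (λ { {k} (e , refl) → e , next s }) h))) , λ h → ¬rh (rhombus-step s h)
          where
          next : ∀ {k y} → Step k y → y ≡ 1ℤ + k ⊎ y ≡ k
          next stay = inj₂ refl
          next rise = inj₁ refl

        initial⇒cell : ∀ {c} → c ∈ initial b → Cell 0 c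
        initial⇒cell {c} c∈ with initial⇒bound b c∈
        ... | h , g = (subst (c ℤ.≤_) (sym (ℤP.+-identityʳ (ℤ.+ b))) h , g) ,
          (λ i → let (k , e , _) = VecAny.satisfied i in odd≢even {0} {k} e) ,
          λ { (g₁ , g₂) → Rhombi.first {ℤ.+ a} {ℤ.+ r} {0ℤ} {c} (ℤ.+≤+ r≤a) g₁ g₂ }

      halfRegion : HalfRegion (H◇ a b ks r) a b P₀ N mid gap
      halfRegion = record
        { unique = H◇-unique
        ; rot-◁ = Rotation.σ-◁ ; rot-▷ = Rotation.σ-▷ ; ref-◁ = Reflection.σ-◁ ; ref-▷ = Reflection.σ-▷
        ; Bound = Bound ; Cell = Cell ; Source = Source
        ; source? = source?
        ; left-column = column-◁ ; right-column = column-▷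
        ; ◁⇒cell = ◁⇒cell ; cell⇒◁ = cell⇒◁ ; ▷⇒cell = ▷⇒cell ; cell⇒▷ = cell⇒▷
        ; cell-mirror = cell-mirror
        ; source-zero = inj₁ refl
        ; initial⇒cell = initial⇒cell
        ; cell⇒initial = λ { {c} ((h , g) , _) → bound⇒initial b (subst (c ℤ.≤_) (ℤP.+-identityʳ (ℤ.+ b)) h) g }
        ; gap⇒source = gap⇒source ; source⇒gap = source⇒gap
        ; cell⇒range = cell⇒range ; range⇒cell = range⇒cell
        ; cell⇒bound = proj₁
        ; bound-step = bound-step
        ; cell-back = cell-back
        }

      M-square : M (rotation a ∷ []) (H◇ a b ks r) ≡ M (rotation a ∷ reflection a ∷ []) (H◇ a b ks r) ℕ.^ 2
      M-square = begin
        M (rotation a ∷ []) (H◇ a b ks r)                       ≡⟨ sym rotation-count ⟩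
        _                                                        ≡⟨ ℤP.+-injective (trans count-square (sym (ℤP.pos-* u u))) ⟩
        u ℕ.* u                                                  ≡⟨ cong₂ ℕ._*_ reflection-count reflection-count ⟩
        m ℕ.* m                                                  ≡⟨ cong (m ℕ.*_) (sym (ℕP.*-identityʳ m)) ⟩
        m ℕ.^ 2                                                  ∎
        where
        open ≡-Reasoning
        open Correspondence {H◇ a b ks r} {a} {b} {P₀} {N} {mid} {gap} gap-even halfRegion
        open Core a b P₀ N mid big gap gap-even
        u : ℕ
        u = length (System.chains (λ j → appendMaybe (gap j)) UpperState upperState? FinalUpper finalUpper? a 0 (initialUpper b))
        m : ℕ
        m = M (rotation a ∷ reflection a ∷ []) (H◇ a b ks r)

-- Both identities as instances of one, with an empty rhombus in the first.

open import Data.List using ([]; _∷_)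
open import Data.Nat using (ℕ; _*_; _∸_; _^_; _<_; _≤_)
open import Data.Product using (_×_)
open import Data.Vec using (Vec; []; _∷_)
open import Data.Vec.Relation.Unary.All using (All)
open import Data.Vec.Relation.Unary.Linked using (Linked)
open import Relation.Binary.PropositionalEquality using (_≡_)
open import Defs

import Data.Integer as ℤ
import Data.Integer.Properties as ℤP
import Data.List.Properties as LP
import Data.List.Relation.Unary.All as ListAll
import Data.Nat.Properties as ℕP
import Data.Vec.Relation.Unary.All as VecAll
import Data.Vec.Relation.Unary.Linked as VecLinked
open import Data.Nat using (suc; z≤n; s≤s)
open import Data.Product using (_,_)
open import Relation.Binary.PropositionalEquality using (sym; trans; subst)
open import Relation.Nullary using (¬_)
open import Relation.Nullary.Decidable using (¬?)

-- A rhombus of side 0 is a single point, while the vertices of a unit triangle lie in two different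
-- columns.
H◇-zero : ∀ {s} a b (ks : Vec ℕ s) → H◇ a b ks 0 ≡ H a b ks
H◇-zero a b ks = LP.filter-all (λ t → ¬? (ListAll.all? (rhombus? a 0) (vertices t))) (ListAll.universal nonempty (H a b ks))
  where
  column : ∀ {P} → Rhombus a 0 P → xc P ≡ ℤ.+ a
  column {P} h = ℤP.i-j≡0⇒i≡j (xc P) (ℤ.+ a) (ℤP.∣i∣≡0⇒i≡0 (ℕP.n≤0⇒n≡0 (ℕP.≤-trans (ℕP.m≤m+n _ _) h)))
  nonempty : ∀ t → ¬ ListAll.All (Rhombus a 0) (vertices t)
  nonempty (◁ (p , q)) (h ListAll.∷ g ListAll.∷ _) = ℤP.<-irrefl (trans (column {p , q} h) (sym (column {ℤ.suc p , q} g)))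
    (ℤP.+-monoˡ-< q {p} {ℤ.suc p} (ℤP.suc[i]≤j⇒i<j (ℤP.≤-refl {ℤ.suc p})))
  nonempty (▷ (p , q)) (h ListAll.∷ g ListAll.∷ _) = ℤP.<-irrefl (trans (column {ℤ.pred p , q} g) (sym (column {p , q} h)))
    (ℤP.+-monoˡ-< q {ℤ.pred p} {p} (ℤP.i≤pred[j]⇒i<j (ℤP.≤-refl {ℤ.pred p})))

above-head : ∀ {s x} {ks : Vec ℕ s} → Linked _<_ (x ∷ ks) → All (0 <_) ks
above-head {ks = []}     _                   = VecAll.[]
above-head {ks = k ∷ ks} (x<k VecLinked.∷ l) = ℕP.≤-<-trans z≤n x<k VecAll.∷ above-head l

theorem2p1 : (a b s x : ℕ) → 0 < a → 0 < b → 0 < s → 0 < x → x ≤ a →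
    (ks : Vec ℕ s) → Linked _<_ (0 ∷ ks) → All (λ k → 2 * k ≤ a) ks →
    (M (rotation a ∷ []) (H a b ks) ≡ M (rotation a ∷ reflection a ∷ []) (H a b ks) ^ 2)
    × (M (rotation (2 * a ∸ 1) ∷ []) (H◇ (2 * a ∸ 1) b ks (2 * x ∸ 1))
    ≡ M (rotation (2 * a ∸ 1) ∷ reflection (2 * a ∸ 1) ∷ []) (H◇ (2 * a ∸ 1) b ks (2 * x ∸ 1)) ^ 2)
theorem2p1 a b s x 0<a 0<b 0<s 0<x x≤a ks increasing small =
  subst (λ R → M (rotation a ∷ []) R ≡ M (rotation a ∷ reflection a ∷ []) R ^ 2) (H◇-zero a b ks)
    (Regions.M-square a b ks 0 z≤n (above-head increasing) small) ,
  -- With `2 * a ∸ 1` in place of `a`, the rhombus fits because `x ≤ a`, and the holes stay in the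
  -- left half because `2 * k ≤ a ≤ 2 * a ∸ 1`.
  Regions.M-square (2 * a ∸ 1) b ks (2 * x ∸ 1) (ℕP.∸-monoˡ-≤ 1 (ℕP.*-monoʳ-≤ 2 x≤a)) (above-head increasing)
    (VecAll.map (λ 2k≤a → ℕP.≤-trans 2k≤a (wider 0<a)) small)
  where
  wider : ∀ {a} → 0 < a → a ≤ 2 * a ∸ 1
  wider {suc a} _ = subst (suc a ≤_) (sym (ℕP.+-suc a (a Data.Nat.+ 0))) (s≤s (ℕP.m≤m+n a (a Data.Nat.+ 0)))
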